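{- There exists a universal decompressor $U$ such that $H \notin \mathrm{P}^{F_{C_U}}$.
   Context: $C_U(x)$ denotes the plain Kolmogorov complexity of a string $x$ with respect to a decompressor $U$, i.e. $C_U(x)=\min\{|p| : U(p)=x\}$. $F_{C_U} = \{ \langle x, k \rangle \in \{0,1\}^* \times \mathbb{N} : C_U(x) \le k \}$ is the cumulative complexity oracle. $H = \{ x \mid \text{program } x \text{ halts on the empty input}\}$ is the Halting Problem. $\mathrm{P}^{F_{C_U}}$ is the class of languages decidable by polynomial-time oracle machines with oracle $F_{C_U}$. -}

module Defs where

open import Data.Nat using (ℕ; zero; suc; _+_; _*_; _^_; _≤_)
open import Data.Bool using (Bool; true; false)
open import Data.Maybe using (Maybe; just; nothing)
open import Data.List using (List; []; _∷_; _++_; map; concatMap; length; replicate; allFin)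
open import Data.Fin using (Fin; toℕ) renaming (zero to fzero)
open import Data.Product using (Σ; ∃; _×_; _,_; proj₂)
open import Data.Empty using (⊥)
open import Relation.Nullary using (¬_)
open import Relation.Binary.PropositionalEquality using (_≡_)
open import Function.Bundles using (_⇔_)
open import Data.Nat.Binary.Base using (ℕᵇ; 2[1+_]; 1+[2_]) renaming (zero to zeroᵇ; fromℕ to toℕᵇ)

-- Machine model: one-tape Turing machines over {0,1,blank} with an
-- oracle-query instruction.  A machine that never consults its oracle
-- (or runs relative to the empty oracle) is an ordinary Turing machine.

Sym : Set
Sym = Maybe Bool          -- nothing = blank

data Move : Set where
  left right stay : Move

data Action (Q : ℕ) : Set where
  halt  : Action Q
  write : Fin (suc Q) → Sym → Move → Action Q
  query : Fin (suc Q) → Fin (suc Q) → Action Q          -- ask oracle; go to 1st state if yes, 2nd if no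

-- states are Fin (suc Q); the start state is fzero
record TM : Set where
  constructor tm
  field
    Q : ℕ
    δ : Fin (suc Q) → Sym → Action Q
open TM public

record Tape : Set where
  constructor tape
  field
    lft : List Sym    -- cells left of the head, nearest first
    hd  : Sym
    rgt : List Sym    -- cells right of the head, nearest first
open Tape public

moveHead : Move → Tape → Tape
moveHead left  (tape [] h r)       = tape [] nothing (h ∷ r)
moveHead left  (tape (l ∷ ls) h r) = tape ls l (h ∷ r)
moveHead right (tape l h [])       = tape (h ∷ l) nothing []
moveHead right (tape l h (r ∷ rs)) = tape (h ∷ l) r rs
moveHead stay  t                   = t

readBits : Sym → List Sym → List Bool
readBits nothing  _        = []
readBits (just b) []       = b ∷ []
readBits (just b) (s ∷ ss) = b ∷ readBits s ss

contents : Tape → List Bool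
contents (tape _ h r) = readBits h r

inputTape : List Bool → Tape
inputTape []       = tape [] nothing []
inputTape (b ∷ bs) = tape [] (just b) (map just bs)

Config : TM → Set
Config M = Fin (suc (Q M)) × Tape

Oracle : Set₁
Oracle = List Bool → Set

data Step (A : Oracle) (M : TM) : Config M → Config M → Set where
  stepW : ∀ {q t q' s m} → δ M q (hd t) ≡ write q' s m →
          Step A M (q , t) (q' , moveHead m (tape (lft t) s (rgt t)))
  stepY : ∀ {q t qy qn} → δ M q (hd t) ≡ query qy qn → A (contents t) →
          Step A M (q , t) (qy , t)
  stepN : ∀ {q t qy qn} → δ M q (hd t) ≡ query qy qn → ¬ A (contents t) →
          Step A M (q , t) (qn , t)

data Steps (A : Oracle) (M : TM) : ℕ → Config M → Config M → Set where
  done : ∀ {c} → Steps A M zero c c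
  next : ∀ {n c c' c''} → Step A M c c' → Steps A M n c' c'' → Steps A M (suc n) c c''

Halted : (M : TM) → Config M → Set
Halted M (q , t) = δ M q (hd t) ≡ halt

RunsTo : Oracle → (M : TM) → List Bool → ℕ → List Bool → Set
RunsTo A M x n y = Σ (Config M) λ c →
  Steps A M n (fzero , inputTape x) c × Halted M c × contents (proj₂ c) ≡ y

emptyOracle : Oracle
emptyOracle _ = ⊥

Outputs : TM → List Bool → List Bool → Set
Outputs M p x = ∃ λ n → RunsTo emptyOracle M p n x

-- C_U(x) ≤ k   (C_U(x) = min { |p| : U(p) = x }, = ∞ if no such p)
C≤ : TM → List Bool → ℕ → Set
C≤ U x k = ∃ λ p → length p ≤ k × Outputs U p x

-- U is a universal (optimal) decompressor: for every decompressor D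
-- there is c with C_U(x) ≤ C_D(x) + c for all x
Universal : TM → Set
Universal U = ∀ (D : TM) → ∃ λ c → ∀ p x → Outputs D p x →
  ∃ λ p' → length p' ≤ length p + c × Outputs U p' x

-- bijective base-2 encoding of naturals as bit strings
ℕᵇbits : ℕᵇ → List Bool
ℕᵇbits zeroᵇ    = []
ℕᵇbits 2[1+ n ] = true ∷ ℕᵇbits n
ℕᵇbits 1+[2 n ] = false ∷ ℕᵇbits n

natBits : ℕ → List Bool
natBits k = ℕᵇbits (toℕᵇ k)

pairEnc : List Bool → ℕ → List Bool
pairEnc x k = concatMap (λ b → b ∷ b ∷ []) x ++ false ∷ true ∷ natBits k

F-C : TM → Oracle
F-C U w = ∃ λ x → ∃ λ k → w ≡ pairEnc x k × C≤ U x k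

encUnary : ℕ → List Bool
encUnary n = replicate n true ++ false ∷ []

encSym : Sym → List Bool
encSym nothing      = false ∷ false ∷ []
encSym (just false) = false ∷ true ∷ []
encSym (just true)  = true ∷ false ∷ []

encMove : Move → List Bool
encMove left  = false ∷ false ∷ []
encMove right = false ∷ true ∷ []
encMove stay  = true ∷ false ∷ []

encAction : ∀ {Q} → Action Q → List Bool
encAction halt          = false ∷ false ∷ []
encAction (write q s m) = false ∷ true ∷ encUnary (toℕ q) ++ encSym s ++ encMove m
encAction (query a b)   = true ∷ false ∷ encUnary (toℕ a) ++ encUnary (toℕ b)

allSyms : List Sym
allSyms = nothing ∷ just false ∷ just true ∷ []

encTM : TM → List Bool
encTM (tm Q δ) = encUnary Q ++
  concatMap (λ q → concatMap (λ s → encAction (δ q s)) allSyms) (allFin (suc Q))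

HaltSet : List Bool → Set
HaltSet x = ∃ λ M → encTM M ≡ x × Σ ℕ λ n → Σ (Config M) λ c →
  Steps emptyOracle M n (fzero , inputTape []) c × Halted M c

InPOracle : Oracle → (List Bool → Set) → Set
InPOracle A L = Σ TM λ M → ∃ λ a → ∃ λ k → ∀ x → ∃ λ n → ∃ λ y →
  n ≤ a * suc (length x) ^ k × RunsTo A M x n y × ((y ≡ true ∷ []) ⇔ L x)

{-# OPTIONS --safe #-}
-- U runs a universal machine on the programs 111r and keeps the programs 0b for a strategy, which lists pairs (x , k)
-- and so makes C_U(x) ≤ k.  The i-th requirement has a machine M, a range of levels k and a machine x of its own
-- whose halting the strategy controls.  All strings of complexity at least q are treated alike by a run of M on x that is
-- short compared with q, so the answer of M is a function of the finite list of pairs of level below q.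
-- Let two players with equal budgets extend this list by turns they may skip, one wanting M to accept x and the other wanting
-- it to reject: one of the two can force the answer.  The strategy plays that side against the programs 111r, and lets x halt
-- exactly if it forces rejection; hence M errs.
-- The real opponent need not respect the budget.  Whenever he exceeds it, the game is restarted with a new x, and the
-- price of a level is raised by the debt there, the excess of the weight spent by the strategy over that spent by the
-- opponent.  The total weight of the opponent is at most 1/8 per level, and the sum of the squared debts serves as a potential
-- bounding the number of restarts by a polynomial in q.  So the strategy spends at most 1/2 per level, which the programs 0b
-- afford, and x remains short.  The ranges of different requirements are disjoint, with tower-like growth: the few
-- moves of other requirements inside the view of the i-th one lie below its range, and each causes a restart at most.

module Submission where

open import Defs
open import Data.Bool using (Bool; true; false; if_then_else_; not; _∧_; _∨_)
open import Data.Empty using (⊥; ⊥-elim)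
open import Data.Fin using (Fin; zero; suc; toℕ; join; splitAt; _↑ˡ_; _↑ʳ_)
open import Data.Fin.Properties using (splitAt-join; splitAt-↑ˡ; splitAt-↑ʳ; toℕ-↑ˡ; toℕ-↑ʳ; toℕ-injective; toℕ<n)
open import Data.List using (List; []; _∷_; _++_; map; length; replicate; _ʳ++_; reverse; _∷ʳ_; concatMap; take; drop; tabulate; allFin)
open import Data.List.Membership.Propositional using (_∈_)
open import Data.List.Membership.Propositional.Properties using (∈-concatMap⁺; ∈-concatMap⁻; ∈-map⁺; ∈-map⁻; ∈-++⁺ˡ; ∈-++⁺ʳ; ∈-++⁻)
open import Data.List.Properties
import Data.List.Relation.Unary.All as All
open import Data.List.Relation.Unary.All using (All; []; _∷_)
import Data.List.Relation.Unary.All.Properties as All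
open import Data.List.Relation.Unary.AllPairs using ([]; _∷_)
import Data.List.Relation.Unary.Any as Any
open import Data.List.Relation.Unary.Any using (here; there)
import Data.List.Relation.Unary.Any.Properties as Any
open import Data.List.Relation.Unary.Unique.Propositional using (Unique)
open import Data.Maybe using (Maybe; just; nothing; maybe)
open import Data.Maybe.Properties using (just-injective)
open import Data.Nat
open import Data.Nat.Binary.Base using (ℕᵇ; 2[1+_]; 1+[2_]) renaming (zero to zeroᵇ; suc to sucᵇ; fromℕ to toℕᵇ; fromℕ' to toℕᵇ'; toℕ to fromℕᵇ)
open import Data.Nat.Binary.Properties using (fromℕ≡fromℕ'; toℕ-fromℕ; fromℕ-toℕ)
open import Data.Nat.Properties
open import Data.Nat.Solver using (module +-*-Solver)
open import Data.Product using (Σ; ∃; ∃₂; _×_; _,_; proj₁; proj₂)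
open import Data.Sum using (_⊎_; inj₁; inj₂)
open import Data.Unit using (⊤; tt)
import Data.Vec as Vec
open import Data.Vec using (Vec; []; _∷_; lookup; _[_]≔_)
open import Data.Vec.Properties using (lookup∘update; []≔-idempotent; []≔-lookup; map-[]≔; lookup-map)
open import Function using (_∘_)
open import Function.Bundles using (_⇔_; Equivalence)
open import Relation.Binary.PropositionalEquality
open import Relation.Nullary using (¬_)
open import Relation.Nullary.Decidable using (decidable-stable)

-- The price is what makes the potential work. When an interval ends by overspending, the strategy
-- has paid at most E and the opponent at least E, both at the prices m + z_k, where z_k is the debt
-- at level k. Hence the sum of z_k (a_k - b_k), the cross term in the change of the squared debts,
-- is at most m times the opponent's weight, whose total is bounded. At fixed prices the opponent
-- could answer at other levels, and nothing would tie this term to his weight. The machine x has to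
-- run the strategy, which in turn simulates M on the code of x. Since x carries the number of its
-- interval, only polynomially many restarts in q are tolerable: then x has length polylogarithmic
-- in q. The machines must be actual Turing machines. A total language with recursors is compiled to
-- them; its terms denote Agda functions, and the combinatorial argument speaks of these functions
-- only. The stage from which a view is constant cannot be computed. It exists up to double
-- negation, which is enough for a negative conclusion.

-- Structured Turing machines

-- The index counts exits, so that control flow is typed: `seq` continues according to the exit
-- taken, and `loop` leads exit `zero` back to the entry and renumbers the others. States are
-- numbered only once the machine is complete.
data Frag : ℕ → Set where
  auto : ∀ {k} n → (Fin (suc n) → Sym → Sym × Move × (Fin (suc n) ⊎ Fin k)) → Frag k
  seq  : ∀ {j k} → Frag j → (Fin j → Frag k) → Frag k
  loop : ∀ {k} → Frag (suc k) → Frag k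

Pos : ∀ {k} → Frag k → Set
Pos (auto n _)         = Fin (suc n)
Pos (seq {j = j} f g)  = Pos f ⊎ Σ (Fin j) (λ i → Pos (g i))
Pos (loop f)           = Pos f

entry : ∀ {k} (f : Frag k) → Pos f
entry (auto n _) = zero
entry (seq f g)  = inj₁ (entry f)
entry (loop f)   = entry f

Next : ∀ {k} → Frag k → Set
Next {k} f = Pos f ⊎ Fin k

seqL : ∀ {j k} (f : Frag j) (g : Fin j → Frag k) → Next f → Next (seq f g)
seqL f g (inj₁ p) = inj₁ (inj₁ p)
seqL f g (inj₂ i) = inj₁ (inj₂ (i , entry (g i)))

seqR : ∀ {j k} (f : Frag j) (g : Fin j → Frag k) i → Next (g i) → Next (seq f g)
seqR f g i (inj₁ p) = inj₁ (inj₂ (i , p))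
seqR f g i (inj₂ j) = inj₂ j

loopN : ∀ {k} (f : Frag (suc k)) → Next f → Next (loop f)
loopN f (inj₁ p)       = inj₁ p
loopN f (inj₂ zero)    = inj₁ (entry f)
loopN f (inj₂ (suc j)) = inj₂ j

retarget : ∀ {A B : Set} → (A → B) → Sym × Move × A → Sym × Move × B
retarget h (w , m , r) = w , m , h r

control : ∀ {k} (f : Frag k) → Pos f → Sym → Sym × Move × Next f
control (auto n d) p s             = d p s
control (seq f g) (inj₁ p) s       = retarget (seqL f g) (control f p s)
control (seq f g) (inj₂ (i , p)) s = retarget (seqR f g i) (control (g i) p s)
control (loop f) p s               = retarget (loopN f) (control f p s)

act : Sym → Move → Tape → Tape
act w m t = moveHead m (tape (lft t) w (rgt t))

data Run {k} (f : Frag k) : ℕ → Pos f → Tape → Fin k → Tape → Set where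
  last : ∀ {p t w m j} → control f p (hd t) ≡ (w , m , inj₂ j) → Run f 1 p t j (act w m t)
  more : ∀ {n p t w m p' j t'} → control f p (hd t) ≡ (w , m , inj₁ p') →
         Run f n p' (act w m t) j t' → Run f (suc n) p t j t'

data Path {k} (f : Frag k) : ℕ → Pos f → Tape → Pos f → Tape → Set where
  here : ∀ {p t} → Path f 0 p t p t
  step : ∀ {n p t w m p' q t'} → control f p (hd t) ≡ (w , m , inj₁ p') →
         Path f n p' (act w m t) q t' → Path f (suc n) p t q t'

infix 4 _∶_⇓_,_
_∶_⇓_,_ : ∀ {k} → Frag k → Tape → Fin k → Tape → Set
f ∶ t ⇓ j , t' = ∃ λ n → Run f n (entry f) t j t'

path-run : ∀ {k} {f : Frag k} {n m p t q t' j t''} →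
  Path f n p t q t' → Run f m q t' j t'' → Run f (n + m) p t j t''
path-run here r = r
path-run (step e s) r = more e (path-run s r)

path-path : ∀ {k} {f : Frag k} {n m p t q t' q' t''} →
  Path f n p t q t' → Path f m q t' q' t'' → Path f (n + m) p t q' t''
path-path here r = r
path-path (step e s) r = step e (path-path s r)

seq-l : ∀ {j k} {f : Frag j} {g : Fin j → Frag k} {n p t i t'} →
  Run f n p t i t' → Path (seq f g) n (inj₁ p) t (inj₂ (i , entry (g i))) t'
seq-l {f = f} {g} (last e)   = step (cong (retarget (seqL f g)) e) here
seq-l {f = f} {g} (more e r) = step (cong (retarget (seqL f g)) e) (seq-l r)

seq-r : ∀ {j k} {f : Frag j} {g : Fin j → Frag k} {n i p t l t'} →
  Run (g i) n p t l t' → Run (seq f g) n (inj₂ (i , p)) t l t'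
seq-r {f = f} {g} {i = i} (last e)   = last (cong (retarget (seqR f g i)) e)
seq-r {f = f} {g} {i = i} (more e r) = more (cong (retarget (seqR f g i)) e) (seq-r r)

seq-r-path : ∀ {j k} {f : Frag j} {g : Fin j → Frag k} {n i p t q t'} →
  Path (g i) n p t q t' → Path (seq f g) n (inj₂ (i , p)) t (inj₂ (i , q)) t'
seq-r-path here = here
seq-r-path {f = f} {g} {i = i} (step e r) = step (cong (retarget (seqR f g i)) e) (seq-r-path r)

loop-path : ∀ {k} {f : Frag (suc k)} {n p t t'} →
  Run f n p t zero t' → Path (loop f) n p t (entry f) t'
loop-path {f = f} (last e)   = step (cong (retarget (loopN f)) e) here
loop-path {f = f} (more e r) = step (cong (retarget (loopN f)) e) (loop-path r)

loop-run : ∀ {k} {f : Frag (suc k)} {n p t j t'} →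
  Run f n p t (suc j) t' → Run (loop f) n p t j t'
loop-run {f = f} (last e)   = last (cong (retarget (loopN f)) e)
loop-run {f = f} (more e r) = more (cong (retarget (loopN f)) e) (loop-run r)

⇓seq : ∀ {j k} {f : Frag j} {g : Fin j → Frag k} {t i t' l t''} →
  f ∶ t ⇓ i , t' → g i ∶ t' ⇓ l , t'' → seq f g ∶ t ⇓ l , t''
⇓seq (n , r) (m , r') = n + m , path-run (seq-l r) (seq-r r')

⇓again : ∀ {k} {f : Frag (suc k)} {t t' j t''} →
  f ∶ t ⇓ zero , t' → loop f ∶ t' ⇓ j , t'' → loop f ∶ t ⇓ j , t''
⇓again (n , r) (m , r') = n + m , path-run (loop-path r) r'

⇓break : ∀ {k} {f : Frag (suc k)} {t j t'} → f ∶ t ⇓ suc j , t' → loop f ∶ t ⇓ j , t'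
⇓break (n , r) = n , loop-run r

Run-pos : ∀ {k} {f : Frag k} {n p t j t'} → Run f n p t j t' → 1 ≤ n
Run-pos (last _)   = s≤s z≤n
Run-pos (more _ _) = s≤s z≤n

-- Numbering the control states

record Finite (A : Set) : Set where
  field
    size    : ℕ
    to      : A → Fin size
    from    : Fin size → A
    from-to : ∀ a → from (to a) ≡ a
open Finite

finFin : ∀ n → Finite (Fin n)
finFin n = record { size = n ; to = λ i → i ; from = λ i → i ; from-to = λ _ → refl }

fin⊎ : ∀ {A B} → Finite A → Finite B → Finite (A ⊎ B)
fin⊎ {A} {B} a b = record { size = size a + size b ; to = to′ ; from = from′ ; from-to = ok }
  where
  to′ : A ⊎ B → Fin (size a + size b)
  to′ x = join (size a) (size b) (Data.Sum.map (to a) (to b) x)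
  from′ : Fin (size a + size b) → A ⊎ B
  from′ i = Data.Sum.map (from a) (from b) (splitAt (size a) i)
  ok : ∀ x → from′ (to′ x) ≡ x
  ok (inj₁ x) rewrite splitAt-join (size a) (size b) (inj₁ (to a x)) = cong inj₁ (from-to a x)
  ok (inj₂ y) rewrite splitAt-join (size a) (size b) (inj₂ (to b y)) = cong inj₂ (from-to b y)

finΣ : ∀ n {B : Fin n → Set} → (∀ i → Finite (B i)) → Finite (Σ (Fin n) B)
finΣ zero    b = record { size = 0 ; to = λ () ; from = λ () ; from-to = λ () }
finΣ (suc n) {B} b = record
  { size = size s ; to = λ x → to s (split x) ; from = λ i → unsplit (from s i)
  ; from-to = λ x → trans (cong unsplit (from-to s (split x))) (unsplit-split x) }
  where
  s : Finite (B zero ⊎ Σ (Fin n) (λ i → B (suc i)))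
  s = fin⊎ (b zero) (finΣ n (λ i → b (suc i)))
  split : Σ (Fin (suc n)) B → B zero ⊎ Σ (Fin n) (λ i → B (suc i))
  split (zero , x)  = inj₁ x
  split (suc i , x) = inj₂ (i , x)
  unsplit : B zero ⊎ Σ (Fin n) (λ i → B (suc i)) → Σ (Fin (suc n)) B
  unsplit (inj₁ x)       = zero , x
  unsplit (inj₂ (i , x)) = suc i , x
  unsplit-split : ∀ x → unsplit (split x) ≡ x
  unsplit-split (zero , _)  = refl
  unsplit-split (suc i , _) = refl

finPos : ∀ {k} (f : Frag k) → Finite (Pos f)
finPos (auto n _)        = finFin (suc n)
finPos (seq {j = j} f g) = fin⊎ (finPos f) (finΣ j (λ i → finPos (g i)))
finPos (loop f)          = finPos f

module _ (f : Frag 1) where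
  private
    fin : Finite (Next f)
    fin = fin⊎ (finPos f) (finFin 1)

  -- A fresh state is put in front, because a `TM` starts in `zero` whereas the numbering may place
  -- the entry anywhere.
  fragδ : Fin (suc (size fin)) → Sym → Action (size fin)
  fragδ zero    s = write (suc (to fin (inj₁ (entry f)))) s stay
  fragδ (suc q) s with from fin q
  ... | inj₂ _ = halt
  ... | inj₁ p = write (suc (to fin (proj₂ (proj₂ (control f p s))))) (proj₁ (control f p s)) (proj₁ (proj₂ (control f p s)))

  fragTM : TM
  fragTM = tm (size fin) fragδ

  state : Next f → Fin (suc (size fin))
  state r = suc (to fin r)

  fragδ-pos : ∀ p s {w m r} → control f p s ≡ (w , m , r) → fragδ (state (inj₁ p)) s ≡ write (state r) w m
  fragδ-pos p s e rewrite from-to fin (inj₁ p) | e = refl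

  fragδ-exit : ∀ j s → fragδ (state (inj₂ j)) s ≡ halt
  fragδ-exit j s rewrite from-to fin (inj₂ j) = refl

  start-step : ∀ {A} t → Step A fragTM (zero , t) (state (inj₁ (entry f)) , t)
  start-step t = stepW {t = t} {s = hd t} {m = stay} refl

  steps-path : ∀ {A n p t q t'} → Path f n p t q t' →
    Steps A fragTM n (state (inj₁ p) , t) (state (inj₁ q) , t')
  steps-path here = done
  steps-path {p = p} {t} (step e r) = next (stepW {t = t} (fragδ-pos p (hd t) e)) (steps-path r)

  steps-run : ∀ {A n p t j t'} → Run f n p t j t' →
    Steps A fragTM n (state (inj₁ p) , t) (state (inj₂ j) , t')
  steps-run {p = p} {t} (last e)   = next (stepW {t = t} (fragδ-pos p (hd t) e)) done
  steps-run {p = p} {t} (more e r) = next (stepW {t = t} (fragδ-pos p (hd t) e)) (steps-run r)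

-- Determinism

write-inj : ∀ {Q} {q q' : Fin (suc Q)} {s s' m m'} → write {Q} q s m ≡ write q' s' m' → q ≡ q' × s ≡ s' × m ≡ m'
write-inj refl = refl , refl , refl

query-inj : ∀ {Q} {q q' r r' : Fin (suc Q)} → query {Q} q r ≡ query q' r' → q ≡ q' × r ≡ r'
query-inj refl = refl , refl

halt≢write : ∀ {Q} {q : Fin (suc Q)} {s m} → halt {Q} ≡ write q s m → ⊥
halt≢write ()
halt≢query : ∀ {Q} {q r : Fin (suc Q)} → halt {Q} ≡ query q r → ⊥
halt≢query ()
write≢query : ∀ {Q} {q : Fin (suc Q)} {s m} {r r' : Fin (suc Q)} → write {Q} q s m ≡ query r r' → ⊥
write≢query ()

step-det : ∀ {A M c d d'} → Step A M c d → Step A M c d' → d ≡ d'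
step-det (stepW e) (stepW e') with write-inj (trans (sym e) e')
... | refl , refl , refl = refl
step-det (stepW e) (stepY e' _) = ⊥-elim (write≢query (trans (sym e) e'))
step-det (stepW e) (stepN e' _) = ⊥-elim (write≢query (trans (sym e) e'))
step-det (stepY e _) (stepW e') = ⊥-elim (write≢query (trans (sym e') e))
step-det (stepY e a) (stepY e' _) with query-inj (trans (sym e) e')
... | refl , refl = refl
step-det (stepY _ a) (stepN _ ¬a) = ⊥-elim (¬a a)
step-det (stepN e _) (stepW e') = ⊥-elim (write≢query (trans (sym e') e))
step-det (stepN _ ¬a) (stepY _ a) = ⊥-elim (¬a a)
step-det (stepN e _) (stepN e' _) with query-inj (trans (sym e) e')
... | refl , refl = refl

halted-stuck : ∀ {A M c d} → Halted M c → Step A M c d → ⊥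
halted-stuck h (stepW e)   = halt≢write (trans (sym h) e)
halted-stuck h (stepY e _) = halt≢query (trans (sym h) e)
halted-stuck h (stepN e _) = halt≢query (trans (sym h) e)

steps-det : ∀ {A M n m c d d'} → Steps A M n c d → Halted M d → Steps A M m c d' → Halted M d' → d ≡ d'
steps-det done h done h' = refl
steps-det done h (next s _) h' = ⊥-elim (halted-stuck h s)
steps-det (next s _) h done h' = ⊥-elim (halted-stuck h' s)
steps-det (next s r) h (next s' r') h' rewrite step-det s s' = steps-det r h r' h'

-- Serves to prove divergence: exhibiting a run longer than `n` refutes halting after `n` steps.
steps-bound : ∀ {A M n m c d d'} → Steps A M n c d → Halted M d → Steps A M m c d' → m ≤ n
steps-bound _ _ done = z≤n
steps-bound done h (next s _) = ⊥-elim (halted-stuck h s)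
steps-bound (next s r) h (next s' r') rewrite step-det s s' = s≤s (steps-bound r h r')

steps-++ : ∀ {A M n m c d e} → Steps A M n c d → Steps A M m d e → Steps A M (n + m) c e
steps-++ done r = r
steps-++ (next s r) r' = next s (steps-++ r r')

-- Counters on a tape

blanks : ℕ → List Sym
blanks n = replicate n nothing

-- Trailing blanks are counted because a tape is a finite list: a move past its right end adds a
-- cell. How many are left depends on the run, hence the existential `n'` in the specifications.
at : List Sym → List Bool → ℕ → Tape
at L []      n = tape L nothing (blanks n)
at L (b ∷ w) n = tape L (just b) (map just w ++ blanks n)

-- A counter x occupies the cells 1ˣ0.
cells : ∀ {r} → Vec ℕ r → List Bool
cells []      = []
cells (x ∷ ρ) = replicate x true ++ false ∷ cells ρ

-- The head rests on the blank separating the counters from `L`, the cells on the left, where the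
-- unread input and later the output are kept.
homeW : List Sym → List Bool → ℕ → Tape
homeW L w n = tape L nothing (map just w ++ blanks n)

home : ∀ {r} → List Sym → Vec ℕ r → ℕ → Tape
home L ρ n = homeW L (cells ρ) n

on : List Bool → List Sym → List Sym
on l L = map just l ++ nothing ∷ L

right-at : ∀ s L w n → ∃ λ n' → moveHead right (tape L s (map just w ++ blanks n)) ≡ at (s ∷ L) w n'
right-at s L []      zero    = zero , refl
right-at s L []      (suc n) = n , refl
right-at s L (b ∷ w) n       = n , refl

goRight : Frag 1
goRight = auto 0 λ _ s → s , right , inj₂ zero

goRight-ok : ∀ L w n → ∃ λ n' → goRight ∶ homeW L w n ⇓ zero , at (nothing ∷ L) w n'
goRight-ok L w n with right-at nothing L w n
... | n' , e = n' , 1 , subst (Run goRight 1 zero (homeW L w n) zero) e (last refl)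

stop : ∀ {k} → Fin k → Frag k
stop j = auto 0 λ _ s → s , stay , inj₂ j

stop-ok : ∀ {k} (j : Fin k) t → stop j ∶ t ⇓ j , t
stop-ok j t = 1 , last {w = hd t} {m = stay} refl

homewardD : Fin 1 → Sym → Sym × Move × (Fin 1 ⊎ Fin 1)
homewardD _ nothing  = nothing , stay , inj₂ zero
homewardD _ (just b) = just b , left , inj₁ zero

homeward : Frag 1
homeward = auto 0 homewardD

homeward-ok : ∀ l b v L n → homeward ∶ at (on l L) (b ∷ v) n ⇓ zero , homeW L (l ʳ++ (b ∷ v)) n
homeward-ok []      b v L n = 2 , more refl (last refl)
homeward-ok (c ∷ l) b v L n with homeward-ok l c (b ∷ v) L n
... | m , r = suc m , more refl r

pastZeroD : Fin 1 → Sym → Sym × Move × (Fin 1 ⊎ Fin 1)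
pastZeroD _ nothing      = nothing , stay , inj₂ zero
pastZeroD _ (just true)  = just true , right , inj₁ zero
pastZeroD _ (just false) = just false , right , inj₂ zero

pastZero : Frag 1
pastZero = auto 0 pastZeroD

pastZero-ok : ∀ x w l L n → ∃ λ n' →
  pastZero ∶ at (on l L) (replicate x true ++ false ∷ w) n ⇓ zero ,
    at (on ((replicate x true ++ false ∷ []) ʳ++ l) L) w n'
pastZero-ok zero    w l L n with right-at (just false) (on l L) w n
... | n' , e = n' , 1 , subst (Run pastZero 1 zero (at (on l L) (false ∷ w) n) zero) e (last refl)
pastZero-ok (suc x) w l L n
  with right-at (just true) (on l L) (replicate x true ++ false ∷ w) n
... | n₁ , e with pastZero-ok x w (true ∷ l) L n₁
... | n' , m , r = n' , suc m , more refl (subst (λ t → Run pastZero m zero t zero _) (sym e) r)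

-- Everything right of the head is shifted by one cell; the state remembers the bit just displaced.
insertD : Fin 2 → Sym → Sym × Move × (Fin 2 ⊎ Fin 1)
insertD zero       nothing      = just true  , stay  , inj₂ zero
insertD zero       (just true)  = just true  , right , inj₁ zero
insertD zero       (just false) = just true  , right , inj₁ (suc zero)
insertD (suc zero) nothing      = just false , stay  , inj₂ zero
insertD (suc zero) (just true)  = just false , right , inj₁ zero
insertD (suc zero) (just false) = just false , right , inj₁ (suc zero)

insertTrue : Frag 1
insertTrue = auto 1 insertD

carry : Bool → Fin 2
carry true  = zero
carry false = suc zero

insert-end : ∀ c → insertD (carry c) nothing ≡ (just c , stay , inj₂ zero)
insert-end true  = refl
insert-end false = refl

insert-step : ∀ c b → insertD (carry c) (just b) ≡ (just c , right , inj₁ (carry b))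
insert-step true  true  = refl
insert-step true  false = refl
insert-step false true  = refl
insert-step false false = refl

insert-ok : ∀ c w l L n → ∃ λ l' → ∃ λ b → ∃ λ v → ∃ λ n' → ∃ λ m →
  Run insertTrue m (carry c) (at (on l L) w n) zero (at (on l' L) (b ∷ v) n') ×
  l' ʳ++ (b ∷ v) ≡ l ʳ++ (c ∷ w)
insert-ok c []      l L n = l , c , [] , n , 1 , last (insert-end c) , refl
insert-ok c (b ∷ w) l L n with right-at (just c) (on l L) w n
... | n₁ , e with insert-ok b w (c ∷ l) L n₁
... | l' , b' , v , n' , m , r , q =
  l' , b' , v , n' , suc m ,
  more (insert-step c b) (subst (λ t → Run insertTrue m (carry b) t zero _) (sym e) r) , q

incAt : ∀ {r} → Fin r → Frag 1
incAt zero    = insertTrue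
incAt (suc i) = seq pastZero (λ _ → incAt i)

incAt-ok : ∀ {r} (i : Fin r) (ρ : Vec ℕ r) l L n → ∃ λ l' → ∃ λ b → ∃ λ v → ∃ λ n' →
  incAt i ∶ at (on l L) (cells ρ) n ⇓ zero , at (on l' L) (b ∷ v) n' ×
  l' ʳ++ (b ∷ v) ≡ l ʳ++ cells (ρ [ i ]≔ suc (lookup ρ i))
incAt-ok zero (x ∷ ρ) l L n with insert-ok true (cells (x ∷ ρ)) l L n
... | l' , b , v , n' , m , r , q = l' , b , v , n' , (m , r) , q
incAt-ok (suc i) (x ∷ ρ) l L n with pastZero-ok x (cells ρ) l L n
... | n₁ , r₁ with incAt-ok i ρ ((replicate x true ++ false ∷ []) ʳ++ l) L n₁
... | l' , b , v , n' , r₂ , q = l' , b , v , n' , ⇓seq r₁ r₂ ,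
  trans q (trans (ʳ++-ʳ++ (replicate x true ++ false ∷ []))
    (cong (l ʳ++_) (++-assoc (replicate x true) (false ∷ []) _)))

-- A decrement blanks the deleted cell, runs to the right end, and shifts the rest back to that blank.
removeD : Fin 5 → Sym → Sym × Move × (Fin 5 ⊎ Fin 2)
removeD zero (just true) = nothing , right , inj₁ (suc zero)
removeD zero s           = s , stay , inj₂ zero
removeD (suc zero) (just b) = just b , right , inj₁ (suc zero)
removeD (suc zero) nothing  = nothing , left , inj₁ (suc (suc zero))
removeD (suc (suc zero)) (just true)  = nothing , left , inj₁ (suc (suc (suc zero)))
removeD (suc (suc zero)) (just false) = nothing , left , inj₁ (suc (suc (suc (suc zero))))
removeD (suc (suc zero)) nothing      = nothing , stay , inj₂ zero
removeD (suc (suc (suc zero))) (just true)  = just true , left , inj₁ (suc (suc (suc zero)))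
removeD (suc (suc (suc zero))) (just false) = just true , left , inj₁ (suc (suc (suc (suc zero))))
removeD (suc (suc (suc zero))) nothing      = just true , stay , inj₂ (suc zero)
removeD (suc (suc (suc (suc zero)))) (just true)  = just false , left , inj₁ (suc (suc (suc zero)))
removeD (suc (suc (suc (suc zero)))) (just false) = just false , left , inj₁ (suc (suc (suc (suc zero))))
removeD (suc (suc (suc (suc zero)))) nothing      = just false , stay , inj₂ (suc zero)

remove : Frag 2
remove = auto 4 removeD

shifting : Bool → Fin 5
shifting true  = suc (suc (suc zero))
shifting false = suc (suc (suc (suc zero)))

shift-end : ∀ c → removeD (shifting c) nothing ≡ (just c , stay , inj₂ (suc zero))
shift-end true  = refl
shift-end false = refl

shift-step : ∀ c b → removeD (shifting c) (just b) ≡ (just c , left , inj₁ (shifting b))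
shift-step true  true  = refl
shift-step true  false = refl
shift-step false true  = refl
shift-step false false = refl

shift-start : ∀ b → removeD (suc (suc zero)) (just b) ≡ (nothing , left , inj₁ (shifting b))
shift-start true  = refl
shift-start false = refl

-- The tape whose left part, head cell included, is the given list.
popped : List Bool → List Sym → List Sym → Tape
popped []      L R = tape L nothing R
popped (d ∷ l) L R = tape (on l L) (just d) R

left-popped : ∀ l L s R → moveHead left (tape (on l L) s R) ≡ popped l L (s ∷ R)
left-popped []      L s R = refl
left-popped (d ∷ l) L s R = refl

shift-ok : ∀ c l L v n → ∃ λ b → ∃ λ w → ∃ λ m →
  Run remove m (shifting c) (popped l L (map just v ++ blanks n)) (suc zero) (at L (b ∷ w) n) ×
  b ∷ w ≡ l ʳ++ (c ∷ v)
shift-ok c []      L v n = c , v , 1 , last (shift-end c) , refl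
shift-ok c (d ∷ l) L v n with shift-ok d l L (c ∷ v) n
... | b , w , m , r , q = b , w , suc m ,
  more (shift-step c d) (subst (λ t → Run remove m (shifting d) t _ _)
    (sym (left-popped l L (just c) (map just v ++ blanks n))) r) , q

nonempty-ʳ++ : ∀ (w l : List Bool) c → ∃₂ λ d l' → w ʳ++ (c ∷ l) ≡ d ∷ l'
nonempty-ʳ++ []      l c = c , l , refl
nonempty-ʳ++ (b ∷ w) l c = nonempty-ʳ++ w (c ∷ l) b

toEnd-ok : ∀ w l L n → ∃ λ b → ∃ λ v → ∃ λ n' → ∃ λ m → ∀ {d l'} → w ʳ++ l ≡ d ∷ l' →
  Run remove m (suc zero) (at (on l L) w n) (suc zero) (at L (b ∷ v) n') × b ∷ v ≡ l' ʳ++ (d ∷ [])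
toEnd-ok (b ∷ w) l L n with right-at (just b) (on l L) w n
... | n₁ , e with toEnd-ok w (b ∷ l) L n₁
... | c , v , n' , m , f = c , v , n' , suc m , λ q →
  more refl (subst (λ t → Run remove m (suc zero) t _ _) (sym e) (proj₁ (f q))) , proj₂ (f q)
toEnd-ok [] [] L n = true , [] , 0 , 0 , λ ()
toEnd-ok [] (d ∷ l) L n with shift-ok d l L [] (suc (suc n))
... | b , v , m , r , q = b , v , suc (suc n) , suc (suc m) , λ { refl →
  more refl (more (shift-start d) (subst (λ t → Run remove m (shifting d) t _ _)
    (sym (left-popped l L nothing (nothing ∷ blanks n))) r)) , q }

remove-ok : ∀ c w l L n → ∃ λ b → ∃ λ v → ∃ λ n' →
  remove ∶ at (on l L) (true ∷ c ∷ w) n ⇓ suc zero , at (on l L) (b ∷ v) n' × b ∷ v ≡ c ∷ w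
remove-ok c w l L n with right-at nothing (on l L) (c ∷ w) n
... | n₁ , e with toEnd-ok (c ∷ w) [] (on l L) n₁
... | b , v , n' , m , f with nonempty-ʳ++ w [] c
... | d , l' , q with f q
... | r , q' = b , v , n' , (suc m , more refl (subst (λ t → Run remove m (suc zero) t (suc zero) (at (on l L) (b ∷ v) n')) (sym e) r)) ,
  trans q' (trans (cong (λ z → z ʳ++ []) (sym q)) (trans (ʳ++-ʳ++ (c ∷ w)) (++-identityʳ (c ∷ w))))

decAt : ∀ {r} → Fin r → Frag 2
decAt zero    = remove
decAt (suc i) = seq pastZero (λ _ → decAt i)

decAt-zero : ∀ {r} (i : Fin r) (ρ : Vec ℕ r) l L n → lookup ρ i ≡ 0 → ∃ λ l' → ∃ λ b → ∃ λ v → ∃ λ n' →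
  decAt i ∶ at (on l L) (cells ρ) n ⇓ zero , at (on l' L) (b ∷ v) n' × l' ʳ++ (b ∷ v) ≡ l ʳ++ cells ρ
decAt-zero zero (.0 ∷ ρ) l L n refl = l , false , cells ρ , n , (1 , last refl) , refl
decAt-zero (suc i) (x ∷ ρ) l L n z with pastZero-ok x (cells ρ) l L n
... | n₁ , r₁ with decAt-zero i ρ ((replicate x true ++ false ∷ []) ʳ++ l) L n₁ z
... | l' , b , v , n' , r₂ , q = l' , b , v , n' , ⇓seq r₁ r₂ ,
  trans q (trans (ʳ++-ʳ++ (replicate x true ++ false ∷ []))
    (cong (l ʳ++_) (++-assoc (replicate x true) (false ∷ []) _)))

decAt-suc : ∀ {r} (i : Fin r) (ρ : Vec ℕ r) l L n y → lookup ρ i ≡ suc y → ∃ λ l' → ∃ λ b → ∃ λ v → ∃ λ n' →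
  decAt i ∶ at (on l L) (cells ρ) n ⇓ suc zero , at (on l' L) (b ∷ v) n' ×
  l' ʳ++ (b ∷ v) ≡ l ʳ++ cells (ρ [ i ]≔ y)
decAt-suc zero (.1 ∷ ρ) l L n zero refl with remove-ok false (cells ρ) l L n
... | b , v , n' , r , q = l , b , v , n' , r , cong (l ʳ++_) q
decAt-suc zero (.(suc (suc y)) ∷ ρ) l L n (suc y) refl
  with remove-ok true (replicate y true ++ false ∷ cells ρ) l L n
... | b , v , n' , r , q = l , b , v , n' , r , cong (l ʳ++_) q
decAt-suc (suc i) (x ∷ ρ) l L n y z with pastZero-ok x (cells ρ) l L n
... | n₁ , r₁ with decAt-suc i ρ ((replicate x true ++ false ∷ []) ʳ++ l) L n₁ y z
... | l' , b , v , n' , r₂ , q = l' , b , v , n' , ⇓seq r₁ r₂ ,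
  trans q (trans (ʳ++-ʳ++ (replicate x true ++ false ∷ []))
    (cong (l ʳ++_) (++-assoc (replicate x true) (false ∷ []) _)))

infix 4 _⊨_⇒_,_
-- Holding for every `L`, it lets counter programs run unchanged while input or output occupies the
-- left of the tape.
record _⊨_⇒_,_ {r k} (f : Frag k) (ρ : Vec ℕ r) (j : Fin k) (ρ' : Vec ℕ r) : Set where
  constructor mk⊨
  field at-home : ∀ L n → ∃ λ n' → f ∶ home L ρ n ⇓ j , home L ρ' n'
open _⊨_⇒_,_

⊨seq : ∀ {r j k} {f : Frag j} {g : Fin j → Frag k} {ρ : Vec ℕ r} {i ρ' l ρ''} →
  f ⊨ ρ ⇒ i , ρ' → g i ⊨ ρ' ⇒ l , ρ'' → seq f g ⊨ ρ ⇒ l , ρ''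
⊨seq {f = f} {g} {ρ} {i} {ρ'} {l} {ρ''} a b = mk⊨ go
  where
  go : ∀ L n → ∃ λ n' → seq f g ∶ home L ρ n ⇓ l , home L ρ'' n'
  go L n with at-home a L n
  ... | n₁ , r with at-home b L n₁
  ... | n₂ , r' = n₂ , ⇓seq r r'

⊨again : ∀ {r k} {f : Frag (suc k)} {ρ : Vec ℕ r} {ρ' j ρ''} →
  f ⊨ ρ ⇒ zero , ρ' → loop f ⊨ ρ' ⇒ j , ρ'' → loop f ⊨ ρ ⇒ j , ρ''
⊨again {f = f} {ρ} {ρ'} {j} {ρ''} a b = mk⊨ go
  where
  go : ∀ L n → ∃ λ n' → loop f ∶ home L ρ n ⇓ j , home L ρ'' n'
  go L n with at-home a L n
  ... | n₁ , r with at-home b L n₁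
  ... | n₂ , r' = n₂ , ⇓again r r'

⊨break : ∀ {r k} {f : Frag (suc k)} {ρ : Vec ℕ r} {j ρ'} → f ⊨ ρ ⇒ suc j , ρ' → loop f ⊨ ρ ⇒ j , ρ'
⊨break {f = f} {ρ} {j} {ρ'} a = mk⊨ go
  where
  go : ∀ L n → ∃ λ n' → loop f ∶ home L ρ n ⇓ j , home L ρ' n'
  go L n with at-home a L n
  ... | n₁ , r = n₁ , ⇓break r

⊨stop : ∀ {r k} (j : Fin k) (ρ : Vec ℕ r) → stop j ⊨ ρ ⇒ j , ρ
⊨stop j ρ = mk⊨ λ L n → n , stop-ok j _

opaque
  inc : ∀ {r} → Fin r → Frag 1
  inc i = seq goRight λ _ → seq (incAt i) λ _ → homeward

  inc-ok : ∀ {r} (i : Fin r) ρ → inc i ⊨ ρ ⇒ zero , (ρ [ i ]≔ suc (lookup ρ i))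
  inc-ok i ρ = mk⊨ go
    where
    go : ∀ L n → ∃ λ n' → inc i ∶ home L ρ n ⇓ zero , home L (ρ [ i ]≔ suc (lookup ρ i)) n'
    go L n with goRight-ok L (cells ρ) n
    ... | n₁ , r₁ with incAt-ok i ρ [] L n₁
    ... | l , b , v , n₂ , r₂ , q = n₂ , ⇓seq r₁ (⇓seq r₂
      (subst (λ w → homeward ∶ _ ⇓ zero , homeW L w n₂) q (homeward-ok l b v L n₂)))

  dec : ∀ {r} → Fin r → Frag 2
  dec i = seq goRight λ _ → seq (decAt i) λ j → seq homeward λ _ → stop j

  dec-zero : ∀ {r} (i : Fin r) ρ → lookup ρ i ≡ 0 → dec i ⊨ ρ ⇒ zero , ρ
  dec-zero i ρ z = mk⊨ go
    where
    go : ∀ L n → ∃ λ n' → dec i ∶ home L ρ n ⇓ zero , home L ρ n'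
    go L n with goRight-ok L (cells ρ) n
    ... | n₁ , r₁ with decAt-zero i ρ [] L n₁ z
    ... | l , b , v , n₂ , r₂ , q = n₂ , ⇓seq r₁ (⇓seq r₂ (⇓seq
      (subst (λ w → homeward ∶ _ ⇓ zero , homeW L w n₂) q (homeward-ok l b v L n₂)) (stop-ok zero _)))

  dec-suc : ∀ {r} (i : Fin r) ρ y → lookup ρ i ≡ suc y → dec i ⊨ ρ ⇒ suc zero , (ρ [ i ]≔ y)
  dec-suc i ρ y z = mk⊨ go
    where
    go : ∀ L n → ∃ λ n' → dec i ∶ home L ρ n ⇓ suc zero , home L (ρ [ i ]≔ y) n'
    go L n with goRight-ok L (cells ρ) n
    ... | n₁ , r₁ with decAt-suc i ρ [] L n₁ y z
    ... | l , b , v , n₂ , r₂ , q = n₂ , ⇓seq r₁ (⇓seq r₂ (⇓seq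
      (subst (λ w → homeward ∶ _ ⇓ zero , homeW L w n₂) q (homeward-ok l b v L n₂)) (stop-ok (suc zero) _)))

-- Trees in counters: a node is 2ᵃ(2b + 1)

bumps : ∀ {r k} → List (Fin r) → Frag (suc k)
bumps []       = stop zero
bumps (i ∷ is) = seq (inc i) λ _ → bumps is

bump : ∀ {r} → List (Fin r) → Vec ℕ r → Vec ℕ r
bump []       ρ = ρ
bump (i ∷ is) ρ = bump is (ρ [ i ]≔ suc (lookup ρ i))

bumps-ok : ∀ {r k} is (ρ : Vec ℕ r) → bumps {k = k} is ⊨ ρ ⇒ zero , bump is ρ
bumps-ok []       ρ = ⊨stop zero ρ
bumps-ok (i ∷ is) ρ = ⊨seq {g = λ _ → bumps is} (inc-ok i ρ) (bumps-ok is _)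

drainD : ∀ {r} → List (Fin r) → Fin 2 → Frag 2
drainD is zero    = stop (suc zero)
drainD is (suc _) = bumps is

drain : ∀ {r} → Fin r → List (Fin r) → Frag 1
drain i is = loop (seq (dec i) (drainD is))

drain-zero : ∀ {r} i is (ρ : Vec ℕ r) → lookup ρ i ≡ 0 → drain i is ⊨ ρ ⇒ zero , ρ
drain-zero i is ρ z = ⊨break (⊨seq {g = drainD is} (dec-zero i ρ z) (⊨stop (suc zero) ρ))

drain-suc : ∀ {r} i is (ρ : Vec ℕ r) x {ρ'} → lookup ρ i ≡ suc x →
  drain i is ⊨ bump is (ρ [ i ]≔ x) ⇒ zero , ρ' → drain i is ⊨ ρ ⇒ zero , ρ'
drain-suc i is ρ x z r = ⊨again (⊨seq {g = drainD is} (dec-suc i ρ x z) (bumps-ok is _)) r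

⊨subst : ∀ {r k} {f : Frag k} {ρ : Vec ℕ r} {j ρ' ρ''} → ρ' ≡ ρ'' → f ⊨ ρ ⇒ j , ρ' → f ⊨ ρ ⇒ j , ρ''
⊨subst refl r = r

-- Three working counters precede the `d` registers: `rT` is scratch and is zero between operations,
-- `rA` and `rB` are the two hands on which `mk` and `un` operate.
pattern rT = zero
pattern rA = suc zero
pattern rB = suc (suc zero)
pattern rR i = suc (suc (suc i))

pow2 : ℕ → ℕ → ℕ
pow2 zero    x = x
pow2 (suc k) x = pow2 k x + pow2 k x

pow2-double : ∀ k x → pow2 k (x + x) ≡ pow2 k x + pow2 k x
pow2-double zero    x = refl
pow2-double (suc k) x rewrite pow2-double k x = refl

pow2-pos : ∀ k x → ∃ λ z → pow2 k (suc x) ≡ suc z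
pow2-pos zero    x = x , refl
pow2-pos (suc k) x with pow2 k (suc x) | pow2-pos k x
... | .(suc z) | z , refl = z + suc z , refl

module _ {d : ℕ} where
  private
    Regs = Vec ℕ (3 + d)

  clearA-ok : ∀ t a b (ρ : Vec ℕ d) → drain rA [] ⊨ (t ∷ a ∷ b ∷ ρ) ⇒ zero , (t ∷ 0 ∷ b ∷ ρ)
  clearA-ok t zero    b ρ = drain-zero rA [] _ refl
  clearA-ok t (suc a) b ρ = drain-suc rA [] _ a refl (clearA-ok t a b ρ)

  clearB-ok : ∀ t a b (ρ : Vec ℕ d) → drain rB [] ⊨ (t ∷ a ∷ b ∷ ρ) ⇒ zero , (t ∷ a ∷ 0 ∷ ρ)
  clearB-ok t a zero    ρ = drain-zero rB [] _ refl
  clearB-ok t a (suc b) ρ = drain-suc rB [] _ b refl (clearB-ok t a b ρ)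

  clearR-ok : ∀ x t a b (ρ : Vec ℕ d) i → lookup ρ i ≡ x →
    drain (rR i) [] ⊨ (t ∷ a ∷ b ∷ ρ) ⇒ zero , (t ∷ a ∷ b ∷ ρ [ i ]≔ 0)
  clearR-ok zero    t a b ρ i e =
    ⊨subst (cong (λ z → t ∷ a ∷ b ∷ z) (trans (sym ([]≔-lookup ρ i)) (cong (ρ [ i ]≔_) e)))
      (drain-zero (rR i) [] _ e)
  clearR-ok (suc x) t a b ρ i e = drain-suc (rR i) [] _ x e
    (⊨subst (cong (λ z → t ∷ a ∷ b ∷ z) ([]≔-idempotent ρ i))
      (clearR-ok x t a b (ρ [ i ]≔ x) i (lookup∘update i ρ x)))

  double-ok : ∀ t a b (ρ : Vec ℕ d) → drain {3 + d} rB (rT ∷ rT ∷ []) ⊨ (t ∷ a ∷ b ∷ ρ) ⇒ zero , (b + b + t ∷ a ∷ 0 ∷ ρ)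
  double-ok t a zero    ρ = drain-zero rB _ _ refl
  double-ok t a (suc b) ρ = drain-suc rB _ _ b refl
    (⊨subst (cong (λ z → z ∷ a ∷ 0 ∷ ρ) eq) (double-ok (suc (suc t)) a b ρ))
    where eq : b + b + suc (suc t) ≡ suc (b + suc b + t)
          eq rewrite +-suc b b | +-suc (b + b) (suc t) | +-suc (b + b) t = refl

  T→B-ok : ∀ t a b (ρ : Vec ℕ d) → drain {3 + d} rT (rB ∷ []) ⊨ (t ∷ a ∷ b ∷ ρ) ⇒ zero , (0 ∷ a ∷ t + b ∷ ρ)
  T→B-ok zero    a b ρ = drain-zero rT _ _ refl
  T→B-ok (suc t) a b ρ = drain-suc rT _ _ t refl
    (⊨subst (cong (λ z → 0 ∷ a ∷ z ∷ ρ) (+-suc t b)) (T→B-ok t a (suc b) ρ))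

  private
    bump-lookup : ∀ (ρ : Vec ℕ d) i x →
      (ρ [ i ]≔ suc (lookup ρ i)) [ i ]≔ (x + lookup (ρ [ i ]≔ suc (lookup ρ i)) i) ≡ ρ [ i ]≔ (suc x + lookup ρ i)
    bump-lookup ρ i x rewrite lookup∘update i ρ (suc (lookup ρ i)) | +-suc x (lookup ρ i) = []≔-idempotent ρ i

  B→R-ok : ∀ t a b (ρ : Vec ℕ d) i →
    drain rB (rR i ∷ []) ⊨ (t ∷ a ∷ b ∷ ρ) ⇒ zero , (t ∷ a ∷ 0 ∷ ρ [ i ]≔ (b + lookup ρ i))
  B→R-ok t a zero    ρ i = ⊨subst (cong (λ z → t ∷ a ∷ 0 ∷ z) (sym ([]≔-lookup ρ i))) (drain-zero rB _ _ refl)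
  B→R-ok t a (suc b) ρ i = drain-suc rB _ _ b refl
    (⊨subst (cong (λ z → t ∷ a ∷ 0 ∷ z) (bump-lookup ρ i b)) (B→R-ok t a b _ i))

  A→R-ok : ∀ t a b (ρ : Vec ℕ d) i →
    drain rA (rR i ∷ []) ⊨ (t ∷ a ∷ b ∷ ρ) ⇒ zero , (t ∷ 0 ∷ b ∷ ρ [ i ]≔ (a + lookup ρ i))
  A→R-ok t zero    b ρ i = ⊨subst (cong (λ z → t ∷ 0 ∷ b ∷ z) (sym ([]≔-lookup ρ i))) (drain-zero rA _ _ refl)
  A→R-ok t (suc a) b ρ i = drain-suc rA _ _ a refl
    (⊨subst (cong (λ z → t ∷ 0 ∷ b ∷ z) (bump-lookup ρ i a)) (A→R-ok t a b _ i))

  T→R-ok : ∀ t a b (ρ : Vec ℕ d) i →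
    drain rT (rR i ∷ []) ⊨ (t ∷ a ∷ b ∷ ρ) ⇒ zero , (0 ∷ a ∷ b ∷ ρ [ i ]≔ (t + lookup ρ i))
  T→R-ok zero    a b ρ i = ⊨subst (cong (λ z → 0 ∷ a ∷ b ∷ z) (sym ([]≔-lookup ρ i))) (drain-zero rT _ _ refl)
  T→R-ok (suc t) a b ρ i = drain-suc rT _ _ t refl
    (⊨subst (cong (λ z → 0 ∷ a ∷ b ∷ z) (bump-lookup ρ i t)) (T→R-ok t a b _ i))

  R→BT-ok : ∀ x t a b (ρ : Vec ℕ d) i → lookup ρ i ≡ x →
    drain (rR i) (rB ∷ rT ∷ []) ⊨ (t ∷ a ∷ b ∷ ρ) ⇒ zero , (x + t ∷ a ∷ x + b ∷ ρ [ i ]≔ 0)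
  R→BT-ok zero    t a b ρ i e =
    ⊨subst (cong (λ z → t ∷ a ∷ b ∷ z) (trans (sym ([]≔-lookup ρ i)) (cong (ρ [ i ]≔_) e)))
      (drain-zero (rR i) _ _ e)
  R→BT-ok (suc x) t a b ρ i e = drain-suc (rR i) _ _ x e
    (⊨subst (cong₂ (λ (p : ℕ × ℕ) z → proj₁ p ∷ a ∷ proj₂ p ∷ z) (cong₂ _,_ (+-suc x t) (+-suc x b)) ([]≔-idempotent ρ i))
      (R→BT-ok x (suc t) a (suc b) (ρ [ i ]≔ x) i (lookup∘update i ρ x)))

  R→AT-ok : ∀ x t a b (ρ : Vec ℕ d) i → lookup ρ i ≡ x →
    drain (rR i) (rA ∷ rT ∷ []) ⊨ (t ∷ a ∷ b ∷ ρ) ⇒ zero , (x + t ∷ x + a ∷ b ∷ ρ [ i ]≔ 0)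
  R→AT-ok zero    t a b ρ i e =
    ⊨subst (cong (λ z → t ∷ a ∷ b ∷ z) (trans (sym ([]≔-lookup ρ i)) (cong (ρ [ i ]≔_) e)))
      (drain-zero (rR i) _ _ e)
  R→AT-ok (suc x) t a b ρ i e = drain-suc (rR i) _ _ x e
    (⊨subst (cong₂ (λ (p : ℕ × ℕ) z → proj₁ p ∷ proj₂ p ∷ b ∷ z) (cong₂ _,_ (+-suc x t) (+-suc x a)) ([]≔-idempotent ρ i))
      (R→AT-ok x (suc t) (suc a) b (ρ [ i ]≔ x) i (lookup∘update i ρ x)))

  infixr 4 _then_
  _then_ : ∀ {k} → Frag 1 → Frag k → Frag k
  f then g = seq f λ _ → g

  ⊨then : ∀ {k} {f : Frag 1} {g : Frag k} {ρ : Regs} {ρ' l ρ''} →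
    f ⊨ ρ ⇒ zero , ρ' → g ⊨ ρ' ⇒ l , ρ'' → (f then g) ⊨ ρ ⇒ l , ρ''
  ⊨then {g = g} = ⊨seq {g = λ _ → g}

  storeB storeA loadB loadA : Fin d → Frag 1
  storeB i = drain (rR i) [] then drain {3 + d} rB (rR i ∷ [])
  storeA i = drain (rR i) [] then drain {3 + d} rA (rR i ∷ [])
  loadB i  = drain {3 + d} rB [] then drain (rR i) (rB ∷ rT ∷ []) then drain rT (rR i ∷ [])
  loadA i  = drain {3 + d} rA [] then drain (rR i) (rA ∷ rT ∷ []) then drain rT (rR i ∷ [])

  private
    overwrite : ∀ (ρ : Vec ℕ d) i x → (ρ [ i ]≔ 0) [ i ]≔ (x + lookup (ρ [ i ]≔ 0) i) ≡ ρ [ i ]≔ x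
    overwrite ρ i x rewrite lookup∘update i ρ 0 | +-identityʳ x = []≔-idempotent ρ i

  storeB-ok : ∀ a b (ρ : Vec ℕ d) i → storeB i ⊨ (0 ∷ a ∷ b ∷ ρ) ⇒ zero , (0 ∷ a ∷ 0 ∷ ρ [ i ]≔ b)
  storeB-ok a b ρ i = ⊨then (clearR-ok _ 0 a b ρ i refl)
    (⊨subst (cong (λ z → 0 ∷ a ∷ 0 ∷ z) (overwrite ρ i b)) (B→R-ok 0 a b _ i))

  storeA-ok : ∀ a b (ρ : Vec ℕ d) i → storeA i ⊨ (0 ∷ a ∷ b ∷ ρ) ⇒ zero , (0 ∷ 0 ∷ b ∷ ρ [ i ]≔ a)
  storeA-ok a b ρ i = ⊨then (clearR-ok _ 0 a b ρ i refl)
    (⊨subst (cong (λ z → 0 ∷ 0 ∷ b ∷ z) (overwrite ρ i a)) (A→R-ok 0 a b _ i))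

  private
    restore : ∀ (ρ : Vec ℕ d) i → (ρ [ i ]≔ 0) [ i ]≔ (lookup ρ i + 0 + lookup (ρ [ i ]≔ 0) i) ≡ ρ
    restore ρ i rewrite lookup∘update i ρ 0 | +-identityʳ (lookup ρ i) | +-identityʳ (lookup ρ i) =
      trans ([]≔-idempotent ρ i) ([]≔-lookup ρ i)

  loadB-ok : ∀ a b (ρ : Vec ℕ d) i → loadB i ⊨ (0 ∷ a ∷ b ∷ ρ) ⇒ zero , (0 ∷ a ∷ lookup ρ i ∷ ρ)
  loadB-ok a b ρ i = ⊨then (clearB-ok 0 a b ρ) (⊨then (R→BT-ok _ 0 a 0 ρ i refl)
    (⊨subst (cong₂ (λ y z → 0 ∷ a ∷ y ∷ z) (+-identityʳ _) (restore ρ i)) (T→R-ok _ a _ _ i)))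

  loadA-ok : ∀ a b (ρ : Vec ℕ d) i → loadA i ⊨ (0 ∷ a ∷ b ∷ ρ) ⇒ zero , (0 ∷ lookup ρ i ∷ b ∷ ρ)
  loadA-ok a b ρ i = ⊨then (clearA-ok 0 a b ρ) (⊨then (R→AT-ok _ 0 0 b ρ i refl)
    (⊨subst (cong₂ (λ y z → 0 ∷ y ∷ b ∷ z) (+-identityʳ _) (restore ρ i)) (T→R-ok _ _ b _ i)))

  doubleB : Frag 1
  doubleB = drain {3 + d} rB (rT ∷ rT ∷ []) then drain {3 + d} rT (rB ∷ [])

  doubleB-ok : ∀ a b (ρ : Vec ℕ d) → doubleB ⊨ (0 ∷ a ∷ b ∷ ρ) ⇒ zero , (0 ∷ a ∷ b + b ∷ ρ)
  doubleB-ok a b ρ = ⊨then (double-ok 0 a b ρ)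
    (⊨subst (cong (λ z → 0 ∷ a ∷ z ∷ ρ) (trans (+-identityʳ _) (+-identityʳ _))) (T→B-ok _ a 0 ρ))

  shiftD : Fin 2 → Frag 2
  shiftD zero    = stop (suc zero)
  shiftD (suc _) = doubleB then stop zero

  shiftB : Frag 1
  shiftB = loop (seq (dec {3 + d} rA) shiftD)

  shiftB-ok : ∀ a b (ρ : Vec ℕ d) → shiftB ⊨ (0 ∷ a ∷ b ∷ ρ) ⇒ zero , (0 ∷ 0 ∷ pow2 a b ∷ ρ)
  shiftB-ok zero    b ρ = ⊨break (⊨seq {g = shiftD} (dec-zero rA _ refl) (⊨stop (suc zero) _))
  shiftB-ok (suc a) b ρ = ⊨again
    (⊨seq {g = shiftD} (dec-suc rA _ a refl) (⊨then (doubleB-ok a b ρ) (⊨stop zero _)))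
    (⊨subst (cong (λ z → 0 ∷ 0 ∷ z ∷ ρ) (pow2-double a b)) (shiftB-ok a (b + b) ρ))

  consB : Frag 1
  consB = doubleB then inc {3 + d} rB then shiftB

  consB-ok : ∀ a b (ρ : Vec ℕ d) → consB ⊨ (0 ∷ a ∷ b ∷ ρ) ⇒ zero , (0 ∷ 0 ∷ pow2 a (suc (b + b)) ∷ ρ)
  consB-ok a b ρ = ⊨then (doubleB-ok a b ρ) (⊨then (inc-ok rB _) (shiftB-ok a _ ρ))

  halveE halveD : Fin 2 → Frag 3
  halveE zero    = drain {3 + d} rT (rB ∷ []) then stop (suc (suc zero))
  halveE (suc _) = inc {3 + d} rT then stop zero
  halveD zero    = inc {3 + d} rA then drain {3 + d} rT (rB ∷ []) then stop zero
  halveD (suc _) = seq (dec {3 + d} rB) halveE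

  -- Two decrements of `rB` pay for one unit of `rT`. Running out after an even number means a
  -- factor 2: the exponent in `rA` is raised and the half is treated again. Running out in the
  -- middle of a pair means that the odd part is reached.
  halve : Frag 2
  halve = loop (seq (dec {3 + d} rB) halveD)

  halve-two : ∀ t a b (ρ : Vec ℕ d) {j ρ'} → halve ⊨ (suc t ∷ a ∷ b ∷ ρ) ⇒ j , ρ' →
    halve ⊨ (t ∷ a ∷ suc (suc b) ∷ ρ) ⇒ j , ρ'
  halve-two t a b ρ r = ⊨again (⊨seq {g = halveD} (dec-suc rB _ (suc b) refl)
    (⊨seq {g = halveE} (dec-suc rB _ b refl) (⊨then (inc-ok rT _) (⊨stop zero _)))) r

  halve-even : ∀ y t a (ρ : Vec ℕ d) {j ρ'} → halve ⊨ (0 ∷ suc a ∷ t + y ∷ ρ) ⇒ j , ρ' →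
    halve ⊨ (t ∷ a ∷ y + y ∷ ρ) ⇒ j , ρ'
  halve-even zero    t a ρ r = ⊨again (⊨seq {g = halveD} (dec-zero rB _ refl)
    (⊨then (inc-ok rA _) (⊨then (T→B-ok t (suc a) 0 ρ) (⊨stop zero _)))) r
  halve-even (suc y) t a ρ r rewrite +-suc y y | +-suc t y = halve-two t a (y + y) ρ (halve-even y (suc t) a ρ r)

  halve-odd : ∀ y t a (ρ : Vec ℕ d) → halve ⊨ (t ∷ a ∷ suc (y + y) ∷ ρ) ⇒ suc zero , (0 ∷ a ∷ t + y ∷ ρ)
  halve-odd zero    t a ρ = ⊨break (⊨seq {g = halveD} (dec-suc rB _ 0 refl)
    (⊨seq {g = halveE} (dec-zero rB _ refl) (⊨then (T→B-ok t a 0 ρ) (⊨stop (suc (suc zero)) _))))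
  halve-odd (suc y) t a ρ rewrite +-suc y y | +-suc t y = halve-two t a (suc (y + y)) ρ (halve-odd y (suc t) a ρ)

  halve-ok : ∀ k y a (ρ : Vec ℕ d) → halve ⊨ (0 ∷ a ∷ pow2 k (suc (y + y)) ∷ ρ) ⇒ suc zero , (0 ∷ k + a ∷ y ∷ ρ)
  halve-ok zero    y a ρ = halve-odd y 0 a ρ
  halve-ok (suc k) y a ρ = halve-even (pow2 k (suc (y + y))) 0 a ρ
    (⊨subst (cong (λ z → 0 ∷ z ∷ y ∷ ρ) (+-suc k a)) (halve-ok k y (suc a) ρ))

  -- A leaf is 0, on which `halve` would never stop; so it is tested first, and the unit consumed by
  -- the test is put back.
  splitD : Fin 2 → Frag 2
  splitD zero    = stop zero
  splitD (suc _) = inc {3 + d} rB then halve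

  splitB : Frag 2
  splitB = drain {3 + d} rA [] then seq (dec {3 + d} rB) splitD

  splitB-leaf : ∀ a (ρ : Vec ℕ d) → splitB ⊨ (0 ∷ a ∷ 0 ∷ ρ) ⇒ zero , (0 ∷ 0 ∷ 0 ∷ ρ)
  splitB-leaf a ρ = ⊨then (clearA-ok 0 a 0 ρ) (⊨seq {g = splitD} (dec-zero rB _ refl) (⊨stop zero _))

  splitB-node : ∀ a x y (ρ : Vec ℕ d) →
    splitB ⊨ (0 ∷ a ∷ pow2 x (suc (y + y)) ∷ ρ) ⇒ suc zero , (0 ∷ x ∷ y ∷ ρ)
  splitB-node a x y ρ with pow2-pos x (y + y)
  ... | z , e = ⊨then (clearA-ok 0 a _ ρ) (⊨seq {g = splitD} (dec-suc rB _ z e)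
    (⊨then (inc-ok rB _) (⊨subst (cong (λ w → 0 ∷ w ∷ y ∷ ρ) (+-identityʳ x))
      (subst (λ w → halve ⊨ (0 ∷ 0 ∷ w ∷ ρ) ⇒ suc zero , (0 ∷ x + 0 ∷ y ∷ ρ)) e (halve-ok x y 0 ρ)))))

data Tree : Set where
  leaf : Tree
  node : Tree → Tree → Tree

num : Tree → ℕ
num leaf       = 0
num (node a b) = pow2 (num a) (suc (num b + num b))

-- Branching code without loops, on registers that hold trees

data Code (d k : ℕ) : Set where
  ret  : Fin k → Code d k
  getA getB setA setB : Fin d → Code d k → Code d k
  lit  : Tree → Code d k → Code d k
  mk   : Code d k → Code d k
  un   : Code d k → Code d k → Code d k

-- Storing empties the hand whereas loading copies, just as the counter programs behind these
-- instructions do.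
exec : ∀ {d k} → Code d k → Tree → Tree → Vec Tree d → Fin k × Tree × Tree × Vec Tree d
exec (ret j)    a b ρ = j , a , b , ρ
exec (getA i c) a b ρ = exec c (lookup ρ i) b ρ
exec (getB i c) a b ρ = exec c a (lookup ρ i) ρ
exec (setA i c) a b ρ = exec c leaf b (ρ [ i ]≔ a)
exec (setB i c) a b ρ = exec c a leaf (ρ [ i ]≔ b)
exec (lit t c)  a b ρ = exec c a t ρ
exec (mk c)     a b ρ = exec c leaf (node a b) ρ
exec (un c c')  a leaf       ρ = exec c leaf leaf ρ
exec (un c c')  a (node x y) ρ = exec c' x y ρ

incs : ∀ {r} → Fin r → ℕ → Frag 1
incs i zero    = stop zero
incs i (suc n) = seq (inc i) λ _ → incs i n

regs : ∀ {d} → Tree → Tree → Vec Tree d → Vec ℕ (3 + d)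
regs a b ρ = 0 ∷ num a ∷ num b ∷ Vec.map num ρ

incsB-ok : ∀ {d} t a b (ρ : Vec ℕ d) n → incs {3 + d} rB n ⊨ (t ∷ a ∷ b ∷ ρ) ⇒ zero , (t ∷ a ∷ n + b ∷ ρ)
incsB-ok t a b ρ zero    = ⊨stop zero _
incsB-ok t a b ρ (suc n) = ⊨seq {g = λ _ → incs rB n} (inc-ok rB _)
  (⊨subst (cong (λ z → t ∷ a ∷ z ∷ ρ) (+-suc n b)) (incsB-ok t a (suc b) ρ n))

choose : ∀ {k} → Frag k → Frag k → Fin 2 → Frag k
choose f g zero    = f
choose f g (suc _) = g

opaque
  compile : ∀ {d k} → Code d k → Frag k
  compile (ret j)       = stop j
  compile (getA i c)    = seq (loadA i) λ _ → compile c
  compile (getB i c)    = seq (loadB i) λ _ → compile c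
  compile (setA i c)    = seq (storeA i) λ _ → compile c
  compile (setB i c)    = seq (storeB i) λ _ → compile c
  compile {d} (lit t c) = seq (drain {3 + d} rB []) λ _ → seq (incs {3 + d} rB (num t)) λ _ → compile c
  compile {d} (mk c)    = seq (consB {d}) λ _ → compile c
  compile {d} (un c c') = seq (splitB {d}) (choose (compile c) (compile c'))

  compile-ok : ∀ {d k} (c : Code d k) a b ρ →
    let (j , a' , b' , ρ') = exec c a b ρ in compile c ⊨ regs a b ρ ⇒ j , regs a' b' ρ'
  compile-ok (ret j) a b ρ = ⊨stop j _
  compile-ok (getA i c) a b ρ = ⊨seq {g = λ _ → compile c}
    (⊨subst (cong (λ z → 0 ∷ z ∷ num b ∷ Vec.map num ρ) (lookup-map i num ρ)) (loadA-ok _ _ _ i)) (compile-ok c _ _ _)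
  compile-ok (getB i c) a b ρ = ⊨seq {g = λ _ → compile c}
    (⊨subst (cong (λ z → 0 ∷ num a ∷ z ∷ Vec.map num ρ) (lookup-map i num ρ)) (loadB-ok _ _ _ i)) (compile-ok c _ _ _)
  compile-ok (setA i c) a b ρ = ⊨seq {g = λ _ → compile c}
    (⊨subst (cong (λ z → 0 ∷ 0 ∷ num b ∷ z) (sym (map-[]≔ num ρ i))) (storeA-ok _ _ _ i)) (compile-ok c _ _ _)
  compile-ok (setB i c) a b ρ = ⊨seq {g = λ _ → compile c}
    (⊨subst (cong (λ z → 0 ∷ num a ∷ 0 ∷ z) (sym (map-[]≔ num ρ i))) (storeB-ok _ _ _ i)) (compile-ok c _ _ _)
  compile-ok (lit t c) a b ρ = ⊨seq {g = λ _ → seq (incs rB (num t)) λ _ → compile c} (clearB-ok 0 _ _ _)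
    (⊨seq {g = λ _ → compile c}
      (⊨subst (cong (λ z → 0 ∷ num a ∷ z ∷ Vec.map num ρ) (+-identityʳ (num t))) (incsB-ok 0 _ 0 _ (num t)))
      (compile-ok c _ _ _))
  compile-ok {d} (mk c) a b ρ = ⊨seq {g = λ _ → compile c}
    (consB-ok _ _ _) (compile-ok c _ _ _)
  compile-ok (un c c') a leaf ρ = ⊨seq {g = choose (compile c) (compile c')} (splitB-leaf _ _) (compile-ok c _ _ _)
  compile-ok {d} (un c c') a (node x y) ρ = ⊨seq {g = choose (compile c) (compile c')}
    (splitB-node _ (num x) (num y) (Vec.map num ρ)) (compile-ok c' _ _ _)

-- An environment machine

spine : ℕ → Tree
spine zero    = leaf
spine (suc n) = node leaf (spine n)

-- The left child of a code tree is a unary tag. Variables are de Bruijn indices, `cPop` being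
-- weakening; application and pairing share `cBin`, since both evaluate two subterms in turn.
pattern ⟨1⟩ = node leaf leaf
pattern cTop = leaf
pattern cPop c = node leaf c
pattern cLam c = node ⟨1⟩ c
pattern cLeaf = node (node leaf ⟨1⟩) leaf
pattern cCase c d = node (node leaf (node leaf ⟨1⟩)) (node c d)
pattern cBin g c d = node (node leaf (node leaf (node leaf ⟨1⟩))) (node g (node c d))
pattern cApp c d = cBin leaf c d
pattern cNode c d = cBin ⟨1⟩ c d

pattern evalS c e k = c ∷ e ∷ k ∷ leaf ∷ []
pattern retS v e k = v ∷ e ∷ k ∷ ⟨1⟩ ∷ []

State : Set
State = Vec Tree 4

pattern arg g d e k = node (node leaf (node g (node d e))) k
pattern fun g v k = node (node ⟨1⟩ (node g v)) k

infix 4 _⟶_ _⟶*_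
-- A call-by-value CEK machine: control, environment, continuation, and a mode. A case distinction
-- inspects the top of the environment and pushes the two children in front of it.
data _⟶_ : State → State → Set where
  top   : ∀ {v e k}       → evalS cTop (node v e) k ⟶ retS v (node v e) k
  pop   : ∀ {c v e k}     → evalS (cPop c) (node v e) k ⟶ evalS c e k
  lam   : ∀ {c e k}       → evalS (cLam c) e k ⟶ retS (node c e) e k
  con   : ∀ {e k}         → evalS cLeaf e k ⟶ retS leaf e k
  case0 : ∀ {c d e k}     → evalS (cCase c d) (node leaf e) k ⟶ evalS c (node leaf e) k
  case1 : ∀ {c d a b e k} → evalS (cCase c d) (node (node a b) e) k ⟶
                            evalS d (node a (node b (node (node a b) e))) k
  bin   : ∀ {g c d e k}   → evalS (cBin g c d) e k ⟶ evalS c e (arg g d e k)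
  swap  : ∀ {v e' g d e k} → retS v e' (arg g d e k) ⟶ evalS d e (fun g v k)
  call  : ∀ {v e' c e k}  → retS v e' (fun leaf (node c e) k) ⟶ evalS c (node v e) k
  build : ∀ {v e' w k}    → retS v e' (fun ⟨1⟩ w k) ⟶ retS (node w v) e' k

data _⟶*_ : State → State → Set where
  []  : ∀ {s} → s ⟶* s
  _∷_ : ∀ {s s' s''} → s ⟶ s' → s' ⟶* s'' → s ⟶* s''

_++*_ : ∀ {s s' s''} → s ⟶* s' → s' ⟶* s'' → s ⟶* s''
[] ++* q = q
(x ∷ p) ++* q = x ∷ (p ++* q)

-- `#S` (stage of the search) and `#P` (its input, finally its output) are left alone by the machine
-- steps; `#X` and `#Y` are scratch.
pattern #C = zero
pattern #E = suc zero
pattern #K = suc (suc zero)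
pattern #M = suc (suc (suc zero))
pattern #S = suc (suc (suc (suc zero)))
pattern #P = suc (suc (suc (suc (suc zero))))
pattern #X = suc (suc (suc (suc (suc (suc zero)))))
pattern #Y = suc (suc (suc (suc (suc (suc (suc zero))))))

private
  again stuck : Code 8 2
  again = ret zero
  stuck = ret zero
  toRet toEval : Code 8 2
  toRet  = lit ⟨1⟩ (setB #M again)
  toEval = lit leaf (setB #M again)

  doPop doLam doCase doBin doEval doArg doFun doRet : Code 8 2
  doPop  = getB #X (setB #C (getB #E (un stuck (setB #E again))))
  doLam  = getA #X (getB #E (mk (setB #C toRet)))
  doCase = getB #E (un stuck (setA #Y (getB #Y (un
             (getB #X (un stuck (setA #C again)))
             (setA #Y (setB #C (getA #C (getB #E (mk (getA #Y (mk (setB #E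
               (getB #X (un stuck (setB #C again)))))))))))))))
  doBin  = getB #X (un stuck (setA #Y (un stuck (setA #C (setB #X (getA #X (getB #E (mk (getA #Y
             (mk (mk (setB #X (getA #X (getB #K (mk (setB #K again))))))))))))))))
  doEval = getB #C (un
             (getB #E (un stuck (setA #C toRet)))
             (setB #X (setA #Y (getB #Y (un doPop (un doLam (un
               (lit leaf (setB #C toRet)) (un doCase doBin))))))))
  doArg  = getB #X (un stuck (setA #Y (un stuck (setB #E (setA #X (getA #Y (getB #C (mk
             (setB #Y (lit ⟨1⟩ (setB #C (getA #C (getB #Y (mk (setB #Y (getA #Y (getB #K (mk (setB #K
             (getB #X (setB #C toEval)))))))))))))))))))))
  doFun  = getB #X (un stuck (setB #X (setA #Y (getB #Y (un
             (getB #X (un stuck (setA #Y (setB #X (getA #C (getB #X (mk (setB #E (getB #Y (setB #C toEval))))))))))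
             (getA #X (getB #C (mk (setB #C again)))))))))
  doRet  = getB #K (un (ret (suc zero)) (setB #K (setA #X (getB #X (un stuck
             (setA #Y (setB #X (getB #Y (un doArg doFun)))))))))

machineStep : Code 8 2
machineStep = getB #M (un doEval doRet)

layout : State → Tree → Tree → Tree → Tree → Vec Tree 8
layout (c ∷ e ∷ k ∷ m ∷ []) s p x y = c ∷ e ∷ k ∷ m ∷ s ∷ p ∷ x ∷ y ∷ []

machineStep-ok : ∀ {q q'} → q ⟶ q' → ∀ a b s p x y → ∃ λ a' → ∃ λ b' → ∃ λ x' → ∃ λ y' →
  exec machineStep a b (layout q s p x y) ≡ (zero , a' , b' , layout q' s p x' y')
machineStep-ok top   a b s p x y = _ , _ , _ , _ , refl
machineStep-ok pop   a b s p x y = _ , _ , _ , _ , refl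
machineStep-ok lam   a b s p x y = _ , _ , _ , _ , refl
machineStep-ok con   a b s p x y = _ , _ , _ , _ , refl
machineStep-ok case0 a b s p x y = _ , _ , _ , _ , refl
machineStep-ok case1 a b s p x y = _ , _ , _ , _ , refl
machineStep-ok bin   a b s p x y = _ , _ , _ , _ , refl
machineStep-ok swap  a b s p x y = _ , _ , _ , _ , refl
machineStep-ok call  a b s p x y = _ , _ , _ , _ , refl
machineStep-ok build a b s p x y = _ , _ , _ , _ , refl

machine : Frag 1
machine = loop (compile machineStep)

machine-ok : ∀ {q v e} → q ⟶* retS v e leaf → ∀ a b s p x y →
  ∃ λ a' → ∃ λ b' → ∃ λ x' → ∃ λ y' →
  machine ⊨ regs a b (layout q s p x y) ⇒ zero , regs a' b' (layout (retS v e leaf) s p x' y')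
machine-ok {v = v} {e} [] a b s p x y = leaf , leaf , x , y , ⊨break (compile-ok machineStep a b (layout (retS v e leaf) s p x y))
machine-ok {q} (_∷_ {s' = q'} st r) a b s p x y with machineStep-ok st a b s p x y
... | a₁ , b₁ , x₁ , y₁ , eq with machine-ok r a₁ b₁ s p x₁ y₁
... | a₂ , b₂ , x₂ , y₂ , run = a₂ , b₂ , x₂ , y₂ , ⊨again
  (subst (λ (z : Fin 2 × Tree × Tree × Vec Tree 8) → let (j , a' , b' , ρ') = z in
      compile machineStep ⊨ regs a b (layout q s p x y) ⇒ j , regs a' b' ρ')
    eq (compile-ok machineStep a b (layout q s p x y))) run

-- A typed functional language

infixr 5 _⇒_
infixr 6 _⊗_
-- Gödel's T with lists, pairs and options. The language is total, so that its terms have Agda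
-- functions as denotations; partiality enters only through the search built around a term.
data Ty : Set where
  nat bool   : Ty
  list opt   : Ty → Ty
  _⊗_ _⇒_    : Ty → Ty → Ty

⟦_⟧ : Ty → Set
⟦ nat ⟧    = ℕ
⟦ bool ⟧   = Bool
⟦ list σ ⟧ = List ⟦ σ ⟧
⟦ opt σ ⟧  = Maybe ⟦ σ ⟧
⟦ σ ⊗ τ ⟧  = ⟦ σ ⟧ × ⟦ τ ⟧
⟦ σ ⇒ τ ⟧  = ⟦ σ ⟧ → ⟦ τ ⟧

natrec : {A : Set} → A → (ℕ → A → A) → ℕ → A
natrec z s zero    = z
natrec z s (suc n) = s n (natrec z s n)

listrec : {A B : Set} → B → (A → List A → B → B) → List A → B
listrec z s []       = z
listrec z s (x ∷ xs) = s x xs (listrec z s xs)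

cond : {A : Set} → A → A → Bool → A
cond x y b = if b then x else y

data Const : Ty → Set where
  `zero    : Const nat
  `suc     : Const (nat ⇒ nat)
  `natrec  : ∀ {τ} → Const (τ ⇒ (nat ⇒ τ ⇒ τ) ⇒ nat ⇒ τ)
  `true `false : Const bool
  `cond    : ∀ {τ} → Const (τ ⇒ τ ⇒ bool ⇒ τ)
  `nil     : ∀ {σ} → Const (list σ)
  `cons    : ∀ {σ} → Const (σ ⇒ list σ ⇒ list σ)
  `listrec : ∀ {σ τ} → Const (τ ⇒ (σ ⇒ list σ ⇒ τ ⇒ τ) ⇒ list σ ⇒ τ)
  `pair    : ∀ {σ τ} → Const (σ ⇒ τ ⇒ σ ⊗ τ)
  `fst     : ∀ {σ τ} → Const (σ ⊗ τ ⇒ σ)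
  `snd     : ∀ {σ τ} → Const (σ ⊗ τ ⇒ τ)
  `nothing : ∀ {σ} → Const (opt σ)
  `just    : ∀ {σ} → Const (σ ⇒ opt σ)
  `maybe   : ∀ {σ τ} → Const ((σ ⇒ τ) ⇒ τ ⇒ opt σ ⇒ τ)

constant : ∀ {τ} → Const τ → ⟦ τ ⟧
constant `zero    = zero
constant `suc     = suc
constant `natrec  = natrec
constant `true    = true
constant `false   = false
constant `cond    = cond
constant `nil     = []
constant `cons    = _∷_
constant `listrec = listrec
constant `pair    = _,_
constant `fst     = proj₁
constant `snd     = proj₂
constant `nothing = nothing
constant `just    = just
constant `maybe   = λ f z m → maybe f z m

-- Equality once all arguments are supplied: what an induction such as `rec-+` proves, without
-- function extensionality.
agree : ∀ τ → ⟦ τ ⟧ → ⟦ τ ⟧ → Set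
agree (σ ⇒ τ) f g = ∀ x → agree τ (f x) (g x)
agree _       x y = x ≡ y

infixl 5 _▸_
data Ctx : Set where
  ∅   : Ctx
  _▸_ : Ctx → Ty → Ctx

Env : Ctx → Set
Env ∅       = ⊤
Env (Γ ▸ σ) = Env Γ × ⟦ σ ⟧

data Var : Ctx → Ty → Set where
  vz : ∀ {Γ σ} → Var (Γ ▸ σ) σ
  vs : ∀ {Γ σ τ} → Var Γ τ → Var (Γ ▸ σ) τ

var⟦_⟧ : ∀ {Γ τ} → Var Γ τ → Env Γ → ⟦ τ ⟧
var⟦ vz ⟧   (γ , x) = x
var⟦ vs v ⟧ (γ , x) = var⟦ v ⟧ γ

infixl 8 _·_

-- `as` replaces a closed program by any extensionally equal function, which becomes its meaning.
data Tm : Ctx → Ty → Set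
tm⟦_⟧ : ∀ {Γ τ} → Tm Γ τ → Env Γ → ⟦ τ ⟧

data Tm where
  var  : ∀ {Γ τ} → Var Γ τ → Tm Γ τ
  ƛ    : ∀ {Γ σ τ} → Tm (Γ ▸ σ) τ → Tm Γ (σ ⇒ τ)
  _·_  : ∀ {Γ σ τ} → Tm Γ (σ ⇒ τ) → Tm Γ σ → Tm Γ τ
  con  : ∀ {Γ τ} → Const τ → Tm Γ τ
  as   : ∀ {Γ τ} (f : ⟦ τ ⟧) (t : Tm ∅ τ) → agree τ (tm⟦ t ⟧ tt) f → Tm Γ τ

tm⟦ var v ⟧    γ = var⟦ v ⟧ γ
tm⟦ ƛ t ⟧      γ = λ x → tm⟦ t ⟧ (γ , x)
tm⟦ t · u ⟧    γ = tm⟦ t ⟧ γ (tm⟦ u ⟧ γ)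
tm⟦ con c ⟧    γ = constant c
tm⟦ as f _ _ ⟧ γ = f

constCode : ∀ {τ} → Const τ → Tree
constCode `zero    = cLeaf
constCode `suc     = cLam (cNode cLeaf cTop)
constCode `natrec  = cLam (cLam (cLam (cApp (cApp W W) cTop)))
  -- The target is untyped, so recursion is self-application: `W` is given itself as its first
  -- argument. After the push by the case distinction, index 3 is `W` and index 5 the step function.
  where W = cLam (cLam (cCase (cPop (cPop (cPop (cPop cTop))))
              (cApp (cApp (cPop (cPop (cPop (cPop (cPop cTop))))) (cPop cTop))
                    (cApp (cApp (cPop (cPop (cPop cTop))) (cPop (cPop (cPop cTop)))) (cPop cTop)))))
constCode `true    = cNode cLeaf cLeaf
constCode `false   = cLeaf
constCode `cond    = cLam (cLam (cLam (cCase (cPop cTop) (cPop (cPop (cPop (cPop cTop)))))))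
constCode `nil     = cLeaf
constCode `cons    = cLam (cLam (cNode (cPop cTop) cTop))
constCode `listrec = cLam (cLam (cLam (cApp (cApp W W) cTop)))
  where W = cLam (cLam (cCase (cPop (cPop (cPop (cPop cTop))))
              (cApp (cApp (cApp (cPop (cPop (cPop (cPop (cPop cTop))))) cTop) (cPop cTop))
                    (cApp (cApp (cPop (cPop (cPop cTop))) (cPop (cPop (cPop cTop)))) (cPop cTop)))))
constCode `pair    = cLam (cLam (cNode (cPop cTop) cTop))
constCode `fst     = cLam (cCase cLeaf cTop)
constCode `snd     = cLam (cCase cLeaf (cPop cTop))
constCode `nothing = cLeaf
constCode `just    = cLam (cNode cLeaf cTop)
constCode `maybe   = cLam (cLam (cLam (cCase (cPop cTop) (cApp (cPop (cPop (cPop (cPop cTop)))) (cPop cTop)))))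

varCode : ∀ {Γ τ} → Var Γ τ → Tree
varCode vz     = cTop
varCode (vs v) = cPop (varCode v)

code : ∀ {Γ τ} → Tm Γ τ → Tree
code (var v)    = varCode v
code (ƛ t)      = cLam (code t)
code (t · u)    = cApp (code t) (code u)
code (con c)    = constCode c
code (as _ t _) = code t

-- Evaluation and the logical relation between trees and denotations

record Ev (c e v : Tree) : Set where
  constructor ev
  field reduces : ∀ k → ∃ λ e' → evalS c e k ⟶* retS v e' k
open Ev

ev-top : ∀ {v e} → Ev cTop (node v e) v
ev-top = ev λ k → _ , top ∷ []

ev-pop : ∀ {c v e w} → Ev c e w → Ev (cPop c) (node v e) w
ev-pop h = ev λ k → _ , pop ∷ proj₂ (reduces h k)

ev-lam : ∀ {c e} → Ev (cLam c) e (node c e)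
ev-lam = ev λ k → _ , lam ∷ []

ev-leaf : ∀ {e} → Ev cLeaf e leaf
ev-leaf = ev λ k → _ , con ∷ []

ev-case0 : ∀ {c d e v} → Ev c (node leaf e) v → Ev (cCase c d) (node leaf e) v
ev-case0 h = ev λ k → _ , case0 ∷ proj₂ (reduces h k)

ev-case1 : ∀ {c d a b e v} → Ev d (node a (node b (node (node a b) e))) v → Ev (cCase c d) (node (node a b) e) v
ev-case1 h = ev λ k → _ , case1 ∷ proj₂ (reduces h k)

ev-app : ∀ {c d e c' e' v w} → Ev c e (node c' e') → Ev d e v → Ev c' (node v e') w → Ev (cApp c d) e w
ev-app f x b = ev λ k → _ , bin ∷ (proj₂ (reduces f _) ++* (swap ∷ (proj₂ (reduces x _) ++* (call ∷ proj₂ (reduces b k)))))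

ev-node : ∀ {c d e v w} → Ev c e v → Ev d e w → Ev (cNode c d) e (node v w)
ev-node x y = ev λ k → _ , bin ∷ (proj₂ (reduces x _) ++* (swap ∷ (proj₂ (reduces y _) ++* (build ∷ []))))

-- A logical relation in the style of Tait: at function types a closure has to terminate on related
-- arguments, which builds termination of all well-typed terms into the induction.
R : ∀ τ → Tree → ⟦ τ ⟧ → Set
Rlist : ∀ σ → Tree → List ⟦ σ ⟧ → Set
R nat      v n           = v ≡ spine n
R bool     v false       = v ≡ leaf
R bool     v true        = v ≡ ⟨1⟩
R (list σ) v xs          = Rlist σ v xs
R (opt σ)  v nothing     = v ≡ leaf
R (opt σ)  v (just x)    = ∃ λ w → v ≡ node leaf w × R σ w x
R (σ ⊗ τ)  v (x , y)     = ∃₂ λ a b → v ≡ node a b × R σ a x × R τ b y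
R (σ ⇒ τ)  v f           = ∃₂ λ c e → v ≡ node c e × (∀ a x → R σ a x → ∃ λ w → Ev c (node a e) w × R τ w (f x))
Rlist σ v []       = v ≡ leaf
Rlist σ v (x ∷ xs) = ∃₂ λ a b → v ≡ node a b × R σ a x × Rlist σ b xs

-- At function types `R` looks at values only, so extensionally equal functions are realised by the
-- same trees. This is the soundness of `as`.
R-agree : ∀ τ {v f g} → agree τ f g → R τ v f → R τ v g
R-agree nat      refl r = r
R-agree bool     refl r = r
R-agree (list σ) refl r = r
R-agree (opt σ)  refl r = r
R-agree (σ ⊗ τ)  refl r = r
R-agree (σ ⇒ τ)  h (c , e , q , k) = c , e , q , λ a x ra →
  let (w , s , rw) = k a x ra in w , s , R-agree τ (h x) rw

REnv : ∀ Γ → Tree → Env Γ → Set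
REnv ∅       e γ       = ⊤
REnv (Γ ▸ σ) e (γ , x) = ∃₂ λ v e' → e ≡ node v e' × R σ v x × REnv Γ e' γ

var-ok : ∀ {Γ τ} (v : Var Γ τ) e γ → REnv Γ e γ → ∃ λ w → Ev (varCode v) e w × R τ w (var⟦ v ⟧ γ)
var-ok vz     _ (γ , x) (v , e' , refl , r , _) = v , ev-top , r
var-ok (vs n) _ (γ , x) (v , e' , refl , _ , h) with var-ok n e' γ h
... | w , s , r = w , ev-pop s , r

fun-R : ∀ σ τ {c e} (f : ⟦ σ ⇒ τ ⟧) →
  (∀ a x → R σ a x → ∃ λ w → Ev c (node a e) w × R τ w (f x)) → R (σ ⇒ τ) (node c e) f
fun-R σ τ f h = _ , _ , refl , h

app-R : ∀ σ τ {v a} (f : ⟦ σ ⇒ τ ⟧) (x : ⟦ σ ⟧) → R (σ ⇒ τ) v f → R σ a x →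
  ∃ λ w → R τ w (f x) × (∀ {c d e} → Ev c e v → Ev d e a → Ev (cApp c d) e w)
app-R σ τ f x (c , e , refl , h) ra with h _ _ ra
... | w , s , rw = w , rw , λ p q → ev-app p q s

module _ {τ : Ty} {z' s' : Tree} where
  private
    W : Tree
    W = cLam (cCase (cPop (cPop (cPop (cPop cTop))))
              (cApp (cApp (cPop (cPop (cPop (cPop (cPop cTop))))) (cPop cTop))
                    (cApp (cApp (cPop (cPop (cPop cTop))) (cPop (cPop (cPop cTop)))) (cPop cTop))))
    body : Tree → Tree
    body (cLam c) = c
    body t = t

  natrec-R : ∀ {z s n'} → R τ z' z → R (nat ⇒ τ ⇒ τ) s' s → ∀ n →
    ∀ e₀ →
    ∃ λ w → Ev (body W) (node (spine n) (node (node W (node n' (node s' (node z' e₀)))) (node n' (node s' (node z' e₀))))) w × R τ w (natrec z s n)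
  natrec-R rz rs zero e₀ = z' , ev-case0 (ev-pop (ev-pop (ev-pop (ev-pop ev-top)))) , rz
  natrec-R {z} {s} rz rs (suc n) e₀ with natrec-R rz rs n e₀
  ... | w , h , rw with app-R nat (τ ⇒ τ) s n rs refl
  ... | f , rf , hf with app-R τ τ (s n) (natrec z s n) rf rw
  ... | u , ru , hu = u , ev-case1 (hu (hf (ev-pop (ev-pop (ev-pop (ev-pop (ev-pop ev-top))))) (ev-pop ev-top))
    (ev-app (ev-app (ev-pop (ev-pop (ev-pop ev-top))) (ev-pop (ev-pop (ev-pop ev-top))) ev-lam) (ev-pop ev-top) h)) , ru

module _ {σ τ : Ty} {z' s' : Tree} where
  private
    W : Tree
    W = cLam (cCase (cPop (cPop (cPop (cPop cTop))))
              (cApp (cApp (cApp (cPop (cPop (cPop (cPop (cPop cTop))))) cTop) (cPop cTop))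
                    (cApp (cApp (cPop (cPop (cPop cTop))) (cPop (cPop (cPop cTop)))) (cPop cTop))))
    body : Tree → Tree
    body (cLam c) = c
    body t = t

  listrec-R : ∀ {z s n'} → R τ z' z → R (σ ⇒ list σ ⇒ τ ⇒ τ) s' s → ∀ xs xs' → Rlist σ xs' xs → ∀ e₀ →
    ∃ λ w → Ev (body W) (node xs' (node (node W (node n' (node s' (node z' e₀)))) (node n' (node s' (node z' e₀))))) w × R τ w (listrec z s xs)
  listrec-R rz rs [] _ refl e₀ = z' , ev-case0 (ev-pop (ev-pop (ev-pop (ev-pop ev-top)))) , rz
  listrec-R {z} {s} rz rs (x ∷ xs) _ (a , b , refl , ra , rb) e₀ with listrec-R rz rs xs b rb e₀
  ... | w , h , rw with app-R σ (list σ ⇒ τ ⇒ τ) s x rs ra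
  ... | f , rf , hf with app-R (list σ) (τ ⇒ τ) (s x) xs rf rb
  ... | g , rg , hg with app-R τ τ (s x xs) (listrec z s xs) rg rw
  ... | u , ru , hu = u , ev-case1 (hu (hg (hf (ev-pop (ev-pop (ev-pop (ev-pop (ev-pop ev-top))))) ev-top) (ev-pop ev-top))
    (ev-app (ev-app (ev-pop (ev-pop (ev-pop ev-top))) (ev-pop (ev-pop (ev-pop ev-top))) ev-lam) (ev-pop ev-top) h)) , ru

const-ok : ∀ {τ} (c : Const τ) e → ∃ λ w → Ev (constCode c) e w × R τ w (constant c)
const-ok `zero    e = _ , ev-leaf , refl
const-ok `suc     e = _ , ev-lam , fun-R nat nat suc λ { a n refl → _ , ev-node ev-leaf ev-top , refl }
const-ok {τ ⇒ σ ⇒ _} `natrec e = _ , ev-lam , fun-R τ (σ ⇒ nat ⇒ τ) natrec λ z' z rz →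
  _ , ev-lam , fun-R σ (nat ⇒ τ) (natrec z) λ s' s rs →
  _ , ev-lam , fun-R nat τ (natrec z s) λ { n' n refl → let (w , h , r) = natrec-R {τ} {z'} {s'} {z} {s} rz rs n e in
    w , ev-app (ev-app ev-lam ev-lam ev-lam) ev-top h , r }
const-ok `true    e = _ , ev-node ev-leaf ev-leaf , refl
const-ok `false   e = _ , ev-leaf , refl
const-ok {τ ⇒ _} `cond e = _ , ev-lam , fun-R τ (τ ⇒ bool ⇒ τ) cond λ x' x rx →
  _ , ev-lam , fun-R τ (bool ⇒ τ) (cond x) λ y' y ry →
  _ , ev-lam , fun-R bool τ (cond x y)
    λ { b' false refl → y' , ev-case0 (ev-pop ev-top) , ry
      ; b' true  refl → x' , ev-case1 (ev-pop (ev-pop (ev-pop (ev-pop ev-top)))) , rx }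
const-ok `nil     e = _ , ev-leaf , refl
const-ok {σ ⇒ _} `cons e = _ , ev-lam , fun-R σ (list σ ⇒ list σ) _∷_ λ x' x rx →
  _ , ev-lam , fun-R (list σ) (list σ) (x ∷_) λ y' y ry →
  _ , ev-node (ev-pop ev-top) ev-top , (_ , _ , refl , rx , ry)
const-ok {τ ⇒ (σ ⇒ ρ) ⇒ _} `listrec e = _ , ev-lam , fun-R τ ((σ ⇒ ρ) ⇒ list σ ⇒ τ) listrec λ z' z rz →
  _ , ev-lam , fun-R (σ ⇒ ρ) (list σ ⇒ τ) (listrec z) λ s' s rs →
  _ , ev-lam , fun-R (list σ) τ (listrec z s) λ n' n rn →
    let (w , h , r) = listrec-R {σ} {τ} {z'} {s'} {z} {s} rz rs n n' rn e in
    w , ev-app (ev-app ev-lam ev-lam ev-lam) ev-top h , r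
const-ok {σ ⇒ τ ⇒ _} `pair e = _ , ev-lam , fun-R σ (τ ⇒ σ ⊗ τ) _,_ λ x' x rx →
  _ , ev-lam , fun-R τ (σ ⊗ τ) (x ,_) λ y' y ry →
  _ , ev-node (ev-pop ev-top) ev-top , (_ , _ , refl , rx , ry)
const-ok {(σ ⊗ τ) ⇒ _} `fst e = _ , ev-lam , fun-R (σ ⊗ τ) σ proj₁ λ { _ _ (a , b , refl , ra , rb) → a , ev-case1 ev-top , ra }
const-ok {(σ ⊗ τ) ⇒ _} `snd e = _ , ev-lam , fun-R (σ ⊗ τ) τ proj₂ λ { _ _ (a , b , refl , ra , rb) → b , ev-case1 (ev-pop ev-top) , rb }
const-ok `nothing e = _ , ev-leaf , refl
const-ok {σ ⇒ _} `just e = _ , ev-lam , fun-R σ (opt σ) just λ a x ra → _ , ev-node ev-leaf ev-top , (_ , refl , ra)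
const-ok {(σ ⇒ τ) ⇒ _} `maybe e = _ , ev-lam , fun-R (σ ⇒ τ) (τ ⇒ opt σ ⇒ τ) (λ f z m → maybe f z m) λ f' f rf →
  _ , ev-lam , fun-R τ (opt σ ⇒ τ) (λ z m → maybe f z m) λ z' z rz →
  _ , ev-lam , fun-R (opt σ) τ (λ m → maybe f z m)
    λ { m' nothing refl → z' , ev-case0 (ev-pop ev-top) , rz
      ; m' (just x) (w , refl , rw) → let (u , ru , h) = app-R σ τ f x rf rw in
          u , ev-case1 (h (ev-pop (ev-pop (ev-pop (ev-pop ev-top)))) (ev-pop ev-top)) , ru }

-- The fundamental lemma of the logical relation. The program inside `as` is closed and therefore
-- may run in any environment.
tm-ok : ∀ {Γ τ} (t : Tm Γ τ) e γ → REnv Γ e γ → ∃ λ w → Ev (code t) e w × R τ w (tm⟦ t ⟧ γ)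
tm-ok (var v) e γ h = var-ok v e γ h
tm-ok {τ = σ ⇒ τ} (ƛ t) e γ h = _ , ev-lam , fun-R σ τ (λ x → tm⟦ t ⟧ (γ , x)) λ a x ra →
  tm-ok t (node a e) (γ , x) (a , e , refl , ra , h)
tm-ok (_·_ {σ = σ} {τ} t u) e γ h with tm-ok t e γ h | tm-ok u e γ h
... | f , ef , rf | a , ea , ra with app-R σ τ (tm⟦ t ⟧ γ) (tm⟦ u ⟧ γ) rf ra
... | w , rw , k = w , k ef ea , rw
tm-ok (con c) e γ h = const-ok c e
tm-ok {τ = τ} (as f t p) e γ h with tm-ok t e tt tt
... | w , s , r = w , s , R-agree τ p r

-- Unbounded search as a Turing machine

pastBitsD : Fin 1 → Sym → Sym × Move × (Fin 1 ⊎ Fin 1)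
pastBitsD _ nothing  = nothing , stay , inj₂ zero
pastBitsD _ (just b) = just b , right , inj₁ zero

pastBits : Frag 1
pastBits = auto 0 pastBitsD

pastBits-ok : ∀ w l n → ∃ λ n' → pastBits ∶ at (map just l) w n ⇓ zero , at (map just (w ʳ++ l)) [] n'
pastBits-ok []      l n = n , 1 , last {p = zero} {w = nothing} {m = stay} refl
pastBits-ok (b ∷ w) l n with right-at (just b) (map just l) w n
... | n₁ , e with pastBits-ok w (b ∷ l) n₁
... | n' , m , r = n' , suc m , more refl (subst (λ t → Run pastBits m zero t zero (at (map just (w ʳ++ (b ∷ l))) [] n')) (sym e) r)

putZero : Frag 1
putZero = auto 0 λ _ _ → just false , right , inj₂ zero

writeZeros : ℕ → Frag 1
writeZeros zero    = stop zero
writeZeros (suc n) = seq putZero λ _ → writeZeros n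

writeZeros-ok : ∀ k l L n → ∃ λ n' →
  writeZeros k ∶ at (on l L) [] n ⇓ zero , at (on (replicate k false ʳ++ l) L) [] n'
writeZeros-ok zero    l L n = n , stop-ok zero _
writeZeros-ok (suc k) l L n with right-at (just false) (on l L) [] n
... | n₁ , e with writeZeros-ok k (false ∷ l) L n₁
... | n' , r = n' , ⇓seq {g = λ _ → writeZeros k} {t = at (on l L) [] n}
  (1 , subst (Run putZero 1 zero (at (on l L) [] n) zero) e (last refl)) r

goLeft : Frag 1
goLeft = auto 0 λ _ s → s , left , inj₂ zero

setup : Frag 1
-- Eleven counters: three working ones and the eight registers of the machine.
setup = seq pastBits λ _ → seq goRight λ _ → seq (writeZeros 11) λ _ → seq goLeft λ _ → homeward

setup-ok : ∀ xs → ∃ λ n → setup ∶ inputTape xs ⇓ zero , home (map just (reverse xs)) (Vec.replicate 11 0) n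
setup-ok xs with pastBits-ok xs [] 0
... | n₁ , r₁ with goRight-ok (map just (reverse xs)) [] n₁
... | n₂ , r₂ with writeZeros-ok 11 [] (map just (reverse xs)) n₂
... | n₃ , r₃ = suc n₃ , ⇓seq (subst (λ t → pastBits ∶ t ⇓ zero , at (map just (reverse xs)) [] n₁) (input-at xs) r₁)
  (⇓seq r₂ (⇓seq r₃ (⇓seq {t' = at (on (replicate 10 false) _) (false ∷ []) (suc n₃)} (1 , last refl)
    (homeward-ok (replicate 10 false) false [] _ (suc n₃)))))
  where
  input-at : ∀ xs → at [] xs 0 ≡ inputTape xs
  input-at []       = refl
  input-at (x ∷ xs) = cong (tape [] (just x)) (++-identityʳ (map just xs))

-- Reading a bit turns its cell into the new left blank and the old left blank into a 1 of the first counter.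
getBitD : Fin 2 → Sym → Sym × Move × (Fin 2 ⊎ Fin 3)
getBitD zero       _            = just true , left , inj₁ (suc zero)
getBitD (suc zero) nothing      = nothing , stay , inj₂ zero
getBitD (suc zero) (just false) = nothing , stay , inj₂ (suc zero)
getBitD (suc zero) (just true)  = nothing , stay , inj₂ (suc (suc zero))

getBit : Frag 3
getBit = auto 1 getBitD

bitExit : Bool → Fin 2
bitExit false = zero
bitExit true  = suc zero

getBit-end : ∀ {r} t (ρ : Vec ℕ r) n → getBit ∶ home [] (t ∷ ρ) n ⇓ zero , home [] (suc t ∷ ρ) n
getBit-end t ρ n = 2 , more refl (last refl)

getBit-bit : ∀ {r} b L t (ρ : Vec ℕ r) n →
  getBit ∶ home (just b ∷ L) (t ∷ ρ) n ⇓ suc (bitExit b) , home L (suc t ∷ ρ) n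
getBit-bit false L t ρ n = 2 , more refl (last refl)
getBit-bit true  L t ρ n = 2 , more refl (last refl)

bitTree : Bool → Tree
bitTree false = leaf
bitTree true  = ⟨1⟩

bitsTree : List Bool → Tree
bitsTree []       = leaf
bitsTree (b ∷ bs) = node (bitTree b) (bitsTree bs)

pushBit : Bool → Code 8 2
pushBit b = lit (bitTree b) (setB #X (getA #X (getB #P (mk (setB #P (ret zero))))))

readBit : Bool → Frag 2
readBit b = seq (dec {11} zero) λ _ → compile (pushBit b)

inputD : Fin 3 → Frag 2
inputD zero          = seq (dec {11} zero) λ _ → stop (suc zero)
inputD (suc zero)    = readBit false
inputD (suc (suc _)) = readBit true

getBit-then : ∀ b L (ρ : Vec ℕ 10) n {j t} → readBit b ∶ home L (1 ∷ ρ) n ⇓ j , t →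
  seq getBit inputD ∶ home (just b ∷ L) (0 ∷ ρ) n ⇓ j , t
getBit-then false L ρ n h = ⇓seq {g = inputD} (getBit-bit false L 0 ρ n) h
getBit-then true  L ρ n h = ⇓seq {g = inputD} (getBit-bit true L 0 ρ n) h

inputLoop : Frag 1
inputLoop = loop (seq getBit inputD)

cells10 : Tree → Tree → Vec Tree 8 → Vec ℕ 10
cells10 a b ρ = num a ∷ num b ∷ Vec.map num ρ

untick : ∀ a b ρ → dec {11} zero ⊨ (1 ∷ cells10 a b ρ) ⇒ suc zero , regs a b ρ
untick a b ρ = dec-suc zero (1 ∷ cells10 a b ρ) 0 refl

readBit-ok : ∀ c a b q s acc x y → readBit c ⊨ (1 ∷ cells10 a b (layout q s (bitsTree acc) x y)) ⇒ zero ,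
  regs leaf leaf (layout q s (bitsTree (c ∷ acc)) (bitTree c) y)
readBit-ok c a b q@(_ ∷ _ ∷ _ ∷ _ ∷ []) s acc x y =
  ⊨seq {g = λ _ → compile (pushBit c)} (untick a b ρ) (compile-ok (pushBit c) a b ρ)
  where ρ = layout q s (bitsTree acc) x y

inputLoop-ok : ∀ l acc a b q s x y n → ∃ λ n' → ∃ λ a' → ∃ λ b' → ∃ λ x' →
  inputLoop ∶ home (map just l) (regs a b (layout q s (bitsTree acc) x y)) n ⇓ zero ,
    home [] (regs a' b' (layout q s (bitsTree (l ʳ++ acc)) x' y)) n'
inputLoop-ok [] acc a b q s x y n with at-home (untick a b (layout q s (bitsTree acc) x y)) [] n
... | n' , r = n' , a , b , x , ⇓break (⇓seq {g = inputD} (getBit-end 0 (cells10 a b (layout q s (bitsTree acc) x y)) n)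
  (⇓seq {g = λ _ → stop (suc zero)} r (stop-ok (suc zero) _)))
inputLoop-ok (c ∷ l) acc a b q s x y n with at-home (readBit-ok c a b q s acc x y) (map just l) n
... | n₁ , r₁ with inputLoop-ok l (c ∷ acc) leaf leaf q s (bitTree c) y n₁
... | n' , a' , b' , x' , r = n' , a' , b' , x' ,
  ⇓again (getBit-then c (map just l) (cells10 a b (layout q s (bitsTree acc) x y)) n r₁) r

bits-R : ∀ xs → R (list bool) (bitsTree xs) xs
bits-R []           = refl
bits-R (false ∷ xs) = _ , _ , refl , refl , bits-R xs
bits-R (true ∷ xs)  = _ , _ , refl , refl , bits-R xs

R-bits : ∀ xs v → R (list bool) v xs → v ≡ bitsTree xs
R-bits []           v r = r
R-bits (false ∷ xs) v (a , b , refl , refl , r) = cong (node leaf) (R-bits xs b r)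
R-bits (true ∷ xs)  v (a , b , refl , refl , r) = cong (node ⟨1⟩) (R-bits xs b r)

-- Kleene's normal form: a partial computable function is the first success of a total function of
-- the input and a stage.
Search : Set
Search = Tm ∅ (list bool ⇒ nat ⇒ opt (list bool))

module _ (t : Search) where
  private
    f : List Bool → ℕ → Maybe (List Bool)
    f = tm⟦ t ⟧ tt

  callCode : Tree
  callCode = cApp (cApp (code t) cTop) (cPop cTop)

  launch : Code 8 1
  launch = getA #S (lit leaf (mk (setB #X (getA #P (getB #X (mk (setB #E
             (lit callCode (setB #C (lit leaf (setB #K (lit leaf (setB #M (ret zero))))))))))))))

  -- `nothing` is `leaf`, after which `mk` turns the stage into its successor. `just v` is
  -- `node leaf v`, whose right child takes the place of the input in `#P`.
  check : Code 8 2
  check = getB #C (un (getB #S (mk (setB #S (ret zero)))) (setB #P (ret (suc zero))))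

  attempt : Frag 2
  attempt = seq (compile launch) λ _ → seq machine λ _ → compile check

  call-ok : ∀ xs s → ∃ λ w → ∃ λ e →
    evalS callCode (node (bitsTree xs) (node (spine s) leaf)) leaf ⟶* retS w e leaf × R (opt (list bool)) w (f xs s)
  call-ok xs s with tm-ok t (node (bitsTree xs) (node (spine s) leaf)) tt tt
  ... | g , eg , rg with app-R (list bool) (nat ⇒ opt (list bool)) f xs rg (bits-R xs)
  ... | h , rh , k with app-R nat (opt (list bool)) (f xs) s rh refl
  ... | w , rw , k' = w , _ , proj₂ (Ev.reduces (k' (k eg ev-top) (ev-pop ev-top)) leaf) , rw

  Inv : ℕ → Tree → Tree → Tree → State → Tree → Tree → Vec ℕ 11
  Inv s p a b q x y = regs a b (layout q (spine s) p x y)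

  attempt-run : ∀ p s w e a b q x y → evalS callCode (node p (node s leaf)) leaf ⟶* retS w e leaf →
    ∃ λ a' → ∃ λ b' → ∃ λ x' → ∃ λ y' → ∀ {j ρ} →
    compile check ⊨ regs a' b' (layout (retS w e leaf) s p x' y') ⇒ j , ρ →
    attempt ⊨ regs a b (layout q s p x y) ⇒ j , ρ
  attempt-run p s w e a b q@(_ ∷ _ ∷ _ ∷ _ ∷ []) x y run =
    let (a₁ , b₁ , x₁ , y₁ , r) = machine-ok run leaf leaf s p (node s leaf) y in
    a₁ , b₁ , x₁ , y₁ , λ h →
      ⊨seq {g = λ _ → seq machine λ _ → compile check} (compile-ok launch a b (layout q s p x y))
        (⊨seq {g = λ _ → compile check} r h)

  attempt-fails : ∀ xs s a b q x y → f xs s ≡ nothing → ∃ λ a' → ∃ λ b' → ∃ λ q' → ∃ λ x' → ∃ λ y' →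
    attempt ⊨ Inv s (bitsTree xs) a b q x y ⇒ zero , Inv (suc s) (bitsTree xs) a' b' q' x' y'
  attempt-fails xs s a b q x y eq =
    let (w , e , run , rw) = call-ok xs s in go w e run (subst (R (opt (list bool)) w) eq rw)
    where
    go : ∀ w e → evalS callCode (node (bitsTree xs) (node (spine s) leaf)) leaf ⟶* retS w e leaf → w ≡ leaf →
      ∃ λ a' → ∃ λ b' → ∃ λ q' → ∃ λ x' → ∃ λ y' →
      attempt ⊨ Inv s (bitsTree xs) a b q x y ⇒ zero , Inv (suc s) (bitsTree xs) a' b' q' x' y'
    go _ e run refl =
      let (a₁ , b₁ , x₁ , y₁ , r) = attempt-run (bitsTree xs) (spine s) leaf e a b q x y run in
      leaf , leaf , retS leaf e leaf , x₁ , y₁ ,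
      r (compile-ok check a₁ b₁ (layout (retS leaf e leaf) (spine s) (bitsTree xs) x₁ y₁))

  attempt-succeeds : ∀ xs s v a b q x y → f xs s ≡ just v → ∃ λ a' → ∃ λ b' → ∃ λ q' → ∃ λ x' → ∃ λ y' →
    attempt ⊨ Inv s (bitsTree xs) a b q x y ⇒ suc zero , Inv s (bitsTree v) a' b' q' x' y'
  attempt-succeeds xs s v a b q x y eq =
    let (w , e , run , rw) = call-ok xs s in go w e run (subst (R (opt (list bool)) w) eq rw)
    where
    go : ∀ w e → evalS callCode (node (bitsTree xs) (node (spine s) leaf)) leaf ⟶* retS w e leaf →
      R (opt (list bool)) w (just v) → ∃ λ a' → ∃ λ b' → ∃ λ q' → ∃ λ x' → ∃ λ y' →
      attempt ⊨ Inv s (bitsTree xs) a b q x y ⇒ suc zero , Inv s (bitsTree v) a' b' q' x' y'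
    go _ e run (u , refl , ru) with R-bits v u ru
    ... | refl =
      let (a₁ , b₁ , x₁ , y₁ , r) = attempt-run (bitsTree xs) (spine s) (node leaf (bitsTree v)) e a b q x y run in
      leaf , leaf , retS (node leaf (bitsTree v)) e leaf , x₁ , y₁ ,
      r (compile-ok check a₁ b₁ (layout (retS (node leaf (bitsTree v)) e leaf) (spine s) (bitsTree xs) x₁ y₁))

-- The output is written leftwards from the left blank, last bit first.
popTape : List Bool → List Sym → Tape
popTape []      r = tape [] nothing r
popTape (c ∷ l) r = tape (map just l) (just c) r

pushTape : List Sym → List Bool → List Sym → Tape
pushTape x []      r = tape x nothing r
pushTape x (c ∷ v) r = tape x (just c) (map just v ++ nothing ∷ r)

left-pop : ∀ l s r → moveHead left (tape (map just l) s r) ≡ popTape l (s ∷ r)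
left-pop []      s r = refl
left-pop (c ∷ l) s r = refl

right-push : ∀ x s v r → moveHead right (tape x s (map just v ++ nothing ∷ r)) ≡ pushTape (s ∷ x) v r
right-push x s []      r = refl
right-push x s (c ∷ v) r = refl

putBitD : Bool → Fin 3 → Sym → Sym × Move × (Fin 3 ⊎ Fin 1)
putBitD b zero             s        = s , left , inj₁ (suc zero)
putBitD b (suc zero)       (just c) = just c , left , inj₁ (suc zero)
putBitD b (suc zero)       nothing  = just b , right , inj₁ (suc (suc zero))
putBitD b (suc (suc zero)) (just c) = just c , right , inj₁ (suc (suc zero))
putBitD b (suc (suc zero)) nothing  = nothing , stay , inj₂ zero

putBit : Bool → Frag 1
putBit b = auto 2 (putBitD b)

putBit-ok : ∀ b l r → putBit b ∶ tape (map just l) nothing r ⇓ zero , tape (map just (l ∷ʳ b)) nothing r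
putBit-ok b l r with leftwards l []
  where
  rightwards : ∀ v x → ∃ λ m → Run (putBit b) m (suc (suc zero)) (pushTape (map just x) v r) zero (tape (map just (v ʳ++ x)) nothing r)
  rightwards []      x = 1 , last refl
  rightwards (c ∷ v) x with rightwards v (c ∷ x)
  ... | m , h = suc m , more refl (subst (λ t → Run (putBit b) m _ t zero (tape (map just (v ʳ++ (c ∷ x))) nothing r))
    (sym (right-push (map just x) (just c) v r)) h)
  leftwards : ∀ l v → ∃ λ m → Run (putBit b) m (suc zero) (popTape l (map just v ++ nothing ∷ r)) zero
    (tape (map just ((l ʳ++ v) ʳ++ (b ∷ []))) nothing r)
  leftwards []      v with rightwards v (b ∷ [])
  ... | m , h = suc m , more refl (subst (λ t → Run (putBit b) m _ t zero (tape (map just (v ʳ++ (b ∷ []))) nothing r))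
    (sym (right-push [] (just b) v r)) h)
  leftwards (c ∷ l) v with leftwards l (c ∷ v)
  ... | m , h = suc m , more refl (subst (λ t → Run (putBit b) m _ t zero (tape (map just ((l ʳ++ (c ∷ v)) ʳ++ (b ∷ []))) nothing r))
    (sym (left-pop l (just c) (map just v ++ nothing ∷ r))) h)
... | m , h = suc m , more refl (subst₂ (λ t w → Run (putBit b) m (suc zero) t zero (tape (map just w) nothing r))
  (sym (left-pop l nothing r)) (trans (ʳ++-ʳ++ l) refl) h)

rewindD : Fin 2 → Sym → Sym × Move × (Fin 2 ⊎ Fin 1)
rewindD zero       s        = s , left , inj₁ (suc zero)
rewindD (suc zero) (just c) = just c , left , inj₁ (suc zero)
rewindD (suc zero) nothing  = nothing , right , inj₂ zero

rewind : Frag 1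
rewind = auto 1 rewindD

rewind-ok : ∀ l r → rewind ∶ tape (map just l) nothing r ⇓ zero , pushTape (nothing ∷ []) (reverse l) r
rewind-ok l r with leftwards l []
  where
  leftwards : ∀ l v → ∃ λ m → Run rewind m (suc zero) (popTape l (map just v ++ nothing ∷ r)) zero
    (pushTape (nothing ∷ []) (l ʳ++ v) r)
  leftwards []      v = 1 , subst (Run rewind 1 (suc zero) _ zero) (right-push [] nothing v r) (last refl)
  leftwards (c ∷ l) v with leftwards l (c ∷ v)
  ... | m , h = suc m , more refl (subst (λ t → Run rewind m (suc zero) t zero (pushTape (nothing ∷ []) (l ʳ++ (c ∷ v)) r))
    (sym (left-pop l (just c) (map just v ++ nothing ∷ r))) h)
... | m , h = suc m , more refl (subst (λ t → Run rewind m (suc zero) t zero (pushTape (nothing ∷ []) (reverse l) r)) (sym (left-pop l nothing r)) h)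

contents-push : ∀ x v r → contents (pushTape x v r) ≡ v
contents-push x []      r = refl
contents-push x (c ∷ v) r = go c v
  where go : ∀ c v → readBits (just c) (map just v ++ nothing ∷ r) ≡ c ∷ v
        go c []      = refl
        go c (d ∷ v) = cong (c ∷_) (go d v)

popBit : Code 8 3
popBit = getB #P (un (ret (suc (suc zero))) (setB #P (setA #X (getB #X (un (ret zero) (ret (suc zero)))))))

outputD : Fin 3 → Frag 2
outputD zero          = seq (putBit false) λ _ → stop zero
outputD (suc zero)    = seq (putBit true) λ _ → stop zero
outputD (suc (suc _)) = stop (suc zero)

outBit : Bool → Fin 3
outBit false = zero
outBit true  = suc zero

outputLoop : Frag 1
outputLoop = loop (seq (compile popBit) outputD)

outputLoop-ok : ∀ v l a b q s x y n → ∃ λ r →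
  outputLoop ∶ home (map just l) (regs a b (layout q s (bitsTree v) x y)) n ⇓ zero , tape (map just (l ++ v)) nothing r
outputLoop-ok [] l a b q@(_ ∷ _ ∷ _ ∷ _ ∷ []) s x y n
  with at-home (compile-ok popBit a b (layout q s leaf x y)) (map just l) n
... | n₁ , r₁ = after , subst (λ z → outputLoop ∶ home (map just l) (regs a b (layout q s leaf x y)) n ⇓ zero , tape (map just z) nothing after) (sym (++-identityʳ l))
  (⇓break (⇓seq {g = outputD} r₁ (stop-ok (suc zero) _)))
  where after = map just (cells (regs leaf leaf (layout q s leaf x y))) ++ blanks n₁
outputLoop-ok (c ∷ v) l a b q@(_ ∷ _ ∷ _ ∷ _ ∷ []) s x y n
  with at-home (popBit-ok c) (map just l) n
  where
  popBit-ok : ∀ c → compile popBit ⊨ regs a b (layout q s (bitsTree (c ∷ v)) x y) ⇒ outBit c , regs leaf leaf (layout q s (bitsTree v) (bitTree c) y)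
  popBit-ok false = compile-ok popBit a b (layout q s (bitsTree (false ∷ v)) x y)
  popBit-ok true  = compile-ok popBit a b (layout q s (bitsTree (true ∷ v)) x y)
... | n₁ , r₁ with outputLoop-ok v (l ∷ʳ c) leaf leaf q s (bitTree c) y n₁
... | r , h = r , ⇓again (⇓seq {g = outputD} r₁ (put c))
  (subst (λ z → outputLoop ∶ home (map just (l ∷ʳ c)) (regs leaf leaf (layout q s (bitsTree v) (bitTree c) y)) n₁ ⇓ zero , tape (map just z) nothing r)
    (++-assoc l (c ∷ []) v) h)
  where
  put : ∀ c → outputD (outBit c) ∶ home (map just l) (regs leaf leaf (layout q s (bitsTree v) (bitTree c) y)) n₁ ⇓ zero ,
    home (map just (l ∷ʳ c)) (regs leaf leaf (layout q s (bitsTree v) (bitTree c) y)) n₁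
  put false = ⇓seq {g = λ _ → stop zero} (putBit-ok false l _) (stop-ok zero _)
  put true  = ⇓seq {g = λ _ → stop zero} (putBit-ok true l _) (stop-ok zero _)

seq-l-path : ∀ {j k} {f : Frag j} {g : Fin j → Frag k} {n p t q t'} →
  Path f n p t q t' → Path (seq f g) n (inj₁ p) t (inj₁ q) t'
seq-l-path here = here
seq-l-path {f = f} {g} (step e r) = step (cong (retarget (seqL f g)) e) (seq-l-path r)

zeroRegs : Vec ℕ 11
zeroRegs = regs leaf leaf (layout (evalS leaf leaf leaf) leaf leaf leaf leaf)

module _ (t : Search) where
  private
    f : List Bool → ℕ → Maybe (List Bool)
    f = tm⟦ t ⟧ tt

    pre post : Frag 1
    pre  = seq setup λ _ → inputLoop
    post = seq outputLoop λ _ → rewind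

    main : Frag 1
    main = loop (attempt t)

    rest whole : Frag 1
    rest  = seq main λ _ → post
    whole = seq pre λ _ → rest

    pre-ok : ∀ xs → ∃ λ a → ∃ λ b → ∃ λ x → ∃ λ n →
      pre ∶ inputTape xs ⇓ zero , home [] (Inv t 0 (bitsTree xs) a b (evalS leaf leaf leaf) x leaf) n
    pre-ok xs with setup-ok xs
    ... | n₁ , r₁ with inputLoop-ok (reverse xs) [] leaf leaf (evalS leaf leaf leaf) leaf leaf leaf n₁
    ... | n₂ , a , b , x , r₂ = a , b , x , n₂ , ⇓seq {g = λ _ → inputLoop} r₁
      (subst (λ z → inputLoop ∶ home (map just (reverse xs)) zeroRegs n₁ ⇓ zero ,
        home [] (regs a b (layout (evalS leaf leaf leaf) leaf (bitsTree z) x leaf)) n₂)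
        (trans (ʳ++-defn (reverse xs)) (trans (++-identityʳ _) (reverse-involutive xs))) r₂)

    Start : List Bool → ℕ → Tape → Set
    Start xs s τ = ∃ λ a → ∃ λ b → ∃ λ q → ∃ λ x → ∃ λ y → ∃ λ n → τ ≡ home [] (Inv t s (bitsTree xs) a b q x y) n

    -- The conclusion `d ≤ m`, true because each attempt takes a step, is what makes an unsuccessful
    -- search an endless run.
    iterate : ∀ xs d s → (∀ i → i < d → f xs (s + i) ≡ nothing) → ∀ τ → Start xs s τ →
      ∃ λ m → ∃ λ τ' → Path main m (entry main) τ (entry main) τ' × d ≤ m × Start xs (s + d) τ'
    iterate xs zero s h τ st = 0 , τ , here , z≤n , subst (λ z → Start xs z τ) (sym (+-identityʳ s)) st
    iterate xs (suc d) s h τ (a , b , q , x , y , n , refl) =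
      let (a' , b' , q' , x' , y' , r) = attempt-fails t xs s a b q x y (subst (λ z → f xs z ≡ nothing) (+-identityʳ s) (h 0 (s≤s z≤n)))
          (n' , m , run) = at-home r [] n
          τ₁ = home [] (Inv t (suc s) (bitsTree xs) a' b' q' x' y') n'
          (m' , τ' , path , le , st) = iterate xs d (suc s)
             (λ i lt → subst (λ z → f xs z ≡ nothing) (+-suc s i) (h (suc i) (s≤s lt))) τ₁ (a' , b' , q' , x' , y' , n' , refl)
      in m + m' , τ' , path-path {f = main} (loop-path {f = attempt t} run) path ,
         +-mono-≤ (Run-pos run) le , subst (λ z → Start xs z τ') (sym (+-suc s d)) st

    finish : ∀ xs s v τ → Start xs s τ → f xs s ≡ just v → ∃ λ τ' → ∃ λ m →
      Run rest m (entry rest) τ zero τ' × contents τ' ≡ reverse v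
    finish xs s v τ (a , b , q , x , y , n , refl) eq =
      let (a' , b' , q' , x' , y' , r) = attempt-succeeds t xs s v a b q x y eq
          (n' , m , run) = at-home r [] n
          (r' , out) = outputLoop-ok v [] a' b' q' (spine s) x' y' n'
          (m₁ , r₁) = ⇓seq {g = λ _ → post} (m , loop-run run) (⇓seq {g = λ _ → rewind} out (rewind-ok v r'))
      in pushTape (nothing ∷ []) (reverse v) r' , m₁ , r₁ , contents-push (nothing ∷ []) (reverse v) r'

    initial : ∀ xs d → (∀ i → i < d → f xs i ≡ nothing) → ∃ λ m → ∃ λ τ' →
      Path whole m (entry whole) (inputTape xs) (inj₂ (zero , inj₁ (entry main))) τ' × d ≤ m × Start xs d τ'
    initial xs d h =
      let (a , b , x , n , m , run) = pre-ok xs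
          (m' , τ' , path , le , st) = iterate xs d 0 h _ (a , b , evalS leaf leaf leaf , x , leaf , n , refl)
      in m + m' , τ' , path-path (seq-l run) (seq-r-path {g = λ _ → rest} (seq-l-path path)) , ≤-trans le (m≤n+m m' m) , st

    -- Whether a search succeeds at all is undecidable, but a run of `n` steps can be compared with
    -- `n + 1` failing attempts, so a decision up to a bound is enough.
    bounded : ∀ xs n → (∃₂ λ s v → (∀ i → i < s → f xs i ≡ nothing) × f xs s ≡ just v) ⊎ (∀ i → i < n → f xs i ≡ nothing)
    bounded xs zero = inj₂ λ _ ()
    bounded xs (suc n) with bounded xs n
    ... | inj₁ w = inj₁ w
    ... | inj₂ h with f xs n in eq
    ... | just v  = inj₁ (n , v , h , eq)
    ... | nothing = inj₂ λ i lt → case (m≤n⇒m<n∨m≡n (≤-pred lt)) i eq h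
      where case : ∀ {i} → i < n ⊎ i ≡ n → ∀ j → f xs n ≡ nothing → (∀ i → i < n → f xs i ≡ nothing) → f xs i ≡ nothing
            case (inj₁ lt) _ _ h = h _ lt
            case (inj₂ refl) _ e _ = e

  opaque
    searchTM : TM
    searchTM = fragTM whole

    search-complete : ∀ {A} xs s v → (∀ i → i < s → f xs i ≡ nothing) → f xs s ≡ just v →
      ∃ λ n → RunsTo A searchTM xs n (reverse v)
    search-complete xs s v h eq =
      let (m , τ , path , _ , st) = initial xs s h
          (τ' , m' , run , c) = finish xs s v τ st eq
      in _ , _ , next (start-step whole _) (steps-run whole (path-run path (seq-r {g = λ _ → rest} run))) , fragδ-exit whole zero _ , c

    search-sound : ∀ {A} xs n c → Steps A searchTM n (zero , inputTape xs) c → Halted searchTM c →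
      ∃₂ λ s v → (∀ i → i < s → f xs i ≡ nothing) × f xs s ≡ just v × contents (proj₂ c) ≡ reverse v
    search-sound xs n c st hc with bounded xs (suc n)
    ... | inj₁ (s , v , h , eq) =
      let (m , d , st' , hd , e) = search-complete xs s v h eq
      in s , v , h , eq , trans (cong (λ z → contents (proj₂ z)) (steps-det st hc st' hd)) e
    ... | inj₂ h =
      let (m , τ , path , le , _) = initial xs (suc n) h
      in ⊥-elim (<-irrefl refl (≤-trans (m≤n⇒m≤1+n le) (steps-bound st hc (next (start-step whole _) (steps-path whole path)))))

-- Interpreting machines

Bits : Set
Bits = List Bool

Conf : Set
Conf = ℕ × (List Sym × (Sym × List Sym))

-- From here on the computed functions are written with the recursors of the language, so that their
-- terms denote them definitionally and `as` can be justified by `refl`.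
leq : ℕ → ℕ → Bool
leq = natrec (λ n → true) (λ _ r → natrec false (λ n _ → r n))

eqN : ℕ → ℕ → Bool
eqN m n = leq m n ∧ leq n m

eqBool : Bool → Bool → Bool
eqBool a b = if a then b else not b

eqBits : Bits → Bits → Bool
eqBits = listrec (listrec true λ _ _ _ → false) λ x _ r → listrec false λ y ys _ → eqBool x y ∧ r ys

nth : List ℕ → ℕ → ℕ
nth = listrec (λ _ → 0) λ x _ r → natrec x λ n _ → r n

symIx : Sym → ℕ
symIx = maybe (λ b → if b then 2 else 1) 0

symOf : ℕ → Sym
symOf = natrec nothing λ n _ → natrec (just false) (λ _ _ → just true) n

moveL moveR : List Sym → Sym → List Sym → List Sym × (Sym × List Sym)
moveL l h r = listrec ([] , nothing , h ∷ r) (λ x l' _ → l' , x , h ∷ r) l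
moveR l h r = listrec (h ∷ l , nothing , []) (λ x r' _ → h ∷ l , x , r') r

move : ℕ → List Sym → Sym → List Sym → List Sym × (Sym × List Sym)
move m l h r = natrec (moveL l h r) (λ n _ → natrec (moveR l h r) (λ _ _ → l , h , r) n) m

-- A machine table has four numbers for each state and symbol: the kind of action (0 halt, 1 write,
-- 2 query) and up to three arguments.
offset : ℕ → Sym → ℕ
offset q h = 4 * (3 * q + symIx h)

haltedC : List ℕ → Conf → Bool
haltedC c (q , l , h , r) = eqN (nth c (offset q h)) 0

action : (Bits → Bool) → List ℕ → ℕ → List Sym → Sym → List Sym → Conf
action orc c o l h r =
  if eqN (nth c o) 1
  then (nth c (1 + o) , move (nth c (3 + o)) l (symOf (nth c (2 + o))) r)
  else ((if orc (readBits h r) then nth c (1 + o) else nth c (2 + o)) , l , h , r)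

stepC : (Bits → Bool) → List ℕ → Conf → Conf
stepC orc c (q , l , h , r) =
  if haltedC c (q , l , h , r) then (q , l , h , r) else action orc c (offset q h) l h r

contentsC : Conf → Bits
contentsC (q , l , h , r) = readBits h r

runC : (Bits → Bool) → List ℕ → ℕ → Conf → Conf
runC orc c = natrec (λ x → x) λ _ rec x → rec (stepC orc c x)

noOracle : Bits → Bool
noOracle _ = false

-- It succeeds at the exact halting time only, so that each program yields one event and the
-- opponent's moves can be counted by programs.
haltsIn : List ℕ → ℕ → Conf → Maybe Bits
haltsIn c = natrec (λ x → if haltedC c x then just (contentsC x) else nothing)
                   (λ _ rec x → if haltedC c x then nothing else rec (stepC noOracle c x))

startC : Bits → Conf
startC = listrec (0 , [] , nothing , []) λ b bs _ → 0 , [] , just b , map just bs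

unary : Bits → ℕ × Bits
unary = listrec (0 , []) λ b bs r → if b then (suc (proj₁ r) , proj₂ r) else (0 , bs)

unaries : ℕ → Bits → List ℕ × Bits
unaries = natrec (λ b → [] , b) λ _ rec b →
  let r = rec (proj₂ (unary b)) in proj₁ (unary b) ∷ proj₁ r , proj₂ r

parse : Bits → List ℕ × Bits
parse b = unaries (proj₁ (unary b)) (proj₂ (unary b))

vRun : Bits → ℕ → Maybe Bits
vRun b t = haltsIn (proj₁ (parse b)) t (startC (proj₂ (parse b)))

-- The program in question is `111p`, whence the 3 in the level.
vEvent : ℕ × Bits → Maybe (Bits × ℕ)
vEvent (t , p) = maybe (λ w → just (w , 3 + length p)) nothing (vRun p t)

-- unary also accepts strings without a zero; they are discarded to keep the coding one-to-one.
eventOf : Bits → Maybe (Bits × ℕ)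
eventOf b = if eqBits (encUnary (proj₁ (unary b)) ++ proj₂ (unary b)) b then vEvent (unary b) else nothing

event : ℕ → Maybe (Bits × ℕ)
event u = eventOf (natBits u)

Move' : Set
Move' = Bits × ℕ

Hist : Set
Hist = List Move'

toNat : Bits → ℕ
toNat = listrec 0 λ b _ r → if b then suc (suc (r + r)) else suc (r + r)

-- The optional bit is the first half of a doubled bit whose second half is still to be read.
unpair : Bits → Maybe Bool → Maybe (Bits × Bits)
unpair = listrec (λ _ → nothing) λ b bs r →
  maybe (λ a → if eqBool a b then maybe (λ p → just (a ∷ proj₁ p , proj₂ p)) nothing (r nothing)
               else (if a then nothing else just ([] , bs)))
        (r (just b))

anyB allB : {A : Set} → (A → Bool) → List A → Bool
anyB p = listrec false λ x _ r → p x ∨ r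
allB p = listrec true λ x _ r → p x ∧ r

listed : Hist → Bits → ℕ → Bool
listed h w k = anyB (λ m → eqBits w (proj₁ m) ∧ leq (proj₂ m) k) h

-- The oracle as seen by a short run. From level `K` on the answer yes is true for every string
-- whose trivial program has length at most `K`; below `K` the finite list decides.
histOracle : ℕ → Hist → Bits → Bool
histOracle K h q =
  maybe (λ p → leq K (toNat (proj₂ p)) ∨ listed h (proj₁ p) (toNat (proj₂ p))) false (unpair q nothing)

-- The strategy

module Game (ans : Hist → Bool) (cost : ℕ → ℕ) (E : ℕ) (moves : Hist) where

  -- In `r X h a b` it is the turn of the player who wants the answer `X`; he has spent `a`, the
  -- other player `b`, and `h` is the history. The value says whether he can force `X`.
  Reach : Set
  Reach = Bool → Hist → ℕ → ℕ → Bool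

  afford : ℕ → Move' → Bool
  afford a m = leq (a + cost (proj₂ m)) E

  own : Reach → Bool → Hist → ℕ → ℕ → Move' → Bool
  own r X h a b m = afford a m ∧ r X (m ∷ h) (a + cost (proj₂ m)) b

  -- Where the player of `X` may skip his turn: the answer suits him, and after each move that the
  -- other can pay for he can force it again. If the other skips as well, `X` is the outcome.
  safe : Reach → Reach
  safe r X h a b = eqBool (ans h) X ∧
    allB (λ m → not (afford b m) ∨ r X (m ∷ h) a (b + cost (proj₂ m))) moves

  reach : ℕ → Reach
  reach = natrec (λ _ _ _ _ → false) λ _ r X h a b → safe r X h a b ∨ anyB (own r X h a b) moves

  find : (Move' → Bool) → Maybe Move'
  find p = listrec nothing (λ m _ r → if p m then just m else r) moves

  -- One turn may consist of several moves; they are collected newest first until the position is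
  -- safe.
  play : ℕ → Bool → Hist → ℕ → ℕ → Hist
  play = natrec (λ _ _ _ _ → []) λ n rec X h a b →
    if safe (reach n) X h a b then []
    else maybe (λ m → rec X (m ∷ h) (a + cost (proj₂ m)) b ++ (m ∷ [])) [] (find (own (reach n) X h a b))

-- The i-th requirement moves at the levels from lowest i = κ + 5 to q − 1, where κ = scale i and q = size′ i = 2^κ = scale (1 + i).
scale : ℕ → ℕ
scale = natrec 10 λ _ r → 2 ^ r

-- `unit′` is the number P with 2^q = 2^14 P q². At the basic price `μ` = 256 P q the budget buys
-- weight P. These are the parameters of `Accounts` with A = 256.
size′ lowest unit′ μ budget : ℕ → ℕ
size′ i  = 2 ^ scale i
lowest i = scale i + 5
unit′ i  = 2 ^ (size′ i ∸ (scale i + scale i + 14))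
μ i      = unit′ i * size′ i * 256
budget i = μ i * unit′ i

-- The share 2^(-k) that one move takes of the 2^k words of length k, scaled by 2^q to be an
-- integer.
weight : ℕ → ℕ → ℕ
weight i k = 2 ^ (size′ i ∸ k)

price : ℕ → (ℕ → ℕ) → ℕ → ℕ
price i z k = (μ i + z k) * weight i k

strings : ℕ → List Bits
strings = natrec ([] ∷ []) λ _ r → [] ∷ (map (true ∷_) r ++ map (false ∷_) r)

below : ℕ → List ℕ
below = natrec [] λ n r → n ∷ r

filterB : {A : Set} → (A → Bool) → List A → List A
filterB p = listrec [] λ x _ r → if p x then x ∷ r else r

movesOf : ℕ → Hist
movesOf i = concatMap (λ k → map (_, k) (strings (size′ i))) (filterB (leq (lowest i)) (below (size′ i)))

threeTimes : (Sym → Bits) → Bits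
threeTimes f = f nothing ++ (f (just false) ++ f (just true))

writeCode : ℕ → Sym → Move → Bits
writeCode q s m = false ∷ true ∷ encUnary q ++ encSym s ++ encMove m

writersCode : Bits → ℕ → Bits
writersCode = listrec (λ _ → []) λ b w r q →
  threeTimes (λ _ → listrec (writeCode 1 (just b) stay) (λ _ _ _ → writeCode (suc q) (just b) left) w) ++ r (suc q)

-- The value of `encTM` on the machine of the module `Prelude`, as a string operation which the
-- strategy itself can carry out. `Q₀` and `ρ` describe the core machine, `w` is its input in
-- reverse.
preludeCode : ℕ → Bits → Bits → Bits
preludeCode Q₀ ρ w = encUnary (Q₀ + suc (length w)) ++
  (threeTimes (λ s → writeCode (2 + Q₀) s stay) ++ (ρ ++ writersCode w (2 + Q₀)))

query′ : ℕ → ℕ → Bits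
query′ i t = encUnary i ++ natBits t

asBits : List ℕ → Bits
asBits = map (λ n → not (leq n 0))

-- The number i supplies the table of the i-th machine and also the code of the machine `instances` below, whose definition
-- refers to the strategy: this replaces the recursion theorem.
machineOf : ℕ → List ℕ
machineOf i = proj₁ (parse (natBits i))

coreOf : ℕ → List ℕ
coreOf i = proj₁ (parse (proj₂ (parse (natBits i))))

-- The instance x of the t-th interval: the code of the machine running `instances` on `query′ i t`.
-- The reversal is due to the prelude, which writes leftwards.
inputOf : ℕ → ℕ → Bits
inputOf i t = preludeCode (nth (coreOf i) 0) (asBits (drop 1 (coreOf i))) (reverse (query′ i t))

-- The run is cut off after q/2 steps: more than any fixed polynomial in the length of x when i is
-- large, yet few enough that all queries, even with the overhead of a trivial program, are shorter
-- than q.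
answer : ℕ → ℕ → Hist → Bool
answer i t h = eqBits (true ∷ [])
  (contentsC (runC (histOracle (size′ i) h) (machineOf i) (2 ^ (scale i ∸ 1)) (startC (inputOf i t))))

-- The flag is `true` for moves of the strategy, `false` for those of the opponent.
Owned : Set
Owned = Bool × Move'

level : Owned → ℕ
level m = proj₂ (proj₂ m)

-- The number of the current interval, the debts, and the length of the view when the interval began.
Data : Set
Data = ℕ × ((ℕ → ℕ) × ℕ)

sumBy : {A : Set} → (A → ℕ) → List A → ℕ
sumBy f = listrec 0 λ x _ r → f x + r

-- What may influence the simulated run: it cannot mention longer strings, and questions about
-- levels from q on are answered without consulting the list.
relevant : ℕ → Owned → Bool
relevant i m = leq (length (proj₁ (proj₂ m))) (size′ i) ∧ not (leq (size′ i) (level m))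

view : ℕ → List Owned → List Owned
view i = filterB (relevant i)

-- Histories are newest first and only grow in front, so a length recorded at the start of an
-- interval marks the boundary for good.
recent older : ℕ → List Owned → List Owned
recent n l = take (length l ∸ n) l
older  n l = drop (length l ∸ n) l

spent : ℕ → (ℕ → ℕ) → Bool → List Owned → ℕ
spent i z o = sumBy λ m → if eqBool o (proj₁ m) then price i z (level m) else 0

weightAt : ℕ → Bool → List Owned → ℕ → ℕ
weightAt i o l k = sumBy (λ m → if eqBool o (proj₁ m) ∧ eqN (level m) k then weight i k else 0) l

hasLow : ℕ → List Owned → Bool
hasLow i = anyB λ m → not (leq (lowest i) (level m))

-- Interval 0 stands for a requirement that has not begun. It is never valid, so the first response
-- opens interval 1.
valid : ℕ → Data → List Owned → Bool
valid i (t , z , n) l =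
  not (leq t 0) ∧ (not (hasLow i (recent n l)) ∧ leq (spent i z false (recent n l)) (budget i))

-- Truncation forgets any surplus of the opponent. Afterwards a debt is an upper bound for the
-- excess of the strategy, not its exact value.
settle : ℕ → (ℕ → ℕ) → List Owned → ℕ → ℕ
settle i z new k = (z k + weightAt i true new k) ∸ weightAt i false new k

renew : ℕ → Data → List Owned → Data
renew i (t , z , n) l =
  if valid i (t , z , n) l then (t , z , n) else (suc t , settle i z (recent n l) , length l)

-- Every move costs at least 1, so the two budgets together bound the length of a play.
fuel : ℕ → ℕ
fuel i = budget i + budget i

-- It depends on the history before the interval only and is therefore fixed as long as the interval
-- lasts. The halting of x relies on this.
winner : ℕ → Data → List Owned → Bool
winner i (t , z , n) l =
  Game.reach (answer i t) (price i z) (budget i) (movesOf i) (suc (fuel i)) true (map proj₂ (older n l)) 0 0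

reply : ℕ → Data → List Owned → Hist
reply i (t , z , n) l =
  Game.play (answer i t) (price i z) (budget i) (movesOf i) (suc (fuel i)) (winner i (t , z , n) l)
    (map proj₂ l) (spent i z true (recent n l)) (spent i z false (recent n l))

Global : Set
Global = List Owned × (ℕ → Data)

setAt : ℕ → Data → (ℕ → Data) → ℕ → Data
setAt i d f j = if eqN i j then d else f j

respondWith : ℕ → Data → Global → Global
respondWith i d (h , f) = map (true ,_) (reply i d (view i h)) ++ h , setAt i d f

respond : ℕ → Global → Global
respond i (h , f) = respondWith i (renew i (f i) (view i h)) (h , f)

-- Requirements respond in increasing order. The i-th meets the moves of its predecessors in the
-- same stage as moves below its range; those of its successors lie above its view.
respondAll : ℕ → Global → Global
respondAll = natrec (λ g → g) λ n rec g → respond n (rec g)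

addEvent : Maybe Move' → Global → Global
addEvent e (h , f) = maybe (λ m → (false , m) ∷ h) h e , f

-- Only the requirements up to `s` act in stage `s + 1`, so a stage is a finite computation and
-- every requirement eventually takes part.
stage : ℕ → Global
stage = natrec ([] , λ _ → 0 , (λ _ → 0) , 0) λ s g → respondAll (suc s) (addEvent (event s) g)

value : Bits → ℕ
value = listrec 0 λ b bs r → if b then 2 ^ length bs + r else r

nthMove : List Owned → ℕ → Maybe Bits
nthMove = listrec (λ _ → nothing) λ m _ r → natrec (just (proj₁ (proj₂ m))) λ n _ → r n

-- Oldest first, so that a position in this list keeps its entry when the history grows. The program
-- `0b` addresses position `value b` at the level of its own length.
issued : ℕ → List Owned → List Owned
issued k h = reverse (filterB (λ m → proj₁ m ∧ eqN (level m) k) h)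

mapMaybe′ : (Bits → Bits) → Maybe Bits → Maybe Bits
mapMaybe′ f = maybe (λ x → just (f x)) nothing

-- A search yields the reverse of what it finds, hence the reversals.
decompress : Bits → ℕ → Maybe Bits
decompress p s = listrec nothing
  (λ b p' _ → if b
    then listrec nothing (λ b₁ p₁ _ → if b₁
      then listrec nothing (λ b₂ p₂ _ → if b₂ then mapMaybe′ reverse (vRun p₂ s) else nothing) p₁
      else nothing) p'
    else mapMaybe′ reverse (nthMove (issued (suc (length p')) (proj₁ (stage s))) (value p'))) p

-- The halting of an instance can only be caused, never revoked. This is consistent because the side
-- taken by the strategy does not change within interval `t`.
haltsNow : ℕ → ℕ → Global → Maybe Bits
haltsNow i t (h , f) =
  if eqN t (proj₁ (f i)) ∧ (not (leq t 0) ∧ not (winner i (f i) (view i h))) then just [] else nothing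

instance′ : Bits → ℕ → Maybe Bits
instance′ y s = haltsNow (proj₁ (unary y)) (toNat (proj₂ (unary y))) (stage s)

-- The programs as terms of the functional language

pattern v0 = var vz
pattern v1 = var (vs vz)
pattern v2 = var (vs (vs vz))
pattern v3 = var (vs (vs (vs vz)))
pattern v4 = var (vs (vs (vs (vs vz))))
pattern v5 = var (vs (vs (vs (vs (vs vz)))))
pattern v6 = var (vs (vs (vs (vs (vs (vs vz))))))
pattern v7 = var (vs (vs (vs (vs (vs (vs (vs vz)))))))
pattern v8 = var (vs (vs (vs (vs (vs (vs (vs (vs vz))))))))
pattern v9 = var (vs (vs (vs (vs (vs (vs (vs (vs (vs vz)))))))))

numeral : ∀ {Γ} → ℕ → Tm Γ nat
numeral zero    = con `zero
numeral (suc n) = con `suc · numeral n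

cell conf bits move′ owned : Ty
cell  = opt bool
conf  = nat ⊗ (list cell ⊗ (cell ⊗ list cell))
bits  = list bool
move′ = bits ⊗ nat
owned = bool ⊗ move′
data′ global : Ty
data′  = nat ⊗ ((nat ⇒ nat) ⊗ nat)
global = list owned ⊗ (nat ⇒ data′)

rec-+ : ∀ m n → natrec n (λ _ r → suc r) m ≡ m + n
rec-+ zero    n = refl
rec-+ (suc m) n = cong suc (rec-+ m n)

rec-* : ∀ m n → natrec 0 (λ _ r → n + r) m ≡ m * n
rec-* zero    n = refl
rec-* (suc m) n = cong (n +_) (rec-* m n)

rec-^ : ∀ m n → natrec 1 (λ _ r → m * r) n ≡ m ^ n
rec-^ m zero    = refl
rec-^ m (suc n) = cong (m *_) (rec-^ m n)

rec-∸ : ∀ m n → natrec m (λ _ r → natrec 0 (λ k _ → k) r) n ≡ m ∸ n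
rec-∸ m zero    = refl
rec-∸ m (suc n) rewrite rec-∸ m n with m ∸ n | m ∸ suc n | sym (pred[m∸n]≡m∸[1+n] m n)
... | zero  | _ | refl = refl
... | suc _ | _ | refl = refl

rec-++ : ∀ {A : Set} (xs ys : List A) → listrec ys (λ x _ r → x ∷ r) xs ≡ xs ++ ys
rec-++ []       ys = refl
rec-++ (x ∷ xs) ys = cong (x ∷_) (rec-++ xs ys)

rec-length : ∀ {A : Set} (xs : List A) → listrec 0 (λ _ _ r → suc r) xs ≡ length xs
rec-length []       = refl
rec-length (x ∷ xs) = cong suc (rec-length xs)

rec-map : ∀ {A B : Set} (f : A → B) xs → listrec [] (λ x _ r → f x ∷ r) xs ≡ map f xs
rec-map f []       = refl
rec-map f (x ∷ xs) = cong (f x ∷_) (rec-map f xs)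

rec-concatMap : ∀ {A B : Set} (f : A → List B) xs → listrec [] (λ x _ r → f x ++ r) xs ≡ concatMap f xs
rec-concatMap f []       = refl
rec-concatMap f (x ∷ xs) = cong (f x ++_) (rec-concatMap f xs)

rec-take : ∀ {A : Set} n (xs : List A) → natrec (λ _ → []) (λ _ r xs → listrec [] (λ x l _ → x ∷ r l) xs) n xs ≡ take n xs
rec-take zero    xs       = refl
rec-take (suc n) []       = refl
rec-take (suc n) (x ∷ xs) = cong (x ∷_) (rec-take n xs)

rec-drop : ∀ {A : Set} n (xs : List A) → natrec (λ xs → xs) (λ _ r xs → listrec [] (λ x l _ → r l) xs) n xs ≡ drop n xs
rec-drop zero    xs       = refl
rec-drop (suc n) []       = refl
rec-drop (suc n) (x ∷ xs) = rec-drop n xs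

rec-reverse : ∀ {A : Set} (xs : List A) → listrec [] (λ x _ r → r ++ (x ∷ [])) xs ≡ reverse xs
rec-reverse []       = refl
rec-reverse (x ∷ xs) = trans (cong (_++ (x ∷ [])) (rec-reverse xs)) (sym (unfold-reverse x xs))

rec-readBits : ∀ h r → listrec (λ h → maybe (λ b → b ∷ []) [] h) (λ s _ rec h → maybe (λ b → b ∷ rec s) [] h) r h ≡ readBits h r
rec-readBits nothing  []      = refl
rec-readBits (just b) []      = refl
rec-readBits nothing  (s ∷ r) = refl
rec-readBits (just b) (s ∷ r) = cong (b ∷_) (rec-readBits s r)

incr : Bits → Bits
incr = listrec (false ∷ []) λ b bs r → if b then false ∷ r else true ∷ bs

incr-suc : ∀ b → incr (ℕᵇbits b) ≡ ℕᵇbits (sucᵇ b)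
incr-suc zeroᵇ    = refl
incr-suc 2[1+ b ] = cong (false ∷_) (incr-suc b)
incr-suc 1+[2 b ] = refl

rec-natBits : ∀ n → natrec [] (λ _ r → incr r) n ≡ natBits n
rec-natBits n = trans (go n) (cong ℕᵇbits (sym (fromℕ≡fromℕ' n)))
  where
  go : ∀ n → natrec [] (λ _ r → incr r) n ≡ ℕᵇbits (toℕᵇ' n)
  go zero    = refl
  go (suc n) = trans (cong incr (go n)) (incr-suc (toℕᵇ' n))

rec-encUnary : ∀ n → natrec (false ∷ []) (λ _ r → true ∷ r) n ≡ encUnary n
rec-encUnary zero    = refl
rec-encUnary (suc n) = cong (true ∷_) (rec-encUnary n)

encSym-maybe : ∀ s → maybe (λ b → if b then true ∷ false ∷ [] else (false ∷ true ∷ [])) (false ∷ false ∷ []) s ≡ encSym s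
encSym-maybe nothing      = refl
encSym-maybe (just false) = refl
encSym-maybe (just true)  = refl

∧-cond : ∀ a b → (if a then b else false) ≡ a ∧ b
∧-cond true  b = refl
∧-cond false b = refl

∨-cond : ∀ a b → (if a then true else b) ≡ a ∨ b
∨-cond true  b = refl
∨-cond false b = refl

not-cond : ∀ a → (if a then false else true) ≡ not a
not-cond true  = refl
not-cond false = refl

plusT : ∀ {Γ} → Tm Γ (nat ⇒ nat ⇒ nat)
plusT = as _+_ (ƛ (ƛ ((con `natrec) · v0 · (ƛ (ƛ ((con `suc) · v0))) · v1))) rec-+

timesT : ∀ {Γ} → Tm Γ (nat ⇒ nat ⇒ nat)
timesT = as _*_ (ƛ (ƛ ((con `natrec) · (con `zero) · (ƛ (ƛ (plusT · v2 · v0))) · v1))) rec-*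

powT : ∀ {Γ} → Tm Γ (nat ⇒ nat ⇒ nat)
powT = as _^_ (ƛ (ƛ ((con `natrec) · (numeral 1) · (ƛ (ƛ (timesT · v3 · v0))) · v0))) rec-^

monusT : ∀ {Γ} → Tm Γ (nat ⇒ nat ⇒ nat)
monusT = as _∸_ (ƛ (ƛ ((con `natrec) · v1 · (ƛ (ƛ ((con `natrec) · (con `zero) · (ƛ (ƛ v1)) · v0))) · v0))) rec-∸

andT : ∀ {Γ} → Tm Γ (bool ⇒ bool ⇒ bool)
andT = as _∧_ (ƛ (ƛ ((con `cond) · v0 · (con `false) · v1))) ∧-cond

orT : ∀ {Γ} → Tm Γ (bool ⇒ bool ⇒ bool)
orT = as _∨_ (ƛ (ƛ ((con `cond) · (con `true) · v0 · v1))) ∨-cond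

notT : ∀ {Γ} → Tm Γ (bool ⇒ bool)
notT = as not (ƛ ((con `cond) · (con `false) · (con `true) · v0)) not-cond

leqT : ∀ {Γ} → Tm Γ (nat ⇒ nat ⇒ bool)
leqT = as leq ((con `natrec) · (ƛ (con `true)) · (ƛ (ƛ ((con `natrec) · (con `false) · (ƛ (ƛ (v2
    · v1))))))) (λ _ _ → refl)

eqNT : ∀ {Γ} → Tm Γ (nat ⇒ nat ⇒ bool)
eqNT = as eqN (ƛ (ƛ (andT · (leqT · v1 · v0) · (leqT · v0 · v1)))) (λ _ _ → refl)

eqBoolT : ∀ {Γ} → Tm Γ (bool ⇒ bool ⇒ bool)
eqBoolT = as eqBool (ƛ (ƛ ((con `cond) · v0 · (notT · v0) · v1))) (λ _ _ → refl)

eqBitsT : ∀ {Γ} → Tm Γ (bits ⇒ bits ⇒ bool)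
eqBitsT = as eqBits ((con `listrec) · ((con `listrec) · (con `true) · (ƛ (ƛ (ƛ (con `false)))))
    · (ƛ (ƛ (ƛ ((con `listrec) · (con `false) · (ƛ (ƛ (ƛ (andT · (eqBoolT · v5 · v2) · (v3
    · v1)))))))))) (λ _ _ → refl)

appendT : ∀ {Γ σ} → Tm Γ (list σ ⇒ list σ ⇒ list σ)
appendT = as _++_ (ƛ (ƛ ((con `listrec) · v0 · (ƛ (ƛ (ƛ ((con `cons) · v2 · v0)))) · v1))) rec-++

lengthT : ∀ {Γ σ} → Tm Γ (list σ ⇒ nat)
lengthT = as length ((con `listrec) · (con `zero) · (ƛ (ƛ (ƛ ((con `suc) · v0))))) rec-length

mapT : ∀ {Γ σ τ} → Tm Γ ((σ ⇒ τ) ⇒ list σ ⇒ list τ)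
mapT = as map (ƛ ((con `listrec) · (con `nil) · (ƛ (ƛ (ƛ ((con `cons) · (v3 · v2) · v0)))))) rec-map

concatMapT : ∀ {Γ σ τ} → Tm Γ ((σ ⇒ list τ) ⇒ list σ ⇒ list τ)
concatMapT = as concatMap (ƛ ((con `listrec) · (con `nil) · (ƛ (ƛ (ƛ (appendT · (v3 · v2) · v0)))))) rec-concatMap

takeT : ∀ {Γ σ} → Tm Γ (nat ⇒ list σ ⇒ list σ)
takeT = as take ((con `natrec) · (ƛ (con `nil)) · (ƛ (ƛ (ƛ ((con `listrec) · (con `nil) · (ƛ (ƛ (ƛ ((con `cons)
    · v2 · (v4 · v1))))) · v0))))) rec-take

dropT : ∀ {Γ σ} → Tm Γ (nat ⇒ list σ ⇒ list σ)
dropT = as drop ((con `natrec) · (ƛ v0) · (ƛ (ƛ (ƛ ((con `listrec) · (con `nil) · (ƛ (ƛ (ƛ (v4 · v1))))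
    · v0))))) rec-drop

reverseT : ∀ {Γ σ} → Tm Γ (list σ ⇒ list σ)
reverseT = as reverse ((con `listrec) · (con `nil) · (ƛ (ƛ (ƛ (appendT · v0 · ((con `cons) · v2
    · (con `nil))))))) rec-reverse

readBitsT : ∀ {Γ} → Tm Γ (cell ⇒ list cell ⇒ bits)
readBitsT = as readBits (ƛ (ƛ ((con `listrec) · (ƛ ((con `maybe) · (ƛ ((con `cons) · v0 · (con `nil))) · (con `nil)
    · v0)) · (ƛ (ƛ (ƛ (ƛ ((con `maybe) · (ƛ ((con `cons) · v0 · (v2 · v4))) · (con `nil) · v0))))) · v0
    · v1))) rec-readBits

natBitsT : ∀ {Γ} → Tm Γ (nat ⇒ bits)
natBitsT = as natBits ((con `natrec) · (con `nil) · (ƛ (ƛ ((con `listrec) · ((con `cons) · (con `false)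
    · (con `nil)) · (ƛ (ƛ (ƛ ((con `cond) · ((con `cons) · (con `false) · v0) · ((con `cons) · (con `true) · v1)
    · v2)))) · v0)))) rec-natBits

encUnaryT : ∀ {Γ} → Tm Γ (nat ⇒ bits)
encUnaryT = as encUnary ((con `natrec) · ((con `cons) · (con `false) · (con `nil)) · (ƛ (ƛ ((con `cons)
    · (con `true) · v0)))) rec-encUnary

encSymT : ∀ {Γ} → Tm Γ (cell ⇒ bits)
encSymT = as encSym ((con `maybe) · (ƛ ((con `cond) · ((con `cons) · (con `true) · ((con `cons) · (con `false)
    · (con `nil))) · ((con `cons) · (con `false) · ((con `cons) · (con `true) · (con `nil))) · v0)) · ((con `cons)
    · (con `false) · ((con `cons) · (con `false) · (con `nil)))) encSym-maybe

nthT : ∀ {Γ} → Tm Γ (list nat ⇒ nat ⇒ nat)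
nthT = as nth ((con `listrec) · (ƛ (con `zero)) · (ƛ (ƛ (ƛ ((con `natrec) · v2 · (ƛ (ƛ (v2 · v1)))))))) (λ _ _ → refl)

symIxT : ∀ {Γ} → Tm Γ (cell ⇒ nat)
symIxT = as symIx ((con `maybe) · (ƛ ((con `cond) · (numeral 2) · (numeral 1) · v0)) · (con `zero)) (λ _ → refl)

symOfT : ∀ {Γ} → Tm Γ (nat ⇒ cell)
symOfT = as symOf ((con `natrec) · (con `nothing) · (ƛ (ƛ ((con `natrec) · ((con `just) · (con `false))
    · (ƛ (ƛ ((con `just) · (con `true)))) · v1)))) (λ _ → refl)

moveLT : ∀ {Γ} → Tm Γ (list cell ⇒ cell ⇒ list cell ⇒ list cell ⊗ (cell ⊗ list cell))
moveLT = as moveL (ƛ (ƛ (ƛ ((con `listrec) · ((con `pair) · (con `nil) · ((con `pair) · (con `nothing)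
    · ((con `cons) · v1 · v0))) · (ƛ (ƛ (ƛ ((con `pair) · v1 · ((con `pair) · v2 · ((con `cons) · v4 · v3))))))
    · v2)))) (λ _ _ _ → refl)

moveRT : ∀ {Γ} → Tm Γ (list cell ⇒ cell ⇒ list cell ⇒ list cell ⊗ (cell ⊗ list cell))
moveRT = as moveR (ƛ (ƛ (ƛ ((con `listrec) · ((con `pair) · ((con `cons) · v1 · v2) · ((con `pair) · (con `nothing)
    · (con `nil))) · (ƛ (ƛ (ƛ ((con `pair) · ((con `cons) · v4 · v5) · ((con `pair) · v2 · v1)))))
    · v0)))) (λ _ _ _ → refl)

moveT : ∀ {Γ} → Tm Γ (nat ⇒ list cell ⇒ cell ⇒ list cell ⇒ list cell ⊗ (cell ⊗ list cell))
moveT = as move (ƛ (ƛ (ƛ (ƛ ((con `natrec) · (moveLT · v2 · v1 · v0) · (ƛ (ƛ ((con `natrec) · (moveRT · v4 · v3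
    · v2) · (ƛ (ƛ ((con `pair) · v6 · ((con `pair) · v5 · v4)))) · v1))) · v3))))) (λ _ _ _ _ → refl)

offsetT : ∀ {Γ} → Tm Γ (nat ⇒ cell ⇒ nat)
offsetT = as offset (ƛ (ƛ (timesT · (numeral 4) · (plusT · (timesT · (numeral 3) · v1) · (symIxT
    · v0))))) (λ _ _ → refl)

haltedCT : ∀ {Γ} → Tm Γ (list nat ⇒ conf ⇒ bool)
haltedCT = as haltedC (ƛ (ƛ (eqNT · (nthT · v1 · (offsetT · ((con `fst) · v0) · ((con `fst) · ((con `snd)
    · ((con `snd) · v0))))) · (con `zero)))) (λ _ _ → refl)

actionT : ∀ {Γ} → Tm Γ ((bits ⇒ bool) ⇒ list nat ⇒ nat ⇒ list cell ⇒ cell ⇒ list cell ⇒ conf)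
actionT = as action (ƛ (ƛ (ƛ (ƛ (ƛ (ƛ ((con `cond) · ((con `pair) · (nthT · v4 · (plusT · (numeral 1) · v3))
    · (moveT · (nthT · v4 · (plusT · (numeral 3) · v3)) · v2 · (symOfT · (nthT · v4 · (plusT · (numeral 2) · v3)))
    · v0)) · ((con `pair) · ((con `cond) · (nthT · v4 · (plusT · (numeral 1) · v3)) · (nthT · v4 · (plusT
    · (numeral 2) · v3)) · (v5 · (readBitsT · v1 · v0))) · ((con `pair) · v2 · ((con `pair) · v1 · v0))) · (eqNT
    · (nthT · v4 · v3) · (numeral 1))))))))) (λ _ _ _ _ _ _ → refl)

stepCT : ∀ {Γ} → Tm Γ ((bits ⇒ bool) ⇒ list nat ⇒ conf ⇒ conf)
stepCT = as stepC (ƛ (ƛ (ƛ ((con `cond) · v0 · (actionT · v2 · v1 · (offsetT · ((con `fst) · v0) · ((con `fst)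
    · ((con `snd) · ((con `snd) · v0)))) · ((con `fst) · ((con `snd) · v0)) · ((con `fst) · ((con `snd)
    · ((con `snd) · v0))) · ((con `snd) · ((con `snd) · ((con `snd) · v0)))) · (haltedCT · v1
    · v0))))) (λ _ _ _ → refl)

contentsCT : ∀ {Γ} → Tm Γ (conf ⇒ bits)
contentsCT = as contentsC (ƛ (readBitsT · ((con `fst) · ((con `snd) · ((con `snd) · v0))) · ((con `snd)
    · ((con `snd) · ((con `snd) · v0))))) (λ _ → refl)

runCT : ∀ {Γ} → Tm Γ ((bits ⇒ bool) ⇒ list nat ⇒ nat ⇒ conf ⇒ conf)
runCT = as runC (ƛ (ƛ ((con `natrec) · (ƛ v0) · (ƛ (ƛ (ƛ (v1 · (stepCT · v4 · v3 · v0)))))))) (λ _ _ _ _ → refl)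

noOracleT : ∀ {Γ} → Tm Γ (bits ⇒ bool)
noOracleT = as noOracle (ƛ (con `false)) (λ _ → refl)

haltsInT : ∀ {Γ} → Tm Γ (list nat ⇒ nat ⇒ conf ⇒ opt bits)
haltsInT = as haltsIn (ƛ ((con `natrec) · (ƛ ((con `cond) · ((con `just) · (contentsCT · v0)) · (con `nothing)
    · (haltedCT · v1 · v0))) · (ƛ (ƛ (ƛ ((con `cond) · (con `nothing) · (v1 · (stepCT · noOracleT · v3 · v0))
    · (haltedCT · v3 · v0))))))) (λ _ _ _ → refl)

startCT : ∀ {Γ} → Tm Γ (bits ⇒ conf)
startCT = as startC ((con `listrec) · ((con `pair) · (con `zero) · ((con `pair) · (con `nil) · ((con `pair)
    · (con `nothing) · (con `nil)))) · (ƛ (ƛ (ƛ ((con `pair) · (con `zero) · ((con `pair) · (con `nil)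
    · ((con `pair) · ((con `just) · v2) · (mapT · (con `just) · v1)))))))) (λ _ → refl)

unaryT : ∀ {Γ} → Tm Γ (bits ⇒ nat ⊗ bits)
unaryT = as unary ((con `listrec) · ((con `pair) · (con `zero) · (con `nil)) · (ƛ (ƛ (ƛ ((con `cond) · ((con `pair)
    · ((con `suc) · ((con `fst) · v0)) · ((con `snd) · v0)) · ((con `pair) · (con `zero) · v1) · v2))))) (λ _ → refl)

unariesT : ∀ {Γ} → Tm Γ (nat ⇒ bits ⇒ list nat ⊗ bits)
unariesT = as unaries ((con `natrec) · (ƛ ((con `pair) · (con `nil) · v0)) · (ƛ (ƛ (ƛ ((con `pair) · ((con `cons)
    · ((con `fst) · (unaryT · v0)) · ((con `fst) · (v1 · ((con `snd) · (unaryT · v0))))) · ((con `snd) · (v1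
    · ((con `snd) · (unaryT · v0))))))))) (λ _ _ → refl)

parseT : ∀ {Γ} → Tm Γ (bits ⇒ list nat ⊗ bits)
parseT = as parse (ƛ (unariesT · ((con `fst) · (unaryT · v0)) · ((con `snd) · (unaryT · v0)))) (λ _ → refl)

vRunT : ∀ {Γ} → Tm Γ (bits ⇒ nat ⇒ opt bits)
vRunT = as vRun (ƛ (ƛ (haltsInT · ((con `fst) · (parseT · v1)) · v0 · (startCT · ((con `snd) · (parseT
    · v1)))))) (λ _ _ → refl)

vEventT : ∀ {Γ} → Tm Γ (nat ⊗ bits ⇒ opt move′)
vEventT = as vEvent (ƛ ((con `maybe) · (ƛ ((con `just) · ((con `pair) · v0 · (plusT · (numeral 3) · (lengthT
    · ((con `snd) · v1)))))) · (con `nothing) · (vRunT · ((con `snd) · v0) · ((con `fst) · v0)))) (λ _ → refl)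

eventOfT : ∀ {Γ} → Tm Γ (bits ⇒ opt move′)
eventOfT = as eventOf (ƛ ((con `cond) · (vEventT · (unaryT · v0)) · (con `nothing) · (eqBitsT · (appendT
    · (encUnaryT · ((con `fst) · (unaryT · v0))) · ((con `snd) · (unaryT · v0))) · v0))) (λ _ → refl)

eventT : ∀ {Γ} → Tm Γ (nat ⇒ opt move′)
eventT = as event (ƛ (eventOfT · (natBitsT · v0))) (λ _ → refl)

toNatT : ∀ {Γ} → Tm Γ (bits ⇒ nat)
toNatT = as toNat ((con `listrec) · (con `zero) · (ƛ (ƛ (ƛ ((con `cond) · ((con `suc) · ((con `suc) · (plusT · v0
    · v0))) · ((con `suc) · (plusT · v0 · v0)) · v2))))) (λ _ → refl)

unpairT : ∀ {Γ} → Tm Γ (bits ⇒ opt bool ⇒ opt (bits ⊗ bits))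
unpairT = as unpair ((con `listrec) · (ƛ (con `nothing)) · (ƛ (ƛ (ƛ ((con `maybe) · (ƛ ((con `cond) · ((con `maybe)
    · (ƛ ((con `just) · ((con `pair) · ((con `cons) · v1 · ((con `fst) · v0)) · ((con `snd) · v0))))
    · (con `nothing) · (v1 · (con `nothing))) · ((con `cond) · (con `nothing) · ((con `just) · ((con `pair)
    · (con `nil) · v2)) · v0) · (eqBoolT · v0 · v3))) · (v0 · ((con `just) · v2))))))) (λ _ _ → refl)

anyBT : ∀ {Γ σ} → Tm Γ ((σ ⇒ bool) ⇒ list σ ⇒ bool)
anyBT = as anyB (ƛ ((con `listrec) · (con `false) · (ƛ (ƛ (ƛ (orT · (v3 · v2) · v0)))))) (λ _ _ → refl)

allBT : ∀ {Γ σ} → Tm Γ ((σ ⇒ bool) ⇒ list σ ⇒ bool)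
allBT = as allB (ƛ ((con `listrec) · (con `true) · (ƛ (ƛ (ƛ (andT · (v3 · v2) · v0)))))) (λ _ _ → refl)

listedT : ∀ {Γ} → Tm Γ (list move′ ⇒ bits ⇒ nat ⇒ bool)
listedT = as listed (ƛ (ƛ (ƛ (anyBT · (ƛ (andT · (eqBitsT · v2 · ((con `fst) · v0)) · (leqT · ((con `snd) · v0)
    · v1))) · v2)))) (λ _ _ _ → refl)

histOracleT : ∀ {Γ} → Tm Γ (nat ⇒ list move′ ⇒ bits ⇒ bool)
histOracleT = as histOracle (ƛ (ƛ (ƛ ((con `maybe) · (ƛ (orT · (leqT · v3 · (toNatT · ((con `snd) · v0)))
    · (listedT · v2 · ((con `fst) · v0) · (toNatT · ((con `snd) · v0))))) · (con `false) · (unpairT · v0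
    · (con `nothing)))))) (λ _ _ _ → refl)

reachTy : Ty
reachTy = bool ⇒ list move′ ⇒ nat ⇒ nat ⇒ bool

affordT : ∀ {Γ} → Tm Γ ((list move′ ⇒ bool) ⇒ (nat ⇒ nat) ⇒ nat ⇒ list move′ ⇒ nat ⇒ move′ ⇒ bool)
affordT = as Game.afford (ƛ (ƛ (ƛ (ƛ (ƛ (ƛ (leqT · (plusT · v1 · (v4 · ((con `snd) · v0)))
    · v3))))))) (λ _ _ _ _ _ _ → refl)

ownT : ∀ {Γ} → Tm Γ ((list move′ ⇒ bool) ⇒ (nat ⇒ nat) ⇒ nat ⇒ list move′ ⇒ reachTy ⇒ bool ⇒ list move′ ⇒ nat ⇒ nat ⇒
    move′ ⇒ bool)
ownT = as Game.own (ƛ (ƛ (ƛ (ƛ (ƛ (ƛ (ƛ (ƛ (ƛ (ƛ (andT · (affordT · v9 · v8 · v7 · v6 · v2 · v0) · (v5 · v4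
    · ((con `cons) · v0 · v3) · (plusT · v2 · (v8 · ((con `snd) · v0)))
    · v1)))))))))))) (λ _ _ _ _ _ _ _ _ _ _ → refl)

safeT : ∀ {Γ} → Tm Γ ((list move′ ⇒ bool) ⇒ (nat ⇒ nat) ⇒ nat ⇒ list move′ ⇒ reachTy ⇒ reachTy)
safeT = as Game.safe (ƛ (ƛ (ƛ (ƛ (ƛ (ƛ (ƛ (ƛ (ƛ (andT · (eqBoolT · (v8 · v2) · v3) · (allBT · (ƛ (orT · (notT
    · (affordT · v9 · v8 · v7 · v6 · v1 · v0)) · (v5 · v4 · ((con `cons) · v0 · v3) · v2 · (plusT · v1 · (v8
    · ((con `snd) · v0)))))) · v5))))))))))) (λ _ _ _ _ _ _ _ _ _ → refl)

reachT : ∀ {Γ} → Tm Γ ((list move′ ⇒ bool) ⇒ (nat ⇒ nat) ⇒ nat ⇒ list move′ ⇒ nat ⇒ reachTy)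
reachT = as Game.reach (ƛ (ƛ (ƛ (ƛ ((con `natrec) · (ƛ (ƛ (ƛ (ƛ (con `false))))) · (ƛ (ƛ (ƛ (ƛ (ƛ (ƛ (orT · (safeT
    · v9 · v8 · v7 · v6 · v4 · v3 · v2 · v1 · v0) · (anyBT · (ownT · v9 · v8 · v7 · v6 · v4 · v3 · v2 · v1 · v0)
    · v6))))))))))))) (λ _ _ _ _ _ _ _ _ _ → refl)

findT : ∀ {Γ} → Tm Γ ((list move′ ⇒ bool) ⇒ (nat ⇒ nat) ⇒ nat ⇒ list move′ ⇒ (move′ ⇒ bool) ⇒ opt move′)
findT = as Game.find (ƛ (ƛ (ƛ (ƛ (ƛ ((con `listrec) · (con `nothing) · (ƛ (ƛ (ƛ ((con `cond) · ((con `just) · v2)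
    · v0 · (v3 · v2))))) · v1)))))) (λ _ _ _ _ _ → refl)

playT : ∀ {Γ} → Tm Γ ((list move′ ⇒ bool) ⇒ (nat ⇒ nat) ⇒ nat ⇒ list move′ ⇒ nat ⇒ bool ⇒ list move′ ⇒ nat ⇒ nat ⇒
    list move′)
playT = as Game.play (ƛ (ƛ (ƛ (ƛ ((con `natrec) · (ƛ (ƛ (ƛ (ƛ (con `nil))))) · (ƛ (ƛ (ƛ (ƛ (ƛ (ƛ ((con `cond)
    · (con `nil) · ((con `maybe) · (ƛ (appendT · (v5 · v4 · ((con `cons) · v0 · v3) · (plusT · v2 · (v9
    · ((con `snd) · v0))) · v1) · ((con `cons) · v0 · (con `nil)))) · (con `nil) · (findT · v9 · v8 · v7 · v6
    · (ownT · v9 · v8 · v7 · v6 · (reachT · v9 · v8 · v7 · v6 · v5) · v3 · v2 · v1 · v0))) · (safeT · v9 · v8 · v7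
    · v6 · (reachT · v9 · v8 · v7 · v6 · v5) · v3 · v2 · v1 · v0))))))))))))) (λ _ _ _ _ _ _ _ _ _ → refl)

scaleT : ∀ {Γ} → Tm Γ (nat ⇒ nat)
scaleT = as scale ((con `natrec) · (numeral 10) · (ƛ (ƛ (powT · (numeral 2) · v0)))) (λ _ → refl)

size′T : ∀ {Γ} → Tm Γ (nat ⇒ nat)
size′T = as size′ (ƛ (powT · (numeral 2) · (scaleT · v0))) (λ _ → refl)

lowestT : ∀ {Γ} → Tm Γ (nat ⇒ nat)
lowestT = as lowest (ƛ (plusT · (scaleT · v0) · (numeral 5))) (λ _ → refl)

unit′T : ∀ {Γ} → Tm Γ (nat ⇒ nat)
unit′T = as unit′ (ƛ (powT · (numeral 2) · (monusT · (size′T · v0) · (plusT · (plusT · (scaleT · v0) · (scaleT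
    · v0)) · (numeral 14))))) (λ _ → refl)

μT : ∀ {Γ} → Tm Γ (nat ⇒ nat)
μT = as μ (ƛ (timesT · (timesT · (unit′T · v0) · (size′T · v0)) · (numeral 256))) (λ _ → refl)

budgetT : ∀ {Γ} → Tm Γ (nat ⇒ nat)
budgetT = as budget (ƛ (timesT · (μT · v0) · (unit′T · v0))) (λ _ → refl)

weightT : ∀ {Γ} → Tm Γ (nat ⇒ nat ⇒ nat)
weightT = as weight (ƛ (ƛ (powT · (numeral 2) · (monusT · (size′T · v1) · v0)))) (λ _ _ → refl)

priceT : ∀ {Γ} → Tm Γ (nat ⇒ (nat ⇒ nat) ⇒ nat ⇒ nat)
priceT = as price (ƛ (ƛ (ƛ (timesT · (plusT · (μT · v2) · (v1 · v0)) · (weightT · v2 · v0))))) (λ _ _ _ → refl)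

stringsT : ∀ {Γ} → Tm Γ (nat ⇒ list bits)
stringsT = as strings ((con `natrec) · ((con `cons) · (con `nil) · (con `nil)) · (ƛ (ƛ ((con `cons) · (con `nil)
    · (appendT · (mapT · ((con `cons) · (con `true)) · v0) · (mapT · ((con `cons) · (con `false))
    · v0)))))) (λ _ → refl)

belowT : ∀ {Γ} → Tm Γ (nat ⇒ list nat)
belowT = as below ((con `natrec) · (con `nil) · (ƛ (ƛ ((con `cons) · v1 · v0)))) (λ _ → refl)

filterBT : ∀ {Γ σ} → Tm Γ ((σ ⇒ bool) ⇒ list σ ⇒ list σ)
filterBT = as filterB (ƛ ((con `listrec) · (con `nil) · (ƛ (ƛ (ƛ ((con `cond) · ((con `cons) · v2 · v0) · v0 · (v3
    · v2))))))) (λ _ _ → refl)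

movesOfT : ∀ {Γ} → Tm Γ (nat ⇒ list move′)
movesOfT = as movesOf (ƛ (concatMapT · (ƛ (mapT · (ƛ ((con `pair) · v0 · v1)) · (stringsT · (size′T · v1))))
    · (filterBT · (leqT · (lowestT · v0)) · (belowT · (size′T · v0))))) (λ _ → refl)

threeTimesT : ∀ {Γ} → Tm Γ ((cell ⇒ bits) ⇒ bits)
threeTimesT = as threeTimes (ƛ (appendT · (v0 · (con `nothing)) · (appendT · (v0 · ((con `just) · (con `false)))
    · (v0 · ((con `just) · (con `true)))))) (λ _ → refl)

-- `Move` is not a type of the language, so the term receives the code of the move instead.
writeWith : ℕ → Sym → Bits → Bits
writeWith q s m = false ∷ true ∷ encUnary q ++ encSym s ++ m

writeWithT : ∀ {Γ} → Tm Γ (nat ⇒ cell ⇒ bits ⇒ bits)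
writeWithT = as writeWith (ƛ (ƛ (ƛ ((con `cons) · (con `false) · ((con `cons) · (con `true) · (appendT · (encUnaryT
    · v2) · (appendT · (encSymT · v1) · v0))))))) (λ _ _ _ → refl)

writersCodeT : ∀ {Γ} → Tm Γ (bits ⇒ nat ⇒ bits)
writersCodeT = as writersCode ((con `listrec) · (ƛ (con `nil)) · (ƛ (ƛ (ƛ (ƛ (appendT · (threeTimesT
    · (ƛ ((con `listrec) · (writeWithT · (numeral 1) · ((con `just) · v4) · ((con `cons) · (con `true)
    · ((con `cons) · (con `false) · (con `nil)))) · (ƛ (ƛ (ƛ (writeWithT · ((con `suc) · v4) · ((con `just) · v7)
    · ((con `cons) · (con `false) · ((con `cons) · (con `false) · (con `nil))))))) · v3))) · (v1 · ((con `suc)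
    · v0)))))))) (λ _ _ → refl)

preludeCodeT : ∀ {Γ} → Tm Γ (nat ⇒ bits ⇒ bits ⇒ bits)
preludeCodeT = as preludeCode (ƛ (ƛ (ƛ (appendT · (encUnaryT · (plusT · v2 · ((con `suc) · (lengthT · v0))))
    · (appendT · (threeTimesT · (ƛ (writeWithT · (plusT · (numeral 2) · v3) · v0 · ((con `cons) · (con `true)
    · ((con `cons) · (con `false) · (con `nil)))))) · (appendT · v1 · (writersCodeT · v0 · (plusT · (numeral 2)
    · v2)))))))) (λ _ _ _ → refl)

query′T : ∀ {Γ} → Tm Γ (nat ⇒ nat ⇒ bits)
query′T = as query′ (ƛ (ƛ (appendT · (encUnaryT · v1) · (natBitsT · v0)))) (λ _ _ → refl)

asBitsT : ∀ {Γ} → Tm Γ (list nat ⇒ bits)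
asBitsT = as asBits (mapT · (ƛ (notT · (leqT · v0 · (con `zero))))) (λ _ → refl)

machineOfT : ∀ {Γ} → Tm Γ (nat ⇒ list nat)
machineOfT = as machineOf (ƛ ((con `fst) · (parseT · (natBitsT · v0)))) (λ _ → refl)

coreOfT : ∀ {Γ} → Tm Γ (nat ⇒ list nat)
coreOfT = as coreOf (ƛ ((con `fst) · (parseT · ((con `snd) · (parseT · (natBitsT · v0)))))) (λ _ → refl)

inputOfT : ∀ {Γ} → Tm Γ (nat ⇒ nat ⇒ bits)
inputOfT = as inputOf (ƛ (ƛ (preludeCodeT · (nthT · (coreOfT · v1) · (con `zero)) · (asBitsT · (dropT · (numeral 1)
    · (coreOfT · v1))) · (reverseT · (query′T · v1 · v0))))) (λ _ _ → refl)

answerT : ∀ {Γ} → Tm Γ (nat ⇒ nat ⇒ list move′ ⇒ bool)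
answerT = as answer (ƛ (ƛ (ƛ (eqBitsT · ((con `cons) · (con `true) · (con `nil)) · (contentsCT · (runCT
    · (histOracleT · (size′T · v2) · v0) · (machineOfT · v2) · (powT · (numeral 2) · (monusT · (scaleT · v2)
    · (numeral 1))) · (startCT · (inputOfT · v2 · v1)))))))) (λ _ _ _ → refl)

levelT : ∀ {Γ} → Tm Γ (owned ⇒ nat)
levelT = as level (ƛ ((con `snd) · ((con `snd) · v0))) (λ _ → refl)

sumByT : ∀ {Γ σ} → Tm Γ ((σ ⇒ nat) ⇒ list σ ⇒ nat)
sumByT = as sumBy (ƛ ((con `listrec) · (con `zero) · (ƛ (ƛ (ƛ (plusT · (v3 · v2) · v0)))))) (λ _ _ → refl)

relevantT : ∀ {Γ} → Tm Γ (nat ⇒ owned ⇒ bool)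
relevantT = as relevant (ƛ (ƛ (andT · (leqT · (lengthT · ((con `fst) · ((con `snd) · v0))) · (size′T · v1)) · (notT
    · (leqT · (size′T · v1) · (levelT · v0)))))) (λ _ _ → refl)

viewT : ∀ {Γ} → Tm Γ (nat ⇒ list owned ⇒ list owned)
viewT = as view (ƛ (filterBT · (relevantT · v0))) (λ _ _ → refl)

recentT : ∀ {Γ} → Tm Γ (nat ⇒ list owned ⇒ list owned)
recentT = as recent (ƛ (ƛ (takeT · (monusT · (lengthT · v0) · v1) · v0))) (λ _ _ → refl)

olderT : ∀ {Γ} → Tm Γ (nat ⇒ list owned ⇒ list owned)
olderT = as older (ƛ (ƛ (dropT · (monusT · (lengthT · v0) · v1) · v0))) (λ _ _ → refl)

spentT : ∀ {Γ} → Tm Γ (nat ⇒ (nat ⇒ nat) ⇒ bool ⇒ list owned ⇒ nat)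
spentT = as spent (ƛ (ƛ (ƛ (sumByT · (ƛ ((con `cond) · (priceT · v3 · v2 · (levelT · v0)) · (con `zero) · (eqBoolT
    · v1 · ((con `fst) · v0)))))))) (λ _ _ _ _ → refl)

weightAtT : ∀ {Γ} → Tm Γ (nat ⇒ bool ⇒ list owned ⇒ nat ⇒ nat)
weightAtT = as weightAt (ƛ (ƛ (ƛ (ƛ (sumByT · (ƛ ((con `cond) · (weightT · v4 · v1) · (con `zero) · (andT
    · (eqBoolT · v3 · ((con `fst) · v0)) · (eqNT · (levelT · v0) · v1)))) · v1))))) (λ _ _ _ _ → refl)

hasLowT : ∀ {Γ} → Tm Γ (nat ⇒ list owned ⇒ bool)
hasLowT = as hasLow (ƛ (anyBT · (ƛ (notT · (leqT · (lowestT · v1) · (levelT · v0)))))) (λ _ _ → refl)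

validT : ∀ {Γ} → Tm Γ (nat ⇒ data′ ⇒ list owned ⇒ bool)
validT = as valid (ƛ (ƛ (ƛ (andT · (notT · (leqT · ((con `fst) · v1) · (con `zero))) · (andT · (notT · (hasLowT
    · v2 · (recentT · ((con `snd) · ((con `snd) · v1)) · v0))) · (leqT · (spentT · v2 · ((con `fst) · ((con `snd)
    · v1)) · (con `false) · (recentT · ((con `snd) · ((con `snd) · v1)) · v0)) · (budgetT · v2))))))) (λ _ _ _ → refl)

settleT : ∀ {Γ} → Tm Γ (nat ⇒ (nat ⇒ nat) ⇒ list owned ⇒ nat ⇒ nat)
settleT = as settle (ƛ (ƛ (ƛ (ƛ (monusT · (plusT · (v2 · v0) · (weightAtT · v3 · (con `true) · v1 · v0))
    · (weightAtT · v3 · (con `false) · v1 · v0)))))) (λ _ _ _ _ → refl)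

renewT : ∀ {Γ} → Tm Γ (nat ⇒ data′ ⇒ list owned ⇒ data′)
renewT = as renew (ƛ (ƛ (ƛ ((con `cond) · v1 · ((con `pair) · ((con `suc) · ((con `fst) · v1)) · ((con `pair)
    · (settleT · v2 · ((con `fst) · ((con `snd) · v1)) · (recentT · ((con `snd) · ((con `snd) · v1)) · v0))
    · (lengthT · v0))) · (validT · v2 · v1 · v0))))) (λ _ _ _ → refl)

fuelT : ∀ {Γ} → Tm Γ (nat ⇒ nat)
fuelT = as fuel (ƛ (plusT · (budgetT · v0) · (budgetT · v0))) (λ _ → refl)

winnerT : ∀ {Γ} → Tm Γ (nat ⇒ data′ ⇒ list owned ⇒ bool)
winnerT = as winner (ƛ (ƛ (ƛ (reachT · (answerT · v2 · ((con `fst) · v1)) · (priceT · v2 · ((con `fst)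
    · ((con `snd) · v1))) · (budgetT · v2) · (movesOfT · v2) · ((con `suc) · (fuelT · v2)) · (con `true) · (mapT
    · (con `snd) · (olderT · ((con `snd) · ((con `snd) · v1)) · v0)) · (con `zero) · (con `zero))))) (λ _ _ _ → refl)

replyT : ∀ {Γ} → Tm Γ (nat ⇒ data′ ⇒ list owned ⇒ list move′)
replyT = as reply (ƛ (ƛ (ƛ (playT · (answerT · v2 · ((con `fst) · v1)) · (priceT · v2 · ((con `fst) · ((con `snd)
    · v1))) · (budgetT · v2) · (movesOfT · v2) · ((con `suc) · (fuelT · v2)) · (winnerT · v2 · v1 · v0) · (mapT
    · (con `snd) · v0) · (spentT · v2 · ((con `fst) · ((con `snd) · v1)) · (con `true) · (recentT · ((con `snd)
    · ((con `snd) · v1)) · v0)) · (spentT · v2 · ((con `fst) · ((con `snd) · v1)) · (con `false) · (recentT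
    · ((con `snd) · ((con `snd) · v1)) · v0)))))) (λ _ _ _ → refl)

setAtT : ∀ {Γ} → Tm Γ (nat ⇒ data′ ⇒ (nat ⇒ data′) ⇒ nat ⇒ data′)
setAtT = as setAt (ƛ (ƛ (ƛ (ƛ ((con `cond) · v2 · (v1 · v0) · (eqNT · v3 · v0)))))) (λ _ _ _ _ → refl)

respondWithT : ∀ {Γ} → Tm Γ (nat ⇒ data′ ⇒ global ⇒ global)
respondWithT = as respondWith (ƛ (ƛ (ƛ ((con `pair) · (appendT · (mapT · ((con `pair) · (con `true)) · (replyT · v2
    · v1 · (viewT · v2 · ((con `fst) · v0)))) · ((con `fst) · v0)) · (setAtT · v2 · v1 · ((con `snd)
    · v0)))))) (λ _ _ _ → refl)

respondT : ∀ {Γ} → Tm Γ (nat ⇒ global ⇒ global)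
respondT = as respond (ƛ (ƛ (respondWithT · v1 · (renewT · v1 · ((con `snd) · v0 · v1) · (viewT · v1 · ((con `fst)
    · v0))) · v0))) (λ _ _ → refl)

respondAllT : ∀ {Γ} → Tm Γ (nat ⇒ global ⇒ global)
respondAllT = as respondAll ((con `natrec) · (ƛ v0) · (ƛ (ƛ (ƛ (respondT · v2 · (v1 · v0)))))) (λ _ _ → refl)

addEventT : ∀ {Γ} → Tm Γ (opt move′ ⇒ global ⇒ global)
addEventT = as addEvent (ƛ (ƛ ((con `pair) · ((con `maybe) · (ƛ ((con `cons) · ((con `pair) · (con `false) · v0)
    · ((con `fst) · v1))) · ((con `fst) · v0) · v1) · ((con `snd) · v0)))) (λ _ _ → refl)

stageT : ∀ {Γ} → Tm Γ (nat ⇒ global)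
stageT = as stage ((con `natrec) · ((con `pair) · (con `nil) · (ƛ ((con `pair) · (con `zero) · ((con `pair)
    · (ƛ (con `zero)) · (con `zero))))) · (ƛ (ƛ (respondAllT · ((con `suc) · v1) · (addEventT · (eventT · v1)
    · v0))))) (λ _ → refl)

valueT : ∀ {Γ} → Tm Γ (bits ⇒ nat)
valueT = as value ((con `listrec) · (con `zero) · (ƛ (ƛ (ƛ ((con `cond) · (plusT · (powT · (numeral 2) · (lengthT
    · v1)) · v0) · v0 · v2))))) (λ _ → refl)

nthMoveT : ∀ {Γ} → Tm Γ (list owned ⇒ nat ⇒ opt bits)
nthMoveT = as nthMove ((con `listrec) · (ƛ (con `nothing)) · (ƛ (ƛ (ƛ ((con `natrec) · ((con `just) · ((con `fst)
    · ((con `snd) · v2))) · (ƛ (ƛ (v2 · v1)))))))) (λ _ _ → refl)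

issuedT : ∀ {Γ} → Tm Γ (nat ⇒ list owned ⇒ list owned)
issuedT = as issued (ƛ (ƛ (reverseT · (filterBT · (ƛ (andT · ((con `fst) · v0) · (eqNT · (levelT · v0) · v2)))
    · v0)))) (λ _ _ → refl)

mapMaybe′T : ∀ {Γ} → Tm Γ ((bits ⇒ bits) ⇒ opt bits ⇒ opt bits)
mapMaybe′T = as mapMaybe′ (ƛ ((con `maybe) · (ƛ ((con `just) · (v1 · v0))) · (con `nothing))) (λ _ _ → refl)

decompressT : ∀ {Γ} → Tm Γ (bits ⇒ nat ⇒ opt bits)
decompressT = as decompress (ƛ (ƛ ((con `listrec) · (con `nothing) · (ƛ (ƛ (ƛ ((con `cond) · ((con `listrec)
    · (con `nothing) · (ƛ (ƛ (ƛ ((con `cond) · ((con `listrec) · (con `nothing) · (ƛ (ƛ (ƛ ((con `cond)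
    · (mapMaybe′T · reverseT · (vRunT · v1 · v9)) · (con `nothing) · v2)))) · v1) · (con `nothing) · v2)))) · v1)
    · (mapMaybe′T · reverseT · (nthMoveT · (issuedT · ((con `suc) · (lengthT · v1)) · ((con `fst) · (stageT · v3)))
    · (valueT · v1))) · v2)))) · v1))) (λ _ _ → refl)

haltsNowT : ∀ {Γ} → Tm Γ (nat ⇒ nat ⇒ global ⇒ opt bits)
haltsNowT = as haltsNow (ƛ (ƛ (ƛ ((con `cond) · ((con `just) · (con `nil)) · (con `nothing) · (andT · (eqNT · v1
    · ((con `fst) · ((con `snd) · v0 · v2))) · (andT · (notT · (leqT · v1 · (con `zero))) · (notT · (winnerT · v2
    · ((con `snd) · v0 · v2) · (viewT · v2 · ((con `fst) · v0)))))))))) (λ _ _ _ → refl)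

instance′T : ∀ {Γ} → Tm Γ (bits ⇒ nat ⇒ opt bits)
instance′T = as instance′ (ƛ (ƛ (haltsNowT · ((con `fst) · (unaryT · v1)) · (toNatT · ((con `snd) · (unaryT · v1)))
    · (stageT · v0)))) (λ _ _ → refl)

-- The interpreter is faithful

leq-true : ∀ m n → leq m n ≡ true → m ≤ n
leq-true zero    n       e = z≤n
leq-true (suc m) (suc n) e = s≤s (leq-true m n e)

true-leq : ∀ {m n} → m ≤ n → leq m n ≡ true
true-leq {zero}  {n}     _       = refl
true-leq {suc m} {suc n} (s≤s h) = true-leq h

leq-false : ∀ m n → leq m n ≡ false → n < m
leq-false (suc m) zero    e = s≤s z≤n
leq-false (suc m) (suc n) e = s≤s (leq-false m n e)

false-leq : ∀ {m n} → n < m → leq m n ≡ false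
false-leq {suc m} {zero}  _       = refl
false-leq {suc m} {suc n} (s≤s h) = false-leq h

∧-true : ∀ a b → a ∧ b ≡ true → a ≡ true × b ≡ true
∧-true true true e = refl , refl

∨-true : ∀ a b → a ∨ b ≡ true → a ≡ true ⊎ b ≡ true
∨-true true  b e = inj₁ refl
∨-true false b e = inj₂ e

eqN-true : ∀ m n → eqN m n ≡ true → m ≡ n
eqN-true m n e = let (a , b) = ∧-true (leq m n) _ e in ≤-antisym (leq-true m n a) (leq-true n m b)

eqN-refl : ∀ n → eqN n n ≡ true
eqN-refl n rewrite true-leq (≤-refl {n}) = refl

eqN-≢ : ∀ m n → (m ≡ n → ⊥) → eqN m n ≡ false
eqN-≢ m n h with eqN m n in e
... | true  = ⊥-elim (h (eqN-true m n e))
... | false = refl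

eqBool-refl : ∀ b → eqBool b b ≡ true
eqBool-refl true  = refl
eqBool-refl false = refl

eqBool-true : ∀ a b → eqBool a b ≡ true → a ≡ b
eqBool-true true  true  e = refl
eqBool-true false false e = refl

eqBits-refl : ∀ x → eqBits x x ≡ true
eqBits-refl []          = refl
eqBits-refl (b ∷ x) rewrite eqBool-refl b = eqBits-refl x

eqBits-true : ∀ x y → eqBits x y ≡ true → x ≡ y
eqBits-true []      []      e = refl
eqBits-true (b ∷ x) (c ∷ y) e =
  let (p , q) = ∧-true (eqBool b c) _ e in cong₂ _∷_ (eqBool-true b c p) (eqBits-true x y q)

moveNo : Move → ℕ
moveNo left  = 0
moveNo right = 1
moveNo stay  = 2

fields : ∀ {Q} → Action Q → List ℕ
fields halt          = 0 ∷ 0 ∷ 0 ∷ 0 ∷ []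
fields (write q s m) = 1 ∷ toℕ q ∷ symIx s ∷ moveNo m ∷ []
fields (query a b)   = 2 ∷ toℕ a ∷ toℕ b ∷ 0 ∷ []

row : (M : TM) → Fin (suc (Q M)) → List ℕ
row M q = fields (δ M q nothing) ++ fields (δ M q (just false)) ++ fields (δ M q (just true))

table : TM → List ℕ
table M = concatMap (row M) (allFin (suc (Q M)))

length-fields : ∀ {Q} (a : Action Q) → length (fields a) ≡ 4
length-fields halt          = refl
length-fields (write _ _ _) = refl
length-fields (query _ _)   = refl

nth-left : ∀ xs ys j → j < length xs → nth (xs ++ ys) j ≡ nth xs j
nth-left (x ∷ xs) ys zero    _       = refl
nth-left (x ∷ xs) ys (suc j) (s≤s h) = nth-left xs ys j h

nth-right : ∀ xs ys j → nth (xs ++ ys) (length xs + j) ≡ nth ys j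
nth-right []       ys j = refl
nth-right (x ∷ xs) ys j = nth-right xs ys j

length-row : ∀ M q → length (row M q) ≡ 12
length-row M q rewrite length-++ (fields (δ M q nothing)) {fields (δ M q (just false)) ++ fields (δ M q (just true))}
  | length-++ (fields (δ M q (just false))) {fields (δ M q (just true))}
  | length-fields (δ M q nothing) | length-fields (δ M q (just false)) | length-fields (δ M q (just true)) = refl

nth-row : ∀ M q s j → j < 4 → nth (row M q) (4 * symIx s + j) ≡ nth (fields (δ M q s)) j
nth-row M q nothing j h = nth-left (fields (δ M q nothing)) _ j (subst (j <_) (sym (length-fields (δ M q nothing))) h)
nth-row M q (just false) j h =
  trans (subst (λ k → nth (row M q) (k + j) ≡ nth (fields (δ M q (just false)) ++ fields (δ M q (just true))) j)
      (length-fields (δ M q nothing)) (nth-right (fields (δ M q nothing)) _ j))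
    (nth-left (fields (δ M q (just false))) _ j (subst (j <_) (sym (length-fields (δ M q (just false)))) h))
nth-row M q (just true) j h =
  trans (subst (λ k → nth (row M q) (k + (4 + j)) ≡ nth (fields (δ M q (just false)) ++ fields (δ M q (just true))) (4 + j))
      (length-fields (δ M q nothing)) (nth-right (fields (δ M q nothing)) _ (4 + j)))
    (subst (λ k → nth (fields (δ M q (just false)) ++ fields (δ M q (just true))) (k + j) ≡ nth (fields (δ M q (just true))) j)
      (length-fields (δ M q (just false))) (nth-right (fields (δ M q (just false))) _ j))

nth-blocks : ∀ {A : Set} (f : A → List ℕ) b → (∀ a → length (f a) ≡ b) → ∀ n (g : Fin n → A) i j → j < b →
  nth (concatMap f (tabulate g)) (b * toℕ i + j) ≡ nth (f (g i)) j
nth-blocks f b len (suc n) g zero j h rewrite *-zeroʳ b =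
  nth-left (f (g zero)) _ j (subst (j <_) (sym (len (g zero))) h)
nth-blocks f b len (suc n) g (suc i) j h rewrite *-suc b (toℕ i) | +-assoc b (b * toℕ i) j =
  trans (subst (λ k → nth (f (g zero) ++ concatMap f (tabulate (λ x → g (suc x)))) (k + (b * toℕ i + j)) ≡
      nth (concatMap f (tabulate (λ x → g (suc x)))) (b * toℕ i + j)) (len (g zero)) (nth-right (f (g zero)) _ _))
    (nth-blocks f b len n (λ x → g (suc x)) i j h)

nth-table : ∀ M q s j → j < 4 → nth (table M) (j + offset (toℕ q) s) ≡ nth (fields (δ M q s)) j
nth-table M q s j h =
  trans (cong (nth (table M)) (rearrange j (toℕ q) (symIx s)))
    (trans (nth-blocks (row M) 12 (length-row M) (suc (Q M)) (λ x → x) q (4 * symIx s + j) (bound s h))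
      (nth-row M q s j h))
  where
  rearrange : ∀ j q s → j + 4 * (3 * q + s) ≡ 12 * q + (4 * s + j)
  rearrange = solve 3 (λ j q s → j :+ con 4 :* (con 3 :* q :+ s) := con 12 :* q :+ (con 4 :* s :+ j)) refl
    where open +-*-Solver
  bound : ∀ s → j < 4 → 4 * symIx s + j < 12
  bound nothing      h = ≤-trans h (s≤s (s≤s (s≤s (s≤s z≤n))))
  bound (just false) h = ≤-trans (+-monoʳ-≤ 4 h) (m≤m+n 8 4)
  bound (just true)  h = +-monoʳ-≤ 8 h

encC : ∀ {M} → Config M → Conf
encC (q , t) = toℕ q , lft t , hd t , rgt t

symOf-symIx : ∀ s → symOf (symIx s) ≡ s
symOf-symIx nothing      = refl
symOf-symIx (just false) = refl
symOf-symIx (just true)  = refl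

tapeC : Tape → List Sym × (Sym × List Sym)
tapeC t = lft t , hd t , rgt t

move-ok : ∀ m l h r → move (moveNo m) l h r ≡ tapeC (moveHead m (tape l h r))
move-ok left  []      h r       = refl
move-ok left  (x ∷ l) h r       = refl
move-ok right l       h []      = refl
move-ok right l       h (x ∷ r) = refl
move-ok stay  l       h r       = refl

module _ (orc : Bits → Bool) (c : List ℕ) (o : ℕ) (l : List Sym) (h : Sym) (r : List Sym) where

  action-write : ∀ {q s m} → nth c o ≡ 1 → nth c (1 + o) ≡ q → nth c (2 + o) ≡ s → nth c (3 + o) ≡ m →
    action orc c o l h r ≡ (q , move m l (symOf s) r)
  action-write {q} {s} {m} e₀ e₁ e₂ e₃ with nth c o | e₀
  ... | _ | refl = cong₂ _,_ e₁ (cong₂ (λ m s → move m l (symOf s) r) e₃ e₂)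

  action-yes : ∀ {q} → nth c o ≡ 2 → orc (readBits h r) ≡ true → nth c (1 + o) ≡ q →
    action orc c o l h r ≡ (q , l , h , r)
  action-yes e₀ e e₁ with nth c o | e₀ | orc (readBits h r) | e
  ... | _ | refl | _ | refl = cong (_, l , h , r) e₁

  action-no : ∀ {q} → nth c o ≡ 2 → orc (readBits h r) ≡ false → nth c (2 + o) ≡ q →
    action orc c o l h r ≡ (q , l , h , r)
  action-no e₀ e e₁ with nth c o | e₀ | orc (readBits h r) | e
  ... | _ | refl | _ | refl = cong (_, l , h , r) e₁

module _ (M : TM) where
  private
    c : List ℕ
    c = table M

  fetch : ∀ q t {a} j → j < 4 → δ M q (hd t) ≡ a → nth c (j + offset (toℕ q) (hd t)) ≡ nth (fields a) j
  fetch q t j h e = trans (nth-table M q (hd t) j h) (cong (λ a → nth (fields a) j) e)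

  halted-is : ∀ q t {a} → δ M q (hd t) ≡ a → haltedC c (encC {M} (q , t)) ≡ eqN (nth (fields a) 0) 0
  halted-is q t e = cong (λ z → eqN z 0) (fetch q t 0 (s≤s z≤n) e)

  halted-true : ∀ (x : Config M) → Halted M x → haltedC c (encC {M} x) ≡ true
  halted-true (q , t) h = halted-is q t h

  -- An oracle is a predicate that need not be decidable; agreement is asked word by word, and for
  -- both outcomes.
  Agrees : Oracle → (Bits → Bool) → Bits → Set
  Agrees A orc w = (A w → orc w ≡ true) × (¬ A w → orc w ≡ false)

  action-ok : ∀ {A orc} q t {y : Config M} → Agrees A orc (contents t) → Step A M (q , t) y →
    action orc c (offset (toℕ q) (hd t)) (lft t) (hd t) (rgt t) ≡ encC {M} y
  action-ok {orc = orc} q t ag (stepW {q' = q'} {s} {m} e) =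
    trans (action-write orc c (offset (toℕ q) (hd t)) (lft t) (hd t) (rgt t) (fetch q t 0 (s≤s z≤n) e) (fetch q t 1 (s≤s (s≤s z≤n)) e)
        (fetch q t 2 (s≤s (s≤s (s≤s z≤n))) e) (fetch q t 3 (s≤s (s≤s (s≤s (s≤s z≤n)))) e))
      (cong (toℕ q' ,_) (trans (cong (λ z → move (moveNo m) (lft t) z (rgt t)) (symOf-symIx s)) (move-ok m (lft t) s (rgt t))))
  action-ok {orc = orc} q t ag (stepY e h) =
    action-yes orc c (offset (toℕ q) (hd t)) (lft t) (hd t) (rgt t) (fetch q t 0 (s≤s z≤n) e) (proj₁ ag h) (fetch q t 1 (s≤s (s≤s z≤n)) e)
  action-ok {orc = orc} q t ag (stepN e h) =
    action-no orc c (offset (toℕ q) (hd t)) (lft t) (hd t) (rgt t) (fetch q t 0 (s≤s z≤n) e) (proj₂ ag h) (fetch q t 2 (s≤s (s≤s (s≤s z≤n))) e)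

  not-halted : ∀ {A q t y} → Step A M (q , t) y → haltedC c (encC {M} (q , t)) ≡ false
  not-halted (stepW {q} {t} e)   = halted-is q t e
  not-halted (stepY {q} {t} e _) = halted-is q t e
  not-halted (stepN {q} {t} e _) = halted-is q t e

  step-ok : ∀ {A orc} {x y : Config M} → Agrees A orc (contents (proj₂ x)) → Step A M x y →
    haltedC c (encC {M} x) ≡ false × stepC orc c (encC {M} x) ≡ encC {M} y
  step-ok {A} {orc} {x = q , t} ag s = not-halted s ,
    trans (cong (λ b → if b then encC {M} (q , t) else action orc c (offset (toℕ q) (hd t)) (lft t) (hd t) (rgt t)) (not-halted s))
      (action-ok {A} {orc} q t ag s)

  stepC-halted : ∀ orc (x : Config M) → Halted M x → stepC orc c (encC {M} x) ≡ encC {M} x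
  stepC-halted orc x@(q , t) h =
    cong (λ b → if b then encC {M} x else action orc c (offset (toℕ q) (hd t)) (lft t) (hd t) (rgt t)) (halted-true x h)

  runC-halted : ∀ orc n (x : Config M) → Halted M x → runC orc c n (encC {M} x) ≡ encC {M} x
  runC-halted orc zero    x h = refl
  runC-halted orc (suc n) x h = trans (cong (runC orc c n) (stepC-halted orc x h)) (runC-halted orc n x h)

  -- Bounds the length of the word that a query would ask about, and grows by at most one per step.
  -- So a run asks only about words no longer than its initial width plus its duration.
  width : Config M → ℕ
  width (q , t) = suc (length (rgt t))

  length-readBits : ∀ h r → length (readBits h r) ≤ suc (length r)
  length-readBits nothing  r       = z≤n
  length-readBits (just b) []      = s≤s z≤n
  length-readBits (just b) (s ∷ r) = s≤s (length-readBits s r)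

  rgt-move : ∀ m l h r → length (rgt (moveHead m (tape l h r))) ≤ suc (length r)
  rgt-move left  []      h r       = ≤-refl
  rgt-move left  (x ∷ l) h r       = ≤-refl
  rgt-move right l       h []      = z≤n
  rgt-move right l       h (x ∷ r) = m≤n⇒m≤1+n (n≤1+n _)
  rgt-move stay  l       h r       = n≤1+n _

  width-step : ∀ {A x y} → Step A M x y → width y ≤ suc (width x)
  width-step (stepW {t = t} {m = m} e) = s≤s (rgt-move m (lft t) _ (rgt t))
  width-step (stepY e h) = n≤1+n _
  width-step (stepN e h) = n≤1+n _

  run-ok : ∀ {A orc B} → (∀ w → length w ≤ B → Agrees A orc w) → ∀ {n x y} → width x + n ≤ B →
    Steps A M n x y → Halted M y → ∀ d → runC orc c (n + d) (encC {M} x) ≡ encC {M} y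
  run-ok {orc = orc} ag w done h d = runC-halted orc d _ h
  run-ok {A} {orc} {B} ag {suc n} {x} w (next {c' = x'} s r) h d =
    trans (cong (runC orc c (n + d)) (proj₂ (step-ok {A} {orc} {x} (ag (contents (proj₂ x)) (≤-trans (length-readBits (hd (proj₂ x)) _) (≤-trans (m≤m+n _ (suc n)) w))) s)))
      (run-ok ag (≤-trans (+-monoˡ-≤ n (width-step s)) (subst (_≤ B) (+-suc (width x) n) w)) r h d)

  haltsIn-ok : ∀ {n x y} → Steps emptyOracle M n x y → Halted M y →
    haltsIn c n (encC {M} x) ≡ just (contents (proj₂ y)) × (∀ i → i < n → haltsIn c i (encC {M} x) ≡ nothing)
  haltsIn-ok {x = x} done h = cong (λ b → if b then just (contents (proj₂ x)) else nothing) (halted-true x h) , λ i ()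
  haltsIn-ok {x = x} (next {n} {c' = x'} s r) h
    with step-ok {A = emptyOracle} {orc = noOracle} ((λ ()) , λ _ → refl) s | haltsIn-ok r h
  ... | e , e' | p , q = trans (later n) p , rest
    where
    later : ∀ i → haltsIn c (suc i) (encC {M} x) ≡ haltsIn c i (encC {M} x')
    later i = trans (cong (λ b → if b then nothing else haltsIn c i (stepC noOracle c (encC {M} x))) e) (cong (haltsIn c i) e')
    rest : ∀ i → i < suc n → haltsIn c i (encC {M} x) ≡ nothing
    rest zero    _        = cong (λ b → if b then just (contents (proj₂ x)) else nothing) e
    rest (suc i) (s≤s lt) = trans (later i) (q i lt)

startC-ok : ∀ M x → startC x ≡ encC {M} (zero , inputTape x)
startC-ok M []      = refl
startC-ok M (b ∷ x) = refl

-- The universal decompressor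

serial : List ℕ → Bits
serial l = encUnary (length l) ++ concatMap encUnary l

unary-enc : ∀ n r → unary (encUnary n ++ r) ≡ (n , r)
unary-enc zero    r = refl
unary-enc (suc n) r rewrite unary-enc n r = refl

unaries-enc : ∀ l r → unaries (length l) (concatMap encUnary l ++ r) ≡ (l , r)
unaries-enc []      r = refl
unaries-enc (n ∷ l) r rewrite ++-assoc (encUnary n) (concatMap encUnary l) r
  | unary-enc n (concatMap encUnary l ++ r) | unaries-enc l r = refl

parse-serial : ∀ l r → parse (serial l ++ r) ≡ (l , r)
parse-serial l r rewrite ++-assoc (encUnary (length l)) (concatMap encUnary l) r
  | unary-enc (length l) (concatMap encUnary l ++ r) = unaries-enc l r

U : TM
U = searchTM decompressT

vRun-serial : ∀ D p n → vRun (serial (table D) ++ p) n ≡ haltsIn (table D) n (startC p)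
vRun-serial D p n rewrite parse-serial (table D) p = refl

map-just : ∀ {f m x} → m ≡ just x → mapMaybe′ f m ≡ just (f x)
map-just refl = refl

map-nothing : ∀ {f m} → m ≡ nothing → mapMaybe′ f m ≡ nothing
map-nothing refl = refl

U-simulates : ∀ D p x → Outputs D p x → Outputs U (true ∷ true ∷ true ∷ serial (table D) ++ p) x
U-simulates D p x (n , d , steps , h , refl) =
  subst (Outputs U (true ∷ true ∷ true ∷ serial (table D) ++ p)) (reverse-involutive x)
    (search-complete decompressT (true ∷ true ∷ true ∷ serial (table D) ++ p) n (reverse x)
      (λ i lt → map-nothing {reverse} (trans (vRun-serial D p i) (trans (cong (haltsIn (table D) i) (startC-ok D p)) (proj₂ ok i lt))))
      (map-just {reverse} (trans (vRun-serial D p n) (trans (cong (haltsIn (table D) n) (startC-ok D p)) (proj₁ ok)))))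
  where ok = haltsIn-ok D steps h

U-universal : Universal U
U-universal D = 3 + length (serial (table D)) , λ p x o →
  true ∷ true ∷ true ∷ serial (table D) ++ p ,
  ≤-reflexive (trans (cong (3 +_) (trans (length-++ (serial (table D))) (+-comm _ (length p)))) (arith (length p) (length (serial (table D))))) ,
  U-simulates D p x o
  where
  arith : ∀ a b → 3 + (a + b) ≡ a + (3 + b)
  arith = solve 2 (λ a b → con 3 :+ (a :+ b) := a :+ (con 3 :+ b)) refl
    where open +-*-Solver

-- A machine that writes its input itself

shiftAction : ∀ {Q Q'} → (Fin (suc Q) → Fin (suc Q')) → Action Q → Action Q'
shiftAction f halt          = halt
shiftAction f (write q s m) = write (f q) s m
shiftAction f (query a b)   = query (f a) (f b)

-- One state for each bit. After the last bit the head stays, so it stands on the leftmost cell of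
-- the reversed word: the initial configuration of the core.
writer : ∀ {Q} (w : Bits) → (Fin (length w) → Fin (suc Q)) → Fin (suc Q) → Fin (length w) → Action Q
writer (b ∷ [])    f core zero    = write core (just b) stay
writer (b ∷ c ∷ w) f core zero    = write (f (suc zero)) (just b) left
writer (b ∷ w)     f core (suc j) = writer w (λ i → f (suc i)) core j

module Prelude (N : TM) (b₀ : Bool) (w₀ : Bits) where

  w : Bits
  w = b₀ ∷ w₀

  n : ℕ
  n = suc (Q N)

  core : Fin n → Fin (suc (n + length w))
  core q = suc (q ↑ˡ length w)

  writing : Fin (length w) → Fin (suc (n + length w))
  writing j = suc (n ↑ʳ j)

  branch : Fin n ⊎ Fin (length w) → Sym → Action (n + length w)
  branch (inj₁ q) s = shiftAction core (δ N q s)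
  branch (inj₂ j) s = writer w writing (core zero) j

  preludeδ : Fin (suc (n + length w)) → Sym → Action (n + length w)
  preludeδ zero    s = write (writing zero) s stay
  preludeδ (suc i) s = branch (splitAt n i) s

  prelude : TM
  prelude = tm (n + length w) preludeδ

  δ-core : ∀ q s → preludeδ (core q) s ≡ shiftAction core (δ N q s)
  δ-core q s rewrite splitAt-↑ˡ n q (length w) = refl

  δ-writing : ∀ j s → preludeδ (writing j) s ≡ writer w writing (core zero) j
  δ-writing j s rewrite splitAt-↑ʳ n (length w) j = refl

  embed : Config N → Config prelude
  embed (q , t) = core q , t

  step-core : ∀ {A x y} → Step A N x y → Step A prelude (embed x) (embed y)
  step-core (stepW {q} {t} e)   = stepW {t = t} (trans (δ-core q (hd t)) (cong (shiftAction core) e))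
  step-core (stepY {q} {t} e h) = stepY {t = t} (trans (δ-core q (hd t)) (cong (shiftAction core) e)) h
  step-core (stepN {q} {t} e h) = stepN {t = t} (trans (δ-core q (hd t)) (cong (shiftAction core) e)) h

  steps-core : ∀ {A m x y} → Steps A N m x y → Steps A prelude m (embed x) (embed y)
  steps-core done       = done
  steps-core (next s r) = next (step-core s) (steps-core r)

  halted-core : ∀ {x} → Halted N x → Halted prelude (embed x)
  halted-core {q , t} h = trans (δ-core q (hd t)) (cong (shiftAction core) h)

  shift-halt : ∀ a → shiftAction core a ≡ halt → a ≡ halt
  shift-halt halt e = refl

  halted-reflect : ∀ x → Halted prelude (embed x) → Halted N x
  halted-reflect (q , t) h = shift-halt _ (trans (sym (δ-core q (hd t))) h)

  step-reflect : ∀ {A x z} → Step A prelude (embed x) z → ∃ λ y → Step A N x y × z ≡ embed y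
  step-reflect {x = q , t} (stepW {s = s} {m} e) with δ N q (hd t) in eq | trans (sym (δ-core q (hd t))) e
  ... | write q' s' m' | refl = _ , stepW {t = t} eq , refl
  step-reflect {x = q , t} (stepY e h) with δ N q (hd t) in eq | trans (sym (δ-core q (hd t))) e
  ... | query a b | refl = _ , stepY {t = t} eq h , refl
  step-reflect {x = q , t} (stepN e h) with δ N q (hd t) in eq | trans (sym (δ-core q (hd t))) e
  ... | query a b | refl = _ , stepN {t = t} eq h , refl

  steps-reflect : ∀ {A m x z} → Steps A prelude m (embed x) z → Halted prelude z →
    ∃ λ y → Steps A N m x y × Halted N y
  steps-reflect {x = x} done h = x , done , halted-reflect x h
  steps-reflect (next s r) h with step-reflect s
  ... | y , s' , refl with steps-reflect r h
  ... | z , r' , h' = z , next s' r' , h'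

  writes : ∀ {A} (u : Bits) c v (f : Fin (length (c ∷ u)) → Fin (length w)) →
    (∀ j → writer w writing (core zero) (f j) ≡ writer (c ∷ u) (writing ∘ f) (core zero) j) →
    ∃ λ m → Steps A prelude m (writing (f zero) , tape [] nothing (map just v)) (core zero , inputTape ((c ∷ u) ʳ++ v))
  writes [] c v f h = 1 , next (stepW {t = tape [] nothing (map just v)} (trans (δ-writing (f zero) nothing) (h zero))) done
  writes (d ∷ u) c v f h =
    let (m , r) = writes u d (c ∷ v) (f ∘ suc) (λ j → h (suc j)) in
    suc m , next (stepW {t = tape [] nothing (map just v)} (trans (δ-writing (f zero) nothing) (h zero))) r

  start : ∀ {A} → ∃ λ m → Steps A prelude m (zero , inputTape []) (core zero , inputTape (reverse w))
  start = let (m , r) = writes w₀ b₀ [] (λ j → j) (λ j → refl) in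
    suc m , next (stepW {t = tape [] nothing []} {m = stay} refl) r

  -- By determinism the halting run passes through everything reachable from its start.
  steps-cancel : ∀ {A M m k a b c} → Steps A M m a b → Steps A M k a c → Halted M c → ∃ λ i → Steps A M i b c
  steps-cancel done r h = _ , r
  steps-cancel (next s r) done h = ⊥-elim (halted-stuck h s)
  steps-cancel (next s r) (next s' r') h with step-det s s'
  ... | refl = steps-cancel r r' h

  halts-if : ∀ {A m y} → Steps A N m (zero , inputTape (reverse w)) y → Halted N y →
    ∃₂ λ k c → Steps A prelude k (zero , inputTape []) c × Halted prelude c
  halts-if {A} {y = y} r h = _ , _ , steps-++ (proj₂ (start {A})) (steps-core r) , halted-core {y} h

  halts-only-if : ∀ {A k c} → Steps A prelude k (zero , inputTape []) c → Halted prelude c →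
    ∃₂ λ m y → Steps A N m (zero , inputTape (reverse w)) y × Halted N y
  halts-only-if {A} r h =
    let (i , r') = steps-cancel (proj₂ (start {A})) r h
        (y , s , h') = steps-reflect r' h in i , y , s , h'

  encShift : Action (Q N) → Bits
  encShift halt          = false ∷ false ∷ []
  encShift (write q s m) = writeCode (suc (toℕ q)) s m
  encShift (query a b)   = true ∷ false ∷ encUnary (suc (toℕ a)) ++ encUnary (suc (toℕ b))

  enc-shift : ∀ a → encAction (shiftAction core a) ≡ encShift a
  enc-shift halt          = refl
  enc-shift (write q s m) rewrite toℕ-↑ˡ q (length w) = refl
  enc-shift (query a b) rewrite toℕ-↑ˡ a (length w) | toℕ-↑ˡ b (length w) = refl

module _ (N : TM) where
  open Prelude N using (encShift)

  coreString : Bits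
  -- Codes of core states are only shifted by one and do not depend on the word written, so an
  -- arbitrary word serves as parameter. That the string is the same for all instances is what
  -- allows the number of a requirement to contain it.
  coreString = concatMap (λ q → threeTimes (λ s → encShift true [] (δ N q s))) (allFin (suc (Q N)))

concatMap-allSyms : ∀ (f : Sym → Bits) → concatMap f allSyms ≡ threeTimes f
concatMap-allSyms f = cong (f nothing ++_) (cong (f (just false) ++_) (++-identityʳ (f (just true))))

concatMap-split : ∀ {A : Set} (f : A → Bits) n m (g : Fin (n + m) → A) →
  concatMap f (tabulate g) ≡ concatMap f (tabulate (λ i → g (i ↑ˡ m))) ++ concatMap f (tabulate (λ j → g (n ↑ʳ j)))
concatMap-split f zero    m g = refl
concatMap-split f (suc n) m g = trans (cong (f (g zero) ++_) (concatMap-split f n m (g ∘ suc)))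
  (sym (++-assoc (f (g zero)) _ _))

concatMap-tabulate : ∀ {A B : Set} (f : A → Bits) (f' : B → Bits) n (g : Fin n → A) (g' : Fin n → B) →
  (∀ i → f (g i) ≡ f' (g' i)) → concatMap f (tabulate g) ≡ concatMap f' (tabulate g')
concatMap-tabulate f f' zero    g g' h = refl
concatMap-tabulate f f' (suc n) g g' h = cong₂ _++_ (h zero) (concatMap-tabulate f f' n (g ∘ suc) (g' ∘ suc) (h ∘ suc))

module _ (N : TM) (b₀ : Bool) (w₀ : Bits) where
  open Prelude N b₀ w₀

  private
    encRow : Fin (suc (n + length w)) → Bits
    encRow q = concatMap (λ s → encAction (preludeδ q s)) allSyms

    threeTimes-cong : ∀ {f g : Sym → Bits} → (∀ s → f s ≡ g s) → threeTimes f ≡ threeTimes g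
    threeTimes-cong h = cong₂ _++_ (h nothing) (cong₂ _++_ (h (just false)) (h (just true)))

    writers-enc : ∀ {Q} (u : Bits) (f : Fin (length u) → Fin (suc Q)) core q → toℕ core ≡ 1 → (∀ j → toℕ (f j) ≡ q + toℕ j) →
      concatMap (λ j → threeTimes (λ _ → encAction (writer u f core j))) (tabulate (λ j → j)) ≡ writersCode u q
    writers-enc [] f core q c h = refl
    writers-enc (b ∷ []) f core q c h rewrite c = refl
    writers-enc {Q} (b ∷ d ∷ u) f core q c h = cong₂ _++_
      (cong (λ k → threeTimes (λ _ → writeCode k (just b) left)) (trans (h (suc zero)) (trans (+-suc q 0) (cong suc (+-identityʳ q)))))
      (trans (concatMap-tabulate _ _ (length (d ∷ u)) suc (λ j → j) (λ j → refl))
        (writers-enc (d ∷ u) (f ∘ suc) core (suc q) c (λ j → trans (h (suc j)) (+-suc q (toℕ j)))))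

  encTM-prelude : encTM prelude ≡ preludeCode (Q N) (coreString N) w
  encTM-prelude = cong₂ _++_ (cong encUnary (sym (+-suc (Q N) (length w))))
    (cong₂ _++_ (trans (concatMap-allSyms (enc zero)) (threeTimes-cong {enc zero} {λ s → writeCode (2 + Q N) s stay}
        λ s → cong (λ k → writeCode k s stay) (cong suc (trans (toℕ-↑ʳ n (zero {length w₀})) (+-identityʳ n)))))
      (trans (concatMap-split encRow n (length w) suc) (cong₂ _++_
        (concatMap-tabulate encRow (λ q → threeTimes (encCore q)) n core (λ q → q)
          (λ q → trans (concatMap-allSyms (enc (core q))) (threeTimes-cong {enc (core q)} {encCore q}
            λ s → trans (cong encAction (δ-core q s)) (enc-core q s))))
        (trans (concatMap-tabulate encRow (λ j → threeTimes (encWriting j)) (length w) writing (λ j → j)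
            (λ j → trans (concatMap-allSyms (enc (writing j))) (threeTimes-cong {enc (writing j)} {encWriting j}
              λ s → cong encAction (δ-writing j s))))
          (writers-enc w writing (core zero) (suc n) refl (λ j → cong suc (toℕ-↑ʳ n j)))))))
    where
    enc : Fin (suc (n + length w)) → Sym → Bits
    enc q s = encAction (preludeδ q s)
    encCore : Fin n → Sym → Bits
    encCore q s = Prelude.encShift N true [] (δ N q s)
    encWriting : Fin (length w) → Sym → Bits
    encWriting j _ = encAction (writer w writing (core zero) j)
    enc-core : ∀ q s → encAction (shiftAction core (δ N q s)) ≡ Prelude.encShift N true [] (δ N q s)
    enc-core q s with δ N q s
    ... | halt = refl
    ... | write q' s' m = enc-shift (write q' s' m)
    ... | query a b = enc-shift (query a b)

-- Machine codes determine machines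

encUnary-inj : ∀ a b {x y} → encUnary a ++ x ≡ encUnary b ++ y → a ≡ b × x ≡ y
encUnary-inj zero    zero    e = refl , ∷-injectiveʳ e
encUnary-inj (suc a) (suc b) e with encUnary-inj a b (∷-injectiveʳ e)
... | refl , e' = refl , e'

encSym-inj : ∀ s s' {x y} → encSym s ++ x ≡ encSym s' ++ y → s ≡ s' × x ≡ y
encSym-inj nothing      nothing      refl = refl , refl
encSym-inj (just false) (just false) refl = refl , refl
encSym-inj (just true)  (just true)  refl = refl , refl
encSym-inj nothing      (just false) ()
encSym-inj nothing      (just true)  ()
encSym-inj (just false) nothing      ()
encSym-inj (just false) (just true)  ()
encSym-inj (just true)  nothing      ()
encSym-inj (just true)  (just false) ()

encMove-inj : ∀ s s' {x y} → encMove s ++ x ≡ encMove s' ++ y → s ≡ s' × x ≡ y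
encMove-inj left  left  refl = refl , refl
encMove-inj right right refl = refl , refl
encMove-inj stay  stay  refl = refl , refl
encMove-inj left  right ()
encMove-inj left  stay  ()
encMove-inj right left  ()
encMove-inj right stay  ()
encMove-inj stay  left  ()
encMove-inj stay  right ()

regroup : ∀ (a b c d : Bits) → (a ++ b ++ c) ++ d ≡ a ++ b ++ c ++ d
regroup a b c d = trans (++-assoc a (b ++ c) d) (cong (a ++_) (++-assoc b c d))

encAction-inj : ∀ {Q} (a b : Action Q) {x y} → encAction a ++ x ≡ encAction b ++ y → a ≡ b × x ≡ y
encAction-inj halt halt refl = refl , refl
encAction-inj (write q s m) (write q' s' m') {x} {y} e
  with encUnary-inj (toℕ q) (toℕ q') (trans (sym (regroup (encUnary (toℕ q)) (encSym s) (encMove m) x))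
    (trans (∷-injectiveʳ (∷-injectiveʳ e)) (regroup (encUnary (toℕ q')) (encSym s') (encMove m') y)))
... | eq , e₁ with encSym-inj s s' e₁
... | refl , e₂ with encMove-inj m m' e₂
... | refl , e₃ with toℕ-injective eq
... | refl = refl , e₃
encAction-inj (query a b) (query a' b') {x} {y} e
  with encUnary-inj (toℕ a) (toℕ a') (trans (sym (++-assoc (encUnary (toℕ a)) _ x))
    (trans (∷-injectiveʳ (∷-injectiveʳ e)) (++-assoc (encUnary (toℕ a')) _ y)))
... | eq , e₁ with encUnary-inj (toℕ b) (toℕ b') e₁
... | eq' , e₂ with toℕ-injective eq | toℕ-injective eq'
... | refl | refl = refl , e₂
encAction-inj halt (write _ _ _) ()
encAction-inj halt (query _ _) ()
encAction-inj (write _ _ _) halt ()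
encAction-inj (write _ _ _) (query _ _) ()
encAction-inj (query _ _) halt ()
encAction-inj (query _ _) (write _ _ _) ()

encRows-inj : ∀ {Q} n (f g : Fin n → Sym → Action Q) {x y} →
  concatMap (λ q → concatMap (λ s → encAction (f q s)) allSyms) (tabulate (λ q → q)) ++ x ≡
  concatMap (λ q → concatMap (λ s → encAction (g q s)) allSyms) (tabulate (λ q → q)) ++ y →
  ∀ q s → f q s ≡ g q s
encRows-inj (suc n) f g {x} {y} e = cases
  where
  rest : (Fin (suc n) → Sym → Action _) → Bits
  rest h = concatMap (λ q → concatMap (λ s → encAction (h q s)) allSyms) (tabulate suc)
  row′ : (Fin (suc n) → Sym → Action _) → Bits → Bits
  row′ h z = encAction (h zero nothing) ++ (encAction (h zero (just false)) ++ (encAction (h zero (just true)) ++ (rest h ++ z)))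
  unfold : ∀ h z → concatMap (λ q → concatMap (λ s → encAction (h q s)) allSyms) (tabulate (λ q → q)) ++ z ≡ row′ h z
  unfold h z = trans (++-assoc (concatMap (λ s → encAction (h zero s)) allSyms) (rest h) z)
    (trans (cong (_++ (rest h ++ z)) (concatMap-allSyms (λ s → encAction (h zero s))))
      (regroup (encAction (h zero nothing)) (encAction (h zero (just false))) (encAction (h zero (just true))) (rest h ++ z)))
  e₀ = encAction-inj (f zero nothing) (g zero nothing) (trans (sym (unfold f x)) (trans e (unfold g y)))
  e₁ = encAction-inj (f zero (just false)) (g zero (just false)) (proj₂ e₀)
  e₂ = encAction-inj (f zero (just true)) (g zero (just true)) (proj₂ e₁)
  reindex : ∀ h → rest h ≡ concatMap (λ q → concatMap (λ s → encAction (h (suc q) s)) allSyms) (tabulate (λ q → q))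
  reindex h = concatMap-tabulate _ _ n suc (λ q → q) (λ q → refl)
  cases : ∀ q s → f q s ≡ g q s
  cases zero nothing      = proj₁ e₀
  cases zero (just false) = proj₁ e₁
  cases zero (just true)  = proj₁ e₂
  cases (suc q) s = encRows-inj n (λ q → f (suc q)) (λ q → g (suc q))
    (trans (cong (_++ x) (sym (reindex f))) (trans (proj₂ e₂) (cong (_++ y) (reindex g)))) q s

module _ {Q : ℕ} {d d' : Fin (suc Q) → Sym → Action Q} (eq : ∀ q s → d q s ≡ d' q s) where

  step-transfer : ∀ {A x y} → Step A (tm Q d) x y → Step A (tm Q d') x y
  step-transfer (stepW {q} {t} e)   = stepW {t = t} (trans (sym (eq q (hd t))) e)
  step-transfer (stepY {q} {t} e h) = stepY {t = t} (trans (sym (eq q (hd t))) e) h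
  step-transfer (stepN {q} {t} e h) = stepN {t = t} (trans (sym (eq q (hd t))) e) h

  steps-transfer : ∀ {A n x y} → Steps A (tm Q d) n x y → Steps A (tm Q d') n x y
  steps-transfer done       = done
  steps-transfer (next s r) = next (step-transfer s) (steps-transfer r)

-- A witness for `HaltSet` is some machine with the given code, hence with pointwise the same
-- transitions. In the absence of function extensionality it is the run that is carried over.
haltSet-machine : ∀ M → HaltSet (encTM M) → Σ ℕ λ n → Σ (Config M) λ c →
  Steps emptyOracle M n (zero , inputTape []) c × Halted M c
haltSet-machine (tm Q d) (tm Q' d' , e , n , c , r , h) with encUnary-inj Q' Q e
... | refl , e' = n , c , steps-transfer eq r , trans (sym (eq (proj₁ c) (hd (proj₂ c)))) h
  where
  eq : ∀ q s → d' q s ≡ d q s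
  eq = encRows-inj (suc Q) d' d {[]} {[]} (cong (_++ []) e')

-- Lengths of machine codes

length-encUnary : ∀ n → length (encUnary n) ≡ suc n
length-encUnary zero    = refl
length-encUnary (suc n) = cong suc (length-encUnary n)

length-symMove : ∀ s m → length (encSym s ++ encMove m) ≡ 4
length-symMove nothing      left  = refl
length-symMove nothing      right = refl
length-symMove nothing      stay  = refl
length-symMove (just false) left  = refl
length-symMove (just false) right = refl
length-symMove (just false) stay  = refl
length-symMove (just true)  left  = refl
length-symMove (just true)  right = refl
length-symMove (just true)  stay  = refl

length-encAction : ∀ {Q} (a : Action Q) → length (encAction a) ≤ 2 * Q + 8
length-encAction {Q} halt = ≤-trans (s≤s (s≤s z≤n)) (m≤n+m 8 (2 * Q))
length-encAction {Q} (write q s m)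
  rewrite length-++ (encUnary (toℕ q)) {encSym s ++ encMove m} | length-encUnary (toℕ q) | length-symMove s m = begin
    2 + suc (toℕ q + 4)  ≤⟨ +-monoʳ-≤ 2 (+-monoˡ-≤ 4 (toℕ<n q)) ⟩
    2 + (suc Q + 4)      ≡⟨ solve 1 (λ Q → con 2 :+ (con 1 :+ Q :+ con 4) := Q :+ con 7) refl Q ⟩
    Q + 7                ≤⟨ +-mono-≤ (m≤m+n Q (Q + 0)) (n≤1+n 7) ⟩
    2 * Q + 8            ∎
  where
  open ≤-Reasoning
  open +-*-Solver
length-encAction {Q} (query a b)
  rewrite length-++ (encUnary (toℕ a)) {encUnary (toℕ b)} | length-encUnary (toℕ a) | length-encUnary (toℕ b) = begin
    2 + (suc (toℕ a) + suc (toℕ b))  ≤⟨ +-monoʳ-≤ 2 (+-mono-≤ (toℕ<n a) (toℕ<n b)) ⟩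
    2 + (suc Q + suc Q)              ≡⟨ solve 1 (λ Q → con 2 :+ (con 1 :+ Q :+ (con 1 :+ Q)) := con 2 :* Q :+ con 4) refl Q ⟩
    2 * Q + 4                        ≤⟨ +-monoʳ-≤ (2 * Q) (s≤s (s≤s (s≤s (s≤s z≤n)))) ⟩
    2 * Q + 8                        ∎
  where
  open ≤-Reasoning
  open +-*-Solver

length-concatMap : ∀ {A : Set} (f : A → Bits) B n (g : Fin n → A) → (∀ a → length (f a) ≤ B) →
  length (concatMap f (tabulate g)) ≤ n * B
length-concatMap f B zero    g h = z≤n
length-concatMap f B (suc n) g h rewrite length-++ (f (g zero)) {concatMap f (tabulate (g ∘ suc))} =
  +-mono-≤ (h (g zero)) (length-concatMap f B n (g ∘ suc) h)

length-threeTimes : ∀ f B → (∀ s → length (f s) ≤ B) → length (threeTimes f) ≤ 3 * B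
length-threeTimes f B h rewrite length-++ (f nothing) {f (just false) ++ f (just true)}
  | length-++ (f (just false)) {f (just true)} | +-identityʳ B =
  +-mono-≤ (h nothing) (+-mono-≤ (h (just false)) (h (just true)))

-- Three actions per state, each naming at most two states in unary: quadratic in the number of
-- states.
length-encTM : ∀ M → length (encTM M) ≤ 25 * (suc (Q M) * suc (Q M))
length-encTM M rewrite length-++ (encUnary (Q M)) {concatMap (λ q → concatMap (λ s → encAction (δ M q s)) allSyms) (allFin (suc (Q M)))}
  | length-encUnary (Q M) = begin
    suc (Q M) + length (concatMap rows (allFin (suc (Q M))))
      ≤⟨ +-monoʳ-≤ (suc (Q M)) (length-concatMap rows (3 * (2 * Q M + 8)) (suc (Q M)) (λ q → q) λ q →
           subst (λ z → length z ≤ 3 * (2 * Q M + 8)) (sym (concatMap-allSyms (λ s → encAction (δ M q s))))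
             (length-threeTimes (λ s → encAction (δ M q s)) _ (λ s → length-encAction (δ M q s)))) ⟩
    suc (Q M) + suc (Q M) * (3 * (2 * Q M + 8))
      ≡⟨ solve 1 (λ Q → (con 1 :+ Q) :+ (con 1 :+ Q) :* (con 3 :* (con 2 :* Q :+ con 8)) :=
           (con 1 :+ Q) :* (con 6 :* Q :+ con 25)) refl (Q M) ⟩
    suc (Q M) * (6 * Q M + 25)
      ≤⟨ *-monoʳ-≤ (suc (Q M)) (+-monoˡ-≤ 25 (*-monoˡ-≤ (Q M) (m≤m+n 6 19))) ⟩
    suc (Q M) * (25 * Q M + 25)
      ≡⟨ solve 1 (λ Q → (con 1 :+ Q) :* (con 25 :* Q :+ con 25) := con 25 :* ((con 1 :+ Q) :* (con 1 :+ Q))) refl (Q M) ⟩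
    25 * (suc (Q M) * suc (Q M)) ∎
  where
  open ≤-Reasoning
  open +-*-Solver
  rows : Fin (suc (Q M)) → Bits
  rows q = concatMap (λ s → encAction (δ M q s)) allSyms

-- The game

anyB-elim : ∀ {A : Set} (p : A → Bool) l → anyB p l ≡ true → ∃ λ x → x ∈ l × p x ≡ true
anyB-elim p (x ∷ l) e with p x in eq
... | true  = x , here refl , eq
... | false = let (y , m , e') = anyB-elim p l e in y , there m , e'

anyB-intro : ∀ {A : Set} (p : A → Bool) l {x} → x ∈ l → p x ≡ true → anyB p l ≡ true
anyB-intro p (x ∷ l) (here refl) e rewrite e = refl
anyB-intro p (y ∷ l) (there m) e with p y
... | true  = refl
... | false = anyB-intro p l m e

allB-elim : ∀ {A : Set} (p : A → Bool) l {x} → allB p l ≡ true → x ∈ l → p x ≡ true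
allB-elim p (y ∷ l) e (here refl) = proj₁ (∧-true (p y) _ e)
allB-elim p (y ∷ l) e (there m)   = allB-elim p l (proj₂ (∧-true (p y) _ e)) m

allB-intro : ∀ {A : Set} (p : A → Bool) l → (∀ {x} → x ∈ l → p x ≡ true) → allB p l ≡ true
allB-intro p []      h = refl
allB-intro p (x ∷ l) h rewrite h (here refl) = allB-intro p l (λ m → h (there m))

allB-false : ∀ {A : Set} (p : A → Bool) l → allB p l ≡ false → ∃ λ x → x ∈ l × p x ≡ false
allB-false p (x ∷ l) e with p x in eq
... | false = x , here refl , eq
... | true  = let (y , m , e') = allB-false p l e in y , there m , e'

∨-left : ∀ {a b} → a ≡ true → a ∨ b ≡ true
∨-left refl = refl

∨-right : ∀ {a b} → b ≡ true → a ∨ b ≡ true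
∨-right {true}  e = refl
∨-right {false} e = e

∧-intro : ∀ {a b} → a ≡ true → b ≡ true → a ∧ b ≡ true
∧-intro refl refl = refl

true-or-false : ∀ b → b ≡ true ⊎ b ≡ false
true-or-false true  = inj₁ refl
true-or-false false = inj₂ refl

not-∨-elim : ∀ a b → not a ∨ b ≡ true → a ≡ true → b ≡ true
not-∨-elim true b e refl = e

not-∨-intro : ∀ a b → (a ≡ true → b ≡ true) → not a ∨ b ≡ true
not-∨-intro true  b h = h refl
not-∨-intro false b h = refl

not-∨-false : ∀ a b → not a ∨ b ≡ false → a ≡ true × b ≡ false
not-∨-false true false e = refl , refl

total : (ℕ → ℕ) → Hist → ℕ
total cost = sumBy (λ m → cost (proj₂ m))

total-snoc : ∀ cost l m → total cost (l ++ m ∷ []) ≡ total cost l + cost (proj₂ m)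
total-snoc cost []      m = +-identityʳ _
total-snoc cost (x ∷ l) m rewrite total-snoc cost l m = sym (+-assoc (cost (proj₂ x)) _ _)

module GameFacts (ans : Hist → Bool) (cost : ℕ → ℕ) (E : ℕ) (moves : Hist) where
  open Game ans cost E moves

  _⊑_ : Reach → Reach → Set
  r ⊑ r' = ∀ X h a b → r X h a b ≡ true → r' X h a b ≡ true

  safe-mono : ∀ {r r'} → r ⊑ r' → safe r ⊑ safe r'
  safe-mono {r} {r'} le X h a b e =
    let (p , q) = ∧-true (eqBool (ans h) X) _ e in
    ∧-intro p (allB-intro _ moves λ {m} i → not-∨-intro (afford b m) _ λ af →
      le _ _ _ _ (not-∨-elim (afford b m) _ (allB-elim _ moves q i) af))

  own-mono : ∀ {r r'} → r ⊑ r' → ∀ X h a b m → own r X h a b m ≡ true → own r' X h a b m ≡ true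
  own-mono le X h a b m e =
    let (p , q) = ∧-true (afford a m) _ e in ∧-intro p (le _ _ _ _ q)

  -- Lets the fuel be refilled after each move, so that all responses can use the same fuel.
  reach-step : ∀ f → reach f ⊑ reach (suc f)
  reach-step (suc f) X h a b e with ∨-true (safe (reach f) X h a b) _ e
  ... | inj₁ s = ∨-left (safe-mono (reach-step f) X h a b s)
  ... | inj₂ o = let (m , i , e') = anyB-elim _ moves o in
    ∨-right {safe (reach (suc f)) X h a b} (anyB-intro (own (reach (suc f)) X h a b) moves i (own-mono (reach-step f) X h a b m e'))

  safe-answer : ∀ r X h a b → safe r X h a b ≡ true → ans h ≡ X
  safe-answer r X h a b e = eqBool-true (ans h) X (proj₁ (∧-true (eqBool (ans h) X) _ e))

  after : ∀ r X h a b {m} → safe r X h a b ≡ true → m ∈ moves → b + cost (proj₂ m) ≤ E →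
    r X (m ∷ h) a (b + cost (proj₂ m)) ≡ true
  after r X h a b {m} e i le =
    not-∨-elim (afford b m) _ (allB-elim _ moves (proj₂ (∧-true (eqBool (ans h) X) _ e)) i) (true-leq le)

  module _ (positive : ∀ k → 1 ≤ cost k) where

    shrink : ∀ a b {m : Move'} {f} → E ∸ a + (E ∸ b) < suc f → b + cost (proj₂ m) ≤ E → E ∸ a + (E ∸ (b + cost (proj₂ m))) < f
    shrink a b {m} (s≤s lt) le = ≤-trans
      (≤-trans (≤-reflexive (sym (+-suc (E ∸ a) _))) (+-monoʳ-≤ (E ∸ a) (∸-monoʳ-< (m<m+n b (positive (proj₂ m))) le))) lt

    -- Zermelo: if the player content with the current answer is not safe, some move of the other player refutes him.
    determined : ∀ f X h a b → ans h ≡ X → E ∸ a + (E ∸ b) < f →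
      reach f X h a b ≡ true ⊎ reach f (not X) h b a ≡ true
    either : ∀ f X h a b → E ∸ a + (E ∸ b) < f → reach f X h a b ≡ true ⊎ reach f (not X) h b a ≡ true

    determined (suc f) X h a b e lt with safe (reach f) X h a b in s
    ... | true  = inj₁ refl
    ... | false with allB-false _ moves (and-false (eqBool (ans h) X) _ (subst (λ z → eqBool (ans h) z ≡ true) e (eqBool-refl (ans h))) s)
      where
      and-false : ∀ a b → a ≡ true → a ∧ b ≡ false → b ≡ false
      and-false true b refl e = e
    ... | m , i , n with not-∨-false (afford b m) _ n
    ... | af , no with either f X (m ∷ h) a (b + cost (proj₂ m)) (shrink a b {m} lt (leq-true _ _ af))
    ... | inj₁ yes with trans (sym yes) no
    ... | ()
    determined (suc f) X h a b e lt | false | m , i , n | af , no | inj₂ r =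
      inj₂ (∨-right {safe (reach f) (not X) h b a} (anyB-intro (own (reach f) (not X) h b a) moves i (∧-intro af r)))

    either f X h a b lt with ans h in e
    either f true  h a b lt | true  = determined f true h a b e lt
    either f false h a b lt | false = determined f false h a b e lt
    either f true  h a b lt | false with determined f false h b a e (subst (_< f) (+-comm (E ∸ a) (E ∸ b)) lt)
    ... | inj₁ r = inj₂ r
    ... | inj₂ r = inj₁ r
    either f false h a b lt | true with determined f true h b a e (subst (_< f) (+-comm (E ∸ a) (E ∸ b)) lt)
    ... | inj₁ r = inj₂ r
    ... | inj₂ r = inj₁ r

    -- The Boolean `reach f true h 0 0` names its own winner: if it is `false`, determinacy hands
    -- the game to the player who wants `false`.
    winning : ∀ f h → E + E < f → reach f (reach f true h 0 0) h 0 0 ≡ true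
    winning f h lt with reach f true h 0 0 in e
    ... | true  = e
    ... | false with either f true h 0 0 lt
    ... | inj₁ r = ⊥-elim (absurd (trans (sym r) e))
      where absurd : true ≡ false → ⊥
            absurd ()
    ... | inj₂ r = r

  find-some : ∀ (p : Move' → Bool) (l : Hist) → anyB p l ≡ true →
    ∃ λ m → listrec nothing (λ m _ r → if p m then just m else r) l ≡ just m × m ∈ l × p m ≡ true
  find-some p (x ∷ l) e with p x in eq
  ... | true  = x , refl , here refl , eq
  ... | false = let (m , e' , i , q) = find-some p l e in m , e' , there i , q

  find-∈ : ∀ (p : Move' → Bool) (l : Hist) {m} → listrec nothing (λ m _ r → if p m then just m else r) l ≡ just m → m ∈ l
  find-∈ p (x ∷ l) e with p x
  find-∈ p (x ∷ l) refl | true  = here refl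
  find-∈ p (x ∷ l) e    | false = there (find-∈ p l e)

  play-moves : ∀ f X h a b → All (_∈ moves) (play f X h a b)
  play-moves zero    X h a b = []
  play-moves (suc f) X h a b = unless (safe (reach f) X h a b)
    where
    next′ : Move' → Hist
    next′ m = play f X (m ∷ h) (a + cost (proj₂ m)) b ++ m ∷ []
    found : ∀ r → (∀ {m} → r ≡ just m → m ∈ moves) → All (_∈ moves) (maybe next′ [] r)
    found nothing  _ = []
    found (just m) i = All.++⁺ (play-moves f X (m ∷ h) (a + cost (proj₂ m)) b) (i refl ∷ [])
    unless : ∀ c → All (_∈ moves) (if c then [] else maybe next′ [] (find (own (reach f) X h a b)))
    unless true  = []
    unless false = found (find (own (reach f) X h a b)) (find-∈ (own (reach f) X h a b) moves)

  Played : ℕ → Bool → Hist → ℕ → ℕ → Hist → Set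
  Played f X h a b l = safe (reach f) X (l ++ h) (a + total cost l) b ≡ true × a + total cost l ≤ E × All (_∈ moves) l

  play-more : ∀ f X h a b {m} → safe (reach (suc f)) X h a b ≡ false → find (own (reach (suc f)) X h a b) ≡ just m →
    play (suc (suc f)) X h a b ≡ play (suc f) X (m ∷ h) (a + cost (proj₂ m)) b ++ m ∷ []
  play-more f X h a b e e' = trans
    (cong (λ c → if c then [] else maybe (λ m → play (suc f) X (m ∷ h) (a + cost (proj₂ m)) b ++ m ∷ []) []
      (find (own (reach (suc f)) X h a b))) e)
    (cong (maybe (λ m → play (suc f) X (m ∷ h) (a + cost (proj₂ m)) b ++ m ∷ []) []) e')

  play-done : ∀ f X h a b → safe (reach f) X h a b ≡ true → play (suc f) X h a b ≡ []
  play-done f X h a b e = cong (λ c → if c then [] else maybe (λ m → play f X (m ∷ h) (a + cost (proj₂ m)) b ++ m ∷ []) []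
      (find (own (reach f) X h a b))) e

  -- Each chosen move leaves a position from which less fuel suffices; monotonicity in the fuel then
  -- restores the amount claimed.
  play-safe : ∀ f X h a b → a ≤ E → reach (suc f) X h a b ≡ true → Played f X h a b (play (suc f) X h a b)
  play-safe f X h a b le e with ∨-true (safe (reach f) X h a b) _ e
  ... | inj₁ s = subst (Played f X h a b) (sym (play-done f X h a b s))
    (subst (λ z → safe (reach f) X h z b ≡ true × z ≤ E × All (_∈ moves) []) (sym (+-identityʳ a)) (s , le , []))
  play-safe zero X h a b le e | inj₂ o with anyB-elim (own (reach zero) X h a b) moves o
  ... | m , _ , o' with ∧-true (afford a m) _ o'
  ... | _ , ()
  play-safe (suc f) X h a b le e | inj₂ o with true-or-false (safe (reach (suc f)) X h a b)
  ... | inj₁ s = subst (Played (suc f) X h a b) (sym (play-done (suc f) X h a b s))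
    (subst (λ z → safe (reach (suc f)) X h z b ≡ true × z ≤ E × All (_∈ moves) []) (sym (+-identityʳ a)) (s , le , []))
  ... | inj₂ s with find-some (own (reach (suc f)) X h a b) moves o
  ... | m , eq , i , o' with ∧-true (afford a m) _ o'
  ... | af , r with play-safe f X (m ∷ h) (a + cost (proj₂ m)) b (leq-true _ _ af) r
  ... | sf , le' , all = subst (Played (suc f) X h a b) (sym (play-more f X h a b s eq))
    (subst₂ (λ u v → safe (reach (suc f)) X u v b ≡ true) (sym (++-assoc l (m ∷ []) h)) (sym tot)
      (safe-mono (reach-step f) X _ _ b sf) ,
    subst (_≤ E) (sym tot) le' , All.++⁺ all (i ∷ []))
    where
    l = play (suc f) X (m ∷ h) (a + cost (proj₂ m)) b
    tot : a + total cost (l ++ m ∷ []) ≡ a + cost (proj₂ m) + total cost l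
    tot = trans (cong (a +_) (trans (total-snoc cost l m) (+-comm _ (cost (proj₂ m))))) (sym (+-assoc a _ _))

-- The accounts

sumTo : ℕ → (ℕ → ℕ) → ℕ
sumTo zero    f = 0
sumTo (suc n) f = f n + sumTo n f

sumTo-mono : ∀ n {f g} → (∀ j → j < n → f j ≤ g j) → sumTo n f ≤ sumTo n g
sumTo-mono zero    h = z≤n
sumTo-mono (suc n) h = +-mono-≤ (h n ≤-refl) (sumTo-mono n (λ j lt → h j (m≤n⇒m≤1+n lt)))

sumTo-cong : ∀ n {f g} → (∀ j → j < n → f j ≡ g j) → sumTo n f ≡ sumTo n g
sumTo-cong zero    h = refl
sumTo-cong (suc n) h = cong₂ _+_ (h n ≤-refl) (sumTo-cong n (λ j lt → h j (m≤n⇒m≤1+n lt)))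

sumTo-+ : ∀ n f g → sumTo n (λ j → f j + g j) ≡ sumTo n f + sumTo n g
sumTo-+ zero    f g = refl
sumTo-+ (suc n) f g rewrite sumTo-+ n f g =
  solve 4 (λ a b c d → a :+ b :+ (c :+ d) := a :+ c :+ (b :+ d)) refl (f n) (g n) (sumTo n f) (sumTo n g)
  where open +-*-Solver

sumTo-* : ∀ n c f → sumTo n (λ j → c * f j) ≡ c * sumTo n f
sumTo-* zero    c f = sym (*-zeroʳ c)
sumTo-* (suc n) c f rewrite sumTo-* n c f = sym (*-distribˡ-+ c (f n) (sumTo n f))

sumTo-0 : ∀ n {f} → (∀ j → j < n → f j ≡ 0) → sumTo n f ≡ 0
sumTo-0 zero    h = refl
sumTo-0 (suc n) h rewrite h n ≤-refl = sumTo-0 n (λ j lt → h j (m≤n⇒m≤1+n lt))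

sumTo-term : ∀ n f j → j < n → f j ≤ sumTo n f
sumTo-term (suc n) f j lt with m≤n⇒m<n∨m≡n (≤-pred lt)
... | inj₁ lt'  = ≤-trans (sumTo-term n f j lt') (m≤n+m _ (f n))
... | inj₂ refl = m≤m+n (f n) _

sumTo-const : ∀ n B {f} → (∀ j → j < n → f j ≤ B) → sumTo n f ≤ n * B
sumTo-const zero    B h = z≤n
sumTo-const (suc n) B h = +-mono-≤ (h n ≤-refl) (sumTo-const n B (λ j lt → h j (m≤n⇒m≤1+n lt)))

sumTo-squares : ∀ n f → sumTo n (λ j → f j * f j) ≤ sumTo n f * sumTo n f
sumTo-squares zero    f = z≤n
sumTo-squares (suc n) f = begin
  f n * f n + sumTo n (λ j → f j * f j)      ≤⟨ +-monoʳ-≤ (f n * f n) (sumTo-squares n f) ⟩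
  f n * f n + S * S                          ≤⟨ m≤m+n _ (2 * (f n * S)) ⟩
  f n * f n + S * S + 2 * (f n * S)          ≡⟨ solve 2 (λ x s → x :* x :+ s :* s :+ con 2 :* (x :* s) := (x :+ s) :* (x :+ s)) refl (f n) S ⟩
  (f n + S) * (f n + S)                      ∎
  where
  open ≤-Reasoning
  open +-*-Solver
  S = sumTo n f

-- (z + a − b)² ≤ z² + 2z(a − b) + a² + b², truncation included
square-step : ∀ z a b → (z + a ∸ b) * (z + a ∸ b) + 2 * (z * b) ≤ z * z + 2 * (z * a) + (a * a + b * b)
square-step z a b with b ≤? z + a
... | Relation.Nullary.yes le = begin
    x * x + 2 * (z * b)              ≤⟨ +-monoʳ-≤ (x * x) (*-monoʳ-≤ 2 (*-monoˡ-≤ b (m≤m+n z a))) ⟩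
    x * x + 2 * ((z + a) * b)        ≡⟨ cong (λ y → x * x + 2 * (y * b)) (sym e) ⟩
    x * x + 2 * ((x + b) * b)        ≡⟨ solve 2 (λ x b → x :* x :+ con 2 :* ((x :+ b) :* b) := (x :+ b) :* (x :+ b) :+ b :* b) refl x b ⟩
    (x + b) * (x + b) + b * b        ≡⟨ cong (λ y → y * y + b * b) e ⟩
    (z + a) * (z + a) + b * b        ≡⟨ solve 3 (λ z a b → (z :+ a) :* (z :+ a) :+ b :* b := z :* z :+ con 2 :* (z :* a) :+ (a :* a :+ b :* b)) refl z a b ⟩
    z * z + 2 * (z * a) + (a * a + b * b) ∎
  where
  open ≤-Reasoning
  open +-*-Solver
  x = z + a ∸ b
  e : x + b ≡ z + a
  e = m∸n+n≡m le
... | Relation.Nullary.no gt rewrite m≤n⇒m∸n≡0 (<⇒≤ (≰⇒> gt)) = begin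
    2 * (z * b)                      ≡⟨ cong (λ y → 2 * (z * y)) (sym e) ⟩
    2 * (z * (z + d))                ≤⟨ m≤m+n _ (d * d) ⟩
    2 * (z * (z + d)) + d * d        ≡⟨ solve 2 (λ z d → con 2 :* (z :* (z :+ d)) :+ d :* d := z :* z :+ (z :+ d) :* (z :+ d)) refl z d ⟩
    z * z + (z + d) * (z + d)        ≡⟨ cong (λ y → z * z + y * y) e ⟩
    z * z + b * b                    ≤⟨ m≤m+n _ (2 * (z * a) + a * a) ⟩
    z * z + b * b + (2 * (z * a) + a * a) ≡⟨ solve 3 (λ z a b → z :* z :+ b :* b :+ (con 2 :* (z :* a) :+ a :* a) := z :* z :+ con 2 :* (z :* a) :+ (a :* a :+ b :* b)) refl z a b ⟩
    z * z + 2 * (z * a) + (a * a + b * b) ∎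
  where
  open ≤-Reasoning
  open +-*-Solver
  d = b ∸ z
  e : z + d ≡ b
  e = m+[n∸m]≡n (≤-trans (m≤m+n z a) (<⇒≤ (≰⇒> gt)))

square-cancel : ∀ x y → x * x ≤ y * y → x ≤ y
square-cancel x y h with x ≤? y
... | Relation.Nullary.yes le = le
... | Relation.Nullary.no gt  = ⊥-elim (<⇒≱ (*-mono-< (≰⇒> gt) (≰⇒> gt)) h)

-- z is the debt per level, a and b the weights spent by the strategy and by its opponent in the current interval,
-- V the opponent's total weight, L the number of moves below the lowest level, t the number of finished intervals.
module Accounts (A P q n : ℕ) (1≤A : 1 ≤ A) (A-large : A * 144 + 32 ≤ A * A * 32) (1≤P : 1 ≤ P) (1≤q : 1 ≤ q) where

  -- `m` is the price of unit weight without debt and `E` the budget; `u` will bound the weight of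
  -- one move. `cap` will be an eighth of 2^q: it bounds the opponent's weight at a level and, by
  -- `debt-bound`, also the debts.
  m E u cap q⁴ : ℕ
  m   = P * q * A
  E   = m * P
  u   = P * q * (A * 2)
  cap = P * q * q * (A * 8)
  q⁴  = q * q * (q * q)

  -- An overspent interval cost the opponent at least `E` at prices up to `m + cap`; one ended by a
  -- low move is charged to `L`. To the potential an interval contributes P² for the squares of the
  -- strategy's weights and a term linear in the opponent's weight, or 2E more if it was ended by a
  -- low move.
  record Account (t : ℕ) (z : ℕ → ℕ) (V L : ℕ) : Set where
    constructor account
    field
      potential : sumTo n (λ j → z j * z j) ≤ (2 * m + P + u) * V + 2 * E * L + t * (P * P)
      intervals : t * E ≤ (m + cap) * V + E * L
  open Account

  private
    open +-*-Solver
    1≤q⁴ : ∀ {x} → x ≤ q * x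
    1≤q⁴ {x} = subst (_≤ q * x) (*-identityˡ x) (*-monoˡ-≤ x 1≤q)

  module _ {t z V L} (acc : Account t z V L) (V≤ : V ≤ q * cap) (L≤ : L ≤ q * 32) where

    private
      1≤E : 1 ≤ E
      1≤E = *-mono-≤ (*-mono-≤ (*-mono-≤ 1≤P 1≤q) 1≤A) 1≤P

    intervals-bound : t ≤ q⁴ * (A * 72 + 32)
    intervals-bound = *-cancelʳ-≤ t (q⁴ * (A * 72 + 32)) E {{>-nonZero 1≤E}} (begin
      t * E                                        ≤⟨ intervals acc ⟩
      (m + cap) * V + E * L                        ≤⟨ +-mono-≤ (*-monoʳ-≤ (m + cap) V≤) (*-monoʳ-≤ E L≤) ⟩
      (m + cap) * (q * cap) + E * (q * 32)         ≤⟨ +-mono-≤ (*-monoˡ-≤ (q * cap) (+-monoˡ-≤ cap (1≤q⁴ {m}))) (*-monoʳ-≤ E (*-monoˡ-≤ 32 q≤q⁴)) ⟩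
      (q * m + cap) * (q * cap) + E * (q⁴ * 32)    ≡⟨ solve 3 (λ A P q →
          (q :* (P :* q :* A) :+ P :* q :* q :* (A :* con 8)) :* (q :* (P :* q :* q :* (A :* con 8)))
            :+ (P :* q :* A :* P) :* (q :* q :* (q :* q) :* con 32)
          := (q :* q :* (q :* q)) :* (A :* con 72 :+ con 32) :* (P :* q :* A :* P)) refl A P q ⟩
      q⁴ * (A * 72 + 32) * E                       ∎)
      where
      open ≤-Reasoning
      q≤q⁴ : q ≤ q⁴
      q≤q⁴ = ≤-trans (1≤q⁴ {q}) (≤-trans (1≤q⁴ {q * q}) (≤-trans (1≤q⁴ {q * (q * q)})
        (≤-reflexive (solve 1 (λ q → q :* (q :* (q :* q)) := q :* q :* (q :* q)) refl q))))

    -- Every term is at most a multiple of P² q⁴. The coefficients add up to 32 A² + 144 A + 32,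
    -- while cap² has 64 A²; this is the purpose of `A-large`.
    debt-bound : ∀ j → j < n → z j ≤ cap
    debt-bound j lt = square-cancel (z j) cap (begin
      z j * z j                                             ≤⟨ sumTo-term n (λ j → z j * z j) j lt ⟩
      sumTo n (λ j → z j * z j)                             ≤⟨ potential acc ⟩
      (2 * m + P + u) * V + 2 * E * L + t * (P * P)         ≤⟨ +-mono-≤ (+-mono-≤ (*-monoʳ-≤ (2 * m + P + u) V≤) (*-monoʳ-≤ (2 * E) L≤)) (*-monoˡ-≤ (P * P) intervals-bound) ⟩
      (2 * m + P + u) * (q * cap) + 2 * E * (q * 32) + q⁴ * (A * 72 + 32) * (P * P)
        ≤⟨ +-monoˡ-≤ _ (+-mono-≤ (*-monoˡ-≤ (q * cap) (+-monoˡ-≤ u (+-monoʳ-≤ (2 * m) (1≤q⁴ {P})))) (*-monoʳ-≤ (2 * E) (*-monoˡ-≤ 32 (≤-trans (1≤q⁴ {q}) (1≤q⁴ {q * q}))))) ⟩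
      (2 * m + q * P + u) * (q * cap) + 2 * E * (q * (q * q) * 32) + q⁴ * (A * 72 + 32) * (P * P)
        ≡⟨ solve 3 (λ A P q →
          (con 2 :* (P :* q :* A) :+ q :* P :+ P :* q :* (A :* con 2)) :* (q :* (P :* q :* q :* (A :* con 8)))
            :+ con 2 :* (P :* q :* A :* P) :* (q :* (q :* q) :* con 32)
            :+ (q :* q :* (q :* q)) :* (A :* con 72 :+ con 32) :* (P :* P)
          := (P :* q :* q) :* (P :* q :* q) :* (A :* A :* con 32 :+ (A :* con 144 :+ con 32))) refl A P q ⟩
      (P * q * q) * (P * q * q) * (A * A * 32 + (A * 144 + 32)) ≤⟨ *-monoʳ-≤ ((P * q * q) * (P * q * q)) (+-monoʳ-≤ (A * A * 32) A-large) ⟩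
      (P * q * q) * (P * q * q) * (A * A * 32 + A * A * 32) ≡⟨ solve 2 (λ A x → x :* x :* (A :* A :* con 32 :+ A :* A :* con 32) := x :* (A :* con 8) :* (x :* (A :* con 8))) refl A (P * q * q) ⟩
      cap * cap                                             ∎)
      where open ≤-Reasoning

  -- An interval comes to its end. Up to the previous response the opponent was within budget and
  -- had bought at most `P`; the move that arrives now adds at most `u`.
  module _ {t z V L} (acc : Account t z V L) (a b : ℕ → ℕ)
    (paid : sumTo n (λ j → (m + z j) * a j) ≤ E) (b≤ : ∀ j → j < n → b j ≤ P + u) where

    private
      S : (ℕ → ℕ) → ℕ
      S = sumTo n
      Φ Φ' za zb : ℕ
      Φ  = S (λ j → z j * z j)
      Φ' = S (λ j → (z j + a j ∸ b j) * (z j + a j ∸ b j))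
      za = S (λ j → z j * a j)
      zb = S (λ j → z j * b j)

      split : ∀ c → S (λ j → (m + z j) * c j) ≡ m * S c + S (λ j → z j * c j)
      split c = trans (sumTo-cong n (λ j _ → *-distribʳ-+ (c j) m (z j)))
        (trans (sumTo-+ n (λ j → m * c j) (λ j → z j * c j)) (cong (_+ S (λ j → z j * c j)) (sumTo-* n m c)))

      1≤m : 1 ≤ m
      1≤m = *-mono-≤ (*-mono-≤ 1≤P 1≤q) 1≤A

      -- No price is below `m`, and `E` is `m * P`.
      a≤P : S a ≤ P
      a≤P = *-cancelˡ-≤ m {{>-nonZero 1≤m}} (≤-trans (m≤m+n (m * S a) za) (≤-trans (≤-reflexive (sym (split a))) paid))

      za≤E : za ≤ E
      za≤E = ≤-trans (m≤n+m za (m * S a)) (≤-trans (≤-reflexive (sym (split a))) paid)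

      squares : Φ' + 2 * zb ≤ Φ + 2 * za + (P * P + (P + u) * S b)
      squares = begin
        Φ' + 2 * zb ≡⟨ cong (Φ' +_) (sym (sumTo-* n 2 (λ j → z j * b j))) ⟩
        Φ' + S (λ j → 2 * (z j * b j)) ≡⟨ sym (sumTo-+ n _ _) ⟩
        S (λ j → (z j + a j ∸ b j) * (z j + a j ∸ b j) + 2 * (z j * b j)) ≤⟨ sumTo-mono n (λ j _ → square-step (z j) (a j) (b j)) ⟩
        S (λ j → z j * z j + 2 * (z j * a j) + (a j * a j + b j * b j)) ≡⟨ sumTo-+ n (λ j → z j * z j + 2 * (z j * a j)) (λ j → a j * a j + b j * b j) ⟩
        S (λ j → z j * z j + 2 * (z j * a j)) + S (λ j → a j * a j + b j * b j)
          ≡⟨ cong₂ _+_ (trans (sumTo-+ n (λ j → z j * z j) (λ j → 2 * (z j * a j))) (cong (Φ +_) (sumTo-* n 2 (λ j → z j * a j))))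
               (sumTo-+ n (λ j → a j * a j) (λ j → b j * b j)) ⟩
        Φ + 2 * za + (S (λ j → a j * a j) + S (λ j → b j * b j))
          ≤⟨ +-monoʳ-≤ (Φ + 2 * za) (+-mono-≤ (≤-trans (sumTo-squares n a) (*-mono-≤ a≤P a≤P))
               (≤-trans (sumTo-mono n (λ j lt → *-monoˡ-≤ (b j) (b≤ j lt))) (≤-reflexive (sumTo-* n (P + u) b)))) ⟩
        Φ + 2 * za + (P * P + (P + u) * S b) ∎
        where open ≤-Reasoning

    -- The chain `za ≤ E ≤ m * S b + zb` replaces the gain `2 * za` in the squares by `2 * zb`,
    -- which cancels against the loss, plus a term linear in the opponent's weight. The bound on the
    -- debts enters only through the prices he paid.
    after-overspending : (∀ j → j < n → z j ≤ cap) → E ≤ sumTo n (λ j → (m + z j) * b j) → ∀ {L'} → L ≤ L' →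
      Account (suc t) (λ j → z j + a j ∸ b j) (sumTo n b + V) L'
    after-overspending z≤ over {L'} L≤ = account
      (begin
        Φ' ≤⟨ +-cancelʳ-≤ (2 * zb) Φ' _ (begin
          Φ' + 2 * zb ≤⟨ squares ⟩
          Φ + 2 * za + (P * P + (P + u) * S b) ≤⟨ +-monoˡ-≤ (P * P + (P + u) * S b) (+-monoʳ-≤ Φ (*-monoʳ-≤ 2 (≤-trans za≤E (≤-trans over (≤-reflexive (split b)))))) ⟩
          Φ + 2 * (m * S b + zb) + (P * P + (P + u) * S b)
            ≡⟨ solve 6 (λ Φ m s w P u → Φ :+ con 2 :* (m :* s :+ w) :+ (P :* P :+ (P :+ u) :* s)
                := Φ :+ (con 2 :* m :+ P :+ u) :* s :+ P :* P :+ con 2 :* w) refl Φ m (S b) zb P u ⟩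
          Φ + (2 * m + P + u) * S b + P * P + 2 * zb ∎) ⟩
        Φ + (2 * m + P + u) * S b + P * P ≤⟨ +-monoˡ-≤ (P * P) (+-monoˡ-≤ _ (≤-trans (potential acc) (+-monoˡ-≤ (t * (P * P)) (+-monoʳ-≤ _ (*-monoʳ-≤ (2 * E) L≤))))) ⟩
        (2 * m + P + u) * V + 2 * E * L' + t * (P * P) + (2 * m + P + u) * S b + P * P
          ≡⟨ solve 6 (λ c V e s t p → c :* V :+ e :+ t :* p :+ c :* s :+ p := c :* (s :+ V) :+ e :+ (p :+ t :* p)) refl
              (2 * m + P + u) V (2 * E * L') (S b) t (P * P) ⟩
        (2 * m + P + u) * (S b + V) + 2 * E * L' + suc t * (P * P) ∎)
      (begin
        E + t * E ≤⟨ +-mono-≤ (≤-trans over (≤-trans (sumTo-mono n (λ j lt → *-monoˡ-≤ (b j) (+-monoʳ-≤ m (z≤ j lt)))) (≤-reflexive (sumTo-* n (m + cap) b))))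
                       (≤-trans (intervals acc) (+-monoʳ-≤ _ (*-monoʳ-≤ E L≤))) ⟩
        (m + cap) * S b + ((m + cap) * V + E * L') ≡⟨ solve 4 (λ c s V e → c :* s :+ (c :* V :+ e) := c :* (s :+ V) :+ e) refl (m + cap) (S b) V (E * L') ⟩
        (m + cap) * (S b + V) + E * L' ∎)
      where open ≤-Reasoning

    -- The opponent need not have paid anything here, so `za` is estimated by `E` alone and the low
    -- move has to bear `2 * E`.
    after-low : ∀ {L'} → suc L ≤ L' → Account (suc t) (λ j → z j + a j ∸ b j) (sumTo n b + V) L'
    after-low {L'} L≤ = account
      (begin
        Φ' ≤⟨ m≤m+n Φ' (2 * zb) ⟩
        Φ' + 2 * zb ≤⟨ squares ⟩
        Φ + 2 * za + (P * P + (P + u) * S b) ≤⟨ +-monoˡ-≤ _ (+-mono-≤ (potential acc) (*-monoʳ-≤ 2 za≤E)) ⟩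
        (2 * m + P + u) * V + 2 * E * L + t * (P * P) + 2 * E + (P * P + (P + u) * S b) ≤⟨ m≤m+n _ (2 * m * S b) ⟩
        (2 * m + P + u) * V + 2 * E * L + t * (P * P) + 2 * E + (P * P + (P + u) * S b) + 2 * m * S b
          ≡⟨ solve 8 (λ m P u V E L t s → (con 2 :* m :+ P :+ u) :* V :+ con 2 :* E :* L :+ t :* (P :* P) :+ con 2 :* E :+ (P :* P :+ (P :+ u) :* s) :+ con 2 :* m :* s
              := (con 2 :* m :+ P :+ u) :* (s :+ V) :+ con 2 :* E :* (con 1 :+ L) :+ (P :* P :+ t :* (P :* P))) refl m P u V E L t (S b) ⟩
        (2 * m + P + u) * (S b + V) + 2 * E * suc L + suc t * (P * P) ≤⟨ +-monoˡ-≤ (suc t * (P * P)) (+-monoʳ-≤ ((2 * m + P + u) * (S b + V)) (*-monoʳ-≤ (2 * E) L≤)) ⟩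
        (2 * m + P + u) * (S b + V) + 2 * E * L' + suc t * (P * P) ∎)
      (begin
        E + t * E ≤⟨ +-monoʳ-≤ E (intervals acc) ⟩
        E + ((m + cap) * V + E * L) ≤⟨ m≤n+m _ ((m + cap) * S b) ⟩
        (m + cap) * S b + (E + ((m + cap) * V + E * L))
          ≡⟨ solve 5 (λ c s V E L → c :* s :+ (E :+ (c :* V :+ E :* L)) := c :* (s :+ V) :+ E :* (con 1 :+ L)) refl (m + cap) (S b) V E L ⟩
        (m + cap) * (S b + V) + E * suc L ≤⟨ +-monoʳ-≤ ((m + cap) * (S b + V)) (*-monoʳ-≤ E L≤) ⟩
        (m + cap) * (S b + V) + E * L' ∎)
      where open ≤-Reasoning

    paid-weight : ∀ j → j < n → a j ≤ P
    paid-weight j lt = ≤-trans (sumTo-term n a j lt) a≤P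

-- Lists of moves

sumBy-++ : ∀ {A : Set} (f : A → ℕ) x l → sumBy f (x ++ l) ≡ sumBy f x + sumBy f l
sumBy-++ f []      l = refl
sumBy-++ f (m ∷ x) l = trans (cong (f m +_) (sumBy-++ f x l)) (sym (+-assoc (f m) _ _))

sumBy-0 : ∀ {A : Set} (f : A → ℕ) {l} → All (λ x → f x ≡ 0) l → sumBy f l ≡ 0
sumBy-0 f []      = refl
sumBy-0 f (e ∷ h) rewrite e = sumBy-0 f h

filterB-++ : ∀ {A : Set} (p : A → Bool) x l → filterB p (x ++ l) ≡ filterB p x ++ filterB p l
filterB-++ p []      l = refl
filterB-++ p (m ∷ x) l with p m
... | true  = cong (m ∷_) (filterB-++ p x l)
... | false = filterB-++ p x l

filterB-all : ∀ {A : Set} (p : A → Bool) {l} → All (λ x → p x ≡ true) l → filterB p l ≡ l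
filterB-all p []      = refl
filterB-all p (e ∷ h) rewrite e = cong (_ ∷_) (filterB-all p h)

filterB-none : ∀ {A : Set} (p : A → Bool) {l} → All (λ x → p x ≡ false) l → filterB p l ≡ []
filterB-none p []      = refl
filterB-none p (e ∷ h) rewrite e = filterB-none p h

filterB-holds : ∀ {A : Set} (p : A → Bool) l → All (λ x → p x ≡ true) (filterB p l)
filterB-holds p [] = []
filterB-holds p (m ∷ l) with p m in e
... | true  = e ∷ filterB-holds p l
... | false = filterB-holds p l

filterB-∈ : ∀ {A : Set} (p : A → Bool) l {x} → x ∈ filterB p l → x ∈ l × p x ≡ true
filterB-∈ p (m ∷ l) i with p m in e
filterB-∈ p (m ∷ l) (here refl) | true = here refl , e
filterB-∈ p (m ∷ l) (there i) | true  = let (j , h) = filterB-∈ p l i in there j , h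
filterB-∈ p (m ∷ l) i | false = let (j , h) = filterB-∈ p l i in there j , h

∈-filterB : ∀ {A : Set} (p : A → Bool) l {x} → x ∈ l → p x ≡ true → x ∈ filterB p l
∈-filterB p (m ∷ l) (here refl) e rewrite e = here refl
∈-filterB p (m ∷ l) (there i)   e with p m
... | true  = there (∈-filterB p l i e)
... | false = ∈-filterB p l i e

sumBy-filterB : ∀ {A : Set} (p : A → Bool) (f : A → ℕ) l → sumBy f (filterB p l) ≤ sumBy f l
sumBy-filterB p f [] = z≤n
sumBy-filterB p f (m ∷ l) with p m
... | true  = +-monoʳ-≤ (f m) (sumBy-filterB p f l)
... | false = ≤-trans (sumBy-filterB p f l) (m≤n+m _ (f m))

recent-++ : ∀ n (x l : List Owned) → n ≤ length l → recent n (x ++ l) ≡ x ++ recent n l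
recent-++ n x l h rewrite length-++ x {l} | +-∸-assoc (length x) h = go x
  where
  go : ∀ x → take (length x + (length l ∸ n)) (x ++ l) ≡ x ++ take (length l ∸ n) l
  go []      = refl
  go (m ∷ x) = cong (m ∷_) (go x)

older-++ : ∀ n (x l : List Owned) → n ≤ length l → older n (x ++ l) ≡ older n l
older-++ n x l h rewrite length-++ x {l} | +-∸-assoc (length x) h = go x
  where
  go : ∀ x → drop (length x + (length l ∸ n)) (x ++ l) ≡ drop (length l ∸ n) l
  go []      = refl
  go (m ∷ x) = go x

recent-older : ∀ n (l : List Owned) → recent n l ++ older n l ≡ l
recent-older n l = take++drop≡id (length l ∸ n) l

recent-all : ∀ (l : List Owned) → recent (length l) l ≡ []
recent-all l rewrite n∸n≡0 (length l) = refl

older-all : ∀ (l : List Owned) → older (length l) l ≡ l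
older-all l rewrite n∸n≡0 (length l) = refl

matches : Bool → ℕ → Owned → Bool
matches o k m = eqBool o (proj₁ m) ∧ eqN (level m) k

count : Bool → ℕ → List Owned → ℕ
count o k = sumBy λ m → if matches o k m then 1 else 0

lows : ℕ → List Owned → ℕ
lows k = sumBy λ m → if leq k (level m) then 0 else 1

weight-count : ∀ i o l k → weightAt i o l k ≡ count o k l * weight i k
weight-count i o []      k = refl
weight-count i o (m ∷ l) k = trans (cong₂ _+_ (go (matches o k m)) (weight-count i o l k))
  (sym (*-distribʳ-+ (weight i k) (if matches o k m then 1 else 0) (count o k l)))
  where
  go : ∀ b → (if b then weight i k else 0) ≡ (if b then 1 else 0) * weight i k
  go true  = sym (*-identityˡ _)
  go false = refl

lows-count : ∀ n l → lows n l ≡ sumTo n (λ k → count false k l + count true k l)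
lows-count n [] = sym (sumTo-0 n (λ _ _ → refl))
lows-count n (m ∷ l) = sym (trans
  (trans (sumTo-cong n (λ k _ → solve 4 (λ a b c d → a :+ b :+ (c :+ d) := a :+ c :+ (b :+ d)) refl
      (if matches false k m then 1 else 0) (count false k l) (if matches true k m then 1 else 0) (count true k l)))
    (sumTo-+ n (λ k → (if matches false k m then 1 else 0) + (if matches true k m then 1 else 0)) _))
  (cong₂ _+_ (trans (sumTo-cong n (λ k _ → owner (proj₁ m) (eqN (level m) k))) (single n (level m))) (sym (lows-count n l))))
  where
  open +-*-Solver
  owner : ∀ o b → (if eqBool false o ∧ b then 1 else 0) + (if eqBool true o ∧ b then 1 else 0) ≡ (if b then 1 else 0)
  owner true  b     = refl
  owner false true  = refl
  owner false false = refl
  single : ∀ n v → sumTo n (λ k → if eqN v k then 1 else 0) ≡ (if leq n v then 0 else 1)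
  single zero    v = refl
  single (suc n) v with <-cmp n v
    where open import Data.Nat.Properties using (<-cmp)
  ... | c = go c
    where
    open import Relation.Binary.Definitions using (Tri; tri<; tri≈; tri>)
    go : Tri (n < v) (n ≡ v) (n > v) → sumTo (suc n) (λ k → if eqN v k then 1 else 0) ≡ (if leq (suc n) v then 0 else 1)
    go (tri< lt ne _) rewrite eqN-≢ v n (λ e → ne (sym e)) | true-leq lt = trans (single n v) (cong (λ b → if b then 0 else 1) (true-leq (<⇒≤ lt)))
    go (tri≈ _ refl _) rewrite eqN-refl n | false-leq (≤-refl {suc n}) = cong suc (trans (single n n) (cong (λ b → if b then 0 else 1) (true-leq (≤-refl {n}))))
    go (tri> _ ne gt) rewrite eqN-≢ v n (λ e → ne (sym e)) | false-leq (m≤n⇒m≤1+n gt) = trans (single n v) (cong (λ b → if b then 0 else 1) (false-leq gt))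

sumTo-single : ∀ a n v (p w : ℕ → ℕ) → a ≤ v → v < a + n →
  sumTo n (λ j → p (a + j) * (if eqN v (a + j) then w (a + j) else 0)) ≡ p v * w v
sumTo-single a zero    v p w h h' = ⊥-elim (<⇒≱ h' (≤-trans (≤-reflexive (+-identityʳ a)) h))
sumTo-single a (suc n) v p w h h' with true-or-false (eqN v (a + n))
... | inj₁ e rewrite e | sym (eqN-true v (a + n) e) =
  trans (cong (p v * w v +_) (sumTo-0 n λ j lt → trans (cong (λ b → p (a + j) * (if b then w (a + j) else 0))
      (eqN-≢ v (a + j) (λ e' → <-irrefl (trans (sym e') (eqN-true v (a + n) e)) (+-monoʳ-< a lt)))) (*-zeroʳ (p (a + j)))))
    (+-identityʳ _)
... | inj₂ e rewrite e | *-zeroʳ (p (a + n)) = sumTo-single a n v p w h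
  (≤∧≢⇒< (≤-pred (≤-trans h' (≤-reflexive (+-suc a n)))) λ e' → true≢false (trans (sym (subst (λ y → eqN v y ≡ true) e' (eqN-refl v))) e))
  where
  true≢false : true ≡ false → ⊥
  true≢false ()

strings-∈ : ∀ n w → length w ≤ n → w ∈ strings n
strings-∈ zero    []          h = here refl
strings-∈ (suc n) []          h = here refl
strings-∈ (suc n) (true ∷ w)  (s≤s h) = there (∈-++⁺ˡ (∈-map⁺ (true ∷_) (strings-∈ n w h)))
strings-∈ (suc n) (false ∷ w) (s≤s h) = there (∈-++⁺ʳ (map (true ∷_) (strings n)) (∈-map⁺ (false ∷_) (strings-∈ n w h)))

∈-strings : ∀ n {w} → w ∈ strings n → length w ≤ n
∈-strings zero    (here refl) = z≤n
∈-strings (suc n) (here refl) = z≤n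
∈-strings (suc n) (there i) with ∈-++⁻ (map (true ∷_) (strings n)) i
... | inj₁ j with ∈-map⁻ (true ∷_) j
... | _ , k , refl = s≤s (∈-strings n k)
∈-strings (suc n) (there i) | inj₂ j with ∈-map⁻ (false ∷_) j
... | _ , k , refl = s≤s (∈-strings n k)

below-∈ : ∀ n k → k < n → k ∈ below n
below-∈ (suc n) k lt with m≤n⇒m<n∨m≡n (≤-pred lt)
... | inj₁ lt'  = there (below-∈ n k lt')
... | inj₂ refl = here refl

∈-below : ∀ n {k} → k ∈ below n → k < n
∈-below (suc n) (here refl) = ≤-refl
∈-below (suc n) (there i)   = m≤n⇒m≤1+n (∈-below n i)

movesOf-∈ : ∀ i w k → length w ≤ size′ i → lowest i ≤ k → k < size′ i → (w , k) ∈ movesOf i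
movesOf-∈ i w k hw hk hk' = ∈-concatMap⁺ (λ k → map (_, k) (strings (size′ i)))
  (Any.map (λ { refl → ∈-map⁺ (_, k) (strings-∈ (size′ i) w hw) })
    (∈-filterB (leq (lowest i)) (below (size′ i)) (below-∈ (size′ i) k hk') (true-leq hk)))

∈-movesOf : ∀ i {m} → m ∈ movesOf i → length (proj₁ m) ≤ size′ i × lowest i ≤ proj₂ m × proj₂ m < size′ i
∈-movesOf i {m} h = go (filterB (leq (lowest i)) (below (size′ i)))
  (λ k j → let (a , b) = filterB-∈ (leq (lowest i)) (below (size′ i)) j in leq-true _ k b , ∈-below (size′ i) a)
  (∈-concatMap⁻ (λ k → map (_, k) (strings (size′ i))) h)
  where
  go : ∀ ks → (∀ k → k ∈ ks → lowest i ≤ k × k < size′ i) → Any.Any (λ k → m ∈ map (_, k) (strings (size′ i))) ks →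
    length (proj₁ m) ≤ size′ i × lowest i ≤ proj₂ m × proj₂ m < size′ i
  go (k ∷ ks) f (here j) with ∈-map⁻ (_, k) j
  ... | w , jw , refl = ∈-strings (size′ i) jw , f k (here refl)
  go (k ∷ ks) f (there j) = go ks (λ k i → f k (there i)) j

-- The scales

scale-large : ∀ i → 10 ≤ scale i
-- For n = κ it makes the truncated exponent of `unit′` a genuine difference, and it shows that the
-- scales increase.
double≤2^ : ∀ n → 10 ≤ n → n + n + 14 ≤ 2 ^ n

double≤2^ n h = subst (λ n → n + n + 14 ≤ 2 ^ n) (m+[n∸m]≡n h) (go (n ∸ 10))
  where
  go : ∀ k → (10 + k) + (10 + k) + 14 ≤ 2 ^ (10 + k)
  go zero    = m≤m+n 34 990
  go (suc k) = begin
    (10 + suc k) + (10 + suc k) + 14       ≡⟨ solve 1 (λ k → (con 10 :+ (con 1 :+ k)) :+ (con 10 :+ (con 1 :+ k)) :+ con 14 := (con 10 :+ k) :+ (con 10 :+ k) :+ con 14 :+ con 2) refl k ⟩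
    (10 + k) + (10 + k) + 14 + 2           ≤⟨ +-mono-≤ (go k) (≤-trans (m≤n+m 2 ((10 + k) + (10 + k) + 12)) (≤-trans (≤-reflexive (+-assoc ((10 + k) + (10 + k)) 12 2)) (go k))) ⟩
    2 ^ (10 + k) + 2 ^ (10 + k)            ≡⟨ cong (2 ^ (10 + k) +_) (sym (+-identityʳ _)) ⟩
    2 ^ (10 + k) + (2 ^ (10 + k) + 0)      ≡⟨⟩
    2 ^ suc (10 + k)                       ≡⟨ cong (2 ^_) (sym (+-suc 10 k)) ⟩
    2 ^ (10 + suc k)                       ∎
    where
    open ≤-Reasoning
    open +-*-Solver

scale-large zero    = ≤-refl
scale-large (suc i) = ≤-trans (scale-large i) (≤-trans (≤-trans (m≤m+n (scale i) (scale i)) (m≤m+n _ 14)) (double≤2^ (scale i) (scale-large i)))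

-- One requirement

1≤2^ : ∀ k → 1 ≤ 2 ^ k
1≤2^ k = m^n>0 2 k

module Requirement (i : ℕ) where

  κ q P lo n : ℕ
  κ  = scale i
  q  = size′ i
  P  = unit′ i
  lo = lowest i
  n  = q ∸ lo

  1≤P : 1 ≤ P
  1≤P = 1≤2^ (q ∸ (κ + κ + 14))

  1≤q : 1 ≤ q
  1≤q = 1≤2^ κ

  private
    fits : κ + κ + 14 ≤ q
    fits = double≤2^ κ (scale-large i)

  lo≤q : lo ≤ q
  lo≤q = ≤-trans (+-mono-≤ (m≤m+n κ κ) (≤ᵇ⇒≤ 5 14 tt)) fits

  open Accounts 256 P q n (s≤s z≤n) (≤ᵇ⇒≤ (256 * 144 + 32) (256 * 256 * 32) tt) 1≤P 1≤q public

  -- The 14 in `unit′` comes from here: 2^14 = 8 · 256 · 8, where 8 · 256 is the factor of P q² in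
  -- `cap` and the last 8 is the opponent's share of one eighth.
  2^q : 2 ^ q ≡ cap * 8
  2^q = trans (cong (2 ^_) (sym (m∸n+n≡m fits))) (trans (^-distribˡ-+-* 2 (q ∸ (κ + κ + 14)) (κ + κ + 14))
    (trans (cong (P *_) (trans (^-distribˡ-+-* 2 (κ + κ) 14) (cong (_* 16384) (^-distribˡ-+-* 2 κ κ))))
      (trans (sym (*-assoc P (q * q) 16384)) (trans (cong (_* 16384) (sym (*-assoc P q q))) (sym (*-assoc (P * q * q) 2048 8))))))

  -- The heaviest moves are those at `lo`, of weight 2^(q - κ - 5) = P · 2^(κ + 9) = 512 P q.
  weight≤u : ∀ k → lo ≤ k → weight i k ≤ u
  weight≤u k h = ≤-trans (^-monoʳ-≤ 2 (∸-monoʳ-≤ q h)) (≤-reflexive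
    (trans (cong (2 ^_) e) (trans (^-distribˡ-+-* 2 (q ∸ (κ + κ + 14)) (κ + 9))
      (trans (cong (P *_) (^-distribˡ-+-* 2 κ 9)) (sym (*-assoc P q 512))))))
    where
    e : q ∸ lo ≡ (q ∸ (κ + κ + 14)) + (κ + 9)
    e = trans (cong (_∸ lo) (trans (sym (m∸n+n≡m fits))
      (solve 2 (λ x κ → x :+ (κ :+ κ :+ con 14) := x :+ (κ :+ con 9) :+ (κ :+ con 5)) refl (q ∸ (κ + κ + 14)) κ)))
      (m+n∸n≡m ((q ∸ (κ + κ + 14)) + (κ + 9)) lo)
      where open +-*-Solver

  level-weight : ∀ k → k ≤ q → 2 ^ k * weight i k ≡ 2 ^ q
  level-weight k h = trans (sym (^-distribˡ-+-* 2 k (q ∸ k))) (cong (2 ^_) (m+[n∸m]≡n h))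

  w : Bool → List Owned → ℕ → ℕ
  w o l j = weightAt i o l (lo + j)

  volume : List Owned → ℕ
  volume l = sumTo n (w false l)

  shifted : (ℕ → ℕ) → ℕ → ℕ
  shifted z j = z (lo + j)

  w-++ : ∀ o x l k → weightAt i o (x ++ l) k ≡ weightAt i o x k + weightAt i o l k
  w-++ o x l k = sumBy-++ _ x l

  InRange : Owned → Set
  InRange m = lo ≤ level m × level m < q

  spent-sum : ∀ z o l → All InRange l → spent i z o l ≡ sumTo n (λ j → (m + shifted z j) * w o l j)
  spent-sum z o [] [] = sym (sumTo-0 n (λ j _ → *-zeroʳ (m + shifted z j)))
  spent-sum z o (x ∷ l) ((h , h') ∷ hs) = trans (cong₂ _+_ (first (eqBool o (proj₁ x))) (spent-sum z o l hs))
    (sym (trans (sumTo-cong n (λ j _ → *-distribˡ-+ (m + shifted z j) _ (w o l j)))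
      (sumTo-+ n (λ j → (m + shifted z j) * (if matches o (lo + j) x then weight i (lo + j) else 0)) (λ j → (m + shifted z j) * w o l j))))
    where
    first : ∀ b → (if b then price i z (level x) else 0) ≡
      sumTo n (λ j → (m + shifted z j) * (if b ∧ eqN (level x) (lo + j) then weight i (lo + j) else 0))
    first true  = sym (sumTo-single lo n (level x) (λ k → m + z k) (weight i) h (≤-trans h' (≤-reflexive (sym (m+[n∸m]≡n lo≤q)))))
    first false = sym (sumTo-0 n (λ j _ → *-zeroʳ (m + shifted z j)))

  quiet-range : ∀ l → hasLow i l ≡ false → All (λ m → relevant i m ≡ true) l → All InRange l
  quiet-range [] e [] = []
  quiet-range (x ∷ l) e (r ∷ rs) with leq lo (level x) in eq
  ... | true = (leq-true _ _ eq , leq-false _ _ (flip (leq q (level x)) (proj₂ (∧-true (leq (length (proj₁ (proj₂ x))) q) _ r)))) ∷ quiet-range l e rs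
    where flip : ∀ b → not b ≡ true → b ≡ false
          flip false _ = refl

  hasLow-++ : ∀ x l → hasLow i (x ++ l) ≡ false → hasLow i x ≡ false × hasLow i l ≡ false
  hasLow-++ []      l e = refl , e
  hasLow-++ (m ∷ x) l e with not (leq lo (level m))
  ... | false = hasLow-++ x l e

  hasLow-quiet : ∀ {l} → All (λ m → lo ≤ level m) l → ∀ r → hasLow i (l ++ r) ≡ hasLow i r
  hasLow-quiet [] r = refl
  hasLow-quiet (h ∷ hs) r rewrite true-leq h = hasLow-quiet hs r

  hasLow-lows : ∀ l → hasLow i l ≡ true → 1 ≤ lows lo l
  hasLow-lows (m ∷ l) e with leq lo (level m)
  ... | true  = hasLow-lows l e
  ... | false = s≤s z≤n

  module G (t : ℕ) (z : ℕ → ℕ) = Game (answer i t) (price i z) (budget i) (movesOf i)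
  module GF (t : ℕ) (z : ℕ → ℕ) = GameFacts (answer i t) (price i z) (budget i) (movesOf i)

  price-pos : ∀ z k → 1 ≤ price i z k
  price-pos z k = *-mono-≤ (≤-trans (*-mono-≤ (*-mono-≤ 1≤P 1≤q) (s≤s (z≤n {255}))) (m≤m+n m (z k))) (1≤2^ (q ∸ k))

  -- The invariant after each response. `secure` states that the side taken is safe at the present
  -- spendings; `books` counts `pred t` intervals, as the current one is still open.
  record Good (d : Data) (l : List Owned) : Set where
    constructor good
    open Σ d renaming (proj₁ to t; proj₂ to zn)
    open Σ zn renaming (proj₁ to z; proj₂ to s)
    field
      started : 1 ≤ t
      marked  : s ≤ length l
      quiet   : hasLow i (recent s l) ≡ false
      opp≤    : spent i z false (recent s l) ≤ budget i
      own≤    : spent i z true (recent s l) ≤ budget i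
      secure  : G.safe t z (G.reach t z (fuel i)) (winner i d l) (map proj₂ l) (spent i z true (recent s l)) (spent i z false (recent s l)) ≡ true
      debts   : ∀ k → lo ≤ k → weightAt i true (older s l) k ≤ z k + weightAt i false (older s l) k
      books   : Account (pred t) (shifted z) (volume (older s l)) (lows lo (older s l))
      inside  : All (λ m → relevant i m ≡ true) l
  open Good public

  winner-older : ∀ t z s l l' → older s l ≡ older s l' → winner i (t , z , s) l ≡ winner i (t , z , s) l'
  winner-older t z s l l' e = cong (λ r → G.reach t z (suc (fuel i)) true (map proj₂ r) 0 0) e

  tagged : Hist → List Owned
  tagged = map (true ,_)

  total-spent : ∀ z l → spent i z true (tagged l) ≡ total (price i z) l
  total-spent z []      = refl
  total-spent z (x ∷ l) = cong (price i z (proj₂ x) +_) (total-spent z l)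

  none-spent : ∀ z l → spent i z false (tagged l) ≡ 0
  none-spent z []      = refl
  none-spent z (x ∷ l) = none-spent z l

  tagged-plain : ∀ l → map proj₂ (tagged l) ≡ l
  tagged-plain []      = refl
  tagged-plain (x ∷ l) = cong (x ∷_) (tagged-plain l)

  relevant-intro : ∀ o m → length (proj₁ m) ≤ q → proj₂ m < q → relevant i (o , m) ≡ true
  relevant-intro o m h h' = ∧-intro (true-leq h) (cong not (false-leq h'))

  -- From a position that its side can win, the reply leads to a safe one. All its moves belong to
  -- the current interval, so the accounts of the finished ones are untouched.
  close : ∀ t z s l → 1 ≤ t → s ≤ length l → hasLow i (recent s l) ≡ false →
    spent i z false (recent s l) ≤ budget i → spent i z true (recent s l) ≤ budget i →
    G.reach t z (suc (fuel i)) (winner i (t , z , s) l) (map proj₂ l) (spent i z true (recent s l)) (spent i z false (recent s l)) ≡ true →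
    (∀ k → lo ≤ k → weightAt i true (older s l) k ≤ z k + weightAt i false (older s l) k) →
    Account (pred t) (shifted z) (volume (older s l)) (lows lo (older s l)) →
    All (λ m → relevant i m ≡ true) l →
    Good (t , z , s) (tagged (reply i (t , z , s) l) ++ l) × All (_∈ movesOf i) (reply i (t , z , s) l)
  close t z s l ht hs hq ho hw hr hd hb hin = record
    { started = ht
    ; marked  = ≤-trans hs (≤-trans (m≤n+m (length l) (length (tagged r))) (≤-reflexive (sym (length-++ (tagged r)))))
    ; quiet   = trans (cong (hasLow i) rec) (trans (hasLow-quiet levels (recent s l)) hq)
    ; opp≤    = subst (_≤ budget i) (sym spF) ho
    ; own≤    = subst (_≤ budget i) (sym spT) le
    ; secure  = subst₂ (λ a b → G.safe t z (G.reach t z (fuel i)) a b (spent i z true (recent s l')) (spent i z false (recent s l')) ≡ true)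
        (winner-older t z s l l' (sym old)) (sym plain)
        (subst₂ (λ a b → G.safe t z (G.reach t z (fuel i)) (winner i (t , z , s) l) (r ++ map proj₂ l) a b ≡ true) (sym spT) (sym spF) sf)
    ; debts   = subst (λ o → ∀ k → lo ≤ k → weightAt i true o k ≤ z k + weightAt i false o k) (sym old) hd
    ; books   = subst (λ o → Account (pred t) (shifted z) (volume o) (lows lo o)) (sym old) hb
    ; inside  = All.++⁺ rel hin
    } , all
    where
    r = reply i (t , z , s) l
    l' = tagged r ++ l
    played = GF.play-safe t z (fuel i) (winner i (t , z , s) l) (map proj₂ l) (spent i z true (recent s l)) (spent i z false (recent s l)) hw hr
    sf  = proj₁ played
    all = proj₂ (proj₂ played)
    rec : recent s l' ≡ tagged r ++ recent s l
    rec = recent-++ s (tagged r) l hs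
    old : older s l' ≡ older s l
    old = older-++ s (tagged r) l hs
    levels : All (λ m → lo ≤ level m) (tagged r)
    levels = All.map⁺ (All.map (λ h → proj₁ (proj₂ (∈-movesOf i h))) all)
    rel : All (λ m → relevant i m ≡ true) (tagged r)
    rel = All.map⁺ (All.map (λ {m} h → let (a , _ , c) = ∈-movesOf i h in relevant-intro true m a c) all)
    spT : spent i z true (recent s l') ≡ spent i z true (recent s l) + total (price i z) r
    spT = trans (cong (spent i z true) rec) (trans (sumBy-++ _ (tagged r) (recent s l)) (trans (cong (_+ spent i z true (recent s l)) (total-spent z r)) (+-comm (total (price i z) r) _)))
    spF : spent i z false (recent s l') ≡ spent i z false (recent s l)
    spF = trans (cong (spent i z false) rec) (trans (sumBy-++ _ (tagged r) (recent s l)) (cong (_+ spent i z false (recent s l)) (none-spent z r)))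
    le = proj₁ (proj₂ played)
    plain : map proj₂ l' ≡ r ++ map proj₂ l
    plain = trans (map-++ proj₂ (tagged r) l) (cong (_++ map proj₂ l) (tagged-plain r))

  winner-reaches : ∀ t z s l → G.reach t z (suc (fuel i)) (winner i (t , z , s) l) (map proj₂ (older s l)) 0 0 ≡ true
  winner-reaches t z s l = GF.winning t z (price-pos z) (suc (fuel i)) (map proj₂ (older s l)) ≤-refl

-- One requirement through one response

-- A stage brings at most one event. So an interval is overspent by a single move at most, and the
-- weight in it stays near `P`.
data Opponent : List Owned → Set where
  none : Opponent []
  one  : ∀ v → Opponent ((false , v) ∷ [])

start₀ : Data
start₀ = 0 , (λ _ → 0) , 0

module Response (i : ℕ) where
  open Requirement i

  Low : Owned → Set
  Low x = proj₁ x ≡ true × level x < lo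

  record Bounded (l : List Owned) : Set where
    constructor bounded
    field
      opponent : ∀ k → k < q → count false k l * 8 ≤ 2 ^ k
      few      : lows lo l ≤ q * 32
  open Bounded public

  lo+j<q : ∀ j → j < n → lo + j < q
  lo+j<q j h = ≤-trans (+-monoʳ-< lo h) (≤-reflexive (m+[n∸m]≡n lo≤q))

  opponent-weight : ∀ l → (∀ k → k < q → count false k l * 8 ≤ 2 ^ k) → ∀ k → k < q → weightAt i false l k ≤ cap
  opponent-weight l h k lt = *-cancelʳ-≤ (weightAt i false l k) cap 8 (begin
    weightAt i false l k * 8           ≡⟨ cong (_* 8) (weight-count i false l k) ⟩
    count false k l * weight i k * 8   ≡⟨ solve 3 (λ a b c → a :* b :* c := a :* c :* b) refl (count false k l) (weight i k) 8 ⟩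
    count false k l * 8 * weight i k   ≤⟨ *-monoˡ-≤ (weight i k) (h k lt) ⟩
    2 ^ k * weight i k                 ≡⟨ level-weight k (<⇒≤ lt) ⟩
    2 ^ q                              ≡⟨ 2^q ⟩
    cap * 8                            ∎)
    where
    open ≤-Reasoning
    open +-*-Solver

  volume≤ : ∀ l → (∀ k → k < q → count false k l * 8 ≤ 2 ^ k) → volume l ≤ q * cap
  volume≤ l h = ≤-trans (sumTo-const n cap (λ j lt → opponent-weight l h (lo + j) (lo+j<q j lt))) (*-monoˡ-≤ cap (m∸n≤m q lo))

  sumBy-older : ∀ (f : Owned → ℕ) s l → sumBy f (older s l) ≤ sumBy f l
  sumBy-older f s l = subst (λ r → sumBy f (older s l) ≤ sumBy f r) (recent-older s l)
    (≤-trans (m≤n+m _ (sumBy f (recent s l))) (≤-reflexive (sym (sumBy-++ f (recent s l) (older s l)))))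

  older-bounded : ∀ s l → Bounded l → Bounded (older s l)
  older-bounded s l b = bounded
    (λ k lt → ≤-trans (*-monoˡ-≤ 8 (sumBy-older _ s l)) (opponent b k lt))
    (≤-trans (sumBy-older _ s l) (few b))

  renew-valid : ∀ d l → valid i d l ≡ true → renew i d l ≡ d
  renew-valid d l e = cong (λ b → if b then d else (suc (proj₁ d) , settle i (proj₁ (proj₂ d)) (recent (proj₂ (proj₂ d)) l) , length l)) e

  renew-invalid : ∀ t z s l → valid i (t , z , s) l ≡ false → renew i (t , z , s) l ≡ (suc t , settle i z (recent s l) , length l)
  renew-invalid t z s l e = cong (λ b → if b then (t , z , s) else (suc t , settle i z (recent s l) , length l)) e

  Response : Data → List Owned → Set
  Response d l = Good d (tagged (reply i d l) ++ l) × All (_∈ movesOf i) (reply i d l)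

  opening : ∀ t z l → 1 ≤ t →
    (∀ k → lo ≤ k → weightAt i true l k ≤ z k + weightAt i false l k) →
    Account (pred t) (shifted z) (volume l) (lows lo l) →
    All (λ x → relevant i x ≡ true) l → Response (t , z , length l) l
  opening t z l ht hd hb hin = close t z (length l) l ht ≤-refl
    (cong (hasLow i) (recent-all l))
    (≤-trans (≤-reflexive (cong (spent i z false) (recent-all l))) z≤n)
    (≤-trans (≤-reflexive (cong (spent i z true) (recent-all l))) z≤n)
    (subst₂ (λ r o → G.reach t z (suc (fuel i)) (winner i (t , z , length l) l) (map proj₂ o) (spent i z true r) (spent i z false r) ≡ true)
      (sym (recent-all l)) (older-all l) (winner-reaches t z (length l) l))
    (subst (λ o → ∀ k → lo ≤ k → weightAt i true o k ≤ z k + weightAt i false o k) (sym (older-all l)) hd)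
    (subst (λ o → Account (pred t) (shifted z) (volume o) (lows lo o)) (sym (older-all l)) hb)
    hin

  -- Before its first response only earlier requirements have moved for the strategy, all below
  -- `lo`. Hence settling interval 0 leaves no debt, whatever the opponent has done.
  first-response : ∀ l → All (λ x → proj₁ x ≡ true → level x < lo) l → All (λ x → relevant i x ≡ true) l →
    Response (renew i start₀ l) l
  first-response l hl hin = opening 1 (settle i (λ _ → 0) (recent 0 l)) l ≤-refl
    (λ k h → ≤-trans (≤-reflexive (none-at k h)) z≤n)
    (account (≤-trans (≤-reflexive (sumTo-0 n (λ j _ → cong₂ _*_ (settled j) (settled j)))) z≤n) z≤n)
    hin
    where
    none-at : ∀ k → lo ≤ k → weightAt i true l k ≡ 0
    none-at k h = sumBy-0 _ (All.map (λ {x} → zero-at {x}) hl)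
      where
      zero-at : ∀ {x} → (proj₁ x ≡ true → level x < lo) → (if matches true k x then weight i k else 0) ≡ 0
      zero-at {true , x}  g = cong (λ b → if b then weight i k else 0) (eqN-≢ (proj₂ x) k (λ e → <⇒≱ (g refl) (subst (lo ≤_) (sym e) h)))
      zero-at {false , x} g = refl
    settled : ∀ j → settle i (λ _ → 0) (recent 0 l) (lo + j) ≡ 0
    settled j = trans (cong (_∸ weightAt i false (recent 0 l) (lo + j))
      (trans (cong (λ r → weightAt i true r (lo + j)) (take-length l)) (none-at (lo + j) (m≤m+n lo j)))) (0∸n≡0 (weightAt i false (recent 0 l) (lo + j)))
      where
      take-length : ∀ (l : List Owned) → take (length l ∸ 0) l ≡ l
      take-length []      = refl
      take-length (x ∷ l) = cong (x ∷_) (take-length l)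

  low-nonempty : ∀ {ws} r → All Low ws → hasLow i (ws ++ r) ≡ false → ws ≡ []
  low-nonempty r [] e = refl
  low-nonempty r ((_ , h) ∷ hs) e rewrite false-leq h with e
  ... | ()

  module _ {t z s l} (g : Good (t , z , s) l) {ws vs} (hws : All Low ws) (hvs : Opponent vs) where

    private
      x l' new : List Owned
      x   = ws ++ vs
      l'  = x ++ l
      new = recent s l'
      rec : List Owned
      rec = recent s l
      new≡ : new ≡ x ++ rec
      new≡ = recent-++ s x l (marked g)
      old≡ : older s l' ≡ older s l
      old≡ = older-++ s x l (marked g)

    -- A valid interval has no low move, so `ws` is empty: at most one opponent move, within his
    -- budget, lies between this position and the last safe one.
    continue : All (λ x → relevant i x ≡ true) l' → valid i (t , z , s) l' ≡ true → Response (t , z , s) l'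
    continue hin e = go hvs (low-nonempty {ws} (vs ++ rec) hws (subst (λ r → hasLow i r ≡ false) (trans new≡ (++-assoc ws vs rec)) quiet'))
      where
      flip : ∀ b → not b ≡ true → b ≡ false
      flip false _ = refl
      e₁ = ∧-true (not (leq t 0)) _ e
      e₂ = ∧-true (not (hasLow i new)) _ (proj₂ e₁)
      quiet' : hasLow i new ≡ false
      quiet' = flip _ (proj₁ e₂)
      opp' : spent i z false new ≤ budget i
      opp' = leq-true _ _ (proj₂ e₂)
      Goal : List Owned → Set
      Goal l' = All (λ x → relevant i x ≡ true) l' → hasLow i (recent s l') ≡ false → spent i z false (recent s l') ≤ budget i → Response (t , z , s) l'
      finish : ∀ y → (recent s (y ++ l) ≡ y ++ rec) → (older s (y ++ l) ≡ older s l) → spent i z true (y ++ rec) ≡ spent i z true rec →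
        (hasLow i (y ++ rec) ≡ false → spent i z false (y ++ rec) ≤ budget i → All (λ x → relevant i x ≡ true) (y ++ l) →
          G.reach t z (suc (fuel i)) (winner i (t , z , s) l) (map proj₂ (y ++ l)) (spent i z true rec) (spent i z false (y ++ rec)) ≡ true) →
        Goal (y ++ l)
      finish y er eo es h hin hq ho = close t z s (y ++ l) (started g)
        (≤-trans (marked g) (≤-trans (m≤n+m (length l) (length y)) (≤-reflexive (sym (length-++ y))))) hq ho
        (subst (_≤ budget i) (sym (trans (cong (spent i z true) er) es)) (own≤ g))
        (subst₂ (λ X a → G.reach t z (suc (fuel i)) X (map proj₂ (y ++ l)) a (spent i z false (recent s (y ++ l))) ≡ true)
          (winner-older t z s l (y ++ l) (sym eo)) (sym (trans (cong (spent i z true) er) es))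
          (subst (λ r → G.reach t z (suc (fuel i)) (winner i (t , z , s) l) (map proj₂ (y ++ l)) (spent i z true rec) (spent i z false r) ≡ true) (sym er)
            (h (subst (λ r → hasLow i r ≡ false) er hq) (subst (λ r → spent i z false r ≤ budget i) er ho) hin)))
        (subst (λ o → ∀ k → lo ≤ k → weightAt i true o k ≤ z k + weightAt i false o k) (sym eo) (debts g))
        (subst (λ o → Account (pred t) (shifted z) (volume o) (lows lo o)) (sym eo) (books g))
        hin
      by : ∀ {vs} → Opponent vs → Goal (vs ++ l)
      by none = finish [] refl refl refl (λ _ _ _ → ∨-left (secure g))
      by (one v) = finish ((false , v) ∷ []) (recent-++ s ((false , v) ∷ []) l (marked g)) (older-++ s ((false , v) ∷ []) l (marked g)) refl λ hq ho hin →
        let rng = quiet-range ((false , v) ∷ []) (proj₁ (hasLow-++ ((false , v) ∷ []) rec hq)) (All.head hin ∷ [])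
            sz  = leq-true _ _ (proj₁ (∧-true (leq (length (proj₁ v)) q) _ (All.head hin)))
            comm = +-comm (price i z (proj₂ v)) (spent i z false rec)
        in GF.reach-step t z (fuel i) (winner i (t , z , s) l) (v ∷ map proj₂ l) (spent i z true rec) (price i z (proj₂ v) + spent i z false rec)
          (subst (λ b → G.reach t z (fuel i) (winner i (t , z , s) l) (v ∷ map proj₂ l) (spent i z true rec) b ≡ true) (sym comm)
            (GF.after t z (G.reach t z (fuel i)) (winner i (t , z , s) l) (map proj₂ l) (spent i z true rec) (spent i z false rec) {v}
              (secure g) (movesOf-∈ i (proj₁ v) (proj₂ v) sz (proj₁ (All.head rng)) (proj₂ (All.head rng)))
              (subst (_≤ budget i) comm ho)))
      go : Opponent vs → ws ≡ [] → Response (t , z , s) l'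
      go hv eq = subst (λ y → Goal (y ++ l)) (cong (_++ vs) (sym eq)) (by hv) hin quiet' opp'

    private
      a b : ℕ → ℕ
      a j = w true new j
      b j = w false new j

      ws-at : ∀ o j → (o ≡ true → ⊥) ⊎ (o ≡ true) → weightAt i o ws (lo + j) ≡ 0
      ws-at o j _ = sumBy-0 _ (All.map (λ {y} → zero-at {y}) hws)
        where
        zero-at : ∀ {y} → Low y → (if matches o (lo + j) y then weight i (lo + j) else 0) ≡ 0
        zero-at {p , y} (e , h) = trans (cong (λ b → if eqBool o p ∧ b then weight i (lo + j) else 0)
          (eqN-≢ (proj₂ y) (lo + j) (λ e' → <⇒≱ h (subst (lo ≤_) (sym e') (m≤m+n lo j))))) (never (eqBool o p))
          where never : ∀ c → (if c ∧ false then weight i (lo + j) else 0) ≡ 0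
                never true  = refl
                never false = refl

      x-own : ∀ j → w true x j ≡ 0
      x-own j = trans (w-++ true ws vs (lo + j)) (cong₂ _+_ (ws-at true j (inj₂ refl)) (vs-own hvs))
        where vs-own : ∀ {vs} → Opponent vs → w true vs j ≡ 0
              vs-own none    = refl
              vs-own (one v) = refl

      x-opp : ∀ j → w false x j ≤ u
      x-opp j = ≤-trans (≤-reflexive (trans (w-++ false ws vs (lo + j)) (cong (_+ w false vs j) (ws-at false j (inj₁ λ ()))))) (vs-opp hvs)
        where vs-opp : ∀ {vs} → Opponent vs → w false vs j ≤ u
              vs-opp none    = z≤n
              vs-opp (one v) = ≤-trans (≤-reflexive (+-identityʳ _)) (at-most (eqN (proj₂ v) (lo + j)))
                where at-most : ∀ c → (if c then weight i (lo + j) else 0) ≤ u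
                      at-most true  = weight≤u (lo + j) (m≤m+n lo j)
                      at-most false = z≤n

      rec-in : All InRange rec
      rec-in = quiet-range rec (quiet g) (All.take⁺ (length l ∸ s) (inside g))

      paid : ∀ o → spent i z o rec ≤ budget i → sumTo n (λ j → (m + shifted z j) * w o rec j) ≤ E
      paid o h = ≤-trans (≤-reflexive (sym (spent-sum z o rec rec-in))) h

      a≡ : ∀ j → a j ≡ w true rec j
      a≡ j = trans (cong (λ r → w true r j) new≡) (trans (w-++ true x rec (lo + j)) (cong (_+ w true rec j) (x-own j)))

      paid-a : sumTo n (λ j → (m + shifted z j) * a j) ≤ E
      paid-a = ≤-trans (≤-reflexive (sumTo-cong n (λ j _ → cong ((m + shifted z j) *_) (a≡ j)))) (paid true (own≤ g))

      b≤ : ∀ j → j < n → b j ≤ P + u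
      b≤ j lt = ≤-trans (≤-reflexive (trans (cong (λ r → w false r j) new≡) (trans (w-++ false x rec (lo + j)) (+-comm (w false x j) _))))
        (+-mono-≤ (paid-weight (books g) (w false rec) (λ _ → 0) (paid false (opp≤ g)) (λ _ _ → z≤n) j lt) (x-opp j))

      l'≡ : new ++ older s l ≡ l'
      l'≡ = trans (cong (new ++_) (sym old≡)) (recent-older s l')

      volume' : sumTo n b + volume (older s l) ≡ volume l'
      volume' = trans (sym (sumTo-+ n b (w false (older s l)))) (sumTo-cong n λ j _ →
        trans (sym (w-++ false new (older s l) (lo + j))) (cong (λ r → w false r j) l'≡))

      lows' : lows lo new + lows lo (older s l) ≡ lows lo l'
      lows' = trans (sym (sumBy-++ _ new (older s l))) (cong (lows lo) l'≡)

    -- A started interval is invalid either because of a low move or because of overspending, and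
    -- each reason has its own entry in the accounts.
    restart : All (λ x → relevant i x ≡ true) l' → Bounded l' → valid i (t , z , s) l' ≡ false →
      Response (suc t , settle i z new , length l') l'
    restart hin bd e = opening (suc t) (settle i z new) l' (s≤s z≤n) debts' books' hin
      where
      debts' : ∀ k → lo ≤ k → weightAt i true l' k ≤ settle i z new k + weightAt i false l' k
      debts' k h = begin
        weightAt i true l' k                                   ≡⟨ at′ true ⟩
        A + weightAt i true (older s l) k                      ≤⟨ +-monoʳ-≤ A (debts g k h) ⟩
        A + (z k + weightAt i false (older s l) k)             ≡⟨ solve 3 (λ a z v → a :+ (z :+ v) := z :+ a :+ v) refl A (z k) _ ⟩
        z k + A + weightAt i false (older s l) k               ≤⟨ +-monoˡ-≤ _ (m≤n+m∸n (z k + A) B) ⟩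
        B + (z k + A ∸ B) + weightAt i false (older s l) k     ≡⟨ solve 3 (λ b y v → b :+ y :+ v := y :+ (b :+ v)) refl B (z k + A ∸ B) _ ⟩
        z k + A ∸ B + (B + weightAt i false (older s l) k)     ≡⟨ cong (settle i z new k +_) (sym (at′ false)) ⟩
        settle i z new k + weightAt i false l' k               ∎
        where
        open ≤-Reasoning
        open +-*-Solver
        A = weightAt i true new k
        B = weightAt i false new k
        at′ : ∀ o → weightAt i o l' k ≡ weightAt i o new k + weightAt i o (older s l) k
        at′ o = trans (cong (λ r → weightAt i o r k) (sym l'≡)) (w-++ o new (older s l) k)
      ob : Bounded (older s l)
      ob = subst Bounded old≡ (older-bounded s l' bd)
      z≤ : ∀ j → j < n → shifted z j ≤ cap
      z≤ = debt-bound (books g) (volume≤ (older s l) (opponent ob)) (few ob)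
      t≡ : suc (pred t) ≡ t
      t≡ = suc-pred t {{>-nonZero (started g)}}
      repack : Account (suc (pred t)) (λ j → shifted z j + a j ∸ b j) (sumTo n b + volume (older s l)) (lows lo l') →
        Account t (shifted (settle i z new)) (volume l') (lows lo l')
      repack = subst₂ (λ t V → Account t (shifted (settle i z new)) V (lows lo l')) t≡ volume'
      books' : Account t (shifted (settle i z new)) (volume l') (lows lo l')
      books' = by (true-or-false (hasLow i new))
        where
        by : hasLow i new ≡ true ⊎ hasLow i new ≡ false → Account t (shifted (settle i z new)) (volume l') (lows lo l')
        by (inj₁ h) = repack (after-low (books g) a b paid-a b≤
            (subst (suc (lows lo (older s l)) ≤_) lows' (+-monoˡ-≤ (lows lo (older s l)) (hasLow-lows new h))))
        by (inj₂ h) = repack (after-overspending (books g) a b paid-a b≤ z≤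
            (≤-trans (<⇒≤ over) (≤-reflexive (spent-sum z false new (quiet-range new h (All.take⁺ (length l' ∸ s) hin)))))
            (subst (lows lo (older s l) ≤_) lows' (m≤n+m _ (lows lo new))))
          where
          over : budget i < spent i z false new
          over = leq-false _ _ (last-false (leq t 0) (hasLow i new) _ (false-leq (started g)) h e)
            where
            last-false : ∀ a b c → a ≡ false → b ≡ false → not a ∧ (not b ∧ c) ≡ false → c ≡ false
            last-false _ _ c refl refl e = e

    next-response : All (λ x → relevant i x ≡ true) l' → Bounded l' → Response (renew i (t , z , s) l') l'
    next-response hin bd = go (true-or-false (valid i (t , z , s) l'))
      where
      go : valid i (t , z , s) l' ≡ true ⊎ valid i (t , z , s) l' ≡ false → Response (renew i (t , z , s) l') l'
      go (inj₁ e) = subst (λ d → Response d l') (sym (renew-valid (t , z , s) l' e)) (continue hin e)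
      go (inj₂ e) = subst (λ d → Response d l') (sym (renew-invalid t z s l' e)) (restart hin bd e)

  module _ {t z s l} (g : Good (t , z , s) l) (bd : Bounded l) where
    private
      ob : Bounded (older s l)
      ob = older-bounded s l bd

    restarts-bound : pred t ≤ q⁴ * (256 * 72 + 32)
    restarts-bound = intervals-bound (books g) (volume≤ (older s l) (opponent ob)) (few ob)

    -- Weight at most `P` in the current interval, and in the finished ones at most the debt plus
    -- the opponent's weight, each at most `cap`. Together this is at most `3 * cap`, whereas half
    -- of 2^q is `4 * cap`.
    own-count : ∀ k → lo ≤ k → k < q → count true k l * 2 ≤ 2 ^ k
    own-count k h h' = *-cancelʳ-≤ (count true k l * 2) (2 ^ k) (weight i k) {{>-nonZero (1≤2^ (q ∸ k))}} (begin
      count true k l * 2 * weight i k     ≡⟨ solve 3 (λ a b c → a :* b :* c := a :* c :* b) refl (count true k l) 2 (weight i k) ⟩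
      count true k l * weight i k * 2     ≡⟨ cong (_* 2) (sym (weight-count i true l k)) ⟩
      weightAt i true l k * 2             ≡⟨ cong (λ r → weightAt i true r k * 2) (sym (recent-older s l)) ⟩
      weightAt i true (recent s l ++ older s l) k * 2 ≡⟨ cong (_* 2) (w-++ true (recent s l) (older s l) k) ⟩
      (weightAt i true (recent s l) k + weightAt i true (older s l) k) * 2
        ≤⟨ *-monoˡ-≤ 2 (+-mono-≤ now (≤-trans (debts g k h) (+-mono-≤ zk (opponent-weight (older s l) (opponent ob) k h')))) ⟩
      (P + (cap + cap)) * 2               ≤⟨ *-monoˡ-≤ 2 (+-monoˡ-≤ (cap + cap) P≤cap) ⟩
      (cap + (cap + cap)) * 2             ≤⟨ m≤m+n _ (cap * 2) ⟩
      (cap + (cap + cap)) * 2 + cap * 2   ≡⟨ solve 1 (λ c → (c :+ (c :+ c)) :* con 2 :+ c :* con 2 := c :* con 8) refl cap ⟩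
      cap * 8                             ≡⟨ sym 2^q ⟩
      2 ^ q                               ≡⟨ sym (level-weight k (<⇒≤ h')) ⟩
      2 ^ k * weight i k                  ∎)
      where
      open ≤-Reasoning
      open +-*-Solver
      j = k ∸ lo
      lo+j : lo + j ≡ k
      lo+j = m+[n∸m]≡n h
      j<n : j < n
      j<n = ∸-monoˡ-< h' h
      rec-in : All InRange (recent s l)
      rec-in = quiet-range (recent s l) (quiet g) (All.take⁺ (length l ∸ s) (inside g))
      now : weightAt i true (recent s l) k ≤ P
      now = subst (λ k → weightAt i true (recent s l) k ≤ P) lo+j
        (paid-weight (books g) (w true (recent s l)) (λ _ → 0) (≤-trans (≤-reflexive (sym (spent-sum z true (recent s l) rec-in))) (own≤ g)) (λ _ _ → z≤n) j j<n)
      zk : z k ≤ cap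
      zk = subst (λ k → z k ≤ cap) lo+j (debt-bound (books g) (volume≤ (older s l) (opponent ob)) (few ob) j j<n)
      P≤cap : P ≤ cap
      P≤cap = ≤-trans (≤-reflexive (sym (trans (cong (_* 1) (trans (*-identityʳ (P * 1)) (*-identityʳ P))) (*-identityʳ P))))
        (*-mono-≤ (*-mono-≤ (*-mono-≤ (≤-refl {P}) 1≤q) 1≤q) (s≤s (z≤n {2047})))

-- The number of opponent moves

toNat-bits : ∀ b → toNat (ℕᵇbits b) ≡ fromℕᵇ b
toNat-bits zeroᵇ    = refl
toNat-bits 2[1+ b ] rewrite toNat-bits b | +-identityʳ (fromℕᵇ b) | +-suc (fromℕᵇ b) (fromℕᵇ b) = refl
toNat-bits 1+[2 b ] rewrite toNat-bits b | +-identityʳ (fromℕᵇ b) = refl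

toNat-natBits : ∀ n → toNat (natBits n) ≡ n
toNat-natBits n = trans (toNat-bits (toℕᵇ n)) (toℕ-fromℕ n)

natBits-inj : ∀ {m n} → natBits m ≡ natBits n → m ≡ n
natBits-inj {m} {n} e = trans (sym (toNat-natBits m)) (trans (cong toNat e) (toNat-natBits n))

tails : Bool → List Bits → List Bits
tails b [] = []
tails b ([] ∷ l) = tails b l
tails b ((c ∷ x) ∷ l) = if eqBool b c then x ∷ tails b l else tails b l

tails-fresh : ∀ b {x} l → All (λ y → b ∷ x ≢ y) l → All (λ y → x ≢ y) (tails b l)
tails-fresh b [] [] = []
tails-fresh b ([] ∷ l) (_ ∷ h) = tails-fresh b l h
tails-fresh true  ((true ∷ x) ∷ l)  (p ∷ h) = (λ e → p (cong (true ∷_) e)) ∷ tails-fresh true l h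
tails-fresh true  ((false ∷ x) ∷ l) (p ∷ h) = tails-fresh true l h
tails-fresh false ((true ∷ x) ∷ l)  (p ∷ h) = tails-fresh false l h
tails-fresh false ((false ∷ x) ∷ l) (p ∷ h) = (λ e → p (cong (false ∷_) e)) ∷ tails-fresh false l h

tails-unique : ∀ b l → Unique l → Unique (tails b l)
tails-unique b [] u = []
tails-unique b ([] ∷ l) (_ ∷ u) = tails-unique b l u
tails-unique true  ((true ∷ x) ∷ l)  (p ∷ u) = tails-fresh true l p ∷ tails-unique true l u
tails-unique true  ((false ∷ x) ∷ l) (p ∷ u) = tails-unique true l u
tails-unique false ((true ∷ x) ∷ l)  (p ∷ u) = tails-unique false l u
tails-unique false ((false ∷ x) ∷ l) (p ∷ u) = tails-fresh false l p ∷ tails-unique false l u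

tails-length : ∀ b k l → All (λ x → length x ≡ suc k) l → All (λ x → length x ≡ k) (tails b l)
tails-length b k [] [] = []
tails-length true  k ((true ∷ x) ∷ l)  (refl ∷ h) = refl ∷ tails-length true k l h
tails-length true  k ((false ∷ x) ∷ l) (_ ∷ h)    = tails-length true k l h
tails-length false k ((true ∷ x) ∷ l)  (_ ∷ h)    = tails-length false k l h
tails-length false k ((false ∷ x) ∷ l) (refl ∷ h) = refl ∷ tails-length false k l h

tails-split : ∀ k l → All (λ x → length x ≡ suc k) l → length l ≡ length (tails true l) + length (tails false l)
tails-split k [] [] = refl
tails-split k ((true ∷ x) ∷ l)  (_ ∷ h) = cong suc (tails-split k l h)
tails-split k ((false ∷ x) ∷ l) (_ ∷ h) = trans (cong suc (tails-split k l h)) (sym (+-suc _ _))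

-- Pigeonhole by splitting the list according to the first bit.
unique-bound : ∀ k l → All (λ x → length x ≡ k) l → Unique l → length l ≤ 2 ^ k
unique-bound zero [] h u = z≤n
unique-bound zero (_ ∷ []) h u = ≤-refl
unique-bound zero ([] ∷ [] ∷ l) h ((p ∷ _) ∷ u) = ⊥-elim (p refl)
unique-bound zero ((_ ∷ _) ∷ _ ∷ _) (() ∷ _) u
unique-bound zero ([] ∷ (_ ∷ _) ∷ _) (_ ∷ () ∷ _) u
unique-bound (suc k) l h u = ≤-trans (≤-reflexive (tails-split k l h))
  (+-mono-≤ (unique-bound k (tails true l) (tails-length true k l h) (tails-unique true l u))
    (≤-trans (unique-bound k (tails false l) (tails-length false k l h) (tails-unique false l u)) (≤-reflexive (sym (+-identityʳ _)))))

haltsIn-zero : ∀ c x {a} → haltsIn c 0 x ≡ just a → haltedC c x ≡ true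
haltsIn-zero c x e with haltedC c x
haltsIn-zero c x e  | true = refl
haltsIn-zero c x () | false

haltsIn-suc : ∀ c t x {a} → haltsIn c (suc t) x ≡ just a → haltedC c x ≡ false × haltsIn c t (stepC noOracle c x) ≡ just a
haltsIn-suc c t x e with haltedC c x
haltsIn-suc c t x () | true
haltsIn-suc c t x e  | false = refl , e

haltsIn-unique : ∀ c s t x {a b} → haltsIn c s x ≡ just a → haltsIn c t x ≡ just b → s ≡ t
haltsIn-unique c zero    zero    x e e' = refl
haltsIn-unique c (suc s) zero    x e e' with trans (sym (haltsIn-zero c x e')) (proj₁ (haltsIn-suc c s x e))
... | ()
haltsIn-unique c zero    (suc t) x e e' with trans (sym (haltsIn-zero c x e)) (proj₁ (haltsIn-suc c t x e'))
... | ()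
haltsIn-unique c (suc s) (suc t) x e e' =
  cong suc (haltsIn-unique c s t (stepC noOracle c x) (proj₂ (haltsIn-suc c s x e)) (proj₂ (haltsIn-suc c t x e')))

program : ℕ → Bits
program s = proj₂ (unary (natBits s))

clock : ℕ → ℕ
clock s = proj₁ (unary (natBits s))

event-inv : ∀ s {w k} → event s ≡ just (w , k) →
  encUnary (clock s) ++ program s ≡ natBits s × vRun (program s) (clock s) ≡ just w × k ≡ 3 + length (program s)
event-inv s {w} {k} e = go (true-or-false (eqBits (encUnary (clock s) ++ program s) (natBits s)))
  where
  run : vEvent (clock s , program s) ≡ just (w , k) → vRun (program s) (clock s) ≡ just w × k ≡ 3 + length (program s)
  run e with vRun (program s) (clock s)
  run refl | just _ = refl , refl
  go : eqBits (encUnary (clock s) ++ program s) (natBits s) ≡ true ⊎ eqBits (encUnary (clock s) ++ program s) (natBits s) ≡ false →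
    encUnary (clock s) ++ program s ≡ natBits s × vRun (program s) (clock s) ≡ just w × k ≡ 3 + length (program s)
  go (inj₁ q) = eqBits-true _ _ q , run (trans (sym (cong (λ b → if b then vEvent (unary (natBits s)) else nothing) q)) e)
  go (inj₂ q) with trans (sym (cong (λ b → if b then vEvent (unary (natBits s)) else nothing) q)) e
  ... | ()

-- The halting time is unique and `eventOf` accepts canonical codes only, so the program determines
-- the number of its event.
program-inj : ∀ s s' {m m'} → event s ≡ just m → event s' ≡ just m' → program s ≡ program s' → s ≡ s'
program-inj s s' e e' h =
  let (a , b , _) = event-inv s e
      (a' , b' , _) = event-inv s' e'
      t≡ = haltsIn-unique (proj₁ (parse (program s))) (clock s) (clock s') (startC (proj₂ (parse (program s)))) b
             (subst (λ p → vRun p (clock s') ≡ just _) (sym h) b')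
  in natBits-inj (trans (sym a) (trans (cong₂ (λ t p → encUnary t ++ p) t≡ h) a'))

atLevel : ℕ → Maybe Move' → Bool
atLevel k = maybe (λ m → eqN (proj₂ m) k) false

programs : ℕ → ℕ → List Bits
programs k zero    = []
programs k (suc s) = if atLevel k (event s) then program s ∷ programs k s else programs k s

opponents : ℕ → ℕ → ℕ
opponents k zero    = 0
opponents k (suc s) = (if atLevel k (event s) then 1 else 0) + opponents k s

opponents-programs : ∀ k s → opponents k s ≡ length (programs k s)
opponents-programs k zero = refl
opponents-programs k (suc s) with atLevel k (event s)
... | true  = cong suc (opponents-programs k s)
... | false = opponents-programs k s

atLevel-true : ∀ k e → atLevel k e ≡ true → ∃ λ w → e ≡ just (w , k)
atLevel-true k (just (w , k')) e = w , cong (λ k → just (w , k)) (eqN-true k' k e)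

programs-length : ∀ k s → All (λ p → 3 + length p ≡ k) (programs k s)
programs-length k zero = []
programs-length k (suc s) with atLevel k (event s) in e
... | true  = let (w , e') = atLevel-true k (event s) e in sym (proj₂ (proj₂ (event-inv s e'))) ∷ programs-length k s
... | false = programs-length k s

programs-fresh : ∀ k s r {w} → s ≤ r → event r ≡ just w → All (λ p → program r ≢ p) (programs k s)
programs-fresh k zero    r h e = []
programs-fresh k (suc s) r h e with atLevel k (event s) in e'
... | true  = (λ q → <-irrefl (sym (program-inj r s e (proj₂ (atLevel-true k (event s) e')) q)) h) ∷ programs-fresh k s r (<⇒≤ h) e
... | false = programs-fresh k s r (<⇒≤ h) e

programs-unique : ∀ k s → Unique (programs k s)
programs-unique k zero = []
programs-unique k (suc s) with atLevel k (event s) in e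
... | true  = programs-fresh k s s ≤-refl (proj₂ (atLevel-true k (event s) e)) ∷ programs-unique k s
... | false = programs-unique k s

-- Events at level k belong to distinct programs of length k - 3: this is where the prefix `111`
-- turns into the opponent's share of one eighth.
opponents-bound : ∀ k s → opponents k s * 8 ≤ 2 ^ k
opponents-bound k s = go (programs k s) refl (programs-length k s) (programs-unique k s)
  where
  go : ∀ l → l ≡ programs k s → All (λ p → 3 + length p ≡ k) l → Unique l → opponents k s * 8 ≤ 2 ^ k
  go [] e h u = ≤-trans (≤-reflexive (cong (_* 8) (trans (opponents-programs k s) (cong length (sym e))))) z≤n
  go (p ∷ l) e h u = ≤-trans (*-monoˡ-≤ 8 (≤-trans (≤-reflexive (trans (opponents-programs k s) (cong length (sym e))))
      (unique-bound (length p) (p ∷ l) (All.map (λ {x} e → +-cancelˡ-≡ 3 (length x) (length p) (trans e (sym (All.head h)))) h) u)))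
    (≤-reflexive (trans (*-comm (2 ^ length p) 8) (trans (sym (^-distribˡ-+-* 2 3 (length p))) (cong (2 ^_) (All.head h)))))

-- The stages

opaque
  -- An opaque copy of `stage`, handled through its equations, so that the strategy is not unfolded
  -- by the type checker.
  staged : ℕ → Global
  staged = stage

  staged-≡ : ∀ s → staged s ≡ stage s
  staged-≡ s = refl

  staged-zero : staged 0 ≡ ([] , λ _ → start₀)
  staged-zero = refl

  staged-suc : ∀ s → staged (suc s) ≡ respondAll (suc s) (addEvent (event s) (staged s))
  staged-suc s = refl

hist : ℕ → List Owned
hist s = proj₁ (staged s)

dat : ℕ → ℕ → Data
dat s = proj₂ (staged s)

arrivals : Maybe Move' → List Owned
arrivals nothing  = []
arrivals (just v) = (false , v) ∷ []

addEvent-hist : ∀ e h f → addEvent e (h , f) ≡ (arrivals e ++ h , f)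
addEvent-hist nothing  h f = refl
addEvent-hist (just v) h f = refl

setAt-same : ∀ i d f → setAt i d f i ≡ d
setAt-same i d f = cong (λ b → if b then d else f i) (eqN-refl i)

setAt-other : ∀ i d f j → (i ≡ j → ⊥) → setAt i d f j ≡ f j
setAt-other i d f j h = cong (λ b → if b then d else f j) (eqN-≢ i j h)

Origin : ℕ → Owned → Set
Origin i x = lowest i ≤ level x × level x < size′ i × length (proj₁ (proj₂ x)) ≤ size′ i

scale-mono : ∀ {i j} → i ≤ j → scale i ≤ scale j
scale-mono {i} {j} h = subst (λ j → scale i ≤ scale j) (m+[n∸m]≡n h) (go (j ∸ i))
  where
  go : ∀ d → scale i ≤ scale (i + d)
  go zero rewrite +-identityʳ i = ≤-refl
  go (suc d) rewrite +-suc i d = ≤-trans (go d) (≤-trans (≤-trans (m≤m+n _ _) (m≤m+n _ 14)) (double≤2^ (scale (i + d)) (scale-large (i + d))))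

-- `size′ i` is `scale (suc i)`, so each range ends before the next one begins.
size≤lowest : ∀ {i j} → i < j → size′ i ≤ lowest j
size≤lowest h = ≤-trans (scale-mono h) (m≤m+n _ 5)

size-mono : ∀ {i j} → i ≤ j → size′ i ≤ size′ j
size-mono h = ^-monoʳ-≤ 2 (scale-mono h)

reply-origin : ∀ i d l → All (λ m → Origin i (true , m)) (reply i d l)
reply-origin i (t , z , s) l = All.map (λ h → let (a , b , c) = ∈-movesOf i h in b , c , a)
  (GameFacts.play-moves (answer i t) (price i z) (budget i) (movesOf i) (suc (fuel i)) (winner i (t , z , s) l)
    (map proj₂ l) (spent i z true (recent s l)) (spent i z false (recent s l)))

record Added (i j : ℕ) (g g' : Global) : Set where
  constructor added
  field
    news  : List Owned
    hist≡ : proj₁ g' ≡ news ++ proj₁ g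
    from  : All (λ x → proj₁ x ≡ true × ∃ λ r → i ≤ r × r < j × Origin r x) news
    kept  : ∀ r → (r < i ⊎ j ≤ r) → proj₂ g' r ≡ proj₂ g r
open Added

respond-added : ∀ i g → Added i (suc i) g (respond i g)
respond-added i (h , f) = added (map (true ,_) r) refl
  (All.map⁺ (All.map (λ o → refl , i , ≤-refl , ≤-refl , o) (reply-origin i d (view i h))))
  λ j c → setAt-other i d f j (other j c)
  where
  d = renew i (f i) (view i h)
  r = reply i d (view i h)
  other : ∀ j → (j < i ⊎ suc i ≤ j) → i ≡ j → ⊥
  other j (inj₁ lt) refl = <-irrefl refl lt
  other j (inj₂ lt) refl = <-irrefl refl lt

added-refl : ∀ i g → Added i i g g
added-refl i g = added [] refl [] (λ _ _ → refl)

added-trans : ∀ {i j k g g' g''} → i ≤ j → j ≤ k → Added i j g g' → Added j k g' g'' → Added i k g g''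
added-trans {i} {j} {k} ij jk a b = added (news b ++ news a)
  (trans (hist≡ b) (trans (cong (news b ++_) (hist≡ a)) (sym (++-assoc (news b) (news a) _))))
  (All.++⁺ (All.map (λ { (e , r , p , q , o) → e , r , ≤-trans ij p , q , o }) (from b))
           (All.map (λ { (e , r , p , q , o) → e , r , p , ≤-trans q jk , o }) (from a)))
  λ r c → trans (kept b r (upper r c)) (kept a r (lower r c))
  where
  upper : ∀ r → r < i ⊎ k ≤ r → r < j ⊎ k ≤ r
  upper r (inj₁ h) = inj₁ (≤-trans h ij)
  upper r (inj₂ h) = inj₂ h
  lower : ∀ r → r < i ⊎ k ≤ r → r < i ⊎ j ≤ r
  lower r (inj₁ h) = inj₁ h
  lower r (inj₂ h) = inj₂ (≤-trans jk h)

respondAll-added : ∀ i d g → Added i (i + d) (respondAll i g) (respondAll (i + d) g)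
respondAll-added i zero g = subst (λ k → Added i k (respondAll i g) (respondAll k g)) (sym (+-identityʳ i)) (added-refl i (respondAll i g))
respondAll-added i (suc d) g = subst (λ k → Added i k (respondAll i g) (respondAll k g)) (sym (+-suc i d))
  (added-trans {g = respondAll i g} {g' = respondAll (i + d) g} {g'' = respondAll (suc (i + d)) g}
    (m≤m+n i d) (n≤1+n (i + d)) (respondAll-added i d g) (respond-added (i + d) (respondAll (i + d) g)))

arrived : ℕ → Global
arrived s = arrivals (event s) ++ hist s , dat s

stage-suc : ∀ s → staged (suc s) ≡ respondAll (suc s) (arrived s)
stage-suc s = trans (staged-suc s) (cong (respondAll (suc s)) (addEvent-hist (event s) (hist s) (dat s)))

stage-added : ∀ s → Added 0 (suc s) (arrived s) (staged (suc s))
stage-added s = subst (Added 0 (suc s) (arrived s)) (sym (stage-suc s)) (respondAll-added 0 (suc s) (arrived s))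

-- Every requirement at every stage

count-none : ∀ o k {l} → All (λ x → matches o k x ≡ false) l → count o k l ≡ 0
count-none o k h = sumBy-0 _ (All.map (λ e → cong (λ b → if b then 1 else 0) e) h)

count-false-news : ∀ k {P : Owned → Set} {l} → All (λ x → proj₁ x ≡ true × P x) l → count false k l ≡ 0
count-false-news k h = count-none false k (All.map (λ { (refl , _) → refl }) h)

count-arrivals : ∀ k e → count false k (arrivals e) ≡ (if atLevel k e then 1 else 0)
count-arrivals k nothing  = refl
count-arrivals k (just v) = +-identityʳ _

hist-suc : ∀ s → hist (suc s) ≡ news (stage-added s) ++ (arrivals (event s) ++ hist s)
hist-suc s = hist≡ (stage-added s)

count-opponents : ∀ k s → count false k (hist s) ≡ opponents k s
count-opponents k zero    = cong (λ g → count false k (proj₁ g)) staged-zero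
count-opponents k (suc s) = begin
  count false k (hist (suc s))                    ≡⟨ cong (count false k) (hist-suc s) ⟩
  count false k (x ++ (arrivals (event s) ++ hist s)) ≡⟨ sumBy-++ _ x (arrivals (event s) ++ hist s) ⟩
  count false k x + count false k (arrivals (event s) ++ hist s)
    ≡⟨ cong₂ _+_ (count-false-news k (from (stage-added s))) (sumBy-++ _ (arrivals (event s)) (hist s)) ⟩
  count false k (arrivals (event s)) + count false k (hist s)
    ≡⟨ cong₂ _+_ (count-arrivals k (event s)) (count-opponents k s) ⟩
  opponents k (suc s) ∎
  where
  open ≡-Reasoning
  x = news (stage-added s)

Sourced : ℕ → Owned → Set
Sourced s x = proj₁ x ≡ true → ∃ λ r → r < s × Origin r x

hist-lawful : ∀ s → All (Sourced s) (hist s)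
hist-lawful zero    = subst (λ g → All (Sourced 0) (proj₁ g)) (sym staged-zero) []
hist-lawful (suc s) = subst (All (Sourced (suc s))) (sym (hist-suc s))
  (All.++⁺ (All.map (λ { (_ , r , _ , lt , o) _ → r , lt , o }) (from (stage-added s)))
    (All.++⁺ (arrivals-lawful (event s)) (All.map (λ {x} → later {x}) (hist-lawful s))))
  where
  later : ∀ {x} → Sourced s x → Sourced (suc s) x
  later h e = let (r , lt , o) = h e in r , m≤n⇒m≤1+n lt , o
  arrivals-lawful : ∀ e → All (Sourced (suc s)) (arrivals e)
  arrivals-lawful nothing  = []
  arrivals-lawful (just v) = (λ ()) ∷ []

All-filterB : ∀ {P : Owned → Set} p {l} → All P l → All P (filterB p l)
All-filterB p [] = []
All-filterB p {x ∷ l} (h ∷ hs) with p x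
... | true  = h ∷ All-filterB p hs
... | false = All-filterB p hs

view-arrivals : ∀ i e → Opponent (view i (arrivals e))
view-arrivals i nothing = none
view-arrivals i (just v) with relevant i (false , v)
... | true  = one v
... | false = none

-- The induction hypothesis passed from requirement to requirement: below its range the strategy has
-- kept to half of the words of each length. This limits the low moves that the i-th requirement has
-- to endure.
OwnBelow : ℕ → Set
OwnBelow i = ∀ s k → k < lowest i → count true k (hist s) * 2 ≤ 2 ^ k

powers : ∀ n → sumTo n (2 ^_) ≤ 2 ^ n
powers zero    = z≤n
powers (suc n) = +-monoʳ-≤ (2 ^ n) (≤-trans (powers n) (≤-reflexive (sym (+-identityʳ _))))

both-counts : ∀ a b p → a * 8 ≤ p → b * 2 ≤ p → a + b ≤ p
both-counts a b p ha hb = *-cancelʳ-≤ (a + b) p 8 (begin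
  (a + b) * 8        ≡⟨ solve 2 (λ a b → (a :+ b) :* con 8 := a :* con 8 :+ b :* con 2 :* con 4) refl a b ⟩
  a * 8 + b * 2 * 4  ≤⟨ +-mono-≤ ha (*-monoˡ-≤ 4 hb) ⟩
  p + p * 4          ≤⟨ m≤m+n _ (p * 3) ⟩
  p + p * 4 + p * 3  ≡⟨ solve 1 (λ p → p :+ p :* con 4 :+ p :* con 3 := p :* con 8) refl p ⟩
  p * 8              ∎)
  where
  open ≤-Reasoning
  open +-*-Solver

module Stages (i : ℕ) where
  open Requirement i
  open Response i

  -- Both players together keep below 2^k moves at each level, hence at most 2^lo = 32 q below the
  -- range. This is the 32 of `Accounts`.
  lows-hist : OwnBelow i → ∀ s → lows lo (hist s) ≤ q * 32
  lows-hist own s = begin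
    lows lo (hist s)  ≡⟨ lows-count lo (hist s) ⟩
    sumTo lo (λ k → count false k (hist s) + count true k (hist s))
      ≤⟨ sumTo-mono lo (λ k lt → both-counts (count false k (hist s)) (count true k (hist s)) (2 ^ k)
           (subst (λ c → c * 8 ≤ 2 ^ k) (sym (count-opponents k s)) (opponents-bound k s)) (own s k lt)) ⟩
    sumTo lo (2 ^_)   ≤⟨ powers lo ⟩
    2 ^ lo            ≡⟨ ^-distribˡ-+-* 2 κ 5 ⟩
    q * 32            ∎
    where open ≤-Reasoning

  part-bounded : OwnBelow i → ∀ s x l → hist s ≡ x ++ l → Bounded (view i l)
  part-bounded own s x l e = bounded
    (λ k _ → ≤-trans (*-monoˡ-≤ 8 (part≤ _)) (subst (λ c → c * 8 ≤ 2 ^ k) (sym (count-opponents k s)) (opponents-bound k s)))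
    (≤-trans (part≤ _) (lows-hist own s))
    where
    part≤ : ∀ (f : Owned → ℕ) → sumBy f (view i l) ≤ sumBy f (hist s)
    part≤ f = ≤-trans (sumBy-filterB (relevant i) f l) (≤-trans (m≤n+m _ (sumBy f x))
      (≤-reflexive (sym (trans (cong (sumBy f) e) (sumBy-++ f x l)))))

  origin-relevant : ∀ {x r} → r ≤ i → Origin r x → relevant i x ≡ true
  origin-relevant {o , m} h (_ , b , c) = relevant-intro o m (≤-trans c (size-mono h)) (≤-trans b (size-mono h))

  later-irrelevant : ∀ {x r} → i < r → Origin r x → relevant i x ≡ false
  later-irrelevant {o , m} h (a , _ , _) = trans
    (cong (λ b → leq (length (proj₁ m)) (size′ i) ∧ not b) (true-leq (≤-trans (size≤lowest h) a))) (never _)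
    where never : ∀ b → b ∧ false ≡ false
          never true  = refl
          never false = refl

  -- ws are the moves of earlier requirements in this stage, pre the moves from the i-th requirement's response on.
  record Turn (d d' : Data) (vs h h' : List Owned) : Set where
    field
      ws rest pre : List Owned
    before : List Owned
    before = view i rest
    field
      ws-low  : All Low ws
      before≡ : before ≡ (ws ++ view i vs) ++ view i h
      split≡  : h' ≡ pre ++ rest
      view≡   : view i h' ≡ tagged (reply i (renew i d before) before) ++ before
      dat≡    : d' ≡ renew i d before
  open Turn

  turn-of : ∀ {d d' vs h h'} (ws rest later : List Owned) (r : Hist) →
    rest ≡ ws ++ (vs ++ h) → h' ≡ later ++ (tagged r ++ rest) →
    r ≡ reply i (renew i d (view i rest)) (view i rest) → d' ≡ renew i d (view i rest) →
    All Low ws → All (λ x → relevant i x ≡ false) later → All (λ m → Origin i (true , m)) r → Turn d d' vs h h'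
  turn-of {d} {vs = us} {h} ws rest later r e e' er ed hws hl hr = record
    { ws      = view i ws
    ; rest    = rest
    ; pre     = later ++ tagged r
    ; ws-low  = All-filterB (relevant i) hws
    ; before≡ = trans (cong (view i) e) (trans (filterB-++ (relevant i) ws (us ++ h))
        (trans (cong (view i ws ++_) (filterB-++ (relevant i) us h)) (sym (++-assoc (view i ws) (view i us) (view i h)))))
    ; split≡  = trans e' (sym (++-assoc later (tagged r) rest))
    ; view≡   = trans (cong (view i) e') (trans (filterB-++ (relevant i) later (tagged r ++ rest))
        (trans (cong (_++ view i (tagged r ++ rest)) (filterB-none (relevant i) hl))
          (trans (filterB-++ (relevant i) (tagged r) rest)
            (trans (cong (_++ view i rest) (filterB-all (relevant i) (All.map⁺ (All.map (λ {m} o → origin-relevant {true , m} ≤-refl o) hr))))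
              (cong (λ r → tagged r ++ view i rest) er)))))
    ; dat≡    = ed
    }

  respond-≡ : ∀ g → respond i g ≡
    (tagged (reply i (renew i (proj₂ g i) (view i (proj₁ g))) (view i (proj₁ g))) ++ proj₁ g ,
      setAt i (renew i (proj₂ g i) (view i (proj₁ g))) (proj₂ g))
  respond-≡ (h , f) = refl

  turn-between : ∀ {j vs h f} g g' → Added 0 i (vs ++ h , f) g → Added (suc i) j (respond i g) g' →
    Turn (f i) (proj₂ g' i) vs h (proj₁ g')
  turn-between {f = f} g g' ga gb = turn-of (news ga) (proj₁ g) (news gb) (reply i (renew i (proj₂ g i) V) V)
    (hist≡ ga) (trans (hist≡ gb) (cong (λ x → news gb ++ proj₁ x) (respond-≡ g)))
    (cong (λ d → reply i (renew i d V) V) (kept ga i (inj₂ ≤-refl)))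
    (trans (kept gb i (inj₁ ≤-refl)) (trans (cong (λ x → proj₂ x i) (respond-≡ g))
      (trans (setAt-same i (renew i (proj₂ g i) V) (proj₂ g)) (cong (λ d → renew i d V) (kept ga i (inj₂ ≤-refl))))))
    (All.map (λ { (e , _ , _ , lt , (_ , b , _)) → e , ≤-trans b (size≤lowest lt) }) (from ga))
    (All.map (λ { {x} (_ , _ , lt , _ , o) → later-irrelevant {x} lt o }) (from gb))
    (reply-origin i (renew i (proj₂ g i) V) V)
    where
    V : List Owned
    V = view i (proj₁ g)

  TurnAt : ℕ → Set
  TurnAt s = Turn (dat s i) (dat (suc s) i) (arrivals (event s)) (hist s) (hist (suc s))

  turn : ∀ s → i ≤ s → TurnAt s
  turn s le = turn-between (respondAll i (arrived s)) (staged (suc s)) (respondAll-added 0 i (arrived s))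
    (subst₂ (λ k g → Added (suc i) k (respondAll (suc i) (arrived s)) g) (cong suc (m+[n∸m]≡n le))
      (trans (cong (λ k → respondAll k (arrived s)) (cong suc (m+[n∸m]≡n le))) (sym (stage-suc s)))
      (respondAll-added (suc i) (s ∸ i) (arrived s)))

  view-inside : ∀ h → All (λ x → relevant i x ≡ true) (view i h)
  view-inside h = filterB-holds (relevant i) h

  good-after : ∀ {d d' vs h h'} (T : Turn d d' vs h h') → Response (renew i d (before T)) (before T) → Good d' (view i h')
  good-after T (g , _) = subst₂ Good (sym (dat≡ T)) (sym (view≡ T)) g

  response-to : ∀ d {ws vs l} → Good d l → All Low ws → Opponent vs →
    All (λ x → relevant i x ≡ true) ((ws ++ vs) ++ l) → Bounded ((ws ++ vs) ++ l) →
    Response (renew i d ((ws ++ vs) ++ l)) ((ws ++ vs) ++ l)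
  response-to (t , z , s) {ws} {us} {l} g hws hvs = next-response {t} {z} {s} {l} g {ws} {us} hws hvs

  good-next : ∀ {d d' e h h'} → Turn d d' (arrivals e) h h' → (∀ x l → h' ≡ x ++ l → Bounded (view i l)) →
    Good d (view i h) → Good d' (view i h')
  good-next {d} {e = e} {h} T bd g = good-after T (subst (λ l → Response (renew i d l) l) (sym (before≡ T))
    (response-to d g (ws-low T) (view-arrivals i e)
      (subst (All (λ x → relevant i x ≡ true)) (before≡ T) (view-inside (rest T)))
      (subst Bounded (before≡ T) (bd (pre T) (rest T) (split≡ T)))))

  good-first : ∀ {d' e h h'} → Turn start₀ d' (arrivals e) h h' → All (λ x → proj₁ x ≡ true → level x < lo) h → Good d' (view i h')
  good-first {e = e} T hl = good-after T (first-response (before T)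
    (subst (All (λ x → proj₁ x ≡ true → level x < lo)) (sym (before≡ T))
      (All.++⁺ (All.++⁺ (All.map (λ { (_ , h) _ → h }) (ws-low T)) (quiet-arrivals (view-arrivals i e))) (All-filterB (relevant i) hl)))
    (view-inside (rest T)))
    where
    quiet-arrivals : ∀ {vs} → Opponent vs → All (λ x → proj₁ x ≡ true → level x < lo) vs
    quiet-arrivals none    = []
    quiet-arrivals (one v) = (λ ()) ∷ []

  data Phase (s : ℕ) : Set where
    idle : s ≤ i → dat s i ≡ start₀ → Phase s
    live : i < s → Good (dat s i) (view i (hist s)) → Phase s

  own-low : ∀ s → s ≤ i → All (λ x → proj₁ x ≡ true → level x < lo) (hist s)
  own-low s le = All.map (λ {x} → low {x}) (hist-lawful s)
    where
    low : ∀ {x} → Sourced s x → proj₁ x ≡ true → level x < lo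
    low h e = let (r , lt , (_ , b , _)) = h e in ≤-trans b (size≤lowest (≤-trans lt le))

  phase-suc : OwnBelow i → ∀ s → Phase s → Phase (suc s)
  phase-suc own s (live lt g) = live (m≤n⇒m≤1+n lt) (good-next {dat s i} {dat (suc s) i} {event s} {hist s} {hist (suc s)} (turn s (<⇒≤ lt)) (part-bounded own (suc s)) g)
  phase-suc own s (idle le e) = split (m≤n⇒m<n∨m≡n le)
    where
    split : s < i ⊎ s ≡ i → Phase (suc s)
    split (inj₁ lt) = idle lt (trans (kept (stage-added s) i (inj₂ lt)) e)
    split (inj₂ eq) = live (s≤s (≤-reflexive (sym eq)))
      (good-first {dat (suc s) i} {event s} {hist s} {hist (suc s)} (subst (λ d → Turn d (dat (suc s) i) (arrivals (event s)) (hist s) (hist (suc s))) e (turn s (≤-reflexive (sym eq)))) (own-low s le))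

  phase : OwnBelow i → ∀ s → Phase s
  phase own zero    = idle z≤n (cong (λ g → proj₂ g i) staged-zero)
  phase own (suc s) = phase-suc own s (phase own s)

  count-view : ∀ k {h} → All (λ x → matches true k x ≡ true → relevant i x ≡ true) h → count true k (view i h) ≡ count true k h
  count-view k [] = refl
  count-view k {x ∷ h} (p ∷ ps) = by (true-or-false (relevant i x)) (true-or-false (matches true k x))
    where
    by : relevant i x ≡ true ⊎ relevant i x ≡ false → matches true k x ≡ true ⊎ matches true k x ≡ false →
      count true k (view i (x ∷ h)) ≡ count true k (x ∷ h)
    by (inj₁ r) _ = trans (cong (λ b → count true k (if b then x ∷ view i h else view i h)) r)
      (cong ((if matches true k x then 1 else 0) +_) (count-view k ps))
    by (inj₂ r) (inj₁ e) = ⊥-elim (absurd (trans (sym (p e)) r))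
      where absurd : true ≡ false → ⊥
            absurd ()
    by (inj₂ r) (inj₂ e) = trans (cong (λ b → count true k (if b then x ∷ view i h else view i h)) r)
      (trans (count-view k ps) (cong (λ b → (if b then 1 else 0) + count true k h) (sym e)))

matches-true : ∀ k x → matches true k x ≡ true → proj₁ x ≡ true × level x ≡ k
matches-true k (true , m)  e = refl , eqN-true _ _ e

no-own : ∀ s k → (∀ r → lowest r ≤ k → k < size′ r → ⊥) → count true k (hist s) * 2 ≤ 2 ^ k
no-own s k h = ≤-trans (≤-reflexive (cong (_* 2) (count-none true k (All.map (λ {x} → never {x}) (hist-lawful s))))) z≤n
  where
  never : ∀ {x} → Sourced s x → matches true k x ≡ false
  never {x} l = by (true-or-false (matches true k x))
    where
    by : matches true k x ≡ true ⊎ matches true k x ≡ false → matches true k x ≡ false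
    by (inj₂ e) = e
    by (inj₁ e) = let (a , b) = matches-true k x e
                      (r , _ , (c , d , _)) = l a
                  in ⊥-elim (h r (subst (lowest r ≤_) b c) (subst (_< size′ r) b d))

-- No level is used by two requirements. In the range of `i` its own invariant gives the bound, and
-- in the gap before the next range the strategy never moves.
own-below-suc : ∀ i → OwnBelow i → OwnBelow (suc i)
own-below-suc i own s k lt = by (<-≤-connex k (lowest i)) (<-≤-connex k (size′ i))
  where
  open Stages i
  open Requirement i using (lo; q; Good)
  open Response i using (own-count)
  apart : ∀ r → lowest r ≤ k → k < size′ r → lowest i ≤ k → k < size′ i → r ≡ i
  apart r a b c d = go (<-cmp r i)
    where
    open import Data.Nat.Properties using (<-cmp)
    open import Relation.Binary.Definitions using (Tri; tri<; tri≈; tri>)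
    go : Tri (r < i) (r ≡ i) (r > i) → r ≡ i
    go (tri< l _ _) = ⊥-elim (<⇒≱ b (≤-trans (size≤lowest l) c))
    go (tri≈ _ e _) = e
    go (tri> _ _ g) = ⊥-elim (<⇒≱ d (≤-trans (size≤lowest g) a))
  by : k < lowest i ⊎ lowest i ≤ k → k < size′ i ⊎ size′ i ≤ k → count true k (hist s) * 2 ≤ 2 ^ k
  by (inj₁ l) _ = own s k l
  by (inj₂ g) (inj₁ l) = level-in (phase own s)
    where
    level-in : Phase s → count true k (hist s) * 2 ≤ 2 ^ k
    level-in (idle le _) = ≤-trans (≤-reflexive (cong (_* 2) (count-none true k (All.map (λ {x} → never {x}) (hist-lawful s))))) z≤n
      where
      never : ∀ {x} → Sourced s x → matches true k x ≡ false
      never {x} h = decide (true-or-false (matches true k x))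
        where
        decide : matches true k x ≡ true ⊎ matches true k x ≡ false → matches true k x ≡ false
        decide (inj₂ e) = e
        decide (inj₁ e) = let (a , b) = matches-true k x e
                              (r , lt , (c , d , _)) = h a
                              eq = apart r (subst (lowest r ≤_) b c) (subst (_< size′ r) b d) g l
                          in ⊥-elim (<⇒≱ lt (subst (s ≤_) (sym eq) le))
    level-in (live _ gd) = subst (λ c → c * 2 ≤ 2 ^ k) (count-view k (All.map (λ {x} → inside′ {x}) (hist-lawful s)))
      (own-count gd (part-bounded own s [] (hist s) refl) k g l)
      where
      inside′ : ∀ {x} → Sourced s x → matches true k x ≡ true → relevant i x ≡ true
      inside′ {x} h e = let (a , b) = matches-true k x e
                            (r , lt , o@(c , d , _)) = h a
                            eq = apart r (subst (lowest r ≤_) b c) (subst (_< size′ r) b d) g l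
                        in origin-relevant {x} (≤-reflexive eq) o
  by (inj₂ g) (inj₂ g') = no-own s k λ r a b → [ (λ l → <⇒≱ b (≤-trans (size-mono (≤-pred l)) g')) , (λ h → <⇒≱ lt (≤-trans (+-monoˡ-≤ 5 (scale-mono h)) a)) ]′ (<-≤-connex r (suc i))
    where open import Data.Sum using ([_,_]′)

own-below : ∀ i → OwnBelow i
own-below zero s k lt = no-own s k λ r a _ → <⇒≱ lt (≤-trans (+-monoˡ-≤ 5 (scale-mono (z≤n {r}))) a)
own-below (suc i) = own-below-suc i (own-below i)

-- Growth and stabilisation of the history

hist-grows : ∀ {s s'} → s ≤ s' → ∃ λ x → hist s' ≡ x ++ hist s
hist-grows {s} {s'} h = subst (λ r → ∃ λ x → hist r ≡ x ++ hist s) (m+[n∸m]≡n h) (go (s' ∸ s))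
  where
  go : ∀ d → ∃ λ x → hist (s + d) ≡ x ++ hist s
  go zero    = [] , cong hist (+-identityʳ s)
  go (suc d) =
    let (x , e) = go d
        y = news (stage-added (s + d))
        v = arrivals (event (s + d))
    in y ++ (v ++ x) , trans (cong hist (+-suc s d)) (trans (hist-suc (s + d))
         (trans (cong (λ h → y ++ (v ++ h)) e) (trans (cong (y ++_) (sym (++-assoc v x (hist s)))) (sym (++-assoc y (v ++ x) (hist s))))))

∈-hist-grows : ∀ {s s' x} → s ≤ s' → x ∈ hist s → x ∈ hist s'
∈-hist-grows {x = x} h p = let (y , e) = hist-grows h in subst (x ∈_) (sym e) (∈-++⁺ʳ y p)

view-grows : ∀ i {s s'} → s ≤ s' → ∃ λ x → view i (hist s') ≡ x ++ view i (hist s)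
view-grows i {s} h = let (x , e) = hist-grows h in view i x , trans (cong (view i) e) (filterB-++ (relevant i) x (hist s))

event-∈ : ∀ s {m} → event s ≡ just m → (false , m) ∈ hist (suc s)
event-∈ s {m} e = subst ((false , m) ∈_) (sym (hist-suc s)) (∈-++⁺ʳ (news (stage-added s))
  (∈-++⁺ˡ (subst (λ e → (false , m) ∈ arrivals e) (sym e) (here refl))))

∈-event : ∀ s {m} → (false , m) ∈ hist s → ∃ λ r → event r ≡ just m
∈-event zero {m} p with subst (λ g → (false , m) ∈ proj₁ g) staged-zero p
... | ()
∈-event (suc s) {m} p = split (∈-++⁻ (news (stage-added s)) (subst ((false , m) ∈_) (hist-suc s) p))
  where
  arrival : ∀ e → (false , m) ∈ arrivals e → e ≡ just m
  arrival (just _) (here refl) = refl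
  own : ∀ {P : Owned → Set} {l} → All (λ x → proj₁ x ≡ true × P x) l → (false , m) ∈ l → ⊥
  own ((() , _) ∷ _) (here refl)
  own (_ ∷ h) (there q) = own h q
  split : (false , m) ∈ news (stage-added s) ⊎ (false , m) ∈ arrivals (event s) ++ hist s → ∃ λ r → event r ≡ just m
  split (inj₁ q) = ⊥-elim (own (from (stage-added s)) q)
  split (inj₂ q) with ∈-++⁻ (arrivals (event s)) q
  ... | inj₁ q' = s , arrival (event s) q'
  ... | inj₂ q' = ∈-event s q'

own-all : ∀ i s k → k < size′ i → count true k (hist s) * 2 ≤ 2 ^ k
own-all i s k lt = own-below (suc i) s k (≤-trans lt (size≤lowest {i} ≤-refl))

length-lows : ∀ i {l} → All (λ x → relevant i x ≡ true) l → length l ≤ lows (size′ i) l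
length-lows i [] = z≤n
length-lows i {x ∷ l} (r ∷ rs) with leq (size′ i) (level x) | ∧-true (leq (length (proj₁ (proj₂ x))) (size′ i)) _ r
... | false | _ = s≤s (length-lows i rs)
... | true  | _ , ()

view-length : ∀ i s → length (view i (hist s)) ≤ 2 ^ size′ i
view-length i s = begin
  length (view i (hist s))  ≤⟨ length-lows i (filterB-holds (relevant i) (hist s)) ⟩
  lows q (view i (hist s))  ≤⟨ sumBy-filterB (relevant i) _ (hist s) ⟩
  lows q (hist s)           ≡⟨ lows-count q (hist s) ⟩
  sumTo q (λ k → count false k (hist s) + count true k (hist s))
    ≤⟨ sumTo-mono q (λ k lt → both-counts (count false k (hist s)) (count true k (hist s)) (2 ^ k)
         (subst (λ c → c * 8 ≤ 2 ^ k) (sym (count-opponents k s)) (opponents-bound k s)) (own-all i s k lt)) ⟩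
  sumTo q (2 ^_)            ≤⟨ powers q ⟩
  2 ^ q                     ∎
  where
  open ≤-Reasoning
  q = size′ i

-- Each increase uses up part of the remaining room below `B`. Whether another increase follows is
-- not decidable, hence the double negation.
eventually-constant : ∀ (f : ℕ → ℕ) B → (∀ {s s'} → s ≤ s' → f s ≤ f s') → (∀ s → f s ≤ B) →
  ¬ ¬ (∃ λ N → ∀ r → N ≤ r → f r ≡ f N)
eventually-constant f B mono bound no = go B 0 (m≤m+n B (f 0))
  where
  go : ∀ d s → B ≤ d + f s → ⊥
  go zero    s h = no (s , λ r le → ≤-antisym (≤-trans (bound r) h) (mono le))
  go (suc d) s h = no (s , λ r le → decidable-stable (f r ≟ f s) λ ne →
    go d r (≤-trans h (≤-trans (≤-reflexive (sym (+-suc d (f s)))) (+-monoʳ-≤ d (≤∧≢⇒< (mono le) (λ e → ne (sym e)))))))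

Final : ℕ → ℕ → Set
Final i N = i < N × (∀ r → N ≤ r → view i (hist r) ≡ view i (hist N))

final-stage : ∀ i → ¬ ¬ (∃ λ N → Final i N)
final-stage i no = eventually-constant (λ s → length (view i (hist s))) (2 ^ size′ i) mono (view-length i)
  λ (N , const) → no (N + suc i , m≤n+m (suc i) N , λ r le → same le (trans (const r (≤-trans (m≤m+n N (suc i)) le)) (sym (const (N + suc i) (m≤m+n N (suc i))))))
  where
  mono : ∀ {s s'} → s ≤ s' → length (view i (hist s)) ≤ length (view i (hist s'))
  mono {s} h = let (x , e) = view-grows i h in
    ≤-trans (m≤n+m _ (length x)) (≤-reflexive (sym (trans (cong length e) (length-++ x))))
  nothing-new : ∀ (x : List Owned) {l} → length (x ++ l) ≡ length l → x ++ l ≡ l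
  nothing-new [] e = refl
  nothing-new (y ∷ x) {l} e = ⊥-elim (<-irrefl (sym e) (s≤s (≤-trans (m≤n+m (length l) (length x)) (≤-reflexive (sym (length-++ x))))))
  same : ∀ {N r} → N ≤ r → length (view i (hist r)) ≡ length (view i (hist N)) → view i (hist r) ≡ view i (hist N)
  same h e = let (x , e') = view-grows i h in trans e' (nothing-new x (trans (sym (cong length e')) e))

final-∈ : ∀ i {N s x} → Final i N → relevant i x ≡ true → x ∈ hist s → x ∈ view i (hist N)
final-∈ i {N} {s} {x} (_ , const) r p = subst (x ∈_) (const (N + s) (m≤m+n N s))
  (∈-filterB (relevant i) (hist (N + s)) (∈-hist-grows (m≤n+m s N) p) r)

-- The current interval and its winner

module _ (i : ℕ) where
  open Requirement i
  open Response i
  open Stages i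

  winnerAt : ℕ → Bool
  winnerAt s = winner i (dat s i) (view i (hist s))

  interval : ℕ → ℕ
  interval s = proj₁ (dat s i)

  renew-cases : ∀ d l → renew i d l ≡ d ⊎ proj₁ d < proj₁ (renew i d l)
  renew-cases (t , z , s) l = by (true-or-false (valid i (t , z , s) l))
    where
    by : valid i (t , z , s) l ≡ true ⊎ valid i (t , z , s) l ≡ false →
      renew i (t , z , s) l ≡ (t , z , s) ⊎ t < proj₁ (renew i (t , z , s) l)
    by (inj₁ e) = inj₁ (renew-valid (t , z , s) l e)
    by (inj₂ e) = inj₂ (≤-reflexive (sym (cong proj₁ (renew-invalid t z s l e))))

  same-or-later : ∀ {s} → i < s → ∀ d → dat (s + d) i ≡ dat s i ⊎ interval s < interval (s + d)
  same-or-later {s} h zero    = inj₁ (cong (λ r → dat r i) (+-identityʳ s))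
  same-or-later {s} h (suc d) = subst (λ r → dat r i ≡ dat s i ⊎ interval s < interval r) (sym (+-suc s d))
    (combine (same-or-later h d) (subst (λ x → x ≡ dat (s + d) i ⊎ interval (s + d) < proj₁ x) (sym (Turn.dat≡ T))
      (renew-cases (dat (s + d) i) (Turn.before T))))
    where
    T = turn (s + d) (≤-trans (<⇒≤ h) (m≤m+n s d))
    combine : dat (s + d) i ≡ dat s i ⊎ interval s < interval (s + d) →
      dat (suc (s + d)) i ≡ dat (s + d) i ⊎ interval (s + d) < interval (suc (s + d)) →
      dat (suc (s + d)) i ≡ dat s i ⊎ interval s < interval (suc (s + d))
    combine (inj₁ a) (inj₁ b) = inj₁ (trans b a)
    combine (inj₁ a) (inj₂ b) = inj₂ (subst (λ t → t < interval (suc (s + d))) (cong proj₁ a) b)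
    combine (inj₂ a) (inj₁ b) = inj₂ (subst (λ t → interval s < t) (sym (cong proj₁ b)) a)
    combine (inj₂ a) (inj₂ b) = inj₂ (<-trans a b)

  alive : ∀ {s} → i < s → Good (dat s i) (view i (hist s))
  alive {s} h = go (phase (own-below i) s)
    where
    go : Phase s → Good (dat s i) (view i (hist s))
    go (idle le _) = ⊥-elim (<⇒≱ h le)
    go (live _ g)  = g

  winner-grows : ∀ d d' x {l l'} → Good d l → d' ≡ d → l' ≡ x ++ l → winner i d l ≡ winner i d' l'
  winner-grows (t , z , n) _ x {l} g refl refl = winner-older t z n l (x ++ l) (sym (older-++ n x l (marked g)))

  good-answer : ∀ d l → Good d l → answer i (proj₁ d) (map proj₂ l) ≡ winner i d l
  good-answer (t , z , n) l g = GF.safe-answer t z (G.reach t z (fuel i)) (winner i (t , z , n) l) (map proj₂ l)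
    (spent i z true (recent n l)) (spent i z false (recent n l)) (secure g)

  good-interval : ∀ d l → Good d l → Bounded l → pred (proj₁ d) ≤ q⁴ * (256 * 72 + 32)
  good-interval (t , z , n) l g b = restarts-bound g b

  winner-stable′ : ∀ {s} → i < s → ∀ d → interval s ≡ interval (s + d) → winnerAt s ≡ winnerAt (s + d)
  winner-stable′ {s} h d e = by (same-or-later h d)
    where
    by : dat (s + d) i ≡ dat s i ⊎ interval s < interval (s + d) → winnerAt s ≡ winnerAt (s + d)
    by (inj₂ lt) = ⊥-elim (<-irrefl e lt)
    by (inj₁ eq) = let (x , e') = view-grows i (m≤m+n s d) in
      winner-grows (dat s i) (dat (s + d) i) x {view i (hist s)} {view i (hist (s + d))} (alive h) eq e'

  -- An instance may halt at any stage of its interval. Interval numbers change only upwards, so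
  -- equal numbers mean the same interval and the same winner.
  winner-stable : ∀ {s s'} → i < s → i < s' → interval s ≡ interval s' → winnerAt s ≡ winnerAt s'
  winner-stable {s} {s'} h h' e = by (≤-total s s')
    where
    later : ∀ {s s'} → i < s → s ≤ s' → interval s ≡ interval s' → winnerAt s ≡ winnerAt s'
    later {s} {s'} h le e = subst (λ r → winnerAt s ≡ winnerAt r) (m+[n∸m]≡n le)
      (winner-stable′ h (s' ∸ s) (trans e (cong interval (sym (m+[n∸m]≡n le)))))
    by : s ≤ s' ⊎ s' ≤ s → winnerAt s ≡ winnerAt s'
    by (inj₁ le) = later h le e
    by (inj₂ le) = sym (later h' le (sym e))

  instance-query : ∀ t s → instance′ (query′ i t) s ≡ haltsNow i t (staged s)
  instance-query t s = trans (cong (haltsNow (proj₁ (unary (query′ i t))) (toNat (proj₂ (unary (query′ i t))))) (sym (staged-≡ s))) (trans (cong (λ r → haltsNow (proj₁ r) (toNat (proj₂ r)) (staged s)) (unary-enc i (natBits t)))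
    (cong (λ t → haltsNow i t (staged s)) (toNat-natBits t)))

  answered : ℕ → ℕ → Bool
  answered t s = eqN t (interval s) ∧ (not (leq t 0) ∧ not (winnerAt s))

  instance-false : ∀ {N} → i < N → winnerAt N ≡ false → instance′ (query′ i (interval N)) N ≡ just []
  instance-false {N} h e = trans (instance-query (interval N) N) (cong (λ b → if b then just [] else nothing) holds)
    where
    positive : ∀ {t} → 1 ≤ t → not (leq t 0) ≡ true
    positive (s≤s _) = refl
    holds : answered (interval N) N ≡ true
    holds = ∧-intro (eqN-refl (interval N)) (∧-intro (positive (started (alive h))) (cong not e))

  -- Numbers of intervals are positive as soon as the requirement is active and 0 before, so the
  -- stage where the instance halts lies in the interval current at `N`.
  false-instance : ∀ {N s v} → i < N → instance′ (query′ i (interval N)) s ≡ just v → winnerAt N ≡ false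
  false-instance {N} {s} {v} h e = conclude (∧-true (eqN t (interval s)) _ holds)
    where
    t : ℕ
    t = interval N
    taken : ∀ b → (if b then just [] else nothing) ≡ just v → b ≡ true
    taken true  _ = refl
    holds : answered t s ≡ true
    holds = taken (answered t s) (trans (sym (instance-query t s)) e)
    negate : ∀ {b} → not b ≡ true → b ≡ false
    negate {false} _ = refl
    conclude : eqN t (interval s) ≡ true × not (leq t 0) ∧ not (winnerAt s) ≡ true → winnerAt N ≡ false
    conclude (a , b) =
      let (c , d) = ∧-true (not (leq t 0)) _ b
          same = eqN-true t (interval s) a
      in trans (winner-stable h (i<s same (negate c) (phase (own-below i) s)) same) (negate d)
      where
      i<s : t ≡ interval s → leq t 0 ≡ false → Phase s → i < s
      i<s same pos (live lt _) = lt
      i<s same pos (idle le e') = ⊥-elim (<⇒≱ (leq-false t 0 pos) (≤-reflexive (trans same (cong proj₁ e'))))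

  answer-final : ∀ {N} → i < N → answer i (interval N) (map proj₂ (view i (hist N))) ≡ winnerAt N
  answer-final {N} h = good-answer (dat N i) (view i (hist N)) (alive h)

  interval-bound : ∀ {N} → i < N → pred (interval N) ≤ q⁴ * (256 * 72 + 32)
  interval-bound {N} h = good-interval (dat N i) (view i (hist N)) (alive h) (part-bounded (own-below i) N [] (hist N) refl)

-- The oracle

toBinary : Bits → ℕᵇ
toBinary []          = zeroᵇ
toBinary (true ∷ b)  = 2[1+ toBinary b ]
toBinary (false ∷ b) = 1+[2 toBinary b ]

bits-toBinary : ∀ b → ℕᵇbits (toBinary b) ≡ b
bits-toBinary []          = refl
bits-toBinary (true ∷ b)  = cong (true ∷_) (bits-toBinary b)
bits-toBinary (false ∷ b) = cong (false ∷_) (bits-toBinary b)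

natBits-toNat : ∀ b → natBits (toNat b) ≡ b
natBits-toNat b = trans (cong natBits (trans (cong toNat (sym (bits-toBinary b))) (toNat-bits (toBinary b))))
  (trans (cong ℕᵇbits (fromℕ-toℕ (toBinary b))) (bits-toBinary b))

doubled : Bits → Bits
doubled = concatMap (λ b → b ∷ b ∷ [])

unpair-doubled : ∀ x b → unpair (doubled x ++ false ∷ true ∷ b) nothing ≡ just (x , b)
unpair-doubled []          b = refl
unpair-doubled (true ∷ x)  b rewrite unpair-doubled x b = refl
unpair-doubled (false ∷ x) b rewrite unpair-doubled x b = refl

unpair-inv : ∀ w {x b} → unpair w nothing ≡ just (x , b) → w ≡ doubled x ++ false ∷ true ∷ b
unpair-inv [] ()
unpair-inv (_ ∷ []) ()
unpair-inv (true ∷ true ∷ w) e with unpair w nothing in e'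
unpair-inv (true ∷ true ∷ w) refl | just _ = cong (λ w → true ∷ true ∷ w) (unpair-inv w e')
unpair-inv (true ∷ false ∷ w) ()
unpair-inv (false ∷ true ∷ w) refl = refl
unpair-inv (false ∷ false ∷ w) e with unpair w nothing in e'
unpair-inv (false ∷ false ∷ w) refl | just _ = cong (λ w → false ∷ false ∷ w) (unpair-inv w e')

length-doubled : ∀ x y → length x ≤ length (doubled x ++ y)
length-doubled []      y = z≤n
length-doubled (b ∷ x) y = s≤s (m≤n⇒m≤1+n (length-doubled x y))

value-onto : ∀ k j → j < 2 ^ k → ∃ λ b → length b ≡ k × value b ≡ j
value-onto zero    zero h = [] , refl , refl
value-onto zero    (suc j) (s≤s ())
value-onto (suc k) j h = by (<-≤-connex j (2 ^ k))
  where
  by : j < 2 ^ k ⊎ 2 ^ k ≤ j → ∃ λ b → length b ≡ suc k × value b ≡ j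
  by (inj₁ lt) = let (b , e , e') = value-onto k j lt in false ∷ b , cong suc e , e'
  by (inj₂ le) =
    let (b , e , e') = value-onto k (j ∸ 2 ^ k) (+-cancelʳ-< (2 ^ k) _ _ (subst₂ _<_ (sym (m∸n+n≡m le)) (cong (2 ^ k +_) (+-identityʳ (2 ^ k))) h))
    in true ∷ b , cong suc e , trans (cong₂ _+_ (cong (2 ^_) e) e') (m+[n∸m]≡n le)

nth-∈ : ∀ l j {x} → nthMove l j ≡ just x → ∃₂ λ o k → (o , (x , k)) ∈ l
nth-∈ ((o , (_ , k)) ∷ l) zero    refl = o , k , here refl
nth-∈ (_ ∷ l)             (suc j) e    = let (o , k , p) = nth-∈ l j e in o , k , there p

∈-nth : ∀ l {o x k} → (o , (x , k)) ∈ l → ∃ λ j → j < length l × nthMove l j ≡ just x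
∈-nth (_ ∷ l) (here refl) = 0 , s≤s z≤n , refl
∈-nth (_ ∷ l) (there p)   = let (j , h , e) = ∈-nth l p in suc j , s≤s h , e

nth-++ : ∀ l r j {x} → nthMove l j ≡ just x → nthMove (l ++ r) j ≡ just x
nth-++ (_ ∷ l) r zero    e = e
nth-++ (_ ∷ l) r (suc j) e = nth-++ l r j e

issued-++ : ∀ k x l → issued k (x ++ l) ≡ issued k l ++ issued k x
issued-++ k x l = trans (cong reverse (filterB-++ (matches true k) x l)) (reverse-++ (filterB (matches true k) x) _)

length-issued : ∀ k l → length (issued k l) ≡ count true k l
length-issued k l = trans (length-reverse (filterB (matches true k) l)) (go l)
  where
  go : ∀ l → length (filterB (matches true k) l) ≡ count true k l
  go [] = refl
  go (x ∷ l) with matches true k x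
  ... | true  = cong suc (go l)
  ... | false = go l

∈-issued : ∀ k l {x} → x ∈ issued k l → x ∈ l × matches true k x ≡ true
∈-issued k l p = filterB-∈ (matches true k) l (Any.reverse⁻ p)

issued-∈ : ∀ k l {x} → x ∈ l → matches true k x ≡ true → x ∈ issued k l
issued-∈ k l p e = Any.reverse⁺ (∈-filterB (matches true k) l p e)

first-just : ∀ {A : Set} (f : ℕ → Maybe A) s {v} → f s ≡ just v → ∃₂ λ r w → (∀ i → i < r → f i ≡ nothing) × f r ≡ just w
first-just {A} f s e = go s 0 (λ _ ()) (trans (cong f (+-identityʳ s)) e)
  where
  go : ∀ d r {v} → (∀ i → i < r → f i ≡ nothing) → f (d + r) ≡ just v → ∃₂ λ r w → (∀ i → i < r → f i ≡ nothing) × f r ≡ just w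
  go d r h e with f r in e'
  ... | just w = r , w , h , e'
  go zero r h e | nothing with trans (sym e') e
  ... | ()
  go (suc d) r h e | nothing = go d (suc r) (λ i lt → [ (λ lt → h i lt) , (λ eq → trans (cong f eq) e') ]′ (m≤n⇒m<n∨m≡n (≤-pred lt)))
    (trans (cong f (+-suc d r)) e)
    where open import Data.Sum using ([_,_]′)

reversed-just : ∀ m {v} → mapMaybe′ reverse m ≡ just v → ∃ λ x → m ≡ just x × v ≡ reverse x
reversed-just (just x) refl = x , refl , refl

-- The search stops at its first success, which may come before stage `s`; therefore all successes
-- have to agree.
outputs-intro : ∀ p s x → decompress p s ≡ just (reverse x) → (∀ r v → decompress p r ≡ just v → v ≡ reverse x) → Outputs U p x
outputs-intro p s x e same =
  let (r , v , h , e') = first-just (decompress p) s e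
  in subst (Outputs U p) (reverse-involutive x)
       (search-complete decompressT p r (reverse x) h (trans e' (cong just (same r v e'))))

outputs-elim : ∀ p x → Outputs U p x → ∃ λ s → decompress p s ≡ just (reverse x)
outputs-elim p x (n , c , st , h , e) =
  let (s , v , _ , e' , e″) = search-sound decompressT p n c st h
  in s , trans e' (cong just (trans (sym (reverse-involutive v)) (cong reverse (trans (sym e″) e))))

opponent-outputs : ∀ s x k → event s ≡ just (x , k) → ∃ λ p → length p ≡ k × Outputs U p x
opponent-outputs s x k e =
  let (_ , run , k≡) = event-inv s e
      p = true ∷ true ∷ true ∷ program s
  in p , sym k≡ , outputs-intro p (clock s) x (map-just {reverse} run) λ r v e' →
       let (y , run' , v≡) = reversed-just (vRun (program s) r) e'
           r≡ = haltsIn-unique (proj₁ (parse (program s))) r (clock s) (startC (proj₂ (parse (program s)))) run' run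
           y≡ = just-injective (trans (sym run') (trans (cong (vRun (program s)) r≡) run))
       in trans v≡ (cong reverse y≡)

own-word : ∀ b s → decompress (false ∷ b) s ≡ mapMaybe′ reverse (nthMove (issued (suc (length b)) (hist s)) (value b))
own-word b s = cong (λ g → mapMaybe′ reverse (nthMove (issued (suc (length b)) (proj₁ g)) (value b))) (sym (staged-≡ s))

nth-stable : ∀ k j r s {x y} → nthMove (issued k (hist r)) j ≡ just x → nthMove (issued k (hist s)) j ≡ just y → x ≡ y
nth-stable k j r s e e' = by (≤-total r s)
  where
  later : ∀ {r s x} → r ≤ s → nthMove (issued k (hist r)) j ≡ just x → nthMove (issued k (hist s)) j ≡ just x
  later {r} {s} h e = let (y , eq) = hist-grows h in
    trans (cong (λ l → nthMove l j) (trans (cong (issued k) eq) (issued-++ k y (hist r)))) (nth-++ (issued k (hist r)) (issued k y) j e)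
  by : r ≤ s ⊎ s ≤ r → _ ≡ _
  by (inj₁ h) = just-injective (trans (sym (later h e)) e')
  by (inj₂ h) = just-injective (trans (sym e) (later h e'))

-- There are 2^(k - 1) programs `0b` of length k, exactly as many as the bound on the strategy's
-- moves allows. At level 0 the bound leaves no move at all.
own-outputs : ∀ s x k → count true k (hist s) * 2 ≤ 2 ^ k → (true , (x , k)) ∈ hist s → ∃ λ p → length p ≡ k × Outputs U p x
own-outputs s x k h m = by k h (∈-nth (issued k (hist s)) (issued-∈ k (hist s) m (eqN-refl k)))
  where
  by : ∀ k → count true k (hist s) * 2 ≤ 2 ^ k → (∃ λ j → j < length (issued k (hist s)) × nthMove (issued k (hist s)) j ≡ just x) →
    ∃ λ p → length p ≡ k × Outputs U p x
  by zero h (j , lt , _) = ⊥-elim (1+n≰n (≤-trans (*-monoˡ-≤ 2 (≤-trans (s≤s z≤n) (subst (j <_) (length-issued 0 (hist s)) lt))) h))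
  by (suc k) h (j , lt , e) =
    let (b , len , val) = value-onto k j (≤-trans (subst (j <_) (length-issued (suc k) (hist s)) lt)
                            (*-cancelʳ-≤ (count true (suc k) (hist s)) (2 ^ k) 2 (≤-trans h (≤-reflexive (*-comm 2 (2 ^ k))))))
        word : nthMove (issued (suc (length b)) (hist s)) (value b) ≡ just x
        word = subst₂ (λ k j → nthMove (issued (suc k) (hist s)) j ≡ just x) (sym len) (sym val) e
    in false ∷ b , cong suc len , outputs-intro (false ∷ b) s x (trans (own-word b s) (map-just {reverse} word)) λ r v e' →
         let (y , e″ , v≡) = reversed-just (nthMove (issued (suc (length b)) (hist r)) (value b)) (trans (sym (own-word b r)) e')
         in trans v≡ (cong reverse (nth-stable (suc (length b)) (value b) r s e″ word))

event-of : ∀ t p → event (toNat (encUnary t ++ p)) ≡ vEvent (t , p)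
event-of t p = trans (cong eventOf (natBits-toNat (encUnary t ++ p))) (trans
  (cong (λ r → if eqBits (encUnary (proj₁ r) ++ proj₂ r) (encUnary t ++ p) then vEvent r else nothing) (unary-enc t p))
  (cong (λ b → if b then vEvent (t , p) else nothing) (eqBits-refl (encUnary t ++ p))))

unreverse : ∀ {x y : Bits} → reverse x ≡ reverse y → y ≡ x
unreverse {x} {y} e = trans (sym (reverse-involutive y)) (trans (cong reverse (sym e)) (reverse-involutive x))

event-run : ∀ t p {x} → vRun p t ≡ just x → event (toNat (encUnary t ++ p)) ≡ just (x , 3 + length p)
event-run t p e = trans (event-of t p) (cong (maybe (λ w → just (w , 3 + length p)) nothing) e)

simulated-listed : ∀ p s x → mapMaybe′ reverse (vRun p s) ≡ just (reverse x) → ∃₂ λ s o → (o , (x , 3 + length p)) ∈ hist s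
simulated-listed p s x e =
  let (y , run , eq) = reversed-just (vRun p s) e
  in suc (toNat (encUnary s ++ p)) , false , event-∈ (toNat (encUnary s ++ p)) (event-run s p (trans run (cong just (unreverse eq))))

issued-listed : ∀ b s x → mapMaybe′ reverse (nthMove (issued (suc (length b)) (hist s)) (value b)) ≡ just (reverse x) →
  ∃₂ λ s o → (o , (x , suc (length b))) ∈ hist s
issued-listed b s x e =
  let (y , e' , eq) = reversed-just (nthMove (issued (suc (length b)) (hist s)) (value b)) e
      (o , k , m) = nth-∈ (issued (suc (length b)) (hist s)) (value b) e'
      (m' , ok) = ∈-issued (suc (length b)) (hist s) m
      (_ , k≡) = matches-true (suc (length b)) (o , (y , k)) ok
  in s , o , subst₂ (λ y k → (o , (y , k)) ∈ hist s) (unreverse eq) k≡ m'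

-- The converse of `own-outputs` and `opponent-outputs`: each program of `U` accounts for a listed
-- pair at the level of its length, so the list determines the complexities.
decompress-listed : ∀ p s x → decompress p s ≡ just (reverse x) → ∃₂ λ s o → (o , (x , length p)) ∈ hist s
decompress-listed [] s x ()
decompress-listed (true ∷ []) s x ()
decompress-listed (true ∷ false ∷ _) s x ()
decompress-listed (true ∷ true ∷ []) s x ()
decompress-listed (true ∷ true ∷ false ∷ _) s x ()
decompress-listed (true ∷ true ∷ true ∷ p) s x e = simulated-listed p s x e
decompress-listed (false ∷ b) s x e = issued-listed b s x (trans (sym (own-word b s)) e)

outputs-listed : ∀ p x → Outputs U p x → ∃₂ λ s o → (o , (x , length p)) ∈ hist s
outputs-listed p x out = let (s , e) = outputs-elim p x out in decompress-listed p s x e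

identity : TM
identity = tm 0 λ _ _ → halt

identity-outputs : ∀ x → Outputs identity x x
identity-outputs x = 0 , _ , done , refl , input x
  where
  reads : ∀ b x → readBits (just b) (map just x) ≡ b ∷ x
  reads b []      = refl
  reads b (c ∷ x) = cong (b ∷_) (reads c x)
  input : ∀ x → contents (inputTape x) ≡ x
  input []      = refl
  input (b ∷ x) = reads b x

overhead : ℕ
overhead = proj₁ (U-universal identity)

short-program : ∀ x → C≤ U x (length x + overhead)
short-program x = proj₂ (U-universal identity) x x (identity-outputs x)

module _ (i : ℕ) {N : ℕ} (final : Final i N) where

  history : Hist
  history = map proj₂ (view i (hist N))

  decide : Bits → Bool
  decide = histOracle (size′ i) history

  decide-pair : ∀ x b → decide (doubled x ++ false ∷ true ∷ b) ≡ leq (size′ i) (toNat b) ∨ listed history x (toNat b)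
  decide-pair x b = cong (maybe (λ p → leq (size′ i) (toNat (proj₂ p)) ∨ listed history (proj₁ p) (toNat (proj₂ p))) false) (unpair-doubled x b)

  decide-complete : ∀ w → length w ≤ size′ i → F-C U w → decide w ≡ true
  decide-complete .(pairEnc x k) h (x , k , refl , p , len , out) =
    trans (trans (decide-pair x (natBits k)) (cong (λ k → leq (size′ i) k ∨ listed history x k) (toNat-natBits k))) (by (<-≤-connex k (size′ i)))
    where
    by : k < size′ i ⊎ size′ i ≤ k → leq (size′ i) k ∨ listed history x k ≡ true
    by (inj₂ le) = ∨-left (true-leq le)
    by (inj₁ lt) =
      let (s , o , m) = outputs-listed p x out
          r = Requirement.relevant-intro i o (x , length p) (≤-trans (length-doubled x _) h) (≤-trans (s≤s len) lt)
      in ∨-right {leq (size′ i) k} (anyB-intro (λ m → eqBits x (proj₁ m) ∧ leq (proj₂ m) k) history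
           (∈-map⁺ proj₂ (final-∈ i final r m)) (∧-intro (eqBits-refl x) (true-leq len)))

  negated : ∀ {b} → not b ≡ true → b ≡ false
  negated {false} _ = refl

  view-outputs : ∀ o x k → (o , (x , k)) ∈ view i (hist N) → C≤ U x k
  view-outputs o x k m =
    let (m' , r) = filterB-∈ (relevant i) (hist N) m
    in by o m' (leq-false (size′ i) k (negated (proj₂ (∧-true (leq (length x) (size′ i)) _ r))))
    where
    weaken : (∃ λ p → length p ≡ k × Outputs U p x) → C≤ U x k
    weaken (p , e , out) = p , ≤-reflexive e , out
    by : ∀ o → (o , (x , k)) ∈ hist N → k < size′ i → C≤ U x k
    by true  m lt = weaken (own-outputs N x k (own-all i N k lt) m)
    by false m lt = let (s , e) = ∈-event N m in weaken (opponent-outputs s x k e)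

  listed-outputs : ∀ x k → (x , k) ∈ history → C≤ U x k
  listed-outputs x k m =
    let ((o , (x' , k')) , m' , e) = ∈-map⁻ proj₂ m
    in subst₂ (C≤ U) (sym (cong proj₁ e)) (sym (cong proj₂ e)) (view-outputs o x' k' m')

  -- From level q on, a yes is justified by the trivial program of x; `overhead` leaves room for it.
  decide-sound : ∀ w → length w + overhead ≤ size′ i → decide w ≡ true → F-C U w
  decide-sound w h e = by (unpair w nothing) refl e
    where
    shown : ∀ x b → w ≡ doubled x ++ false ∷ true ∷ b → leq (size′ i) (toNat b) ≡ true ⊎ listed history x (toNat b) ≡ true → C≤ U x (toNat b)
    shown x b w≡ (inj₁ le) =
      let (p , len , out) = short-program x
      in p , ≤-trans len (≤-trans (+-monoˡ-≤ overhead (subst (λ w → length x ≤ length w) (sym w≡) (length-doubled x _))) (≤-trans h (leq-true _ _ le))) , out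
    shown x b w≡ (inj₂ l) =
      let ((y , k) , m , ok) = anyB-elim (λ m → eqBits x (proj₁ m) ∧ leq (proj₂ m) (toNat b)) history l
          (y≡ , k≤) = ∧-true (eqBits x y) _ ok
          (p , len , out) = listed-outputs y k m
      in p , ≤-trans len (leq-true _ _ k≤) , subst (Outputs U p) (sym (eqBits-true x y y≡)) out
    by : ∀ r → unpair w nothing ≡ r →
      maybe (λ p → leq (size′ i) (toNat (proj₂ p)) ∨ listed history (proj₁ p) (toNat (proj₂ p))) false r ≡ true → F-C U w
    by nothing        eq ()
    by (just (x , b)) eq e = x , toNat b , trans (unpair-inv w eq) (cong (λ b → doubled x ++ false ∷ true ∷ b) (sym (natBits-toNat b))) ,
      shown x b (unpair-inv w eq) (∨-true _ _ e)

-- The diagonalisation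

length≤toNat : ∀ b → length b ≤ toNat b
length≤toNat []          = z≤n
length≤toNat (true ∷ b)  = s≤s (≤-trans (length≤toNat b) (≤-trans (m≤m+n _ _) (n≤1+n _)))
length≤toNat (false ∷ b) = s≤s (≤-trans (length≤toNat b) (m≤m+n _ _))

2^length≤toNat : ∀ b → 2 ^ length b ≤ suc (toNat b)
2^length≤toNat []      = ≤-refl
2^length≤toNat (c ∷ b) = ≤-trans (+-mono-≤ (2^length≤toNat b) (≤-trans (≤-reflexive (+-identityʳ _)) (2^length≤toNat b))) (by c)
  where
  double : suc (toNat b) + suc (toNat b) ≡ suc (suc (toNat b + toNat b))
  double = cong suc (+-suc _ _)
  by : ∀ c → suc (toNat b) + suc (toNat b) ≤ suc (toNat (c ∷ b))
  by true  = ≤-trans (≤-reflexive double) (n≤1+n _)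
  by false = ≤-reflexive double

length-natBits : ∀ t L → suc t ≤ 2 ^ L → length (natBits t) ≤ L
length-natBits t L h = ≮⇒≥ λ lt → <⇒≱ (^-monoʳ-< 2 (s≤s (s≤s z≤n)) lt)
  (≤-trans (2^length≤toNat (natBits t)) (≤-trans (≤-reflexive (cong suc (toNat-natBits t))) h))

i≤scale : ∀ i → i ≤ scale i
i≤scale zero    = z≤n
i≤scale (suc i) = ≤-trans (s≤s (i≤scale i)) (≤-trans (≤-trans (m<m+n (scale i) (≤-trans (s≤s z≤n) (m≤n+m 14 (scale i)))) (≤-reflexive (sym (+-assoc (scale i) (scale i) 14))))
  (double≤2^ (scale i) (scale-large i)))

square<2^ : ∀ n → 10 ≤ n → n * n < 2 ^ n
square<2^ n h = subst (λ n → n * n < 2 ^ n) (m+[n∸m]≡n h) (go (n ∸ 10))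
  where
  go : ∀ k → (10 + k) * (10 + k) < 2 ^ (10 + k)
  go zero    = ≤ᵇ⇒≤ 101 1024 tt
  go (suc k) = begin
    suc ((10 + suc k) * (10 + suc k))
      ≡⟨ solve 1 (λ k → con 1 :+ (con 11 :+ k) :* (con 11 :+ k) := con 122 :+ (k :* con 22 :+ k :* k)) refl k ⟩
    122 + (k * 22 + k * k)
      ≤⟨ +-mono-≤ (m≤m+n 122 80) (+-mono-≤ (*-monoʳ-≤ k (m≤m+n 22 18)) (m≤m+n (k * k) (k * k))) ⟩
    202 + (k * 40 + (k * k + k * k))
      ≡⟨ solve 1 (λ k → con 202 :+ (k :* con 40 :+ (k :* k :+ k :* k)) := (con 1 :+ (con 10 :+ k) :* (con 10 :+ k)) :+ (con 1 :+ (con 10 :+ k) :* (con 10 :+ k))) refl k ⟩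
    suc ((10 + k) * (10 + k)) + suc ((10 + k) * (10 + k))
      ≤⟨ +-mono-≤ (go k) (≤-trans (go k) (≤-reflexive (sym (+-identityʳ _)))) ⟩
    2 ^ (10 + suc k) ∎
    where
    open ≤-Reasoning
    open +-*-Solver

-- Writing κ = 2^λ with λ the preceding scale, κ^E = 2^(λ E), and λ E ≤ λ² < 2^λ = κ. The tower-like
-- growth pays for every fixed polynomial in κ.
scale-power : ∀ i E → E < i → scale i ^ E ≤ 2 ^ (scale i ∸ 1)
scale-power (suc i) E (s≤s h) = ≤-trans (≤-reflexive (^-*-assoc 2 (scale i) E))
  (^-monoʳ-≤ 2 (≤-trans (*-monoʳ-≤ (scale i) (≤-trans h (i≤scale i))) (≤-pred (≤-trans (square<2^ (scale i) (scale-large i))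
    (≤-reflexive (sym (m+[n∸m]≡n (1≤2^ (scale i)))))))))

opaque
  instances : TM
  instances = searchTM instance′T

  instances-halt : ∀ y s {v} → instance′ y s ≡ just v →
    ∃₂ λ n c → Steps emptyOracle instances n (zero , inputTape y) c × Halted instances c
  instances-halt y s e =
    let (r , v , h , e') = first-just (instance′ y) s e
        (n , c , st , hc , _) = search-complete instance′T {emptyOracle} y r v h e'
    in n , c , st , hc

  instances-found : ∀ y n c → Steps emptyOracle instances n (zero , inputTape y) c → Halted instances c →
    ∃₂ λ s v → instance′ y s ≡ just v
  instances-found y n c st hc =
    let (s , v , _ , e , _) = search-sound instance′T y n c st hc in s , v , e

bitNo : Bool → ℕ
bitNo b = if b then 1 else 0

asBits-bitNo : ∀ e → asBits (map bitNo e) ≡ e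
asBits-bitNo []          = refl
asBits-bitNo (true ∷ e)  = cong (true ∷_) (asBits-bitNo e)
asBits-bitNo (false ∷ e) = cong (false ∷_) (asBits-bitNo e)

record Numbered (M : TM) (m i : ℕ) : Set where
  constructor numbered
  field
    machine≡ : machineOf i ≡ table M
    core≡    : coreOf i ≡ Q instances ∷ map bitNo (coreString instances)
    large    : m ≤ i
open Numbered

-- Trailing zeros are ignored by the parser, so every machine is treated by arbitrarily late requirements.
number : ∀ M m → ∃ λ i → Numbered M m i
number M m = toNat text , numbered
  (trans (cong (λ b → proj₁ (parse b)) (natBits-toNat text)) (cong proj₁ first))
  (trans (cong (λ b → proj₁ (parse (proj₂ (parse b)))) (natBits-toNat text))
    (trans (cong (λ r → proj₁ (parse (proj₂ r))) first) (cong proj₁ (parse-serial core zeros))))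
  (≤-trans (≤-trans (≤-reflexive (sym (length-replicate m))) (≤-trans (m≤n+m (length zeros) (length (serial core))) (≤-reflexive (sym (length-++ (serial core))))))
    (≤-trans (m≤n+m _ (length (serial (table M)))) (≤-trans (≤-reflexive (sym (length-++ (serial (table M))))) (length≤toNat text))))
  where
  core : List ℕ
  core = Q instances ∷ map bitNo (coreString instances)
  zeros text : Bits
  zeros = replicate m false
  text  = serial (table M) ++ (serial core ++ zeros)
  first : parse text ≡ (table M , serial core ++ zeros)
  first = parse-serial (table M) (serial core ++ zeros)

reverse-cons : ∀ (w : Bits) → 1 ≤ length w → ∃₂ λ b u → reverse w ≡ b ∷ u
reverse-cons w h = go (reverse w) refl
  where
  go : ∀ r → reverse w ≡ r → ∃₂ λ b u → reverse w ≡ b ∷ u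
  go []      e = ⊥-elim (<-irrefl refl (≤-trans h (≤-reflexive (trans (sym (length-reverse w)) (cong length e)))))
  go (b ∷ u) e = b , u , e

length-query : ∀ i t → length (query′ i t) ≡ suc i + length (natBits t)
length-query i t = trans (length-++ (encUnary i)) (cong (_+ length (natBits t)) (length-encUnary i))

input-size : ∀ κ s → 10 ≤ κ → s ≤ κ * 6 → suc (25 * (s * s)) ≤ κ ^ 5
input-size κ s h le = begin
  suc (25 * (s * s))                        ≡⟨ cong suc (solve 1 (λ s → con 25 :* (s :* s) := s :* con 5 :* (s :* con 5)) refl s) ⟩
  suc (s * 5 * (s * 5))                     ≤⟨ s≤s (*-mono-≤ s5 s5) ⟩
  suc (κ * κ * 3 * (κ * κ * 3))             ≡⟨ solve 1 (λ κ → con 1 :+ κ :* κ :* con 3 :* (κ :* κ :* con 3) := con 1 :+ κ :* κ :* (κ :* κ) :* con 9) refl κ ⟩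
  1 + κ * κ * (κ * κ) * 9                   ≤⟨ +-monoˡ-≤ _ (*-mono-≤ (*-mono-≤ 1≤κ 1≤κ) (*-mono-≤ 1≤κ 1≤κ)) ⟩
  κ * κ * (κ * κ) + κ * κ * (κ * κ) * 9     ≡⟨ solve 1 (λ x → x :+ x :* con 9 := x :* con 10) refl (κ * κ * (κ * κ)) ⟩
  κ * κ * (κ * κ) * 10                      ≤⟨ *-monoʳ-≤ (κ * κ * (κ * κ)) h ⟩
  κ * κ * (κ * κ) * κ                       ≡⟨ solve 1 (λ κ → κ :* κ :* (κ :* κ) :* κ := κ :^ 5) refl κ ⟩
  κ ^ 5                                     ∎
  where
  open ≤-Reasoning
  open +-*-Solver
  1≤κ : 1 ≤ κ
  1≤κ = ≤-trans (s≤s z≤n) h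
  s5 : s * 5 ≤ κ * κ * 3
  s5 = ≤-trans (*-monoˡ-≤ 5 le) (≤-trans (≤-reflexive (solve 1 (λ κ → κ :* con 6 :* con 5 := κ :* con 10 :* con 3) refl κ))
    (*-monoˡ-≤ 3 (*-monoʳ-≤ κ h)))

-- Here the polynomial bound on restarts is used: q is 2^κ, so t has O(κ) bits and the instance has
-- length polynomial in κ.
interval-length : ∀ i t → pred t ≤ Requirement.q⁴ i * (256 * 72 + 32) → length (natBits t) ≤ scale i * 4 + 15
interval-length i t h = length-natBits t (κ * 4 + 15) (begin
  suc t                              ≤⟨ s≤s (suc-pred≤ t) ⟩
  2 + pred t                         ≤⟨ +-mono-≤ (*-monoˡ-≤ 2 1≤q⁴) h ⟩
  q⁴ * 2 + q⁴ * (256 * 72 + 32)      ≡⟨ sym (*-distribˡ-+ q⁴ 2 (256 * 72 + 32)) ⟩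
  q⁴ * (2 + (256 * 72 + 32))         ≤⟨ *-monoʳ-≤ q⁴ (≤ᵇ⇒≤ (2 + (256 * 72 + 32)) (2 ^ 15) tt) ⟩
  q⁴ * 2 ^ 15                        ≡⟨ cong (_* 2 ^ 15) q⁴≡ ⟩
  2 ^ (κ * 4) * 2 ^ 15               ≡⟨ sym (^-distribˡ-+-* 2 (κ * 4) 15) ⟩
  2 ^ (κ * 4 + 15)                   ∎)
  where
  open ≤-Reasoning
  open Requirement i using (κ; q; q⁴)
  suc-pred≤ : ∀ t → t ≤ suc (pred t)
  suc-pred≤ zero    = z≤n
  suc-pred≤ (suc t) = ≤-refl
  q⁴≡ : q⁴ ≡ 2 ^ (κ * 4)
  q⁴≡ = trans (solve 1 (λ q → q :* q :* (q :* q) := q :^ 4) refl q) (^-*-assoc 2 κ 4)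
    where open +-*-Solver
  1≤q⁴ : 1 ≤ q⁴
  1≤q⁴ = subst (1 ≤_) (sym q⁴≡) (1≤2^ (κ * 4))

module _ {M m i} (no : Numbered M m i) (t : ℕ) where

  input≡ : inputOf i t ≡ preludeCode (Q instances) (coreString instances) (reverse (query′ i t))
  input≡ = trans (cong (λ c → preludeCode (nth c 0) (asBits (drop 1 c)) (reverse (query′ i t))) (core≡ no))
    (cong (λ e → preludeCode (Q instances) e (reverse (query′ i t))) (asBits-bitNo (coreString instances)))

  private
    split : ∃₂ λ b u → reverse (query′ i t) ≡ b ∷ u
    split = reverse-cons (query′ i t) (≤-trans (s≤s z≤n) (≤-reflexive (sym (length-query i t))))
    b₀ : Bool
    b₀ = proj₁ split
    w₀ : Bits
    w₀ = proj₁ (proj₂ split)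
    w≡ : reverse (query′ i t) ≡ b₀ ∷ w₀
    w≡ = proj₂ (proj₂ split)
    back : reverse (b₀ ∷ w₀) ≡ query′ i t
    back = trans (cong reverse (sym w≡)) (reverse-involutive (query′ i t))

  asked : TM
  asked = Prelude.prelude instances b₀ w₀

  encTM-asked : encTM asked ≡ inputOf i t
  encTM-asked = sym (trans input≡ (trans (cong (preludeCode (Q instances) (coreString instances)) w≡) (sym (encTM-prelude instances b₀ w₀))))

  halts-instance : HaltSet (inputOf i t) → ∃₂ λ s v → instance′ (query′ i t) s ≡ just v
  halts-instance h =
    let (n , c , r , hc) = haltSet-machine asked (subst HaltSet (sym encTM-asked) h)
        (n' , y , r' , hy) = Prelude.halts-only-if instances b₀ w₀ r hc
    in instances-found (query′ i t) n' y (subst (λ x → Steps emptyOracle instances n' (zero , inputTape x) y) back r') hy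

  instance-halts : ∀ s {v} → instance′ (query′ i t) s ≡ just v → HaltSet (inputOf i t)
  instance-halts s e =
    let (n , y , st , hy) = instances-halt (query′ i t) s e
        (k , c , st' , hc) = Prelude.halts-if instances b₀ w₀ (subst (λ x → Steps emptyOracle instances n (zero , inputTape x) y) (sym back) st) hy
    in asked , encTM-asked , k , c , st' , hc

  length-input : Q instances + 18 ≤ i → length (natBits t) ≤ scale i * 4 + 15 → suc (length (inputOf i t)) ≤ scale i ^ 5
  length-input hi ht = ≤-trans (s≤s (≤-trans (≤-reflexive (cong length (sym encTM-asked))) (length-encTM asked)))
    (input-size κ (suc (Q asked)) (scale-large i) (begin
      suc (suc (Q instances) + length (b₀ ∷ w₀))
        ≡⟨ cong (λ l → suc (suc (Q instances) + l)) (trans (cong length (sym w≡)) (trans (length-reverse (query′ i t)) (length-query i t))) ⟩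
      suc (suc (Q instances) + (suc i + length (natBits t)))
        ≤⟨ s≤s (+-monoʳ-≤ (suc (Q instances)) (+-monoʳ-≤ (suc i) ht)) ⟩
      suc (suc (Q instances) + (suc i + (κ * 4 + 15)))
        ≡⟨ solve 3 (λ Q i κ → con 2 :+ Q :+ (con 1 :+ i :+ (κ :* con 4 :+ con 15)) := Q :+ con 18 :+ (i :+ κ :* con 4)) refl (Q instances) i κ ⟩
      Q instances + 18 + (i + κ * 4)
        ≤⟨ +-mono-≤ (≤-trans hi (i≤scale i)) (+-monoˡ-≤ (κ * 4) (i≤scale i)) ⟩
      κ + (κ + κ * 4)
        ≡⟨ solve 1 (λ κ → κ :+ (κ :+ κ :* con 4) := κ :* con 6) refl κ ⟩
      κ * 6 ∎))
    where
    open ≤-Reasoning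
    open +-*-Solver
    κ : ℕ
    κ = scale i

start-width : ∀ x → suc (length (rgt (inputTape x))) ≤ suc (length x)
start-width []      = ≤-refl
start-width (b ∷ x) = s≤s (≤-trans (≤-reflexive (length-map just x)) (n≤1+n _))

module _ {M : TM} {m i N : ℕ} (no : Numbered M m i) (final : Final i N) where

  private
    t : ℕ
    t = interval i N
    x : Bits
    x = inputOf i t
    i<N : i < N
    i<N = proj₁ final

  -- On the final history the simulated oracle is right about every word this run can ask about, so
  -- the true run ends with the answer that the strategy has secured.
  answer-run : ∀ {n y} → suc (length x) + n + overhead ≤ size′ i → n ≤ 2 ^ (scale i ∸ 1) →
    RunsTo (F-C U) M x n y → eqBits (true ∷ []) y ≡ winnerAt i N
  answer-run {n} {y} fits short (c , st , hc , e) = trans (sym (trans final-answer (cong (eqBits (true ∷ [])) e))) (answer-final i i<N)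
    where
    agrees : ∀ w → length w ≤ suc (length x) + n → Agrees M (F-C U) (decide i final) w
    agrees w h = decide-complete i final w (≤-trans (≤-trans h (m≤m+n _ overhead)) fits) , refuted (true-or-false (decide i final w))
      where
      refuted : decide i final w ≡ true ⊎ decide i final w ≡ false → ¬ F-C U w → decide i final w ≡ false
      refuted (inj₂ e) _  = e
      refuted (inj₁ e) nf = ⊥-elim (nf (decide-sound i final w (≤-trans (+-monoˡ-≤ overhead h) fits) e))
    ran : runC (decide i final) (machineOf i) (2 ^ (scale i ∸ 1)) (startC x) ≡ encC {M} c
    ran = trans (cong₂ (λ T s → runC (decide i final) T (2 ^ (scale i ∸ 1)) s) (machine≡ no) (startC-ok M x))
      (trans (cong (λ k → runC (decide i final) (table M) k (encC {M} (zero , inputTape x))) (sym (m+[n∸m]≡n short)))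
        (run-ok M agrees (+-monoˡ-≤ n (start-width x)) st hc (2 ^ (scale i ∸ 1) ∸ n)))
    final-answer : answer i t (history i final) ≡ eqBits (true ∷ []) (contents (proj₂ c))
    final-answer = cong (λ z → eqBits (true ∷ []) (contentsC z)) ran

  -- If acceptance was secured, an accepted instance would halt, which it does only in an interval
  -- played for rejection. If rejection was secured, the instance does halt, by stage `N`.
  refute : ∀ {y} → eqBits (true ∷ []) y ≡ winnerAt i N → ((y ≡ true ∷ []) ⇔ HaltSet x) → ⊥
  refute {y} e iff = by (true-or-false (winnerAt i N))
    where
    absurd : true ≡ false → ⊥
    absurd ()
    by : winnerAt i N ≡ true ⊎ winnerAt i N ≡ false → ⊥
    by (inj₁ w) =
      let (s , v , h) = halts-instance no t (Equivalence.to iff (sym (eqBits-true (true ∷ []) y (trans e w))))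
      in absurd (trans (sym w) (false-instance i {N} {s} {v} i<N h))
    by (inj₂ w) = absurd (trans (sym (cong (eqBits (true ∷ [])) (Equivalence.from iff (instance-halts no t N (instance-false i i<N w)))))
      (trans e w))

-- Below i, and hence below κ, there must be room for the states and constants in the length of x,
-- for `a` and `overhead` as factor and summand, and for the exponents 6 and 1 + 5k, which
-- `scale-power` requires to be strictly below i.
bound : ℕ → ℕ → ℕ
bound a k = Q instances + 18 + (a + overhead + (7 + (2 + 5 * k)))

undecided : ∀ {M a k i} → Numbered M (bound a k) i → ¬ (∀ x → ∃ λ n → ∃ λ y →
  n ≤ a * suc (length x) ^ k × RunsTo (F-C U) M x n y × ((y ≡ true ∷ []) ⇔ HaltSet x))
undecided {M} {a} {k} {i} no decides = final-stage i λ (N , final) →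
  let t = interval i N
      (n , y , n≤ , run , iff) = decides (inputOf i t)
      X≤ = length-input no t (≤-trans (m≤m+n _ _) (large no)) (interval-length i t (interval-bound i (proj₁ final)))
      short = ≤-trans n≤ (steps≤ (suc (length (inputOf i t))) X≤)
  in refute no final (answer-run no final (fits (suc (length (inputOf i t))) n X≤ short) short run) iff
  where
  m κ : ℕ
  m = bound a k
  κ = scale i
  part : ∀ {c} → c ≤ m → c ≤ i
  part h = ≤-trans h (large no)
  tail≤ : a + overhead + (7 + (2 + 5 * k)) ≤ m
  tail≤ = m≤n+m _ (Q instances + 18)
  steps≤ : ∀ X → X ≤ κ ^ 5 → a * X ^ k ≤ 2 ^ (κ ∸ 1)
  steps≤ X h = ≤-trans (*-mono-≤ (≤-trans (part (≤-trans (≤-trans (m≤m+n a overhead) (m≤m+n _ _)) tail≤)) (i≤scale i)) (^-monoˡ-≤ k h))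
    (≤-trans (≤-reflexive (cong (κ *_) (^-*-assoc κ 5 k)))
      (scale-power i (1 + 5 * k) (part (≤-trans (m≤n+m (2 + 5 * k) 7) (≤-trans (m≤n+m _ (a + overhead)) tail≤)))))
  fits : ∀ X n → X ≤ κ ^ 5 → n ≤ 2 ^ (κ ∸ 1) → X + n + overhead ≤ size′ i
  fits X n h h' = begin
    X + n + overhead             ≡⟨ solve 3 (λ X n o → X :+ n :+ o := X :+ o :+ n) refl X n overhead ⟩
    X + overhead + n             ≤⟨ +-mono-≤ (+-mono-≤ h (≤-trans (part (≤-trans (≤-trans (m≤n+m overhead a) (m≤m+n _ _)) tail≤)) (i≤scale i))) h' ⟩
    κ ^ 5 + κ + 2 ^ (κ ∸ 1)      ≤⟨ +-monoˡ-≤ _ (≤-trans six (scale-power i 6 (part (≤-trans (m≤m+n 7 (2 + 5 * k)) (≤-trans (m≤n+m _ (a + overhead)) tail≤))))) ⟩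
    2 ^ (κ ∸ 1) + 2 ^ (κ ∸ 1)    ≡⟨ cong (2 ^ (κ ∸ 1) +_) (sym (+-identityʳ _)) ⟩
    2 ^ suc (κ ∸ 1)              ≡⟨ cong (2 ^_) (m+[n∸m]≡n 1≤κ) ⟩
    size′ i                      ∎
    where
    open ≤-Reasoning
    open +-*-Solver
    1≤κ : 1 ≤ κ
    1≤κ = ≤-trans (s≤s z≤n) (scale-large i)
    six : κ ^ 5 + κ ≤ κ ^ 6
    six = begin
      κ ^ 5 + κ        ≤⟨ +-monoʳ-≤ (κ ^ 5) (≤-trans (≤-reflexive (sym (*-identityʳ κ))) (*-monoʳ-≤ κ (≤-trans 1≤κ⁴ ≤-refl))) ⟩
      κ ^ 5 + κ ^ 5    ≡⟨ solve 1 (λ x → x :+ x := con 2 :* x) refl (κ ^ 5) ⟩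
      2 * κ ^ 5        ≤⟨ *-monoˡ-≤ (κ ^ 5) (≤-trans (s≤s (s≤s z≤n)) (scale-large i)) ⟩
      κ ^ 6            ∎
      where
      1≤κ⁴ : 1 ≤ κ ^ 4
      1≤κ⁴ = ≤-trans (≤-reflexive (sym (^-zeroˡ 4))) (^-monoˡ-≤ 4 1≤κ)

not-in-P : ¬ InPOracle (F-C U) HaltSet
not-in-P (M , a , k , decides) = undecided {M} {a} {k} {proj₁ (number M (bound a k))} (proj₂ (number M (bound a k))) decides

theorem1 : Σ TM λ U → Universal U × ¬ InPOracle (F-C U) HaltSet
theorem1 = U , U-universal , not-in-P
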